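{- (Monohedral Decomposition.) Let $m\ge0$, $N\in(\mathbb{N}\setminus\{0\})^m$, $I\subseteq\{1,\dots,m\}$, and let $A\subseteq F_I(\Gamma^m)$ be a largely continuous precell mod $N$. Then there exists a complex $\mathcal{C}$ of monohedral largely continuous precells mod $N$ such that $A=\bigcup\mathcal{C}$.
   Context: $\mathcal{Z}$ is a $\mathbb{Z}$-group (linearly ordered abelian group with a smallest positive element such that $\mathcal{Z}/n\mathcal{Z}$ has $n$ elements for all $n\ge1$, e.g. $\mathbb{Z}$), $\mathcal{Q}\supseteq\mathbb{Q}$ its divisible hull, $\Gamma=\mathcal{Z}\cup\{+\infty\}$, $\Omega=\mathcal{Q}\cup\{+\infty\}$, with $a<+\infty$, $a+(+\infty)=+\infty$. $\Omega$ has the topology generated by open intervals and the sets $]a,+\infty]$; $\Omega^m$ the product topology, $\Gamma^m$ the induced one; $\overline S$ is the closure in $\Omega^m$. $\mathrm{Supp}\,a=\{i:a_i\neq+\infty\}$; $F_I(\Gamma^m)=\{a\in\Gamma^m:\mathrm{Supp}\,a=I\}$; $F_I(S)=\{a\in\overline S:\mathrm{Supp}\,a=I\}$, called a face of $S$ when nonempty. Faces are ordered by specialisation ($B\le C$ iff $B\subseteq\overline C$); $S$ is monohedral if its faces are linearly ordered by specialisation. For $m\ge1$, $\widehat a=(a_1,\dots,a_{m-1})$, $\widehat S$ the image of $S$ (socle), $\widehat N=(N_1,\dots,N_{m-1})$. A map $f:S\to\Omega$ is largely continuous if it extends continuously to $\overline S$. For $S\subseteq F_I(\Gamma^m)$,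 $f$ is affine if constantly $+\infty$ or $f(a)=\alpha_0+\sum_{i\in I}\alpha_ia_i$ on $S$ with $\alpha_0\in\mathcal{Q}$, $\alpha_i\in\mathbb{Q}$. For $a,b\in\mathcal Z$, $a\equiv b\,[n]$ means $a-b\in n\mathcal{Z}$; $a\equiv+\infty\,[n]$ always. Precells mod $N$, by induction on $m$: for $m=0$, $\Gamma^0$ is the only precell. For $m\ge1$, $A\subseteq F_I(\Gamma^m)$ is a precell mod $N$ if $\widehat A$ is a precell mod $\widehat N$ and there are non-negative affine $\mu,\nu:\widehat A\to\Omega$ and an integer $0\le\rho<N_m$ with $A=\{a\in F_I(\Gamma^m):\widehat a\in\widehat A,\ \mu(\widehat a)\le a_m\le\nu(\widehat a),\ a_m\equiv\rho\,[N_m]\}$ (presentation $(\mu,\nu,\rho)$, largely continuous if $\mu,\nu$ are). $A$ is a largely continuous precell mod $N$ if $m=0$ or $\widehat A$ is a largely continuous precell mod $\widehat N$ and $A$ has a largely continuous presentation. A complex is a finite family of pairwise disjoint subsets of $\Gamma^m$ such that for any two members $A,B$, $\overline A\cap\overline B$ is the union of the common faces of $A$ and $B$. -}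

module Defs where

open import Level using (0ℓ)
open import Data.Nat as ℕ using (ℕ; zero; suc)
open import Data.Integer as ℤ using (ℤ)
open import Data.Rational as ℚ using (ℚ)
open import Data.Bool using (Bool; true; false)
open import Data.Maybe using (Maybe; just; nothing; is-just)
import Data.Maybe as Maybe
open import Data.Fin using (Fin)
open import Data.Fin.Subset using (Subset)
open import Data.Vec as Vec using (Vec; []; _∷_; _∷ʳ_; init; last)
open import Data.List as List using (List)
open import Data.Product using (Σ; ∃; ∃₂; _×_; _,_)
open import Data.Sum using (_⊎_)
open import Data.Unit using (⊤)
open import Data.Empty using (⊥)
open import Relation.Nullary using (¬_)
open import Relation.Unary using (Pred)
open import Relation.Binary.PropositionalEquality using (_≡_; _≢_)
open import Function.Bundles using (_⇔_)

record ZGStr : Set₁ where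
  infixl 6 _+_
  infix 4 _<_
  field
    Z   : Set
    _+_ : Z → Z → Z
    -_  : Z → Z
    0z  : Z
    1z  : Z
    _<_ : Z → Z → Set

module ZOps (G : ZGStr) where
  open ZGStr G

  times : ℕ → Z → Z
  times zero    x = 0z
  times (suc n) x = x + times n x

  zmul : ℤ → Z → Z
  zmul (ℤ.+ n)     x = times n x
  zmul (ℤ.-[1+ n ]) x = - times (suc n) x

  CongZ : Z → Z → ℕ → Set
  CongZ a b n = ∃ λ c → a + (- b) ≡ times n c

record IsZGroup (G : ZGStr) : Set where
  open ZGStr G
  open ZOps G
  field
    +-assoc   : ∀ x y z → (x + y) + z ≡ x + (y + z)
    +-comm    : ∀ x y → x + y ≡ y + x
    +-identityˡ : ∀ x → 0z + x ≡ x
    -‿inverseˡ : ∀ x → (- x) + x ≡ 0z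
    <-irrefl  : ∀ x → ¬ (x < x)
    <-trans   : ∀ x y z → x < y → y < z → x < z
    <-trichotomy : ∀ x y → x < y ⊎ x ≡ y ⊎ y < x
    <-+-compat : ∀ x y z → x < y → x + z < y + z
    0<1       : 0z < 1z
    1-least   : ∀ x → 0z < x → ¬ (x < 1z)
    quotient-size : ∀ n → 1 ℕ.≤ n → Σ (Fin n → Z) λ r →
      ∀ x → ∃ λ i → CongZ x (r i) n × (∀ j → CongZ x (r j) n → j ≡ i)

module Geometry (G : ZGStr) where
  open ZGStr G
  open ZOps G

  -- The divisible hull 𝒬: elements num / (1 + den)
  record Q : Set where
    constructor _/1+_
    field
      num : Z
      den : ℕ
  open Q

  _≈Q_ : Q → Q → Set
  x ≈Q y = times (suc (den y)) (num x) ≡ times (suc (den x)) (num y)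

  _<Q_ : Q → Q → Set
  x <Q y = times (suc (den y)) (num x) < times (suc (den x)) (num y)

  _≤Q_ : Q → Q → Set
  x ≤Q y = x <Q y ⊎ x ≈Q y

  _+Q_ : Q → Q → Q
  x +Q y = (times (suc (den y)) (num x) + times (suc (den x)) (num y))
             /1+ (den x ℕ.+ den y ℕ.+ den x ℕ.* den y)

  0Q : Q
  0Q = 0z /1+ 0

  embQ : Z → Q
  embQ z = z /1+ 0

  _·Q_ : ℚ → Q → Q
  q ·Q x = zmul (ℚ.numerator q) (num x)
             /1+ (den x ℕ.+ ℚ.denominator-1 q ℕ.+ den x ℕ.* ℚ.denominator-1 q)

  -- Ω = 𝒬 ∪ {+∞}  (nothing = +∞);  Γ = 𝒵 ∪ {+∞}
  Ω : Set
  Ω = Maybe Q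

  Γ : Set
  Γ = Maybe Z

  embΓ : Γ → Ω
  embΓ = Maybe.map embQ

  _+Ω_ : Ω → Ω → Ω
  just x +Ω just y = just (x +Q y)
  just x +Ω nothing = nothing
  nothing +Ω y = nothing

  _≤Ω_ : Ω → Ω → Set
  x ≤Ω nothing = ⊤
  nothing ≤Ω just y = ⊥
  just x ≤Ω just y = x ≤Q y

  _≈Ω_ : Ω → Ω → Set
  nothing ≈Ω nothing = ⊤
  nothing ≈Ω just y = ⊥
  just x ≈Ω nothing = ⊥
  just x ≈Ω just y = x ≈Q y

  GPt : ℕ → Set
  GPt m = Vec Γ m

  ΩPt : ℕ → Set
  ΩPt m = Vec Ω m

  embPt : ∀ {m} → GPt m → ΩPt m
  embPt = Vec.map embΓ

  supp : ∀ {X : Set} {m} → Vec (Maybe X) m → Subset m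
  supp = Vec.map is-just

  -- (l,u) gives a basic neighbourhood of x : ]l,u[ if x finite, ]l,+∞] if x = +∞
  Ok1 : Ω → Q → Q → Set
  Ok1 (just q) l u = l <Q q × q <Q u
  Ok1 nothing  l u = ⊤

  In1 : Ω → Q → Q → Ω → Set
  In1 (just _) l u (just y) = l <Q y × y <Q u
  In1 (just _) l u nothing  = ⊥
  In1 nothing  l u (just y) = l <Q y
  In1 nothing  l u nothing  = ⊤

  OkV : ∀ {m} → ΩPt m → Vec Q m → Vec Q m → Set
  OkV []       []       []       = ⊤
  OkV (x ∷ xs) (l ∷ ls) (u ∷ us) = Ok1 x l u × OkV xs ls us

  InV : ∀ {m} → ΩPt m → Vec Q m → Vec Q m → ΩPt m → Set
  InV []       []       []       []       = ⊤
  InV (x ∷ xs) (l ∷ ls) (u ∷ us) (y ∷ ys) = In1 x l u y × InV xs ls us ys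

  ClΩ : ∀ {m} → Pred (ΩPt m) 0ℓ → Pred (ΩPt m) 0ℓ
  ClΩ S x = ∀ l u → OkV x l u → ∃ λ y → InV x l u y × S y

  ImgΓ : ∀ {m} → Pred (GPt m) 0ℓ → Pred (ΩPt m) 0ℓ
  ImgΓ S y = ∃ λ a → S a × y ≡ embPt a

  Cl : ∀ {m} → Pred (GPt m) 0ℓ → Pred (ΩPt m) 0ℓ
  Cl S = ClΩ (ImgΓ S)

  ContinuousOn : ∀ {m} → Pred (ΩPt m) 0ℓ → (ΩPt m → Ω) → Set
  ContinuousOn T g =
    ∀ x → T x → ∀ l u → Ok1 (g x) l u →
      ∃₂ λ l′ u′ → OkV x l′ u′ ×
        (∀ y → T y → InV x l′ u′ y → In1 (g x) l u (g y))

  LargelyCont : ∀ {m} → Pred (GPt m) 0ℓ → (GPt m → Ω) → Set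
  LargelyCont S f = ∃ λ (g : ΩPt m → Ω) →
    (∀ a → S a → g (embPt a) ≈Ω f a) × ContinuousOn (Cl S) g
    where m = _

  Face : ∀ {m} → Pred (GPt m) 0ℓ → Subset m → Pred (ΩPt m) 0ℓ
  Face S I x = Cl S x × supp x ≡ I

  FaceLE : ∀ {m} → Pred (GPt m) 0ℓ → Subset m → Subset m → Set
  FaceLE S I J = ∀ x → Face S I x → ClΩ (Face S J) x

  Monohedral : ∀ {m} → Pred (GPt m) 0ℓ → Set
  Monohedral S = ∀ I J → ∃ (Face S I) → ∃ (Face S J) →
                 FaceLE S I J ⊎ FaceLE S J I

  CommonFaces : ∀ {m} → Pred (GPt m) 0ℓ → Pred (GPt m) 0ℓ → Set
  CommonFaces A B = ∀ x → (Cl A x × Cl B x) ⇔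
    (∃₂ λ I J → (∀ y → Face A I y ⇔ Face B J y) × Face A I x)

  IsComplex : ∀ {m} → List (Pred (GPt m) 0ℓ) → Set
  IsComplex Cs =
    (∀ i j → i ≢ j → ∀ a → List.lookup Cs i a → List.lookup Cs j a → ⊥) ×
    (∀ i j → CommonFaces (List.lookup Cs i) (List.lookup Cs j))

  -- an affine map on a subset of F_I(Γ^m): constantly +∞, or
  -- a ↦ α₀ + Σ_{i∈I} αᵢ aᵢ  with α₀ ∈ 𝒬, αᵢ ∈ ℚ
  data Aff (m : ℕ) : Set where
    infA : Aff m
    linA : Q → Vec ℚ m → Aff m

  linSum : ∀ {m} → Subset m → Vec ℚ m → GPt m → Ω
  linSum []          []       []              = just 0Q
  linSum (true ∷ I)  (α ∷ αs) (just z ∷ as)   = just (α ·Q embQ z) +Ω linSum I αs as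
  linSum (true ∷ I)  (α ∷ αs) (nothing ∷ as)  = nothing  -- never used on F_I
  linSum (false ∷ I) (α ∷ αs) (_ ∷ as)        = linSum I αs as

  evalAff : ∀ {m} → Subset m → Aff m → GPt m → Ω
  evalAff I infA         a = nothing
  evalAff I (linA α₀ α)  a = just α₀ +Ω linSum I α a

  Soc : ∀ {m} → Pred (GPt (suc m)) 0ℓ → Pred (GPt m) 0ℓ
  Soc A b = ∃ λ z → A (b ∷ʳ z)

  CongΓ : Γ → ℕ → ℕ → Set
  CongΓ nothing  ρ n = ⊤
  CongΓ (just z) ρ n = CongZ z (times ρ 1z) n

  record Presentation (m : ℕ) (N : Vec ℕ (suc m)) (I : Subset (suc m))
                      (A : Pred (GPt (suc m)) 0ℓ) : Set where
    field
      μ ν  : Aff m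
      ρ    : ℕ
      ρ<N  : ρ ℕ.< last N
      μ≥0  : ∀ b → Soc A b → just 0Q ≤Ω evalAff (init I) μ b
      ν≥0  : ∀ b → Soc A b → just 0Q ≤Ω evalAff (init I) ν b
      shape : ∀ b z → A (b ∷ʳ z) ⇔
        (supp (b ∷ʳ z) ≡ I × Soc A b ×
         evalAff (init I) μ b ≤Ω embΓ z × embΓ z ≤Ω evalAff (init I) ν b ×
         CongΓ z ρ (last N))

  IsPrecell : (m : ℕ) → Vec ℕ m → Subset m → Pred (GPt m) 0ℓ → Set
  IsPrecell zero    N I A = ∀ a → A a
  IsPrecell (suc m) N I A =
    IsPrecell m (init N) (init I) (Soc A) × Presentation m N I A

  IsLCPrecell : (m : ℕ) → Vec ℕ m → Subset m → Pred (GPt m) 0ℓ → Set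
  IsLCPrecell zero    N I A = ∀ a → A a
  IsLCPrecell (suc m) N I A =
    IsLCPrecell m (init N) (init I) (Soc A) ×
    Σ (Presentation m N I A) λ p →
      LargelyCont (Soc A) (evalAff (init I) (Presentation.μ p)) ×
      LargelyCont (Soc A) (evalAff (init I) (Presentation.ν p))

{-# OPTIONS --safe #-}
module Submission where

-- Induction on m, over a class of precells described by more data: a piece is a bounded core plus finitely many integral
-- rays, each with a level l < L, and its l-th face (l ≤ L) is obtained by sending to +∞ the coordinates that grow along
-- the rays of level l. These faces form a chain, so pieces are monohedral. An affine map that extends to the closure
-- grows along the rays of level below some g (its grade) and is constant along the others.
-- Let μ ≤ aₘ ≤ ν be the bounds over a piece, of grades g ≤ gν, and let τ i measure how far a point is along the rays of
-- level i. The forms Ψ k = μ + τ g + … + τ (k − 1) (up to constants), g ≤ k ≤ gν, cut the precell into slabs: close to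
-- Ψ k the coordinate aₘ behaves like a form of grade k and the levels do not change; strictly between Ψ k and Ψ (k + 1)
-- the growth of aₘ is independent of the old levels and a new level is inserted. Over a common face of two pieces the
-- forms Ψ k that are finite there coincide, hence so do the faces of the slabs.

open import Defs
open import Data.Nat as ℕ using (ℕ; zero; suc)
import Data.Nat.Properties as ℕₚ
open import Data.Integer as ℤ using (ℤ; -[1+_]; 0ℤ; 1ℤ; -1ℤ) renaming (+_ to pos)
import Data.Integer.Properties as ℤₚ
import Data.Integer.GCD as ℤG
open import Data.Integer.Solver using (module +-*-Solver)
open import Data.Rational as ℚ using (ℚ)
import Data.Rational.Properties as ℚₚ
open import Data.Bool using (Bool; true; false; _∧_; if_then_else_) renaming (T to IsTrue)
open import Data.Maybe as Maybe using (Maybe; just; nothing; is-just)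
open import Data.Fin as Fin using (Fin; zero; suc; toℕ)
import Data.Fin.Properties as Finₚ
open import Data.Fin.Subset using (Subset)
open import Data.Vec as Vec using (Vec; []; _∷_)
open import Data.Vec.Properties using (lookup∘tabulate; lookup-zipWith; lookup-map; tabulate-cong; tabulate∘lookup; map-∷ʳ; init-∷ʳ; last-∷ʳ; ∷ʳ-injective)
import Data.Vec.Relation.Unary.All as VAll
open import Data.List as List using (List; []; _∷_; length)
open import Data.List.Properties using (length-++; length-map; ≡-dec)
open import Data.List.Membership.Propositional using (_∈_)
open import Data.List.Membership.Propositional.Properties using (∈-map⁻; ∈-map⁺; ∈-++⁻; ∈-++⁺ˡ; ∈-++⁺ʳ; ∈-lookup)
open import Data.List.Relation.Unary.Any as Any using (Any; here; there)
import Data.List.Relation.Unary.Any.Properties as Anyₚ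
import Data.List.Relation.Unary.All.Properties as Allₚ
open import Data.List.Relation.Unary.AllPairs as AllPairs using (AllPairs; []; _∷_)
import Data.List.Relation.Unary.AllPairs.Properties as AllPairsₚ
open import Data.Product using (Σ; ∃; ∃₂; _×_; _,_; proj₁; proj₂)
open import Data.Sum using (_⊎_; inj₁; inj₂)
open import Data.Empty using (⊥; ⊥-elim)
open import Data.Unit using (⊤; tt)
open import Function using (_∘_)
open import Function.Bundles using (_⇔_; mk⇔; module Equivalence)
open import Level using (0ℓ)
open import Relation.Binary using (Tri; tri<; tri≈; tri>)
open import Relation.Binary.PropositionalEquality hiding (J)
open import Relation.Nullary using (yes; no)
open import Relation.Unary using (Pred)

-- Denominators and congruences prevent a lifted ray from being undone exactly: a point of X returns
-- to the core only up to bounded errors. So the core is a bounded set in A rather than in X, and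
-- the induction carries constants. W is the common slope of the τ, K bounds them on the core, n
-- bounds the number of rays; these are fixed before the margin E, the lower bound of the τ on X.
-- Building pieces of margin E consumes pieces of margin K + 4E + W′ one dimension lower, hence
-- pieces must be available for every large E. Each summand τ i of a form Ψ k is accompanied by -K.
-- On the core this gives Ψ k ≤ μ ≤ ν, and along the rays Ψ k ≤ ν persists because the positive
-- slopes of ν are at least W; the common denominator D receives a factor W for this purpose. Thus
-- the cuts stay below ν as long as their grade does not exceed that of ν. The functions τ belong to
-- the data that two pieces share along a common face, because the cuts one dimension higher are
-- built from them.

module IntegerIdentities where
  open import Data.Integer using (_+_; _*_; -_)
  open +-*-Solver

  onto-identity : ∀ D N x s → D * (N * x) + -1ℤ * ((D * N) * s) + 0ℤ ≡ (D * N) * (x + - s)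
  onto-identity = solve 4 (λ D N x s → D :* (N :* x) :+ con -1ℤ :* (D :* N :* s) :+ con 0ℤ := D :* N :* (x :+ :- s)) refl

  next-identity : ∀ D N x s → 1ℤ * ((D * N) * s) + (- D) * (N * x) + 0ℤ ≡ (D * N) * (s + - x)
  next-identity = solve 4 (λ D N x s → con 1ℤ :* (D :* N :* s) :+ (:- D) :* (N :* x) :+ con 0ℤ := D :* N :* (s :+ :- x)) refl

open IntegerIdentities using (onto-identity; next-identity)

-- A reflective solver for linear inequalities

record OrderedModule : Set₁ where
  infixl 6 _⊹_
  infixr 7 _·_
  infix 4 _≼_
  field
    C : Set
    _⊹_ : C → C → C
    ⊖_ : C → C
    𝟎 : C
    _·_ : ℤ → C → C
    _≼_ : C → C → Set
    assoc : ∀ x y z → (x ⊹ y) ⊹ z ≡ x ⊹ (y ⊹ z)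
    comm : ∀ x y → x ⊹ y ≡ y ⊹ x
    idˡ : ∀ x → 𝟎 ⊹ x ≡ x
    invˡ : ∀ x → (⊖ x) ⊹ x ≡ 𝟎
    ·-distribʳ : ∀ x a b → (a ℤ.+ b) · x ≡ a · x ⊹ b · x
    ·-distribˡ : ∀ a x y → a · (x ⊹ y) ≡ a · x ⊹ a · y
    ·-assoc : ∀ a b x → (a ℤ.* b) · x ≡ a · (b · x)
    ·-one : ∀ x → pos 1 · x ≡ x
    ≼-refl : ∀ {x} → x ≼ x
    ≼-mono : ∀ {x y z w} → x ≼ y → z ≼ w → x ⊹ z ≼ y ⊹ w

infixl 6 _:+_
infixl 7 _:*_
-- Coefficients are integer polynomials and not numerals: later goals contain products such as D · N
-- · W of unknown integers.
data Scalar : Set where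
  svar : ℕ → Scalar
  con : ℤ → Scalar
  _:+_ _:*_ : Scalar → Scalar → Scalar
  :-_ : Scalar → Scalar

Curry : Set → ℕ → Set → Set
Curry A zero B = B
Curry A (suc n) B = A → Curry A n B

-- Feeds in the variables of index i, i + 1, ..., so that a problem can be written as an Agda
-- function and read back as syntax.
apply : ∀ {A B : Set} n → (ℕ → A) → ℕ → Curry A n B → B
apply zero g i f = f
apply (suc n) g i f = apply n g (suc i) (f (g i))

nth : ∀ {A : Set} {n} → A → Vec A n → ℕ → A
nth d [] i = d
nth d (x ∷ xs) zero = x
nth d (x ∷ xs) (suc i) = nth d xs i

module Lin (M : OrderedModule) where
  open OrderedModule M

  infixl 6 _⊕_ _⊖ₑ_
  infixr 7 _⊙_
  infix 4 _⊑_
  infix 3 _⊢_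

  data Ex : Set where
    var : ℕ → Ex
    _⊕_ : Ex → Ex → Ex
    ⊝_ : Ex → Ex
    𝟘 : Ex
    _⊙_ : Scalar → Ex → Ex

  _⊖ₑ_ : Ex → Ex → Ex
  x ⊖ₑ y = x ⊕ (⊝ y)

  idʳ : ∀ x → x ⊹ 𝟎 ≡ x
  idʳ x = trans (comm x 𝟎) (idˡ x)

  invʳ : ∀ x → x ⊹ (⊖ x) ≡ 𝟎
  invʳ x = trans (comm _ _) (invˡ x)

  interchange : ∀ a b c d → (a ⊹ b) ⊹ (c ⊹ d) ≡ (a ⊹ c) ⊹ (b ⊹ d)
  interchange a b c d = trans (assoc a b _) (trans (cong (a ⊹_) (trans (sym (assoc b c d)) (trans (cong (_⊹ d) (comm b c)) (assoc c b d)))) (sym (assoc a c _)))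

  cancelˡ : ∀ x {y z} → x ⊹ y ≡ x ⊹ z → y ≡ z
  cancelˡ x {y} {z} e = trans (sym (idˡ y)) (trans (cong (_⊹ y) (sym (invˡ x))) (trans (assoc _ x y)
    (trans (cong ((⊖ x) ⊹_) e) (trans (sym (assoc _ x z)) (trans (cong (_⊹ z) (invˡ x)) (idˡ z))))))

  ·-zeroˡ : ∀ x → pos 0 · x ≡ 𝟎
  ·-zeroˡ x = cancelˡ (pos 0 · x) (trans (sym (·-distribʳ x (pos 0) (pos 0))) (sym (idʳ _)))

  ·-zeroʳ : ∀ a → a · 𝟎 ≡ 𝟎
  ·-zeroʳ a = cancelˡ (a · 𝟎) (trans (sym (·-distribˡ a 𝟎 𝟎)) (trans (cong (a ·_) (idˡ 𝟎)) (sym (idʳ _))))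

  ·-negˡ : ∀ a x → (ℤ.- a) · x ≡ ⊖ (a · x)
  ·-negˡ a x = cancelˡ (a · x) (trans (sym (·-distribʳ x a (ℤ.- a)))
    (trans (cong (_· x) (ℤₚ.+-inverseʳ a)) (trans (·-zeroˡ x) (sym (invʳ _)))))

  ·-minus-one : ∀ x → -1ℤ · x ≡ ⊖ x
  ·-minus-one x = trans (·-negˡ 1ℤ x) (cong ⊖_ (·-one x))

  ·-swap : ∀ a b x → a · b · x ≡ b · a · x
  ·-swap a b x = trans (sym (·-assoc a b x)) (trans (cong (_· x) (ℤₚ.*-comm a b)) (·-assoc b a x))

  -- An integer times a monomial in the scalar variables times a module variable. `insert` keeps
  -- `key` sorted, so that equal monomials have equal keys.
  record Term : Set where
    constructor term
    field
      coeff : ℤ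
      key : List ℕ
      atom : ℕ
  open Term

  insert : ℕ → List ℕ → List ℕ
  insert i [] = i ∷ []
  insert i (j ∷ js) with i ℕ.≤ᵇ j
  ... | true = i ∷ j ∷ js
  ... | false = j ∷ insert i js

  scale : Scalar → List Term → List Term
  scale (svar i) = List.map λ t → term (coeff t) (insert i (key t)) (atom t)
  scale (con c) = List.map λ t → term (c ℤ.* coeff t) (key t) (atom t)
  scale (p :+ q) ts = scale p ts List.++ scale q ts
  scale (p :* q) ts = scale p (scale q ts)
  scale (:- p) ts = scale (con -1ℤ) (scale p ts)

  terms : Ex → List Term
  terms (var i) = term 1ℤ [] i ∷ []
  terms (e ⊕ f) = terms e List.++ terms f
  terms (⊝ e) = scale (con -1ℤ) (terms e)
  terms 𝟘 = []
  terms (p ⊙ e) = scale p (terms e)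

  same : (t u : Term) → Relation.Nullary.Dec (key t ≡ key u × atom t ≡ atom u)
  same t u with atom t ℕ.≟ atom u | ≡-dec ℕ._≟_ (key t) (key u)
  ... | yes p | yes q = yes (q , p)
  ... | no p | _ = no λ h → p (proj₂ h)
  ... | yes _ | no q = no λ h → q (proj₁ h)

  add : Term → List Term → List Term
  add t [] = t ∷ []
  add t (u ∷ us) with same t u
  ... | yes _ = term (coeff t ℤ.+ coeff u) (key u) (atom u) ∷ us
  ... | no _ = u ∷ add t us

  collect : List Term → List Term
  collect [] = []
  collect (t ∷ ts) = add t (collect ts)

  isZero : ℤ → Bool
  isZero (pos zero) = true
  isZero _ = false

  vanish : List Term → Bool
  vanish [] = true
  vanish (t ∷ ts) = isZero (coeff t) ∧ vanish ts

  check : Ex → Ex → Bool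
  check e f = vanish (collect (terms (e ⊖ₑ f)))

  module Semantics {k n} (σ : Vec ℤ k) (ρ : Vec C n) where
    ⟦_⟧ₛ : Scalar → ℤ
    ⟦ svar i ⟧ₛ = nth 0ℤ σ i
    ⟦ con c ⟧ₛ = c
    ⟦ p :+ q ⟧ₛ = ⟦ p ⟧ₛ ℤ.+ ⟦ q ⟧ₛ
    ⟦ p :* q ⟧ₛ = ⟦ p ⟧ₛ ℤ.* ⟦ q ⟧ₛ
    ⟦ :- p ⟧ₛ = ℤ.- ⟦ p ⟧ₛ

    ⟦_⟧ : Ex → C
    ⟦ var i ⟧ = nth 𝟎 ρ i
    ⟦ e ⊕ f ⟧ = ⟦ e ⟧ ⊹ ⟦ f ⟧
    ⟦ ⊝ e ⟧ = ⊖ ⟦ e ⟧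
    ⟦ 𝟘 ⟧ = 𝟎
    ⟦ p ⊙ e ⟧ = ⟦ p ⟧ₛ · ⟦ e ⟧

    mon : List ℕ → C → C
    mon [] x = x
    mon (i ∷ is) x = nth 0ℤ σ i · mon is x

    ⟦_⟧₁ : Term → C
    ⟦ term c is a ⟧₁ = c · mon is (nth 𝟎 ρ a)

    ⟦_⟧* : List Term → C
    ⟦ [] ⟧* = 𝟎
    ⟦ t ∷ ts ⟧* = ⟦ t ⟧₁ ⊹ ⟦ ts ⟧*

    mon-insert : ∀ i is x → mon (insert i is) x ≡ nth 0ℤ σ i · mon is x
    mon-insert i [] x = refl
    mon-insert i (j ∷ js) x with i ℕ.≤ᵇ j
    ... | true = refl
    ... | false = trans (cong (nth 0ℤ σ j ·_) (mon-insert i js x)) (·-swap _ _ _)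

    ++-sound : ∀ ts us → ⟦ ts List.++ us ⟧* ≡ ⟦ ts ⟧* ⊹ ⟦ us ⟧*
    ++-sound [] us = sym (idˡ _)
    ++-sound (t ∷ ts) us = trans (cong (_ ⊹_) (++-sound ts us)) (sym (assoc _ _ _))

    map-sound : ∀ (f : Term → Term) c → (∀ t → ⟦ f t ⟧₁ ≡ c · ⟦ t ⟧₁) → ∀ ts → ⟦ List.map f ts ⟧* ≡ c · ⟦ ts ⟧*
    map-sound f c h [] = sym (·-zeroʳ c)
    map-sound f c h (t ∷ ts) = trans (cong₂ _⊹_ (h t) (map-sound f c h ts)) (sym (·-distribˡ _ _ _))

    scale-sound : ∀ p ts → ⟦ scale p ts ⟧* ≡ ⟦ p ⟧ₛ · ⟦ ts ⟧*
    scale-sound (svar i) = map-sound _ _ λ t → trans (cong (coeff t ·_) (mon-insert i (key t) _)) (·-swap _ _ _)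
    scale-sound (con c) = map-sound _ _ λ t → ·-assoc c (coeff t) _
    scale-sound (p :+ q) ts = trans (++-sound (scale p ts) (scale q ts)) (trans (cong₂ _⊹_ (scale-sound p ts) (scale-sound q ts)) (sym (·-distribʳ _ _ _)))
    scale-sound (p :* q) ts = trans (scale-sound p (scale q ts)) (trans (cong (⟦ p ⟧ₛ ·_) (scale-sound q ts)) (sym (·-assoc _ _ _)))
    scale-sound (:- p) ts = trans (scale-sound (con -1ℤ) (scale p ts)) (trans (·-minus-one _)
      (trans (cong ⊖_ (scale-sound p ts)) (sym (·-negˡ _ _))))

    terms-sound : ∀ e → ⟦ terms e ⟧* ≡ ⟦ e ⟧
    terms-sound (var i) = trans (idʳ _) (·-one _)
    terms-sound (e ⊕ f) = trans (++-sound (terms e) (terms f)) (cong₂ _⊹_ (terms-sound e) (terms-sound f))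
    terms-sound (⊝ e) = trans (scale-sound (con -1ℤ) (terms e)) (trans (·-minus-one _) (cong ⊖_ (terms-sound e)))
    terms-sound 𝟘 = refl
    terms-sound (p ⊙ e) = trans (scale-sound p (terms e)) (cong (⟦ p ⟧ₛ ·_) (terms-sound e))

    add-sound : ∀ t ts → ⟦ add t ts ⟧* ≡ ⟦ t ⟧₁ ⊹ ⟦ ts ⟧*
    add-sound t [] = refl
    add-sound t (u ∷ us) with same t u
    ... | yes (refl , refl) = trans (cong (_⊹ ⟦ us ⟧*) (·-distribʳ _ _ _)) (assoc _ _ _)
    ... | no _ = trans (cong (⟦ u ⟧₁ ⊹_) (add-sound t us)) (trans (sym (assoc _ _ _)) (trans (cong (_⊹ ⟦ us ⟧*) (comm _ _)) (assoc _ _ _)))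

    collect-sound : ∀ ts → ⟦ collect ts ⟧* ≡ ⟦ ts ⟧*
    collect-sound [] = refl
    collect-sound (t ∷ ts) = trans (add-sound t (collect ts)) (cong (_ ⊹_) (collect-sound ts))

    vanish-sound : ∀ ts → vanish ts ≡ true → ⟦ ts ⟧* ≡ 𝟎
    vanish-sound [] _ = refl
    vanish-sound (term (pos zero) is a ∷ ts) h = trans (cong₂ _⊹_ (·-zeroˡ _) (vanish-sound ts h)) (idˡ _)

    sound : ∀ e f → check e f ≡ true → ⟦ e ⟧ ≡ ⟦ f ⟧
    sound e f h = cancelˡ (⊖ ⟦ f ⟧) (trans (comm _ _) (trans
      (trans (sym (terms-sound (e ⊖ₑ f))) (trans (sym (collect-sound (terms (e ⊖ₑ f)))) (vanish-sound (collect (terms (e ⊖ₑ f))) h)))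
      (sym (invˡ _))))

  record Rel : Set where
    constructor _⊑_
    field lhs rhs : Ex
  open Rel

  record Problem : Set where
    constructor _⊢_
    field
      hyps : List Rel
      goal : Rel
  open Problem
  open Semantics

  -- The last hypothesis is not paired with a unit, so that callers supply an ordinary tuple.
  Hyps : ∀ {k n} → List Rel → Vec ℤ k → Vec C n → Set
  Hyps [] σ ρ = ⊤
  Hyps (h ∷ []) σ ρ = ⟦_⟧ σ ρ (lhs h) ≼ ⟦_⟧ σ ρ (rhs h)
  Hyps (h ∷ hs@(_ ∷ _)) σ ρ = ⟦_⟧ σ ρ (lhs h) ≼ ⟦_⟧ σ ρ (rhs h) × Hyps hs σ ρ

  sumˡ sumʳ : List Rel → Ex
  sumˡ = List.foldr (λ h e → lhs h ⊕ e) 𝟘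
  sumʳ = List.foldr (λ h e → rhs h ⊕ e) 𝟘

  sum-hyps : ∀ {k n} (hs : List Rel) (σ : Vec ℤ k) (ρ : Vec C n) → Hyps hs σ ρ → ⟦_⟧ σ ρ (sumˡ hs) ≼ ⟦_⟧ σ ρ (sumʳ hs)
  sum-hyps [] σ ρ _ = ≼-refl
  sum-hyps (h ∷ []) σ ρ p = ≼-mono p ≼-refl
  sum-hyps (h ∷ hs@(_ ∷ _)) σ ρ (p , ps) = ≼-mono p (sum-hyps hs σ ρ ps)

  close : ∀ k n {B : Set} → Curry Scalar k (Curry Ex n B) → B
  close k n f = apply n var 0 (apply k svar 0 f)

  -- The goal a ≤ b follows by adding up the hypotheses when a + Σ rhs = b + Σ lhs.
  lin : ∀ {k n} (σ : Vec ℤ k) (ρ : Vec C n) (f : Curry Scalar k (Curry Ex n Problem)) →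
        let P = close k n f in
        check (lhs (goal P) ⊕ sumʳ (hyps P)) (rhs (goal P) ⊕ sumˡ (hyps P)) ≡ true →
        Hyps (hyps P) σ ρ → ⟦_⟧ σ ρ (lhs (goal P)) ≼ ⟦_⟧ σ ρ (rhs (goal P))
  lin {k} {n} σ ρ f eq hs = subst₂ _≼_ l r (≼-mono (≼-refl {x = b}) (≼-mono (sum-hyps (hyps P) σ ρ hs) (≼-refl {x = ⊖ ΣR})))
    where
      P = close k n f
      a = ⟦_⟧ σ ρ (lhs (goal P))
      b = ⟦_⟧ σ ρ (rhs (goal P))
      ΣL = ⟦_⟧ σ ρ (sumˡ (hyps P))
      ΣR = ⟦_⟧ σ ρ (sumʳ (hyps P))
      e : a ⊹ ΣR ≡ b ⊹ ΣL
      e = sound σ ρ (lhs (goal P) ⊕ sumʳ (hyps P)) (rhs (goal P) ⊕ sumˡ (hyps P)) eq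
      r : b ⊹ (ΣR ⊹ ⊖ ΣR) ≡ b
      r = trans (cong (b ⊹_) (invʳ ΣR)) (idʳ b)
      l : b ⊹ (ΣL ⊹ ⊖ ΣR) ≡ a
      l = trans (sym (assoc b ΣL _)) (trans (cong (_⊹ ⊖ ΣR) (sym e))
            (trans (assoc _ _ _) (trans (cong (a ⊹_) (invʳ ΣR)) (idʳ _))))

  eqn : ∀ {k n} (σ : Vec ℤ k) (ρ : Vec C n) (f : Curry Scalar k (Curry Ex n Rel)) →
        let P = close k n f in check (lhs P) (rhs P) ≡ true → ⟦_⟧ σ ρ (lhs P) ≡ ⟦_⟧ σ ρ (rhs P)
  eqn {k} {n} σ ρ f eq = sound σ ρ (lhs (close k n f)) (rhs (close k n f)) eq

module Decompositions (G : ZGStr) (isZ : IsZGroup G) where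
  open import Data.Vec using (_∷ʳ_; init; last; lookup; zipWith; tabulate; initLast)
  open import Data.List.Relation.Unary.All as All using (All; []; _∷_)

  -- Arithmetic in a ℤ-group

  open ZGStr G public
  open ZOps G public
  open IsZGroup isZ public

  infix 4 _≤_
  data _≤_ (x y : Z) : Set where
    lt : x < y → x ≤ y
    eq : x ≡ y → x ≤ y

  ≤-refl : ∀ {x} → x ≤ x
  ≤-refl = eq refl

  ≤-trans : ∀ {x y z} → x ≤ y → y ≤ z → x ≤ z
  ≤-trans (lt p) (lt q) = lt (<-trans _ _ _ p q)
  ≤-trans (lt p) (eq refl) = lt p
  ≤-trans (eq refl) q = q

  ≤-mono : ∀ {x y z w} → x ≤ y → z ≤ w → x + z ≤ y + w
  ≤-mono {x} {y} {z} {w} p q = ≤-trans (l p) (subst₂ _≤_ (+-comm z y) (+-comm w y) (l q))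
    where
      l : ∀ {x y z} → x ≤ y → x + z ≤ y + z
      l (lt p) = lt (<-+-compat _ _ _ p)
      l (eq refl) = ≤-refl

  +-identityʳ : ∀ x → x + 0z ≡ x
  +-identityʳ x = trans (+-comm x 0z) (+-identityˡ x)

  +-interchange : ∀ a b c d → (a + b) + (c + d) ≡ (a + c) + (b + d)
  +-interchange a b c d = trans (+-assoc a b _) (trans (cong (a +_) (trans (sym (+-assoc b c d))
    (trans (cong (_+ d) (+-comm b c)) (+-assoc c b d)))) (sym (+-assoc a c _)))

  +-cancelˡ : ∀ x {y z} → x + y ≡ x + z → y ≡ z
  +-cancelˡ x {y} {z} e = trans (sym (+-identityˡ y)) (trans (cong (_+ y) (sym (-‿inverseˡ x))) (trans (+-assoc _ x y)
    (trans (cong ((- x) +_) e) (trans (sym (+-assoc _ x z)) (trans (cong (_+ z) (-‿inverseˡ x)) (+-identityˡ z))))))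

  -‿+ : ∀ x y → - (x + y) ≡ (- x) + (- y)
  -‿+ x y = +-cancelˡ (x + y) (trans (+-comm _ _) (trans (-‿inverseˡ _) (sym (trans (+-interchange x y _ _)
    (trans (cong₂ _+_ (trans (+-comm _ _) (-‿inverseˡ x)) (trans (+-comm _ _) (-‿inverseˡ y))) (+-identityˡ 0z))))))

  -‿involutive : ∀ x → - (- x) ≡ x
  -‿involutive x = +-cancelˡ (- x) (trans (+-comm _ _) (trans (-‿inverseˡ _) (sym (-‿inverseˡ x))))

  neg-0z : - 0z ≡ 0z
  neg-0z = trans (sym (+-identityʳ _)) (-‿inverseˡ 0z)

  times-+ : ∀ a b x → times (a ℕ.+ b) x ≡ times a x + times b x
  times-+ zero b x = sym (+-identityˡ _)
  times-+ (suc a) b x = trans (cong (x +_) (times-+ a b x)) (sym (+-assoc _ _ _))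

  times-distrib : ∀ a x y → times a (x + y) ≡ times a x + times a y
  times-distrib zero x y = sym (+-identityˡ _)
  times-distrib (suc a) x y = trans (cong (x + y +_) (times-distrib a x y)) (+-interchange _ _ _ _)

  zmul-⊖ : ∀ a b x → zmul (a ℤ.⊖ b) x ≡ times a x + (- times b x)
  zmul-⊖ a zero x = trans (sym (+-identityʳ _)) (cong (times a x +_) (sym neg-0z))
  zmul-⊖ zero (suc b) x = sym (+-identityˡ _)
  zmul-⊖ (suc a) (suc b) x = trans (cong (λ k → zmul k x) (ℤₚ.[1+m]⊖[1+n]≡m⊖n a b)) (trans (zmul-⊖ a b x)
    (sym (trans (cong ((x + times a x) +_) (-‿+ x _)) (trans (+-interchange _ _ _ _)
      (trans (cong (_+ (times a x + (- times b x))) (trans (+-comm _ _) (-‿inverseˡ x))) (+-identityˡ _))))))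

  zmul-+ : ∀ x a b → zmul (a ℤ.+ b) x ≡ zmul a x + zmul b x
  zmul-+ x (pos a) (pos b) = times-+ a b x
  zmul-+ x (pos a) -[1+ b ] = zmul-⊖ a (suc b) x
  zmul-+ x -[1+ a ] (pos b) = trans (zmul-⊖ b (suc a) x) (+-comm _ _)
  zmul-+ x -[1+ a ] -[1+ b ] = trans (cong (λ n → - (x + times n x)) (sym (ℕₚ.+-suc a b)))
    (trans (cong -_ (times-+ (suc a) (suc b) x)) (-‿+ _ _))

  zmul-distrib : ∀ a x y → zmul a (x + y) ≡ zmul a x + zmul a y
  zmul-distrib (pos a) x y = times-distrib a x y
  zmul-distrib -[1+ a ] x y = trans (cong -_ (times-distrib (suc a) x y)) (-‿+ _ _)

  zmul-neg : ∀ a x → zmul (ℤ.- a) x ≡ - zmul a x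
  zmul-neg (pos zero) x = sym neg-0z
  zmul-neg (pos (suc a)) x = refl
  zmul-neg -[1+ a ] x = sym (-‿involutive _)

  zmul-times : ∀ a b x → zmul (pos a ℤ.* b) x ≡ times a (zmul b x)
  zmul-times zero b x = cong (λ k → zmul k x) (ℤₚ.*-zeroˡ b)
  zmul-times (suc a) b x = trans (cong (λ k → zmul k x) (ℤₚ.suc-* (pos a) b))
    (trans (zmul-+ x b (pos a ℤ.* b)) (cong (zmul b x +_) (zmul-times a b x)))

  zmul-* : ∀ a b x → zmul (a ℤ.* b) x ≡ zmul a (zmul b x)
  zmul-* (pos a) b x = zmul-times a b x
  zmul-* -[1+ a ] b x = trans (cong (λ k → zmul k x) (sym (ℤₚ.neg-distribˡ-* (pos (suc a)) b)))
    (trans (zmul-neg (pos (suc a) ℤ.* b) x) (cong -_ (zmul-times (suc a) b x)))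

  infixr 7 _·_
  -- Opaque, so that integer multiples stay atoms for the solver and are never unfolded into
  -- iterated sums.
  abstract
    _·_ : ℤ → Z → Z
    _·_ = zmul

    ·-zmul : ∀ k x → k · x ≡ zmul k x
    ·-zmul k x = refl

  om : OrderedModule
  om = record
    { C = Z ; _⊹_ = _+_ ; ⊖_ = -_ ; 𝟎 = 0z ; _·_ = _·_ ; _≼_ = _≤_
    ; assoc = +-assoc ; comm = +-comm ; idˡ = +-identityˡ ; invˡ = -‿inverseˡ
    ; ·-distribʳ = λ x a b → trans (·-zmul _ x) (trans (zmul-+ x a b) (sym (cong₂ _+_ (·-zmul a x) (·-zmul b x))))
    ; ·-distribˡ = λ a x y → trans (·-zmul a _) (trans (zmul-distrib a x y) (sym (cong₂ _+_ (·-zmul a x) (·-zmul a y))))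
    ; ·-assoc = λ a b x → trans (·-zmul _ x) (trans (zmul-* a b x) (sym (trans (·-zmul a _) (cong (zmul a) (·-zmul b x)))))
    ; ·-one = λ x → trans (·-zmul _ x) (+-identityʳ x)
    ; ≼-refl = ≤-refl ; ≼-mono = ≤-mono
    }

  open Lin om public hiding (idʳ; invʳ; interchange; cancelˡ; same; add; insert; scale)

  times-· : ∀ n x → times n x ≡ pos n · x
  times-· n x = sym (·-zmul (pos n) x)

  eq≥ : ∀ {x y} → x ≡ y → y ≤ x
  eq≥ e = eq (sym e)

  0≤1 : 0z ≤ 1z
  0≤1 = lt 0<1

  -- The difference is positive and `1z` is the least positive element. Strict inequalities are
  -- handled in this form from now on, since `lin` understands it.
  <⇒+1≤ : ∀ {x y} → x < y → x + 1z ≤ y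
  <⇒+1≤ {x} {y} p = lin [] (x ∷ y ∷ 1z ∷ []) (λ x y o → (o ⊑ (y ⊖ₑ x)) ∷ [] ⊢ (x ⊕ o ⊑ y)) refl h
    where
      0<y-x : 0z < y + (- x)
      0<y-x = subst (_< y + (- x)) (trans (+-comm _ _) (-‿inverseˡ x)) (<-+-compat x y (- x) p)
      h : 1z ≤ y + (- x)
      h with <-trichotomy (y + (- x)) 1z
      ... | inj₁ q = ⊥-elim (1-least _ 0<y-x q)
      ... | inj₂ (inj₁ q) = eq (sym q)
      ... | inj₂ (inj₂ q) = lt q

  +1≤⇒< : ∀ {x y} → x + 1z ≤ y → x < y
  +1≤⇒< {x} {y} h = f h
    where
      x<x+1 : x < x + 1z
      x<x+1 = subst₂ _<_ (+-identityˡ x) (+-comm 1z x) (<-+-compat 0z 1z x 0<1)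
      f : x + 1z ≤ y → x < y
      f (lt q) = <-trans _ _ _ x<x+1 q
      f (eq refl) = x<x+1

  compare : ∀ x y → x ≤ y ⊎ y + 1z ≤ x
  compare x y with <-trichotomy x y
  ... | inj₁ p = inj₁ (lt p)
  ... | inj₂ (inj₁ p) = inj₁ (eq p)
  ... | inj₂ (inj₂ p) = inj₂ (<⇒+1≤ p)

  absurd : 1z ≤ 0z → ⊥
  absurd h = <-irrefl 0z (f h)
    where
      f : 1z ≤ 0z → 0z < 0z
      f (lt p) = <-trans _ _ _ 0<1 p
      f (eq p) = subst (0z <_) p 0<1

  ≤-antisym : ∀ {x y} → x ≤ y → y ≤ x → x ≡ y
  ≤-antisym (eq p) _ = p
  ≤-antisym (lt p) (eq q) = sym q
  ≤-antisym (lt p) (lt q) = ⊥-elim (<-irrefl _ (<-trans _ _ _ p q))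

  infix 8 _‼
  _‼ : ℤ → Z
  k ‼ = k · 1z

  ·-nonneg : ∀ {k x} → 0ℤ ℤ.≤ k → 0z ≤ x → 0z ≤ k · x
  ·-nonneg {pos zero} {x} _ h = eq≥ (·-zeroˡ x)
  ·-nonneg {pos (suc n)} {x} _ h = lin (pos n ∷ []) (x ∷ []) (λ n x → ((𝟘 ⊑ x) ∷ (𝟘 ⊑ (n ⊙ x)) ∷ []) ⊢ (𝟘 ⊑ ((con 1ℤ :+ n) ⊙ x))) refl
    (h , ·-nonneg {pos n} (ℤ.+≤+ ℕ.z≤n) h)

  ·-monoʳ : ∀ {k x y} → 0ℤ ℤ.≤ k → x ≤ y → k · x ≤ k · y
  ·-monoʳ {k} {x} {y} 0≤k h = lin (k ∷ []) (x ∷ y ∷ []) (λ k x y → ((𝟘 ⊑ k ⊙ (y ⊖ₑ x)) ∷ []) ⊢ (k ⊙ x ⊑ k ⊙ y)) refl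
    (·-nonneg 0≤k (lin [] (x ∷ y ∷ []) (λ x y → ((x ⊑ y) ∷ []) ⊢ (𝟘 ⊑ (y ⊖ₑ x))) refl h))

  ·-monoˡ : ∀ {k l x} → k ℤ.≤ l → 0z ≤ x → k · x ≤ l · x
  ·-monoˡ {k} {l} {x} h 0≤x = lin (k ∷ l ∷ []) (x ∷ []) (λ k l x → ((𝟘 ⊑ (l :+ (:- k)) ⊙ x) ∷ []) ⊢ (k ⊙ x ⊑ l ⊙ x)) refl
    (·-nonneg (ℤₚ.i≤j⇒0≤j-i h) 0≤x)

  ·-grow : ∀ {k x} → 1ℤ ℤ.≤ k → 0z ≤ x → x ≤ k · x
  ·-grow {k} {x} h 0≤x = lin (k ∷ []) (x ∷ []) (λ k x → ((con 1ℤ ⊙ x ⊑ k ⊙ x) ∷ []) ⊢ (x ⊑ k ⊙ x)) refl (·-monoˡ h 0≤x)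

  ·-cancel-≤ : ∀ {k x y} → 1ℤ ℤ.≤ k → k · x ≤ k · y → x ≤ y
  ·-cancel-≤ {k} {x} {y} h p with compare x y
  ... | inj₁ q = q
  ... | inj₂ q = ⊥-elim (absurd (lin (k ∷ []) (x ∷ y ∷ 1z ∷ []) (λ k x y o →
      ((k ⊙ x ⊑ k ⊙ y) ∷ (k ⊙ (y ⊕ o) ⊑ k ⊙ x) ∷ (o ⊑ k ⊙ o) ∷ []) ⊢ (o ⊑ 𝟘)) refl
      (p , ·-monoʳ (ℤₚ.≤-trans (ℤ.+≤+ ℕ.z≤n) h) q , ·-grow h 0≤1)))

  ·-cancel-≡ : ∀ {k x y} → 1ℤ ℤ.≤ k → k · x ≡ k · y → x ≡ y
  ·-cancel-≡ h p = ≤-antisym (·-cancel-≤ h (eq p)) (·-cancel-≤ h (eq≥ p))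

  cong-· : ∀ {a b n} → CongZ a b n → ∃ λ c → a ≡ b + pos n · c
  cong-· {a} {b} {n} (c , e) = c , trans (eqn [] (a ∷ b ∷ []) (λ a b → a ⊑ (b ⊕ (a ⊖ₑ b))) refl) (cong (b +_) (trans e (times-· n c)))

  ·-cong : ∀ {a b n} c → a ≡ b + pos n · c → CongZ a b n
  ·-cong {a} {b} {n} c refl = c , trans (eqn (pos n ∷ []) (b ∷ c ∷ []) (λ n b c → (b ⊕ n ⊙ c) ⊖ₑ b ⊑ n ⊙ c) refl) (sym (times-· n c))

  max : Z → Z → Z
  max x y with compare x y
  ... | inj₁ _ = y
  ... | inj₂ _ = x

  x≤max : ∀ x y → x ≤ max x y
  x≤max x y with compare x y
  ... | inj₁ p = p
  ... | inj₂ _ = ≤-refl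

  y≤max : ∀ x y → y ≤ max x y
  y≤max x y with compare x y
  ... | inj₁ _ = ≤-refl
  ... | inj₂ p = lin [] (x ∷ y ∷ 1z ∷ []) (λ x y o → ((y ⊕ o ⊑ x) ∷ (𝟘 ⊑ o) ∷ []) ⊢ (y ⊑ x)) refl (p , 0≤1)

  private
    -- The difference j - i lies strictly between 0 and n, whereas n · c is at most 0 or at least n.
    toℕ<-small : ∀ {n} (i j : Fin n) → toℕ i ℕ.< toℕ j → ∀ c → pos (toℕ j) ‼ ≡ pos (toℕ i) ‼ + pos n · c → ⊥
    toℕ<-small {n} i j i<j c e with compare c 0z
    ... | inj₁ c≤0 = absurd (lin (pos (toℕ i) ∷ pos (toℕ j) ∷ pos n ∷ []) (1z ∷ c ∷ []) (λ i j n o c →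
            ((j ⊙ o ⊑ i ⊙ o ⊕ n ⊙ c) ∷ (n ⊙ c ⊑ n ⊙ 𝟘) ∷ ((con 1ℤ :+ i) ⊙ o ⊑ j ⊙ o) ∷ []) ⊢ (o ⊑ 𝟘)) refl
            (eq e , ·-monoʳ (ℤ.+≤+ ℕ.z≤n) c≤0 , ·-monoˡ (ℤ.+≤+ i<j) 0≤1))
    ... | inj₂ 1≤c = absurd (lin (pos (toℕ i) ∷ pos (toℕ j) ∷ pos n ∷ []) (1z ∷ c ∷ []) (λ i j n o c →
            ((i ⊙ o ⊕ n ⊙ c ⊑ j ⊙ o) ∷ (n ⊙ (𝟘 ⊕ o) ⊑ n ⊙ c) ∷ ((con 1ℤ :+ j) ⊙ o ⊑ n ⊙ o) ∷ (𝟘 ⊑ i ⊙ o) ∷ []) ⊢ (o ⊑ 𝟘)) refl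
            (eq≥ e , ·-monoʳ (ℤ.+≤+ ℕ.z≤n) 1≤c , ·-monoˡ (ℤ.+≤+ (Finₚ.toℕ<n j)) 0≤1 , ·-nonneg (ℤ.+≤+ ℕ.z≤n) 0≤1))

  class : ∀ n → 1 ℕ.≤ n → Z → Fin n
  class n 1≤n x = proj₁ (proj₂ (quotient-size n 1≤n) x)

  same-class : ∀ n 1≤n {x y} → class n 1≤n x ≡ class n 1≤n y → ∃ λ c → x ≡ y + pos n · c
  same-class n 1≤n {x} {y} same
    with cong-· (proj₁ (proj₂ (proj₂ (quotient-size n 1≤n) x))) | cong-· (proj₁ (proj₂ (proj₂ (quotient-size n 1≤n) y)))
  ... | c , e | d , f = c + (- d) , trans e (trans (cong (λ a → proj₁ (quotient-size n 1≤n) a + pos n · c) same)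
        (trans (eqn (pos n ∷ []) (r ∷ c ∷ d ∷ []) (λ n r c d → r ⊕ n ⊙ c ⊑ (r ⊕ n ⊙ d) ⊕ n ⊙ (c ⊖ₑ d)) refl)
          (cong (_+ pos n · (c + (- d))) (sym f))))
    where r = proj₁ (quotient-size n 1≤n) (class n 1≤n y)

  -- Two of the n + 1 elements x, 0, 1, …, n − 1 share a residue class, and 0, …, n − 1 do not.
  residue : ∀ n → 1 ℕ.≤ n → ∀ x → ∃ λ (i : Fin n) → ∃ λ c → x ≡ pos (toℕ i) ‼ + pos n · c
  residue n 1≤n x = go (Finₚ.pigeonhole (ℕₚ.n<1+n n) (λ j → class n 1≤n (elt j)))
    where
      elt : Fin (suc n) → Z
      elt zero = x
      elt (suc j) = pos (toℕ j) ‼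
      go : (∃₂ λ i j → i Fin.< j × class n 1≤n (elt i) ≡ class n 1≤n (elt j)) → ∃ λ i → ∃ λ c → x ≡ pos (toℕ i) ‼ + pos n · c
      go (zero , suc j , _ , same) = j , same-class n 1≤n same
      go (suc i , suc j , ℕ.s≤s i<j , same) with same-class n 1≤n (sym same)
      ... | c , e = ⊥-elim (toℕ<-small i j i<j c e)

  divide′ : ∀ d → 1ℤ ℤ.≤ d → ∀ x → ∃ λ q → d · q ≤ x × x + 1z ≤ d · q + d ‼
  divide′ (pos n) (ℤ.+≤+ 1≤n) x with residue n 1≤n x
  ... | i , c , e = c
      , lin (pos n ∷ pos (toℕ i) ∷ []) (x ∷ c ∷ 1z ∷ []) (λ n i x c o → (((i ⊙ o ⊕ n ⊙ c) ⊑ x) ∷ (𝟘 ⊑ i ⊙ o) ∷ []) ⊢ (n ⊙ c ⊑ x)) refl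
          (eq≥ e , ·-nonneg (ℤ.+≤+ ℕ.z≤n) 0≤1)
      , lin (pos n ∷ pos (toℕ i) ∷ []) (x ∷ c ∷ 1z ∷ []) (λ n i x c o → ((x ⊑ (i ⊙ o ⊕ n ⊙ c)) ∷ ((con 1ℤ :+ i) ⊙ o ⊑ n ⊙ o) ∷ []) ⊢ (x ⊕ o ⊑ n ⊙ c ⊕ n ⊙ o)) refl
          (eq e , ·-monoˡ (ℤ.+≤+ (Finₚ.toℕ<n i)) 0≤1)

  abstract
    divide : ∀ d → 1ℤ ℤ.≤ d → ∀ x → ∃ λ q → d · q ≤ x × x + 1z ≤ d · q + d ‼
    divide = divide′

  -- Neighbourhoods and closures

  open Geometry G public
  open Q public

  den⁺ : Q → ℤ
  den⁺ q = pos (suc (den q))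

  1≤pos : ∀ {n} → 1ℤ ℤ.≤ pos (suc n)
  1≤pos = ℤ.+≤+ (ℕ.s≤s ℕ.z≤n)

  0≤pos : ∀ {n} → 0ℤ ℤ.≤ pos n
  0≤pos = ℤ.+≤+ ℕ.z≤n

  <Q⇒ : ∀ x y → x <Q y → den⁺ y · num x + 1z ≤ den⁺ x · num y
  <Q⇒ x y p = <⇒+1≤ (subst₂ _<_ (times-· _ _) (times-· _ _) p)

  ⇒<Q : ∀ x y → den⁺ y · num x + 1z ≤ den⁺ x · num y → x <Q y
  ⇒<Q x y p = subst₂ _<_ (sym (times-· _ _)) (sym (times-· _ _)) (+1≤⇒< p)

  ≈Q⇒ : ∀ x y → x ≈Q y → den⁺ y · num x ≡ den⁺ x · num y
  ≈Q⇒ x y p = trans (sym (times-· _ _)) (trans p (times-· _ _))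

  ⇒≈Q : ∀ x y → den⁺ y · num x ≡ den⁺ x · num y → x ≈Q y
  ⇒≈Q x y p = trans (times-· _ _) (trans p (sym (times-· _ _)))

  ·-cancel-< : ∀ {k x y} → 1ℤ ℤ.≤ k → k · x + 1z ≤ k · y → x + 1z ≤ y
  ·-cancel-< {k} {x} {y} h p with compare y x
  ... | inj₂ q = q
  ... | inj₁ q = ⊥-elim (absurd (lin (k ∷ []) (x ∷ y ∷ 1z ∷ []) (λ k x y o → ((k ⊙ y ⊑ k ⊙ x) ∷ (k ⊙ x ⊕ o ⊑ k ⊙ y) ∷ []) ⊢ (o ⊑ 𝟘)) refl
          (·-monoʳ (ℤₚ.≤-trans (ℤ.+≤+ ℕ.z≤n) h) q , p)))

  ·-strict : ∀ {k x y} → 1ℤ ℤ.≤ k → x + 1z ≤ y → k · x + 1z ≤ k · y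
  ·-strict {k} {x} {y} h p = lin (k ∷ []) (x ∷ y ∷ 1z ∷ []) (λ k x y o → ((k ⊙ (x ⊕ o) ⊑ k ⊙ y) ∷ (o ⊑ k ⊙ o) ∷ []) ⊢ (k ⊙ x ⊕ o ⊑ k ⊙ y)) refl
    (·-monoʳ (ℤₚ.≤-trans (ℤ.+≤+ ℕ.z≤n) h) p , ·-grow h 0≤1)

  ≈Q-trans : ∀ x y z → x ≈Q y → y ≈Q z → x ≈Q z
  ≈Q-trans x y z p q = ⇒≈Q x z (·-cancel-≡ {den⁺ y} 1≤pos
    (trans (eqn (dx ∷ dy ∷ dz ∷ []) (num x ∷ []) (λ _ dy dz x → dy ⊙ dz ⊙ x ⊑ dz ⊙ dy ⊙ x) refl)
    (trans (cong (dz ·_) (≈Q⇒ x y p))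
    (trans (eqn (dx ∷ dy ∷ dz ∷ []) (num y ∷ []) (λ dx _ dz y → dz ⊙ dx ⊙ y ⊑ dx ⊙ dz ⊙ y) refl)
    (trans (cong (dx ·_) (≈Q⇒ y z q))
    (eqn (dx ∷ dy ∷ dz ∷ []) (num z ∷ []) (λ dx dy _ z → dx ⊙ dy ⊙ z ⊑ dy ⊙ dx ⊙ z) refl))))))
    where
      dx = den⁺ x
      dy = den⁺ y
      dz = den⁺ z

  <Q-respʳ : ∀ x y z → x <Q y → y ≈Q z → x <Q z
  <Q-respʳ x y z p q = ⇒<Q x z (·-cancel-< {dy} 1≤pos
    (lin (dx ∷ dy ∷ dz ∷ []) (num x ∷ num y ∷ num z ∷ 1z ∷ []) (λ dx dy dz x y z o →
       (dz ⊙ dy ⊙ x ⊕ o ⊑ dz ⊙ dx ⊙ y) ∷ (dx ⊙ dz ⊙ y ⊑ dx ⊙ dy ⊙ z) ∷ [] ⊢ (dy ⊙ dz ⊙ x ⊕ o ⊑ dy ⊙ dx ⊙ z)) refl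
       (·-strict {dz} {dy · num x} {dx · num y} 1≤pos (<Q⇒ x y p) , eq (cong (dx ·_) (≈Q⇒ y z q)))))
    where
      dx = den⁺ x
      dy = den⁺ y
      dz = den⁺ z

  <Q-respˡ : ∀ x y z → y <Q x → y ≈Q z → z <Q x
  <Q-respˡ x y z p q = ⇒<Q z x (·-cancel-< {dy} 1≤pos
    (lin (dx ∷ dy ∷ dz ∷ []) (num x ∷ num y ∷ num z ∷ 1z ∷ []) (λ dx dy dz x y z o →
       (dz ⊙ dx ⊙ y ⊕ o ⊑ dz ⊙ dy ⊙ x) ∷ (dx ⊙ dy ⊙ z ⊑ dx ⊙ dz ⊙ y) ∷ [] ⊢ (dy ⊙ dx ⊙ z ⊕ o ⊑ dy ⊙ dz ⊙ x)) refl
       (·-strict {dz} {dx · num y} {dy · num x} 1≤pos (<Q⇒ y x p) , eq≥ (cong (dx ·_) (≈Q⇒ y z q)))))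
    where
      dx = den⁺ x
      dy = den⁺ y
      dz = den⁺ z

  infix 9 _//_
  _//_ : Z → ℕ → Q
  z // d = z /1+ d

  //-< : ∀ a b d → (a // d) <Q (b // d) → a + 1z ≤ b
  //-< a b d p = ·-cancel-< {pos (suc d)} 1≤pos (<Q⇒ (a // d) (b // d) p)

  -- q lies in [w/(1+d), (w+1)/(1+d)[ for w = floor d q
  abstract
    floor-spec : ∀ d q → ∃ λ w → den⁺ q · w ≤ pos (suc d) · num q × pos (suc d) · num q + 1z ≤ den⁺ q · w + den⁺ q ‼
    floor-spec d q = divide (den⁺ q) 1≤pos (pos (suc d) · num q)

  floor : ℕ → Q → Z
  floor d q = proj₁ (floor-spec d q)

  floor-low : ∀ d q → ((floor d q + - 1z) // d) <Q q
  floor-low d q = ⇒<Q ((floor d q + - 1z) // d) q (lin (den⁺ q ∷ pos (suc d) ∷ []) (floor d q ∷ num q ∷ 1z ∷ []) (λ e d w n o →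
      ((e ⊙ w ⊑ d ⊙ n) ∷ (o ⊑ e ⊙ o) ∷ []) ⊢ (e ⊙ (w ⊖ₑ o) ⊕ o ⊑ d ⊙ n)) refl (proj₁ (proj₂ (floor-spec d q)) , ·-grow 1≤pos 0≤1))

  floor-high : ∀ d q → q <Q ((floor d q + 1z) // d)
  floor-high d q = ⇒<Q q ((floor d q + 1z) // d) (lin (den⁺ q ∷ pos (suc d) ∷ []) (floor d q ∷ num q ∷ 1z ∷ []) (λ e d w n o →
      ((d ⊙ n ⊕ o ⊑ e ⊙ w ⊕ e ⊙ o) ∷ []) ⊢ (d ⊙ n ⊕ o ⊑ e ⊙ (w ⊕ o))) refl (proj₂ (proj₂ (floor-spec d q))))

  floor-≈ : ∀ d q a → (a // d) ≈Q q → floor d q ≡ a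
  floor-≈ d q a p = ≤-antisym
    (lin [] (floor d q ∷ a ∷ 1z ∷ []) (λ w a o → (((w ⊖ₑ o) ⊕ o ⊑ a ) ∷ []) ⊢ (w ⊑ a)) refl
      (//-< (floor d q + - 1z) a d (<Q-respʳ ((floor d q + - 1z) // d) q (a // d) (floor-low d q) (sym p))))
    (lin [] (floor d q ∷ a ∷ 1z ∷ []) (λ w a o → ((a ⊕ o ⊑ w ⊕ o) ∷ []) ⊢ (a ⊑ w)) refl
      (//-< a (floor d q + 1z) d (<Q-respˡ ((floor d q + 1z) // d) q (a // d) (floor-high d q) (sym p))))

  -- With w the floor of q, the interval is ]w - 1, w + 1[ if q = w and ]w, w + 1[ otherwise; the
  -- latter contains no integral point at all.
  isolate : ∀ q → ∃₂ λ l u → l <Q q × q <Q u × (∀ w → l <Q embQ w → embQ w <Q u → embQ w ≈Q q)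
  isolate q with compare (pos 1 · num q) (den⁺ q · floor 0 q)
  ... | inj₁ h = embQ (w + - 1z) , embQ (w + 1z) , floor-low 0 q , floor-high 0 q , λ v p r →
        ⇒≈Q (embQ v) q (trans (cong (den⁺ q ·_) (≤-antisym {v} {w}
          (lin [] (v ∷ w ∷ 1z ∷ []) (λ v w o → ((v ⊕ o ⊑ w ⊕ o) ∷ []) ⊢ (v ⊑ w)) refl (//-< v (w + 1z) 0 r))
          (lin [] (v ∷ w ∷ 1z ∷ []) (λ v w o → (((w ⊖ₑ o) ⊕ o ⊑ v) ∷ []) ⊢ (w ⊑ v)) refl (//-< (w + - 1z) v 0 p))))
          (≤-antisym (proj₁ (proj₂ (floor-spec 0 q))) h))
    where w = floor 0 q
  ... | inj₂ h = embQ w , embQ (w + 1z) , ⇒<Q (embQ w) q h , floor-high 0 q , λ v p r →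
        ⊥-elim (absurd (lin [] (v ∷ w ∷ 1z ∷ []) (λ v w o → ((w ⊕ o ⊑ v) ∷ (v ⊕ o ⊑ w ⊕ o) ∷ []) ⊢ (o ⊑ 𝟘)) refl
          (//-< w v 0 p , //-< v (w + 1z) 0 r)))
    where w = floor 0 q

  above : ∀ l → ∃ λ b → ∀ w → b ≤ w → l <Q embQ w
  above l = floor 0 l + 1z , λ w h → ⇒<Q l (embQ w) (≤-trans (<Q⇒ l (embQ (floor 0 l + 1z)) (floor-high 0 l)) (·-monoʳ 0≤pos h))

  private variable
    m : ℕ
    Elt : Set

  -- Internally points are stored with the last coordinate first, so that a socle is a tail.
  rv : Vec Elt m → Vec Elt m
  rv {m = zero} [] = []
  rv {m = suc m} xs = last xs ∷ rv (init xs)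

  init-last : (xs : Vec Elt (suc m)) → xs ≡ init xs ∷ʳ last xs
  init-last xs = proj₂ (proj₂ (initLast xs))

  rv-injective : (xs ys : Vec Elt m) → rv xs ≡ rv ys → xs ≡ ys
  rv-injective {m = zero} [] [] _ = refl
  rv-injective {m = suc m} xs ys e = trans (init-last xs) (trans
    (cong₂ _∷ʳ_ (rv-injective (init xs) (init ys) (cong Vec.tail e)) (cong Vec.head e)) (sym (init-last ys)))

  rv-∷ʳ : (xs : Vec Elt m) (x : Elt) → rv (xs ∷ʳ x) ≡ x ∷ rv xs
  rv-∷ʳ xs x = cong₂ _∷_ (last-∷ʳ x xs) (cong rv (init-∷ʳ x xs))

  rv-map : ∀ {B : Set} (f : Elt → B) (xs : Vec Elt m) → rv (Vec.map f xs) ≡ Vec.map f (rv xs)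
  rv-map {m = zero} f [] = refl
  rv-map {m = suc m} f xs = trans (cong (λ v → rv (Vec.map f v)) (init-last xs))
    (trans (cong rv (map-∷ʳ f (last xs) (init xs))) (trans (rv-∷ʳ _ _) (cong (f (last xs) ∷_) (rv-map f (init xs)))))

  Pt : ℕ → Set
  Pt m = Vec Z m

  mk : ∀ {X : Set} → Bool → X → Maybe X
  mk true z = just z
  mk false z = nothing

  -- Points of F_I(Γ^m) are coded by vectors over 𝒵, whose entries outside I are discarded. This
  -- keeps forms and rays free of case distinctions on +∞.
  toG : Vec Bool m → Pt m → GPt m
  toG [] [] = []
  toG (t ∷ I) (z ∷ v) = toG I v ∷ʳ mk t z

  rv-toG : (I : Vec Bool m) (v : Pt m) → rv (toG I v) ≡ Vec.zipWith mk I v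
  rv-toG [] [] = refl
  rv-toG (t ∷ I) (z ∷ v) = trans (rv-∷ʳ _ _) (cong (mk t z ∷_) (rv-toG I v))

  is-just-mk : ∀ {X : Set} t (z : X) → is-just (mk t z) ≡ t
  is-just-mk true z = refl
  is-just-mk false z = refl

  rv-supp-toG : (I : Vec Bool m) (v : Pt m) → rv (supp (toG I v)) ≡ I
  rv-supp-toG I v = trans (rv-map is-just (toG I v)) (trans (cong (Vec.map is-just) (rv-toG I v)) (h I v))
    where
      h : ∀ {m} (I : Vec Bool m) (v : Pt m) → Vec.map is-just (Vec.zipWith mk I v) ≡ I
      h [] [] = refl
      h (t ∷ I) (z ∷ v) = cong₂ _∷_ (is-just-mk t z) (h I v)

  Ok-init : (x : ΩPt (suc m)) (l u : Vec Q (suc m)) → OkV x l u → OkV (init x) (init l) (init u) × Ok1 (last x) (last l) (last u)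
  Ok-init {m = zero} (x ∷ []) (l ∷ []) (u ∷ []) (p , _) = tt , p
  Ok-init {m = suc m} (x ∷ xs) (l ∷ ls) (u ∷ us) (p , ps) = (p , proj₁ (Ok-init xs ls us ps)) , proj₂ (Ok-init xs ls us ps)

  Ok-∷ʳ : (x : ΩPt (suc m)) (l u : Vec Q m) {a b : Q} → OkV (init x) l u → Ok1 (last x) a b → OkV x (l ∷ʳ a) (u ∷ʳ b)
  Ok-∷ʳ {m = zero} (x ∷ []) [] [] _ q = q , tt
  Ok-∷ʳ {m = suc m} (x ∷ xs) (l ∷ ls) (u ∷ us) (p , ps) q = p , Ok-∷ʳ xs ls us ps q

  In-∷ʳ : (x : ΩPt (suc m)) (l u : Vec Q (suc m)) (y : ΩPt m) {c : Ω} → InV (init x) (init l) (init u) y → In1 (last x) (last l) (last u) c → InV x l u (y ∷ʳ c)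
  In-∷ʳ {m = zero} (x ∷ []) (l ∷ []) (u ∷ []) [] _ q = q , tt
  In-∷ʳ {m = suc m} (x ∷ xs) (l ∷ ls) (u ∷ us) (y ∷ ys) (p , ps) q = p , In-∷ʳ xs ls us ys ps q

  In-init : (x : ΩPt (suc m)) (l u : Vec Q m) (y : ΩPt m) {a b : Q} {c : Ω} → InV x (l ∷ʳ a) (u ∷ʳ b) (y ∷ʳ c) → InV (init x) l u y × In1 (last x) a b c
  In-init {m = zero} (x ∷ []) [] [] [] (q , _) = tt , q
  In-init {m = suc m} (x ∷ xs) (l ∷ ls) (u ∷ us) (y ∷ ys) (p , ps) = (p , proj₁ (In-init xs ls us ys ps)) , proj₂ (In-init xs ls us ys ps)

  near1 : Bool → Ω → Z → Z → Set
  near1 true (just q) b z = embQ z ≈Q q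
  near1 true nothing b z = b ≤ z
  near1 false (just q) b z = ⊥
  near1 false nothing b z = ⊤

  -- By `isolate`, the neighbourhoods of x can be tested on 𝒵-points by a single bound b: equality
  -- at the finite coordinates of x, at least b at the infinite ones. The topology of the rest of
  -- the proof is expressed through this relation.
  Near : Vec Bool m → ΩPt m → Z → Pt m → Set
  Near I x b v = ∀ j → near1 (lookup I j) (lookup (rv x) j) b (lookup v j)

  near1-mono : ∀ t x {b b′ z} → b′ ≤ b → near1 t x b z → near1 t x b′ z
  near1-mono true (just q) h p = p
  near1-mono true nothing h p = ≤-trans h p
  near1-mono false nothing h p = p

  Near-mono : ∀ (I : Vec Bool m) x v {b b′} → b′ ≤ b → Near I x b v → Near I x b′ v
  Near-mono I x v h p j = near1-mono (lookup I j) (lookup (rv x) j) h (p j)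

  near1⇒In : ∀ t x l u → Ok1 x l u → ∃ λ b → ∀ z → near1 t x b z → In1 x l u (embΓ (mk t z))
  near1⇒In true (just q) l u (p , r) = 0z , λ z e → <Q-respʳ l q (embQ z) p (sym e) , <Q-respˡ u q (embQ z) r (sym e)
  near1⇒In true nothing l u _ = above l
  near1⇒In false (just q) l u _ = 0z , λ z ()
  near1⇒In false nothing l u _ = 0z , λ _ _ → tt

  Near⇒In : (I : Vec Bool m) (x : ΩPt m) (l u : Vec Q m) → OkV x l u → ∃ λ b → ∀ v → Near I x b v → InV x l u (embPt (toG I v))
  Near⇒In [] [] [] [] _ = 0z , λ { [] _ → tt }
  Near⇒In (t ∷ I) x l u ok with Near⇒In I (init x) (init l) (init u) (proj₁ (Ok-init x l u ok))
                              | near1⇒In t (last x) (last l) (last u) (proj₂ (Ok-init x l u ok))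
  ... | b , f | c , g = max b c , λ { (z ∷ v) n → subst (InV x l u) (sym (map-∷ʳ embΓ (mk t z) (toG I v)))
        (In-∷ʳ x l u _ (f v (Near-mono I (init x) v (x≤max b c) (λ j → n (suc j)))) (g z (near1-mono t (last x) (y≤max b c) (n zero)))) }

  In⇒near1 : ∀ t x b → ∃₂ λ l u → Ok1 x l u × (∀ z → In1 x l u (embΓ (mk t z)) → near1 t x b z)
  In⇒near1 true (just q) b with isolate q
  ... | l , u , p , r , f = l , u , (p , r) , λ z i → f z (proj₁ i) (proj₂ i)
  In⇒near1 true nothing b = embQ (b + - 1z) , 0Q , tt , λ z i →
    lin [] (b ∷ z ∷ 1z ∷ []) (λ b z o → (((b ⊖ₑ o) ⊕ o ⊑ z) ∷ []) ⊢ (b ⊑ z)) refl (//-< (b + - 1z) z 0 i)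
  In⇒near1 false (just q) b with isolate q
  ... | l , u , p , r , f = l , u , (p , r) , λ z ()
  In⇒near1 false nothing b = 0Q , 0Q , tt , λ _ _ → tt

  In⇒Near : (I : Vec Bool m) (x : ΩPt m) (b : Z) → ∃₂ λ l u → OkV x l u × (∀ v → InV x l u (embPt (toG I v)) → Near I x b v)
  In⇒Near [] [] b = [] , [] , tt , λ _ _ ()
  In⇒Near (t ∷ I) x b with In⇒Near I (init x) b | In⇒near1 t (last x) b
  ... | ls , us , ok , f | l , u , ok₁ , g = ls ∷ʳ l , us ∷ʳ u , Ok-∷ʳ x ls us ok ok₁ , λ { (z ∷ v) i → h z v (subst (InV x _ _) (map-∷ʳ embΓ (mk t z) (toG I v)) i) }
    where
      h : ∀ z v → InV x (ls ∷ʳ l) (us ∷ʳ u) (embPt (toG I v) ∷ʳ embΓ (mk t z)) → Near (t ∷ I) x b (z ∷ v)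
      h z v i zero = g z (proj₂ (In-init x ls us _ i))
      h z v i (suc j) = f v (proj₁ (In-init x ls us _ i)) j

  Lim : Vec Bool m → (Pt m → Set) → ΩPt m → Set
  Lim I X x = ∀ b → ∃ λ v → X v × Near I x b v

  gp : Vec Bool m → (Pt m → Set) → Pred (GPt m) _
  gp I X a = ∃ λ v → X v × a ≡ toG I v

  Cl⇒Lim : ∀ (I : Vec Bool m) {X S} → (∀ a → S a → gp I X a) → ∀ x → Cl S x → Lim I X x
  Cl⇒Lim I S⊆ x c b with In⇒Near I x b
  ... | l , u , ok , f with c l u ok
  ... | _ , i , a , s , refl with S⊆ a s
  ... | v , xv , refl = v , xv , f v i

  Lim⇒Cl : ∀ (I : Vec Bool m) {X S} → (∀ v → X v → S (toG I v)) → ∀ x → Lim I X x → Cl S x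
  Lim⇒Cl I ⊆S x lim l u ok with Near⇒In I x l u ok
  ... | b , f with lim b
  ... | v , xv , n = _ , f v n , toG I v , ⊆S v xv , refl

  -- Integral forms and affine maps

  infixl 6 _⊞_ _⊟_
  infixr 7 _⊡_
  -- Affine forms with integral coefficients and constants in 𝒵, kept as syntax so that `eval` and
  -- `slope` compute and a form on the socle lifts by `up`. `top` is the last coordinate, stored
  -- first.
  data Form : ℕ → Set where
    const : Z → Form m
    top : Form (suc m)
    up : Form m → Form (suc m)
    _⊞_ : Form m → Form m → Form m
    _⊡_ : ℤ → Form m → Form m

  _⊟_ : Form m → Form m → Form m
  F ⊟ F′ = F ⊞ (ℤ.-1ℤ ⊡ F′)

  eval : Form m → Pt m → Z
  eval (const c) v = c
  eval top (z ∷ v) = z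
  eval (up F) (z ∷ v) = eval F v
  eval (F ⊞ F′) v = eval F v + eval F′ v
  eval (k ⊡ F) v = k · eval F v

  Dir : ℕ → Set
  Dir m = Vec ℤ m

  slope : Form m → Dir m → ℤ
  slope (const c) r = 0ℤ
  slope top (ρ ∷ r) = ρ
  slope (up F) (ρ ∷ r) = slope F r
  slope (F ⊞ F′) r = slope F r ℤ.+ slope F′ r
  slope (k ⊡ F) r = k ℤ.* slope F r

  infixl 6 _+[_]_
  -- Directions are integral, but the length of a step ranges over 𝒵, which may contain infinitely
  -- large elements.
  _+[_]_ : Pt m → Z → Dir m → Pt m
  v +[ w ] r = zipWith (λ x ρ → x + ρ · w) v r

  eval-move : (F : Form m) (v : Pt m) (w : Z) (r : Dir m) → eval F (v +[ w ] r) ≡ eval F v + slope F r · w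
  eval-move (const c) v w r = eqn [] (c ∷ w ∷ []) (λ c w → c ⊑ c ⊕ con 0ℤ ⊙ w) refl
  eval-move top (z ∷ v) w (ρ ∷ r) = refl
  eval-move (up F) (z ∷ v) w (ρ ∷ r) = eval-move F v w r
  eval-move (F ⊞ F′) v w r = trans (cong₂ _+_ (eval-move F v w r) (eval-move F′ v w r))
    (eqn (slope F r ∷ slope F′ r ∷ []) (eval F v ∷ eval F′ v ∷ w ∷ []) (λ s t x y w → (x ⊕ s ⊙ w) ⊕ (y ⊕ t ⊙ w) ⊑ (x ⊕ y) ⊕ (s :+ t) ⊙ w) refl)
  eval-move (k ⊡ F) v w r = trans (cong (k ·_) (eval-move F v w r))
    (eqn (k ∷ slope F r ∷ []) (eval F v ∷ w ∷ []) (λ k s x w → k ⊙ (x ⊕ s ⊙ w) ⊑ k ⊙ x ⊕ (k :* s) ⊙ w) refl)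

  ext : ∀ {A : Set} → Vec A m → Vec A m
  ext [] = []
  ext (x ∷ xs) = ext xs ∷ʳ x

  rv-ext : ∀ {A : Set} (xs : Vec A m) → rv (ext xs) ≡ xs
  rv-ext [] = refl
  rv-ext (x ∷ xs) = trans (rv-∷ʳ (ext xs) x) (cong (x ∷_) (rv-ext xs))

  ext-rv : ∀ {A : Set} (xs : Vec A m) → ext (rv xs) ≡ xs
  ext-rv xs = rv-injective _ _ (rv-ext (rv xs))

  dot : Vec ℤ m → Pt m → Z
  dot [] [] = 0z
  dot (k ∷ ks) (z ∷ v) = k · z + dot ks v

  dot-∷ʳ : (ks : Vec ℤ m) (v : Pt m) (k : ℤ) (z : Z) → dot (ks ∷ʳ k) (v ∷ʳ z) ≡ k · z + dot ks v
  dot-∷ʳ [] [] k z = refl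
  dot-∷ʳ (k′ ∷ ks) (z′ ∷ v) k z = trans (cong (k′ · z′ +_) (dot-∷ʳ ks v k z))
    (eqn [] (k′ · z′ ∷ k · z ∷ dot ks v ∷ []) (λ a b c → a ⊕ (b ⊕ c) ⊑ b ⊕ (a ⊕ c)) refl)

  dot-ext : (ks : Vec ℤ m) (v : Pt m) → dot (ext ks) (ext v) ≡ dot ks v
  dot-ext [] [] = refl
  dot-ext (k ∷ ks) (z ∷ v) = trans (dot-∷ʳ (ext ks) (ext v) k z) (cong (k · z +_) (dot-ext ks v))

  fromCoeffs : Vec ℤ m → Form m
  fromCoeffs [] = const 0z
  fromCoeffs (k ∷ ks) = k ⊡ top ⊞ up (fromCoeffs ks)

  eval-fromCoeffs : (ks : Vec ℤ m) (v : Pt m) → eval (fromCoeffs ks) v ≡ dot ks v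
  eval-fromCoeffs [] [] = refl
  eval-fromCoeffs (k ∷ ks) (z ∷ v) = cong (k · z +_) (eval-fromCoeffs ks v)

  constOf : Form m → Z
  constOf (const c) = c
  constOf top = 0z
  constOf (up F) = constOf F
  constOf (F ⊞ F′) = constOf F + constOf F′
  constOf (k ⊡ F) = k · constOf F

  zeros : Vec ℤ m
  zeros = Vec.replicate _ 0ℤ

  coeffs : Form m → Vec ℤ m
  coeffs (const c) = zeros
  coeffs top = 1ℤ ∷ zeros
  coeffs (up F) = 0ℤ ∷ coeffs F
  coeffs (F ⊞ F′) = zipWith ℤ._+_ (coeffs F) (coeffs F′)
  coeffs (k ⊡ F) = Vec.map (k ℤ.*_) (coeffs F)

  dot-zeros : (v : Pt m) → dot zeros v ≡ 0z
  dot-zeros [] = refl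
  dot-zeros (z ∷ v) = trans (cong (0ℤ · z +_) (dot-zeros v)) (eqn [] (z ∷ []) (λ z → con 0ℤ ⊙ z ⊕ 𝟘 ⊑ 𝟘) refl)

  dot-+ : (ks ls : Vec ℤ m) (v : Pt m) → dot (zipWith ℤ._+_ ks ls) v ≡ dot ks v + dot ls v
  dot-+ [] [] [] = sym (+-identityˡ 0z)
  dot-+ (k ∷ ks) (l ∷ ls) (z ∷ v) = trans (cong ((k ℤ.+ l) · z +_) (dot-+ ks ls v))
    (eqn (k ∷ l ∷ []) (z ∷ dot ks v ∷ dot ls v ∷ []) (λ k l z a b → (k :+ l) ⊙ z ⊕ (a ⊕ b) ⊑ (k ⊙ z ⊕ a) ⊕ (l ⊙ z ⊕ b)) refl)

  dot-* : ∀ k (ks : Vec ℤ m) (v : Pt m) → dot (Vec.map (k ℤ.*_) ks) v ≡ k · dot ks v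
  dot-* k [] [] = sym (·-zeroʳ k)
  dot-* k (l ∷ ks) (z ∷ v) = trans (cong ((k ℤ.* l) · z +_) (dot-* k ks v))
    (eqn (k ∷ l ∷ []) (z ∷ dot ks v ∷ []) (λ k l z a → (k :* l) ⊙ z ⊕ k ⊙ a ⊑ k ⊙ (l ⊙ z ⊕ a)) refl)

  eval-coeffs : (F : Form m) (v : Pt m) → eval F v ≡ constOf F + dot (coeffs F) v
  eval-coeffs (const c) v = sym (trans (cong (c +_) (dot-zeros v)) (+-identityʳ c))
  eval-coeffs top (z ∷ v) = sym (trans (cong (λ d → 0z + (1ℤ · z + d)) (dot-zeros v)) (eqn [] (z ∷ []) (λ z → 𝟘 ⊕ (con 1ℤ ⊙ z ⊕ 𝟘) ⊑ z) refl))
  eval-coeffs (up F) (z ∷ v) = trans (eval-coeffs F v)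
    (eqn [] (constOf F ∷ z ∷ dot (coeffs F) v ∷ []) (λ c z d → c ⊕ d ⊑ c ⊕ (con 0ℤ ⊙ z ⊕ d)) refl)
  eval-coeffs (F ⊞ F′) v = trans (cong₂ _+_ (eval-coeffs F v) (eval-coeffs F′ v))
    (trans (+-interchange _ _ _ _) (cong (constOf F + constOf F′ +_) (sym (dot-+ (coeffs F) (coeffs F′) v))))
  eval-coeffs (k ⊡ F) v = trans (cong (k ·_) (eval-coeffs F v))
    (trans (eqn (k ∷ []) (constOf F ∷ dot (coeffs F) v ∷ []) (λ k a b → k ⊙ (a ⊕ b) ⊑ k ⊙ a ⊕ k ⊙ b) refl)
      (cong (k · constOf F +_) (sym (dot-* k (coeffs F) v))))

  //-cong : ∀ {a b} d → a ≡ b → (a // d) ≈Q (b // d)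
  //-cong d refl = refl

  +Q-// : ∀ d q q′ {a b} → q ≈Q (a // d) → q′ ≈Q (b // d) → (q +Q q′) ≈Q ((a + b) // d)
  +Q-// d q q′ {a} {b} e e′ = ⇒≈Q (q +Q q′) ((a + b) // d)
    (trans (cong (λ x → k · x) (cong₂ _+_ (times-· _ _) (times-· _ _)))
    (trans (eqn (k ∷ dq ∷ dq′ ∷ []) (num q ∷ num q′ ∷ []) (λ k e f x y → k ⊙ (f ⊙ x ⊕ e ⊙ y) ⊑ f ⊙ k ⊙ x ⊕ e ⊙ k ⊙ y) refl)
    (trans (cong₂ _+_ (cong (dq′ ·_) (≈Q⇒ q (a // d) e)) (cong (dq ·_) (≈Q⇒ q′ (b // d) e′)))
    (trans (eqn (dq ∷ dq′ ∷ []) (a ∷ b ∷ []) (λ e f x y → f ⊙ e ⊙ x ⊕ e ⊙ f ⊙ y ⊑ (e :* f) ⊙ (x ⊕ y)) refl)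
      (cong (_· (a + b)) denom)))))
    where
      k = pos (suc d)
      dq = den⁺ q
      dq′ = den⁺ q′
      denom : dq ℤ.* dq′ ≡ den⁺ (q +Q q′)
      denom = trans (sym (ℤₚ.pos-* (suc (den q)) (suc (den q′)))) (cong pos (cong suc
        (trans (cong (n′ ℕ.+_) (ℕₚ.*-suc n n′)) (trans (sym (ℕₚ.+-assoc n′ n (n ℕ.* n′))) (cong (ℕ._+ n ℕ.* n′) (ℕₚ.+-comm n′ n))))))
        where
          n′ = den q′
          n = den q

  -- q = k / (1 + d)
  record IsFrac (k : ℤ) (d : ℕ) (q : ℚ) : Set where
    constructor isFrac
    field cross : ℚ.numerator q ℤ.* pos (suc d) ≡ k ℤ.* ℚ.denominator q
  open IsFrac

  frac : ∀ k d → IsFrac k d (k ℚ./ suc d)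
  frac k d = isFrac (begin
    n ℤ.* pos (suc d)    ≡⟨ cong (n ℤ.*_) (sym (ℚₚ.↧-/ k (suc d))) ⟩
    n ℤ.* (e ℤ.* g)      ≡⟨ trans (cong (n ℤ.*_) (ℤₚ.*-comm e g)) (sym (ℤₚ.*-assoc n g e)) ⟩
    (n ℤ.* g) ℤ.* e      ≡⟨ cong (ℤ._* e) (ℚₚ.↥-/ k (suc d)) ⟩
    k ℤ.* e              ∎)
    where
      open ≡-Reasoning
      n = ℚ.numerator (k ℚ./ suc d)
      e = ℚ.denominator (k ℚ./ suc d)
      g = ℤG.gcd k (pos (suc d))

  ·Q-// : ∀ k d q z → IsFrac k d q → (q ·Q embQ z) ≈Q ((k · z) // d)
  ·Q-// k d q z h = ⇒≈Q (q ·Q embQ z) ((k · z) // d)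
    (trans (cong (pos (suc d) ·_) (sym (·-zmul (ℚ.numerator q) z)))
    (trans (eqn (pos (suc d) ∷ ℚ.numerator q ∷ []) (z ∷ []) (λ d n z → d ⊙ n ⊙ z ⊑ (n :* d) ⊙ z) refl)
    (trans (cong (_· z) (cross h))
    (trans (eqn (k ∷ ℚ.denominator q ∷ []) (z ∷ []) (λ k e z → (k :* e) ⊙ z ⊑ e ⊙ k ⊙ z) refl)
      (cong (λ n → pos (suc n) · k · z) (sym (ℕₚ.+-identityʳ _)))))))

  data Fracs (d : ℕ) : ∀ {m} → Vec ℤ m → Vec ℚ m → Set where
    [] : Fracs d [] []
    _∷_ : ∀ {k q} {ks : Vec ℤ m} {qs} → IsFrac k d q → Fracs d ks qs → Fracs d (k ∷ ks) (q ∷ qs)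

  mask : Vec Bool m → Vec ℤ m → Vec ℤ m
  mask = zipWith (λ t k → if t then k else 0ℤ)

  linSum-// : ∀ d (I : Vec Bool m) {ks qs} → Fracs d ks qs → (v : Pt m) →
              linSum I qs (zipWith mk I v) ≈Ω just (dot (mask I ks) v // d)
  linSum-// d [] [] [] = ⇒≈Q 0Q (0z // d) (trans (·-zeroʳ (pos (suc d))) (sym (·-zeroʳ (pos 1))))
  linSum-// d (true ∷ I) (_∷_ {k = k} {q} {ks} {qs} h hs) (z ∷ v) with linSum I qs (zipWith mk I v) | linSum-// d I hs v
  ... | just r | e = +Q-// d (q ·Q embQ z) r (·Q-// k d q z h) e
  linSum-// d (false ∷ I) (_∷_ {ks = ks} {qs} h hs) (z ∷ v) with linSum I qs (zipWith mk I v) | linSum-// d I hs v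
  ... | just r | e = ≈Q-trans r (dot (mask I ks) v // d) ((0ℤ · z + dot (mask I ks) v) // d) e
        (//-cong {dot (mask I ks) v} {0ℤ · z + dot (mask I ks) v} d (eqn [] (z ∷ dot (mask I ks) v ∷ []) (λ z x → x ⊑ con 0ℤ ⊙ z ⊕ x) refl))

  rv-zipWith : ∀ {A B C : Set} (f : A → B → C) (xs : Vec A m) (ys : Vec B m) → rv (zipWith f xs ys) ≡ zipWith f (rv xs) (rv ys)
  rv-zipWith {m = zero} f [] [] = refl
  rv-zipWith {m = suc m} f xs ys = trans (cong₂ (λ a b → rv (zipWith f a b)) (init-last xs) (init-last ys))
    (trans (cong rv (h (init xs) (init ys))) (trans (rv-∷ʳ _ _) (cong (_ ∷_) (rv-zipWith f (init xs) (init ys)))))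
    where
      h : ∀ {n} (as : Vec _ n) (bs : Vec _ n) {a b} → zipWith f (as ∷ʳ a) (bs ∷ʳ b) ≡ zipWith f as bs ∷ʳ f a b
      h [] [] = refl
      h (a ∷ as) (b ∷ bs) = cong (f a b ∷_) (h as bs)

  toG-ext : (I : Vec Bool m) (v : Pt m) → toG (rv I) v ≡ zipWith mk I (ext v)
  toG-ext I v = rv-injective _ _ (trans (rv-toG (rv I) v)
    (sym (trans (rv-zipWith mk I (ext v)) (cong (zipWith mk (rv I)) (rv-ext v)))))

  toAff : Form m → ℕ → Aff m
  toAff F d = linA (constOf F // d) (Vec.map (λ k → k ℚ./ suc d) (ext (coeffs F)))

  ZeroOff : Vec Bool m → Pt m → Set
  ZeroOff I v = ∀ j → lookup I j ≡ false → lookup v j ≡ 0z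

  dot-mask : (I : Vec Bool m) (ks : Vec ℤ m) (v : Pt m) → ZeroOff I v → dot (mask I ks) v ≡ dot ks v
  dot-mask [] [] [] _ = refl
  dot-mask (true ∷ I) (k ∷ ks) (z ∷ v) h = cong (k · z +_) (dot-mask I ks v (λ j → h (suc j)))
  dot-mask (false ∷ I) (k ∷ ks) (z ∷ v) h = cong₂ _+_ (trans (·-zeroˡ z) (sym (trans (cong (k ·_) (h zero refl)) (·-zeroʳ k)))) (dot-mask I ks v (λ j → h (suc j)))

  ≈Ω-trans : ∀ x y z → x ≈Ω y → y ≈Ω z → x ≈Ω z
  ≈Ω-trans (just x) (just y) (just z) p q = ≈Q-trans x y z p q
  ≈Ω-trans nothing nothing nothing _ _ = tt

  evalAff-// : ∀ d (I : Vec Bool m) {ks qs} {q₀ c} → q₀ ≈Q (c // d) → Fracs d ks qs → (v : Pt m) →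
               evalAff I (linA q₀ qs) (zipWith mk I v) ≈Ω just ((c + dot (mask I ks) v) // d)
  evalAff-// d I {ks} {qs} {q₀} h hs v with linSum I qs (zipWith mk I v) | linSum-// d I hs v
  ... | just r | e = +Q-// d q₀ r h e

  fracs : ∀ d (ks : Vec ℤ m) → Fracs d ks (Vec.map (λ k → k ℚ./ suc d) ks)
  fracs d [] = []
  fracs d (k ∷ ks) = frac k d ∷ fracs d ks

  mask-rv : (I : Vec Bool m) (ks : Vec ℤ m) → mask I (ext ks) ≡ ext (mask (rv I) ks)
  mask-rv I ks = rv-injective _ _ (trans (rv-zipWith _ I (ext ks)) (trans (cong (mask (rv I)) (rv-ext ks)) (sym (rv-ext _))))

  -- `evalAff` skips the coordinates outside I while `eval` does not; `ZeroOff` makes their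
  -- contribution vanish.
  eval-toAff : ∀ (F : Form m) d (I : Vec Bool m) (v : Pt m) → ZeroOff (rv I) v →
               evalAff I (toAff F d) (toG (rv I) v) ≈Ω just (eval F v // d)
  eval-toAff F d I v h = subst (λ a → evalAff I (toAff F d) a ≈Ω just (eval F v // d)) (sym (toG-ext I v))
    (subst (λ z → evalAff I (toAff F d) (zipWith mk I (ext v)) ≈Ω just (z // d))
      (trans (cong (constOf F +_) (trans (cong (λ ks → dot ks (ext v)) (mask-rv I (coeffs F)))
        (trans (dot-ext (mask (rv I) (coeffs F)) v) (dot-mask (rv I) (coeffs F) v h)))) (sym (eval-coeffs F v)))
      (evalAff-// d I {q₀ = constOf F // d} refl (fracs d (ext (coeffs F))) (ext v)))

  rescale : ∀ {k d q} e → IsFrac k d q → ∀ d′ → pos (suc d′) ≡ e ℤ.* pos (suc d) → IsFrac (e ℤ.* k) d′ q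
  rescale {k} {d} {q} e h d′ eq′ = isFrac (begin
    n ℤ.* pos (suc d′)          ≡⟨ cong (n ℤ.*_) eq′ ⟩
    n ℤ.* (e ℤ.* pos (suc d))   ≡⟨ trans (sym (ℤₚ.*-assoc n e _)) (trans (cong (ℤ._* pos (suc d)) (ℤₚ.*-comm n e)) (ℤₚ.*-assoc e n _)) ⟩
    e ℤ.* (n ℤ.* pos (suc d))   ≡⟨ cong (e ℤ.*_) (cross h) ⟩
    e ℤ.* (k ℤ.* ℚ.denominator q)  ≡⟨ sym (ℤₚ.*-assoc e k _) ⟩
    e ℤ.* k ℤ.* ℚ.denominator q    ∎)
    where
      open ≡-Reasoning
      n = ℚ.numerator q

  rescales : ∀ {d qs} {ks : Vec ℤ m} e → Fracs d ks qs → ∀ d′ → pos (suc d′) ≡ e ℤ.* pos (suc d) → Fracs d′ (Vec.map (e ℤ.*_) ks) qs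
  rescales e [] d′ h = []
  rescales e (x ∷ xs) d′ h = rescale e x d′ h ∷ rescales e xs d′ h

  -- Denominators are stored as predecessors; this is their product in that encoding.
  _⊗_ : ℕ → ℕ → ℕ
  a ⊗ b = b ℕ.+ a ℕ.* suc b

  pos-⊗ : ∀ a b → pos (suc (a ⊗ b)) ≡ pos (suc a) ℤ.* pos (suc b)
  pos-⊗ a b = ℤₚ.pos-* (suc a) (suc b)

  clear : (qs : Vec ℚ m) → ∃₂ λ d ks → Fracs d ks qs
  clear [] = 0 , [] , []
  clear (q ∷ qs) with clear qs
  ... | d , ks , h = ℚ.denominator-1 q ⊗ d , _ ∷ _ ,
        (rescale {ℚ.numerator q} {ℚ.denominator-1 q} {q} (pos (suc d)) (isFrac refl) (ℚ.denominator-1 q ⊗ d)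
           (trans (pos-⊗ (ℚ.denominator-1 q) d) (ℤₚ.*-comm (ℚ.denominator q) (pos (suc d)))) ∷ rescales (ℚ.denominator q) h _ (pos-⊗ (ℚ.denominator-1 q) d))

  fromAff : ∀ (I : Vec Bool m) (q₀ : Q) (qs : Vec ℚ m) → ∃₂ λ F d → ∀ (v : Pt m) →
            evalAff I (linA q₀ qs) (toG (rv I) v) ≈Ω just (eval F v // d)
  fromAff I q₀ qs with clear qs
  ... | d , ks , h = (const (pos (suc d) · num q₀) ⊞ fromCoeffs ls) , d′ , λ v →
        subst (λ a → evalAff I (linA q₀ qs) a ≈Ω just ((pos (suc d) · num q₀ + eval (fromCoeffs ls) v) // d′)) (sym (toG-ext I v))
          (subst (λ z → evalAff I (linA q₀ qs) (zipWith mk I (ext v)) ≈Ω just ((pos (suc d) · num q₀ + z) // d′))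
            (trans (cong (λ ks → dot ks (ext v)) (sym (ext-rv (mask I es)))) (trans (dot-ext ls v) (sym (eval-fromCoeffs ls v))))
            (evalAff-// d′ I {q₀ = q₀} {c = pos (suc d) · num q₀} const≈ fs (ext v)))
    where
      d′ = den q₀ ⊗ d
      es = Vec.map (den⁺ q₀ ℤ.*_) ks
      -- Coefficients outside I become 0, so that the form represents the map on all codes and not
      -- just on those vanishing off I.
      ls = rv (mask I es)
      fs : Fracs d′ es qs
      fs = rescales (den⁺ q₀) h d′ (pos-⊗ (den q₀) d)
      const≈ : q₀ ≈Q ((pos (suc d) · num q₀) // d′)
      const≈ = ⇒≈Q q₀ ((pos (suc d) · num q₀) // d′) (trans (cong (_· num q₀) (pos-⊗ (den q₀) d))
        (eqn (den⁺ q₀ ∷ pos (suc d) ∷ []) (num q₀ ∷ []) (λ e d x → (e :* d) ⊙ x ⊑ e ⊙ d ⊙ x) refl))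

  -- Largely continuous maps

  ≤Q⇒ : ∀ x y → x ≤Q y → den⁺ y · num x ≤ den⁺ x · num y
  ≤Q⇒ x y (inj₁ p) = lin [] (den⁺ y · num x ∷ den⁺ x · num y ∷ 1z ∷ []) (λ a b o → ((a ⊕ o ⊑ b) ∷ (𝟘 ⊑ o) ∷ []) ⊢ (a ⊑ b)) refl (<Q⇒ x y p , 0≤1)
  ≤Q⇒ x y (inj₂ p) = eq (≈Q⇒ x y p)

  ⇒≤Q : ∀ x y → den⁺ y · num x ≤ den⁺ x · num y → x ≤Q y
  ⇒≤Q x y (lt p) = inj₁ (⇒<Q x y (<⇒+1≤ p))
  ⇒≤Q x y (eq p) = inj₂ (⇒≈Q x y p)

  ≤Q-respˡ : ∀ x y z → x ≈Q y → x ≤Q z → y ≤Q z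
  ≤Q-respˡ x y z e (inj₁ p) = inj₁ (<Q-respˡ z x y p e)
  ≤Q-respˡ x y z e (inj₂ p) = inj₂ (≈Q-trans y x z (sym e) p)

  ≤Q-respʳ : ∀ x y z → x ≈Q y → z ≤Q x → z ≤Q y
  ≤Q-respʳ x y z e (inj₁ p) = inj₁ (<Q-respʳ z x y p e)
  ≤Q-respʳ x y z e (inj₂ p) = inj₂ (≈Q-trans z x y p e)

  1· : ∀ x → pos 1 · x ≡ x
  1· x = eqn [] (x ∷ []) (λ x → con 1ℤ ⊙ x ⊑ x) refl

  Ω≤⇒ : ∀ x {a} d z → x ≈Ω just (a // d) → x ≤Ω just (embQ z) → a ≤ pos (suc d) · z
  Ω≤⇒ (just q) {a} d z e p = subst (_≤ _) (1· a) (≤Q⇒ (a // d) (embQ z) (≤Q-respˡ q (a // d) (embQ z) e p))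

  ⇒Ω≤ : ∀ x {a} d z → x ≈Ω just (a // d) → a ≤ pos (suc d) · z → x ≤Ω just (embQ z)
  ⇒Ω≤ (just q) {a} d z e p = ≤Q-respˡ (a // d) q (embQ z) (sym e) (⇒≤Q (a // d) (embQ z) (subst (_≤ _) (sym (1· a)) p))

  ≤Ω⇒ : ∀ x {a} d z → x ≈Ω just (a // d) → just (embQ z) ≤Ω x → pos (suc d) · z ≤ a
  ≤Ω⇒ (just q) {a} d z e p = subst (_ ≤_) (1· a) (≤Q⇒ (embQ z) (a // d) (≤Q-respʳ q (a // d) (embQ z) e p))

  ⇒≤Ω : ∀ x {a} d z → x ≈Ω just (a // d) → pos (suc d) · z ≤ a → just (embQ z) ≤Ω x
  ⇒≤Ω (just q) {a} d z e p = ≤Q-respʳ (a // d) q (embQ z) (sym e) (⇒≤Q (embQ z) (a // d) (subst (_ ≤_) (sym (1· a)) p))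

  0≤Ω⇒ : ∀ x {a} d → x ≈Ω just (a // d) → just 0Q ≤Ω x → 0z ≤ a
  0≤Ω⇒ x d e p = subst (_≤ _) (·-zeroʳ _) (≤Ω⇒ x d 0z e p)

  ⇒0≤Ω : ∀ x {a} d → x ≈Ω just (a // d) → 0z ≤ a → just 0Q ≤Ω x
  ⇒0≤Ω x d e p = ⇒≤Ω x d 0z e (subst (_≤ _) (sym (·-zeroʳ _)) p)

  -- Integral forms take values in a discrete set, so a continuous extension is locally constant where it is finite.
  ExtAt : Vec Bool m → (Pt m → Set) → Form m → ΩPt m → Maybe Z → Set
  ExtAt I X F x (just c) = ∃ λ b → ∀ v → X v → Near I x b v → eval F v ≡ c
  ExtAt I X F x nothing = ∀ c → ∃ λ b → ∀ v → X v → Near I x b v → c ≤ eval F v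

  Ext : Vec Bool m → (Pt m → Set) → Form m → Set
  Ext {m} I X F = Σ (ΩPt m → Maybe Z) λ g → ∀ x → Lim I X x → ExtAt I X F x (g x)

  ExtAt-⊆ : ∀ (I : Vec Bool m) {X Y : Pt m → Set} F x c → (∀ v → Y v → X v) → ExtAt I X F x c → ExtAt I Y F x c
  ExtAt-⊆ I F x (just c) sub (b , h) = b , λ v y → h v (sub v y)
  ExtAt-⊆ I F x nothing sub h c with h c
  ... | b , f = b , λ v y → f v (sub v y)

  Ext-⊆ : ∀ {I : Vec Bool m} {X Y F} → (∀ v → Y v → X v) → Ext I X F → Ext I Y F
  Ext-⊆ {I = I} {F = F} sub (g , h) = g , λ x lim → ExtAt-⊆ I F x (g x) sub (h x λ b → let v , y , n = lim b in v , sub v y , n)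

  <Ω-near : ∀ y {l q} → y ≈Ω just q → ∀ u → In1 nothing l u y → l <Q q
  <Ω-near (just y) {l} {q} e u p = <Q-respʳ l y q p e

  Ω-near : ∀ x y {l q} u → y ≈Ω just q → In1 (just x) l u y → l <Q q × q <Q u
  Ω-near x (just y) {l} {q} u e (p , r) = <Q-respʳ l y q p e , <Q-respˡ u y q r e

  module _ (I : Vec Bool m) {X : Pt m → Set} (F : Form m) (d : ℕ) (gv : Pt m → Ω) (g≈ : ∀ v → X v → gv v ≈Ω just (eval F v // d)) (x : ΩPt m) where

    -- The values of the form divided by 1 + d are discrete: strictly between (w - 1)/(1 + d) and (w
    -- + 1)/(1 + d) there is only w/(1 + d), here with w = `floor d q`.
    pinned : ∀ q v → X v → In1 (just q) ((floor d q + - 1z) // d) ((floor d q + 1z) // d) (gv v) → eval F v ≡ floor d q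
    pinned q v xv i = ≤-antisym
        (lin [] (eval F v ∷ floor d q ∷ 1z ∷ []) (λ v w o → ((v ⊕ o ⊑ w ⊕ o) ∷ []) ⊢ (v ⊑ w)) refl (//-< (eval F v) (floor d q + 1z) d (proj₂ both)))
        (lin [] (eval F v ∷ floor d q ∷ 1z ∷ []) (λ v w o → (((w ⊖ₑ o) ⊕ o ⊑ v) ∷ []) ⊢ (w ⊑ v)) refl (//-< (floor d q + - 1z) (eval F v) d (proj₁ both)))
      where
        both : (((floor d q + - 1z) // d) <Q (eval F v // d)) × ((eval F v // d) <Q ((floor d q + 1z) // d))
        both = Ω-near q (gv v) {(floor d q + - 1z) // d} {eval F v // d} ((floor d q + 1z) // d) (g≈ v xv) i

    cont⇒ExtAt : ∀ o → (∀ l u → Ok1 o l u → ∃₂ λ l′ u′ → OkV x l′ u′ × (∀ v → X v → InV x l′ u′ (embPt (toG I v)) → In1 o l u (gv v))) →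
                 ExtAt I X F x (Maybe.map (floor d) o)
    cont⇒ExtAt (just q) c = fin (c ((floor d q + - 1z) // d) ((floor d q + 1z) // d) (floor-low d q , floor-high d q))
      where
        fin : (∃₂ λ l′ u′ → OkV x l′ u′ × (∀ v → X v → InV x l′ u′ (embPt (toG I v)) → In1 (just q) ((floor d q + - 1z) // d) ((floor d q + 1z) // d) (gv v))) →
              ExtAt I X F x (just (floor d q))
        fin (l , u , ok , h) = let b , k = Near⇒In I x l u ok in b , λ v xv n → pinned q v xv (h v xv (k v n))
    cont⇒ExtAt nothing c k = inf (c ((k + - 1z) // d) 0Q tt)
      where
        inf : (∃₂ λ l′ u′ → OkV x l′ u′ × (∀ v → X v → InV x l′ u′ (embPt (toG I v)) → In1 nothing ((k + - 1z) // d) 0Q (gv v))) →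
              ∃ λ b → ∀ v → X v → Near I x b v → k ≤ eval F v
        inf (l , u , ok , h) = let b , j = Near⇒In I x l u ok in b , λ v xv n →
          lin [] (eval F v ∷ k ∷ 1z ∷ []) (λ v w o → (((w ⊖ₑ o) ⊕ o ⊑ v) ∷ []) ⊢ (w ⊑ v)) refl
            (//-< (k + - 1z) (eval F v) d (<Ω-near (gv v) {(k + - 1z) // d} {eval F v // d} (g≈ v xv) 0Q (h v xv (j v n))))

  -- The limit of the integral form is recovered from the continuous extension by taking the floor
  -- at scale 1 + d.
  LC⇒Ext : ∀ (I : Vec Bool m) {X S} F d f → (∀ v → X v → S (toG I v)) →
           (∀ v → X v → f (toG I v) ≈Ω just (eval F v // d)) → LargelyCont S f → Ext I X F
  LC⇒Ext {m} I {X} {S} F d f ⊆S val (g , agree , cont) = (λ x → Maybe.map (floor d) (g x)) , λ x lim →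
      cont⇒ExtAt I F d (λ v → g (embPt (toG I v))) g≈ x (g x) (λ l u ok →
        let l′ , u′ , ok′ , h = cont x (Lim⇒Cl I ⊆S x lim) l u ok in l′ , u′ , ok′ , λ v xv → h (embPt (toG I v)) (inCl v xv))
    where
      g≈ : ∀ v → X v → g (embPt (toG I v)) ≈Ω just (eval F v // d)
      g≈ v xv = ≈Ω-trans (g (embPt (toG I v))) (f (toG I v)) (just (eval F v // d)) (agree (toG I v) (⊆S v xv)) (val v xv)
      self : ∀ {n} (x : ΩPt n) l u → OkV x l u → InV x l u x
      self [] [] [] _ = tt
      self (just _ ∷ x) (_ ∷ l) (_ ∷ u) (p , ps) = p , self x l u ps
      self (nothing ∷ x) (_ ∷ l) (_ ∷ u) (p , ps) = tt , self x l u ps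
      inCl : ∀ v → X v → Cl S (embPt (toG I v))
      inCl v xv l u ok = embPt (toG I v) , self (embPt (toG I v)) l u ok , toG I v , ⊆S v xv , refl

  Ok-refine1 : ∀ x l u y → Ok1 x l u → In1 x l u y → ∃₂ λ l′ u′ → Ok1 y l′ u′ × (∀ z → In1 y l′ u′ z → In1 x l u z)
  Ok-refine1 (just x) l u (just y) _ i = l , u , i , λ { (just z) j → j }
  Ok-refine1 nothing l u (just y) _ i = l , embQ (floor 0 y + 1z) , (i , floor-high 0 y) , λ { (just z) j → proj₁ j }
  Ok-refine1 nothing l u nothing _ i = l , u , tt , λ z j → j

  Ok-refine : ∀ (x : ΩPt m) l u y → OkV x l u → InV x l u y → ∃₂ λ l′ u′ → OkV y l′ u′ × (∀ z → InV y l′ u′ z → InV x l u z)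
  Ok-refine [] [] [] [] _ _ = [] , [] , tt , λ { [] _ → tt }
  Ok-refine (x ∷ xs) (l ∷ ls) (u ∷ us) (y ∷ ys) (p , ps) (i , is) with Ok-refine1 x l u y p i | Ok-refine xs ls us ys ps is
  ... | l′ , u′ , o , f | ls′ , us′ , os , fs = l′ ∷ ls′ , u′ ∷ us′ , (o , os) , λ { (z ∷ zs) (j , js) → f z j , fs zs js }

  -- A limit point y close to x is approached by points of X that are close to x as well. This
  -- comparison turns pointwise limits into a continuous extension.
  approach : ∀ (I : Vec Bool m) {X} x b → ∃₂ λ l u → OkV x l u × (∀ y → InV x l u y → Lim I X y → ∀ c → ∃ λ v → X v × Near I x b v × Near I y c v)
  approach I x b with In⇒Near I x b
  ... | l , u , ok , f = l , u , ok , λ y i lim c → go y i lim c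
    where
      go : ∀ y → InV x l u y → Lim I _ y → ∀ c → _
      go y i lim c with Ok-refine x l u y ok i
      ... | l′ , u′ , ok′ , h with Near⇒In I y l′ u′ ok′
      ... | e , k with lim (max c e)
      ... | v , xv , n = v , xv , f v (h _ (k v (Near-mono I y v (y≤max c e) n))) , Near-mono I y v (x≤max c e) n

  absurd-< : ∀ {x} → x + 1z ≤ x → ⊥
  absurd-< {x} h = absurd (lin [] (x ∷ 1z ∷ []) (λ x o → ((x ⊕ o ⊑ x) ∷ []) ⊢ (o ⊑ 𝟘)) refl h)

  Ext⇒LC : ∀ (I : Vec Bool m) {X S} F d f → (∀ v → X v → S (toG I v)) → (∀ a → S a → gp I X a) →
           (∀ v → X v → f (toG I v) ≈Ω just (eval F v // d)) → Ext I X F → LargelyCont S f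
  Ext⇒LC {m} I {X} {S} F d f ⊆S S⊆ val (g , h) = g′ , agree , λ x cl → cont x (Cl⇒Lim I S⊆ x cl)
    where
      g′ : ΩPt m → Ω
      g′ x = Maybe.map (_// d) (g x)
      near1-self : ∀ t z b → near1 t (embΓ (mk t z)) b z
      near1-self true z b = refl
      near1-self false z b = tt
      look : ∀ {n} (I : Vec Bool n) (v : Pt n) j → lookup (Vec.map embΓ (zipWith mk I v)) j ≡ embΓ (mk (lookup I j) (lookup v j))
      look (t ∷ I) (z ∷ v) zero = refl
      look (t ∷ I) (z ∷ v) (suc j) = look I v j
      selfNear : ∀ v b → Near I (embPt (toG I v)) b v
      selfNear v b j = subst (λ o → near1 (lookup I j) o b (lookup v j))
        (sym (trans (cong (λ y → lookup y j) (trans (rv-map embΓ (toG I v)) (cong (Vec.map embΓ) (rv-toG I v)))) (look I v j)))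
        (near1-self (lookup I j) (lookup v j) b)
      selfLim : ∀ v → X v → Lim I X (embPt (toG I v))
      selfLim v xv b = v , xv , selfNear v b
      agree′ : ∀ v → X v → g′ (embPt (toG I v)) ≈Ω just (eval F v // d)
      agree′ v xv with g (embPt (toG I v)) | h _ (selfLim v xv)
      ... | just c | b , k = cong (λ x → times (suc d) x) (sym (k v xv (selfNear v b)))
      -- The point v is near itself, so an infinite limit there would force `eval F v` to exceed
      -- itself.
      ... | nothing | k with k (eval F v + 1z)
      ... | b , j = ⊥-elim (absurd-< (j v xv (selfNear v b)))
      agree : ∀ a → S a → g′ (embPt a) ≈Ω f a
      agree a s with S⊆ a s
      ... | v , xv , refl = ≈Ω-trans (g′ (embPt (toG I v))) (just (eval F v // d)) (f (toG I v)) (agree′ v xv) (≈Ω-sym (f (toG I v)) (val v xv))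
        where
          ≈Ω-sym : ∀ x {q} → x ≈Ω just q → just q ≈Ω x
          ≈Ω-sym (just x) e = sym e
      cont : ∀ x → Lim I X x → ∀ l u → Ok1 (g′ x) l u → ∃₂ λ l′ u′ → OkV x l′ u′ × (∀ y → Cl S y → InV x l′ u′ y → In1 (g′ x) l u (g′ y))
      cont x lim l u ok with g x | h x lim
      ... | just c | b , k with approach I {X} x b
      ... | l′ , u′ , ok′ , app = l′ , u′ , ok′ , λ y cl i → go y (Cl⇒Lim I S⊆ y cl) i
        where
          go : ∀ y → Lim I X y → InV x l′ u′ y → In1 (just (c // d)) l u (g′ y)
          go y limy i with g y | h y limy
          ... | just c′ | b′ , k′ with app y i limy b′
          ... | v , xv , n , n′ = subst (λ c → (l <Q (c // d)) × ((c // d) <Q u)) (trans (sym (k v xv n)) (k′ v xv n′)) ok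
          go y limy i | nothing | k′ with k′ (c + 1z)
          ... | b′ , j with app y i limy b′
          ... | v , xv , n , n′ = ⊥-elim (absurd-< (subst (_ ≤_) (k v xv n) (j v xv n′)))
      cont x lim l u ok | nothing | k with k (proj₁ (aboveD l))
        where
          aboveD : ∀ l → ∃ λ c → ∀ e → c ≤ e → l <Q (e // d)
          aboveD l = floor d l + 1z , λ e p → ⇒<Q l (e // d) (≤-trans (<Q⇒ l ((floor d l + 1z) // d) (floor-high d l)) (·-monoʳ 0≤pos p))
      ... | b , j with approach I {X} x b
      ... | l′ , u′ , ok′ , app = l′ , u′ , ok′ , λ y cl i → go y (Cl⇒Lim I S⊆ y cl) i
        where
          go : ∀ y → Lim I X y → InV x l′ u′ y → In1 nothing l u (g′ y)
          go y limy i with g y | h y limy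
          ... | nothing | _ = tt
          ... | just c′ | b′ , k′ with app y i limy b′
          ... | v , xv , n , n′ = ⇒<Q l (c′ // d) (≤-trans (<Q⇒ l ((floor d l + 1z) // d) (floor-high d l))
                  (·-monoʳ 0≤pos (subst (_ ≤_) (k′ v xv n′) (j v xv n))))

  -- Pieces and their faces

  Ray : ℕ → Set
  Ray m = ℕ × Dir m

  -- One non-negative multiple per ray suffices to generate the cone; the fixed order of the list is
  -- what the descent recurses on.
  data Dec {m} : List (Ray m) → Pt m → Pt m → Set where
    done : ∀ {v} → Dec [] v v
    step : ∀ {l r rs c v} t → 0z ≤ t → Dec rs (c +[ t ] r) v → Dec ((l , r) ∷ rs) c v

  Vanishes : List (Ray m) → ℕ → Form m → Set
  Vanishes rays k F = ∀ {l r} → (l , r) ∈ rays → k ℕ.≤ l → slope F r ≡ 0ℤ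

  combination : List (ℤ × Form m) → Pt m → Z
  combination [] v = 0z
  combination ((κ , F) ∷ fs) v = κ · eval F v + combination fs v

  -- F is, up to a constant, a combination of forms that extend to the closure and are constant along the rays of level ≥ k.
  Rep : Vec Bool m → (Pt m → Set) → List (Ray m) → ℕ → Form m → Set
  Rep I X rays k F = ∃₂ λ c fs → All (λ f → Ext I X (proj₂ f) × Vanishes rays k (proj₂ f)) fs × (∀ v → eval F v ≡ c + combination fs v)

  -- A piece of A. Its faces are indexed by l ≤ L; coordinate j is finite on the l-th face iff p j ≤ l, and moving
  -- along a ray of level l leads to the l-th face. Every point of X is a point of the bounded set core plus rays;
  -- the functions τ l measure how far a point is from core along the rays of level l.
  record Piece {m} (I : Vec Bool m) (A : Pt m → Set) (W : ℤ) (K : Z) (n : ℕ) (E : Z) : Set₁ where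
    field
      X core : Pt m → Set
      L : ℕ
      p : Fin m → ℕ
      rays : List (Ray m)
      τ : ℕ → Form m
      inhabited : ∃ X
      X⊆A : ∀ v → X v → A v
      -- The core need not lie in X: on X each τ is at least E, on the core it lies between 0 and K.
      core⊆A : ∀ v → core v → A v
      -- The descent loses a fixed amount per ray, so a bound K common to all pieces requires a
      -- common bound on the number of rays.
      len : length rays ℕ.≤ n
      p≤L : ∀ j → p j ℕ.≤ L
      range : ∀ {l r} → (l , r) ∈ rays → l ℕ.< L
      covers : ∀ l → l ℕ.< L → ∃ λ r → (l , r) ∈ rays
      positive : ∀ {l r} → (l , r) ∈ rays → ∀ j → lookup I j ≡ true → l ℕ.< p j → 1ℤ ℤ.≤ lookup r j
      vanishing : ∀ {l r} → (l , r) ∈ rays → ∀ j → lookup I j ≡ false ⊎ p j ℕ.≤ l → lookup r j ≡ 0ℤ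
      moveX : ∀ {l r} → (l , r) ∈ rays → ∀ v w → 0z ≤ w → X v → X (v +[ w ] r)
      moveA : ∀ {l r} → (l , r) ∈ rays → ∀ v w → 0z ≤ w → A v → A (v +[ w ] r)
      -- With one slope W for all levels, comparing the slopes of Ψ k and ν reduces to comparing
      -- with W.
      slope-τ : ∀ {l r} → (l , r) ∈ rays → slope (τ l) r ≡ W
      slope-τ₀ : ∀ {l r} → (l , r) ∈ rays → ∀ i → i ℕ.< L → i ≢ l → slope (τ i) r ≡ 0ℤ
      τ≥E : ∀ v → X v → ∀ i → i ℕ.< L → E ≤ eval (τ i) v
      τ-core : ∀ v → core v → ∀ i → i ℕ.< L → 0z ≤ eval (τ i) v × eval (τ i) v ≤ K
      -- Bounded subsets of 𝒵 can be infinite, so finiteness is replaced by a bound in 𝒵 for every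
      -- form; lower bounds come from -F.
      bounded : ∀ F → ∃ λ C → ∀ v → core v → eval F v ≤ C
      decompose : ∀ v → X v → ∃ λ c → core c × Dec rays c v
      rep : ∀ i → i ℕ.< L → Rep I X rays (suc i) (τ i)

    J : ℕ → Vec Bool m
    J l = tabulate λ j → lookup I j ∧ (p j ℕ.≤ᵇ l)

  eval-Dec : ∀ (F : Form m) rs {c v} → (∀ {l r} → (l , r) ∈ rs → slope F r ℤ.≤ 0ℤ) → Dec rs c v → eval F v ≤ eval F c
  eval-Dec F [] h done = ≤-refl
  eval-Dec F ((l , r) ∷ rs) {c} {v} h (step t 0≤t d) = lin (slope F r ∷ []) (eval F v ∷ eval F (c +[ t ] r) ∷ eval F c ∷ t ∷ []) (λ s v c′ c t →
      ((v ⊑ c′) ∷ (c′ ⊑ c ⊕ s ⊙ t) ∷ (s ⊙ t ⊑ con 0ℤ ⊙ t) ∷ []) ⊢ (v ⊑ c)) refl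
      (eval-Dec F rs (h ∘ there) d , eq (eval-move F c t r) , ·-monoˡ (h (here refl)) 0≤t)

  eval-Dec-≥ : ∀ (F : Form m) rs {c v} → (∀ {l r} → (l , r) ∈ rs → 0ℤ ℤ.≤ slope F r) → Dec rs c v → eval F c ≤ eval F v
  eval-Dec-≥ F rs {c} {v} h d = lin [] (eval F c ∷ eval F v ∷ []) (λ c v → ((con ℤ.-1ℤ ⊙ v ⊑ con ℤ.-1ℤ ⊙ c) ∷ []) ⊢ (c ⊑ v)) refl
      (eval-Dec (ℤ.-1ℤ ⊡ F) rs (λ i → subst (ℤ._≤ 0ℤ) (sym (ℤₚ.-1*i≡-i _)) (ℤₚ.neg-mono-≤ (h i))) d)

  AgreeOn : Vec Bool m → Pt m → Pt m → Set
  AgreeOn J v v′ = ∀ j → lookup J j ≡ true → lookup v j ≡ lookup v′ j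

  at1 : Bool → Ω → Z → Set
  at1 true (just q) z = embQ z ≈Q q
  at1 true nothing z = ⊥
  at1 false (just q) z = ⊥
  at1 false nothing z = ⊤

  -- x is v with the coordinates outside J sent to +∞.
  FaceAt : Vec Bool m → Pt m → ΩPt m → Set
  FaceAt J v x = ∀ j → at1 (lookup J j) (lookup (rv x) j) (lookup v j)

  lookup-ext : ∀ {A : Set} (xs ys : Vec A m) → (∀ j → lookup xs j ≡ lookup ys j) → xs ≡ ys
  lookup-ext xs ys h = trans (sym (tabulate∘lookup xs)) (trans (tabulate-cong h) (tabulate∘lookup ys))

  FaceAt-supp : ∀ (J : Vec Bool m) v x → FaceAt J v x → rv (supp x) ≡ J
  FaceAt-supp J v x h = lookup-ext _ _ λ j → trans (cong (λ y → lookup y j) (rv-map is-just x))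
      (trans (lookup-map j is-just (rv x)) (one (lookup J j) (lookup (rv x) j) (lookup v j) (h j)))
    where
      one : ∀ t o z → at1 t o z → is-just o ≡ t
      one true (just q) z _ = refl
      one false nothing z _ = refl

  FaceAt-resp : ∀ {J : Vec Bool m} {v v′ x} → AgreeOn J v v′ → FaceAt J v x → FaceAt J v′ x
  FaceAt-resp {J = J} {v} {v′} {x} h f j = one (lookup J j) (lookup (rv x) j) (h j) (f j)
    where
      one : ∀ t o {z z′} → (t ≡ true → z ≡ z′) → at1 t o z → at1 t o z′
      one true (just q) e a = subst (λ z → embQ z ≈Q q) (e refl) a
      one false nothing e a = tt

  FaceAt-agree : ∀ {J : Vec Bool m} {v v′ x} → FaceAt J v x → FaceAt J v′ x → AgreeOn J v v′
  FaceAt-agree {J = J} {v} {v′} {x} f g j = one (lookup J j) (lookup (rv x) j) (lookup v j) (lookup v′ j) (f j) (g j)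
    where
      one : ∀ t o z z′ → at1 t o z → at1 t o z′ → t ≡ true → z ≡ z′
      one true (just q) z z′ a b _ = trans (sym (floor-≈ 0 q z a)) (floor-≈ 0 q z′ b)

  faceΩ : Vec Bool m → Pt m → ΩPt m
  faceΩ J v = embPt (toG J v)

  faceΩ-at : ∀ (J : Vec Bool m) v → FaceAt J v (faceΩ J v)
  faceΩ-at J v j = subst (λ o → at1 (lookup J j) o (lookup v j))
      (sym (trans (cong (λ y → lookup y j) (trans (rv-map embΓ (toG J v)) (cong (Vec.map embΓ) (rv-toG J v))))
        (trans (lookup-map j embΓ (zipWith mk J v)) (cong embΓ (lookup-zipWith mk j J v)))))
      (one (lookup J j) (lookup v j))
    where
      one : ∀ t z → at1 t (embΓ (mk t z)) z
      one true z = refl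
      one false z = tt

  maxAll : ∀ {n} → (Fin n → Z) → Z
  maxAll {zero} f = 0z
  maxAll {suc n} f = max (f zero) (maxAll (f ∘ suc))

  ≤maxAll : ∀ {n} (f : Fin n → Z) j → f j ≤ maxAll f
  ≤maxAll f zero = x≤max _ _
  ≤maxAll f (suc j) = ≤-trans (≤maxAll (f ∘ suc) j) (y≤max (f zero) _)

  lookup-move : ∀ (v : Pt m) w (r : Dir m) j → lookup (v +[ w ] r) j ≡ lookup v j + lookup r j · w
  lookup-move v w r j = lookup-zipWith _ j v r

  coord : Fin m → Form m
  coord zero = top
  coord (suc j) = up (coord j)

  eval-coord : ∀ (j : Fin m) v → eval (coord j) v ≡ lookup v j
  eval-coord zero (z ∷ v) = refl
  eval-coord (suc j) (z ∷ v) = eval-coord j v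

  slope-coord : ∀ (j : Fin m) r → slope (coord j) r ≡ lookup r j
  slope-coord zero (z ∷ r) = refl
  slope-coord (suc j) (z ∷ r) = slope-coord j r

  module _ {I : Vec Bool m} {A W K n E} (P : Piece {m} I A W K n E) where
    open Piece P

    lookup-J : ∀ l j → lookup (J l) j ≡ lookup I j ∧ (p j ℕ.≤ᵇ l)
    lookup-J l j = lookup∘tabulate _ j

    ∈J : ∀ {l j} → lookup I j ≡ true → p j ℕ.≤ l → lookup (J l) j ≡ true
    ∈J {l} {j} i h = trans (lookup-J l j) (trans (cong (_∧ _) i) (≤ᵇ-true h))
      where
        ≤ᵇ-true : ∀ {a b} → a ℕ.≤ b → (a ℕ.≤ᵇ b) ≡ true
        ≤ᵇ-true {a} {b} h with a ℕ.≤ᵇ b | ℕₚ.≤⇒≤ᵇ h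
        ... | true | _ = refl

    J∈ : ∀ {l j} → lookup (J l) j ≡ true → lookup I j ≡ true × p j ℕ.≤ l
    J∈ {l} {j} h with lookup I j | p j ℕ.≤ᵇ l in e | trans (sym (lookup-J l j)) h
    ... | true | true | _ = refl , ℕₚ.≤ᵇ⇒≤ (p j) l (subst IsTrue (sym e) tt)

    J∉ : ∀ {l j} → lookup (J l) j ≡ false → lookup I j ≡ false ⊎ l ℕ.< p j
    J∉ {l} {j} h with lookup I j in e
    ... | false = inj₁ refl
    ... | true with p j ℕ.≤? l
    ... | no q = inj₂ (ℕₚ.≰⇒> q)
    ... | yes q with trans (sym h) (∈J e q)
    ... | ()

    J-mono : ∀ {l l′} j → l ℕ.≤ l′ → lookup (J l) j ≡ true → lookup (J l′) j ≡ true
    J-mono j h t = let i , q = J∈ {j = j} t in ∈J i (ℕₚ.≤-trans q h)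

    ray-agree : ∀ {l r} → (l , r) ∈ rays → ∀ v w {l′} → l′ ℕ.≤ l → AgreeOn (J l′) v (v +[ w ] r)
    ray-agree {l} {r} i v w h j t = sym (trans (lookup-move v w r j) (trans (cong (λ ρ → lookup v j + ρ · w)
      (vanishing i j (inj₂ (ℕₚ.≤-trans (proj₂ (J∈ {j = j} t)) h)))) (eqn [] (lookup v j ∷ w ∷ []) (λ x w → x ⊕ con 0ℤ ⊙ w ⊑ x) refl)))

    Beyond : ℕ → Z → Pt m → Set
    Beyond l b v = ∀ j → lookup I j ≡ true → l ℕ.< p j → b ≤ lookup v j

    far : ∀ {l r} → (l , r) ∈ rays → ∀ v b → ∃ λ w₀ → 0z ≤ w₀ × (∀ w → w₀ ≤ w → Beyond l b (v +[ w ] r))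
    far {l} {r} i v b = max 0z (maxAll f) , x≤max 0z _ , λ w h j t q → subst (b ≤_) (sym (lookup-move v w r j))
        (lin (lookup r j ∷ []) (b ∷ lookup v j ∷ w ∷ []) (λ ρ b x w → ((b ⊕ (⊝ x) ⊑ w) ∷ (w ⊑ ρ ⊙ w) ∷ []) ⊢ (b ⊑ x ⊕ ρ ⊙ w)) refl
          (≤-trans (≤maxAll f j) (≤-trans (y≤max 0z _) h) , ·-grow (positive i j t q) (≤-trans (x≤max 0z (maxAll f)) h)))
      where
        f : Fin m → Z
        f j = b + (- lookup v j)

    near-face : ∀ {l v v′ x b} → FaceAt (J l) v x → AgreeOn (J l) v v′ → Beyond l b v′ → Near I x b v′
    near-face {l} {v} {v′} {x} {b} f a B j with lookup (J l) j in e | lookup (rv x) j | f j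
    ... | true | just q | h = subst (λ t → near1 t (just q) b (lookup v′ j)) (sym (proj₁ (J∈ {j = j} e)))
            (subst (λ z → embQ z ≈Q q) (a j e) h)
    ... | false | nothing | _ with lookup I j in i
    ... | false = tt
    ... | true with J∉ {j = j} e
    ... | inj₁ i′ with trans (sym i) i′
    ... | ()
    near-face {l} {v} {v′} {x} {b} f a B j | false | nothing | _ | true | inj₂ q = B j i q

    -- For l < L there is a ray of level l, which fixes the coordinates of J l and makes the others
    -- in I grow; for l = L none is left to grow.
    escape : ∀ l → l ℕ.≤ L → ∀ v → X v → ∀ b → ∃ λ v′ → X v′ × AgreeOn (J l) v v′ × Beyond l b v′
    escape l l≤L v xv b with ℕₚ.m≤n⇒m<n∨m≡n l≤L
    ... | inj₂ refl = v , xv , (λ _ _ → refl) , λ j _ q → ⊥-elim (ℕₚ.<⇒≱ q (p≤L j))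
    ... | inj₁ l<L = let r , i = covers l l<L ; w₀ , 0≤w , B = far i v b in
          v +[ w₀ ] r , moveX i v w₀ 0≤w xv , ray-agree i v w₀ ℕₚ.≤-refl , B w₀ ≤-refl

    FaceAt⇒Lim : ∀ {l v x} → l ℕ.≤ L → X v → FaceAt (J l) v x → Lim I X x
    FaceAt⇒Lim {l} {v} {x} h xv f b = let v′ , x′ , a , B = escape l h v xv b in v′ , x′ , near-face {v = v} {v′ = v′} {x = x} f a B

    boundedAbove : ∀ F → (∀ {l r} → (l , r) ∈ rays → slope F r ℤ.≤ 0ℤ) → ∃ λ C → ∀ v → X v → eval F v ≤ C
    boundedAbove F h with bounded F
    ... | C , f = C , λ v xv → let c , cc , d = decompose v xv in ≤-trans (eval-Dec F rays h d) (f c cc)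

    slopeBound : ∀ F (rs : List (Ray m)) → ∃ λ c → 0ℤ ℤ.≤ c × (∀ {l r} → (l , r) ∈ rs → slope F r ℤ.≤ c)
    slopeBound F [] = 0ℤ , ℤₚ.≤-refl , λ ()
    slopeBound F ((l , r) ∷ rs) with slopeBound F rs
    ... | c , 0≤c , h = slope F r ℤ.⊔ c , ℤₚ.≤-trans 0≤c (ℤₚ.i≤j⊔i _ c) , λ where
          (here refl) → ℤₚ.i≤i⊔j (slope F r) c
          (there i) → ℤₚ.≤-trans (h i) (ℤₚ.i≤j⊔i (slope F r) c)

    -- For c at least all slopes of F, the form F - (1 + c) F′ has no positive slope: below level k
    -- because F′ has slope at least 1 there, from level k on because F is flat. So it is bounded on
    -- X by its bound on the core.
    dominated : ∀ F F′ k → Vanishes rays k F → (∀ {l r} → (l , r) ∈ rays → l ℕ.< k → 1ℤ ℤ.≤ slope F′ r) →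
                (∀ {l r} → (l , r) ∈ rays → 0ℤ ℤ.≤ slope F′ r) →
                ∃₂ λ c C → 1ℤ ℤ.≤ c × (∀ v → X v → eval F v ≤ c · eval F′ v + C)
    dominated F F′ k van pos₁ pos₀ with slopeBound F rays
    ... | c , 0≤c , h with boundedAbove (F ⊟ (1ℤ ℤ.+ c) ⊡ F′) neg
      where
        c≤ : 0ℤ ℤ.≤ 1ℤ ℤ.+ c
        c≤ = ℤₚ.≤-trans 0≤c (ℤₚ.i≤j+i c 1ℤ)
        neg : ∀ {l r} → (l , r) ∈ rays → slope F r ℤ.+ ℤ.-1ℤ ℤ.* ((1ℤ ℤ.+ c) ℤ.* slope F′ r) ℤ.≤ 0ℤ
        neg {l} {r} i = subst (ℤ._≤ 0ℤ) (cong (λ k → slope F r ℤ.+ k) (sym (ℤₚ.-1*i≡-i _))) (ℤₚ.i≤j⇒i-j≤0 le)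
          where
            le : slope F r ℤ.≤ (1ℤ ℤ.+ c) ℤ.* slope F′ r
            le with l ℕ.<? k
            ... | yes q = ℤₚ.≤-trans (h i) (ℤₚ.≤-trans (ℤₚ.i≤j+i c 1ℤ) (subst (ℤ._≤ (1ℤ ℤ.+ c) ℤ.* slope F′ r) (ℤₚ.*-identityʳ (1ℤ ℤ.+ c))
                    (ℤₚ.*-monoˡ-≤-nonNeg (1ℤ ℤ.+ c) {{ℤ.nonNegative c≤}} (pos₁ i q))))
            ... | no q = subst (ℤ._≤ (1ℤ ℤ.+ c) ℤ.* slope F′ r) (sym (van i (ℕₚ.≮⇒≥ q)))
                    (subst (ℤ._≤ (1ℤ ℤ.+ c) ℤ.* slope F′ r) (ℤₚ.*-zeroʳ (1ℤ ℤ.+ c))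
                      (ℤₚ.*-monoˡ-≤-nonNeg (1ℤ ℤ.+ c) {{ℤ.nonNegative c≤}} (pos₀ i)))
    ... | C , f = 1ℤ ℤ.+ c , C , ℤₚ.i≤i+j 1ℤ c {{ℤ.nonNegative 0≤c}} , λ v xv →
          lin (1ℤ ℤ.+ c ∷ []) (eval F v ∷ eval F′ v ∷ C ∷ []) (λ d x y C → ((x ⊕ con ℤ.-1ℤ ⊙ d ⊙ y ⊑ C) ∷ []) ⊢ (x ⊑ d ⊙ y ⊕ C)) refl (f v xv)

  sumAt : (fs : List (ℤ × Form m)) {I : Vec Bool m} {X : Pt m → Set} {V : Form m → Set} →
          All (λ f → Ext I X (proj₂ f) × V (proj₂ f)) fs → ΩPt m → Maybe Z
  sumAt [] [] x = just 0z
  sumAt ((κ , F) ∷ fs) (((g , _) , _) ∷ es) x = Maybe.zipWith (λ a b → κ · a + b) (g x) (sumAt fs es x)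

  -- If a summand is infinite at x, the combination may have no limit, since coefficients of both
  -- signs occur; all that is recorded then is one form of the list that tends to +∞.
  SumAt : (fs : List (ℤ × Form m)) → Vec Bool m → (Pt m → Set) → (Form m → Set) → ΩPt m → Maybe Z → Set
  SumAt fs I X V x (just s) = ∃ λ b → ∀ v → X v → Near I x b v → combination fs v ≡ s
  SumAt fs I X V x nothing = ∃ λ F → V F × (∀ c → ∃ λ b → ∀ v → X v → Near I x b v → c ≤ eval F v)

  sumAt-spec : (fs : List (ℤ × Form m)) {I : Vec Bool m} {X : Pt m → Set} {V : Form m → Set} →
          (es : All (λ f → Ext I X (proj₂ f) × V (proj₂ f)) fs) → ∀ x → Lim I X x → SumAt fs I X V x (sumAt fs es x)
  sumAt-spec [] [] x _ = 0z , λ _ _ _ → refl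
  sumAt-spec ((κ , F) ∷ fs) {I} (((g , h) , V) ∷ es) x lim with g x | h x lim | sumAt fs es x | sumAt-spec fs es x lim
  ... | just a | b , f | just s | b′ , f′ = max b b′ , λ v xv n →
          cong₂ (λ a s → κ · a + s) (f v xv (Near-mono I x v (x≤max b b′) n)) (f′ v xv (Near-mono I x v (y≤max b b′) n))
  ... | just a | _ | nothing | r = r
  ... | nothing | f | just s | _ = F , V , f
  ... | nothing | f | nothing | _ = F , V , f

  module _ {I : Vec Bool m} {A W K n E} (P : Piece {m} I A W K n E) where
    open Piece P

    -- Where all forms of the combination have finite limits, so has F. Otherwise one of them tends
    -- to +∞, and since F dominates it, F tends to +∞ too, whatever the signs of the coefficients.
    Rep⇒Ext : ∀ k F → Rep I X rays k F → (∀ {l r} → (l , r) ∈ rays → l ℕ.< k → 1ℤ ℤ.≤ slope F r) →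
              (∀ {l r} → (l , r) ∈ rays → 0ℤ ℤ.≤ slope F r) → Ext I X F
    Rep⇒Ext k F (c , fs , es , e) pos₁ pos₀ = g , at
      where
        g : ΩPt m → Maybe Z
        g x = Maybe.map (c +_) (sumAt fs es x)
        at : ∀ x → Lim I X x → ExtAt I X F x (g x)
        at x lim with sumAt fs es x | sumAt-spec fs es x lim
        ... | just s | b , f = b , λ v xv n → trans (e v) (cong (c +_) (f v xv n))
        ... | nothing | F′ , van , f with dominated P F′ F k van pos₁ pos₀
        -- Once F′ reaches this value, `dom` gives d · (a - 1) < d · F, hence F ≥ a.
        ... | d , C , 1≤d , dom = λ a → let b , h = f (d · (a + (- 1z)) + C + 1z) in b , λ v xv n →
              lin [] (a ∷ eval F v ∷ 1z ∷ []) (λ a y o → (((a ⊖ₑ o) ⊕ o ⊑ y) ∷ []) ⊢ (a ⊑ y)) refl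
              (·-cancel-< {d} {a + (- 1z)} {eval F v} 1≤d (lin (d ∷ []) (a ∷ eval F v ∷ eval F′ v ∷ C ∷ 1z ∷ []) (λ d a y x C o →
                 ((d ⊙ (a ⊖ₑ o) ⊕ C ⊕ o ⊑ x) ∷ (x ⊑ d ⊙ y ⊕ C) ∷ []) ⊢ (d ⊙ (a ⊖ₑ o) ⊕ o ⊑ d ⊙ y)) refl (h v xv n , dom v xv)))

  decideFin : ∀ {n} {P Q : Fin n → Set} → (∀ j → P j ⊎ Q j) → (∀ j → P j) ⊎ ∃ Q
  decideFin {zero} d = inj₁ λ ()
  decideFin {suc n} d with d zero | decideFin (d ∘ suc)
  ... | inj₂ q | _ = inj₂ (zero , q)
  ... | inj₁ p | inj₂ (j , q) = inj₂ (suc j , q)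
  ... | inj₁ p | inj₁ ps = inj₁ λ { zero → p ; (suc j) → ps j }

  decideList : ∀ {A : Set} {P Q : A → Set} as → (∀ {a} → a ∈ as → P a ⊎ Q a) → (∀ {a} → a ∈ as → P a) ⊎ (∃ λ a → a ∈ as × Q a)
  decideList [] d = inj₁ λ ()
  decideList (a ∷ as) d with d (here refl) | decideList as (λ i → d (there i))
  ... | inj₂ q | _ = inj₂ (a , here refl , q)
  ... | inj₁ p | inj₂ (b , i , q) = inj₂ (b , there i , q)
  ... | inj₁ p | inj₁ ps = inj₁ λ { (here refl) → p ; (there i) → ps i }

  1≤or≤0 : ∀ k → 1ℤ ℤ.≤ k ⊎ k ℤ.≤ 0ℤ
  1≤or≤0 (pos zero) = inj₂ ℤₚ.≤-refl
  1≤or≤0 (pos (suc n)) = inj₁ 1≤pos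
  1≤or≤0 -[1+ n ] = inj₂ ℤ.-≤+

  module _ {I : Vec Bool m} {A W K n E} (P : Piece {m} I A W K n E) where
    open Piece P

    ray-nonneg : ∀ {l r} → (l , r) ∈ rays → ∀ j → 0ℤ ℤ.≤ lookup r j
    ray-nonneg {l} {r} i j with lookup I j in e | p j ℕ.≤? l
    ... | false | _ = eqℤ (vanishing i j (inj₁ e))
      where eqℤ : ∀ {a} → a ≡ 0ℤ → 0ℤ ℤ.≤ a
            eqℤ refl = ℤₚ.≤-refl
    ... | true | yes q = subst (0ℤ ℤ.≤_) (sym (vanishing i j (inj₂ q))) ℤₚ.≤-refl
    ... | true | no q = ℤₚ.≤-trans (ℤ.+≤+ ℕ.z≤n) (positive i j e (ℕₚ.≰⇒> q))

    Finite Infinite : ΩPt m → ℕ → Fin m → Set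
    Finite x l j = lookup I j ≡ true → p j ℕ.≤ l → is-just (lookup (rv x) j) ≡ true
    Infinite x l j = lookup I j ≡ true × p j ℕ.≤ l × is-just (lookup (rv x) j) ≡ false

    decideLevel : ∀ x l → (∀ j → Finite x l j) ⊎ ∃ (Infinite x l)
    decideLevel x l = decideFin λ j → dec j
      where
        dec : ∀ j → Finite x l j ⊎ Infinite x l j
        dec j with lookup I j | p j ℕ.≤? l | is-just (lookup (rv x) j)
        ... | false | _ | _ = inj₁ λ ()
        ... | true | no q | _ = inj₁ λ _ h → ⊥-elim (q h)
        ... | true | yes _ | true = inj₁ λ _ _ → refl
        ... | true | yes q | false = inj₂ (refl , q , refl)

    -- Finds how far up the levels all coordinates of x stay finite; the infinite coordinate that
    -- stops the search one level higher is kept for `infinite-above`.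
    searchLevel : ∀ x l → (∃ λ l′ → l′ ℕ.≤ l × (∀ j → Finite x l′ j) × (l′ ≡ l ⊎ ∃ (Infinite x (suc l′)))) ⊎ ∃ (Infinite x 0)
    searchLevel x zero with decideLevel x zero
    ... | inj₁ f = inj₁ (0 , ℕ.z≤n , f , inj₁ refl)
    ... | inj₂ i = inj₂ i
    searchLevel x (suc l) with searchLevel x l
    ... | inj₂ i = inj₂ i
    ... | inj₁ (l′ , h , f , inj₂ i) = inj₁ (l′ , ℕₚ.m≤n⇒m≤1+n h , f , inj₂ i)
    ... | inj₁ (.l , h , f , inj₁ refl) with decideLevel x (suc l)
    ... | inj₁ f′ = inj₁ (suc l , ℕₚ.≤-refl , f′ , inj₁ refl)
    ... | inj₂ i = inj₁ (l , ℕₚ.n≤1+n l , f , inj₂ i)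

    infinite-big : ∀ {x l b} v j → Infinite x l j → Near I x b v → b ≤ lookup v j
    infinite-big {x} {b = b} v j (i , _ , e) n with lookup I j | lookup (rv x) j | n j
    infinite-big v j (refl , _ , e) n | .true | nothing | h = h

    coord-dominated : ∀ j₀ j → lookup I j ≡ true → p j₀ ℕ.≤ p j →
                      ∃₂ λ c C → 1ℤ ℤ.≤ c × (∀ v → X v → lookup v j₀ ≤ c · lookup v j + C)
    coord-dominated j₀ j i h with dominated P (coord j₀) (coord j) (p j₀)
        (λ {l} {r} q k → trans (slope-coord j₀ r) (vanishing q j₀ (inj₂ k)))
        (λ {l} {r} q k → subst (1ℤ ℤ.≤_) (sym (slope-coord j r)) (positive q j i (ℕₚ.<-≤-trans k h)))
        (λ {l} {r} q → subst (0ℤ ℤ.≤_) (sym (slope-coord j r)) (ray-nonneg q j))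
    ... | c , C , 1≤c , f = c , C , 1≤c , λ v xv → subst₂ (λ a b → a ≤ c · b + C) (eval-coord j₀ v) (eval-coord j v) (f v xv)

    level0-bounded : ∀ {x} → Lim I X x → ∀ j → Infinite x 0 j → ⊥
    level0-bounded {x} lim j inf with boundedAbove P (coord j) (λ {l} {r} q → subst (ℤ._≤ 0ℤ) (sym (trans (slope-coord j r) (vanishing q j (inj₂ (ℕₚ.≤-trans (proj₁ (proj₂ inf)) ℕ.z≤n))))) ℤₚ.≤-refl)
    ... | C , f with lim (C + 1z)
    ... | v , xv , nr = absurd-< (≤-trans (infinite-big v j inf nr) (subst (_≤ C) (eval-coord j v) (f v xv)))

    -- On X the coordinate j₀ is at most c times the coordinate j plus C. If j were finite at x, it
    -- would be constant near x, while j₀ is unbounded there.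
    infinite-above : ∀ {x} → Lim I X x → ∀ j₀ l → Infinite x l j₀ → ∀ j → lookup I j ≡ true → p j₀ ℕ.≤ p j → lookup (rv x) j ≡ nothing
    infinite-above {x} lim j₀ l inf j i h with lookup (rv x) j in ex
    ... | nothing = refl
    ... | just q with coord-dominated j₀ j i h
    ... | c , C , _ , f with lim 0z
    ... | v , xv , nr with lim (c · lookup v j + C + 1z)
    ... | v′ , xv′ , nr′ = ⊥-elim (absurd-< (≤-trans (infinite-big v′ j₀ inf nr′) (subst (λ z → lookup v′ j₀ ≤ c · z + C) (sym same) (f v′ xv′))))
      where
        pinnedTo : ∀ b u → Near I x b u → embQ (lookup u j) ≈Q q
        pinnedTo b u n = subst₂ (λ t o → near1 t o b (lookup u j)) i ex (n j)
        same : lookup v j ≡ lookup v′ j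
        same = trans (sym (floor-≈ 0 q (lookup v j) (pinnedTo _ v nr))) (floor-≈ 0 q (lookup v′ j) (pinnedTo _ v′ nr′))

    -- Among the coordinates in I, those infinite at x are the ones with p above some level l, so
    -- the support of x is J l, and any point of X near x induces x on that face.
    Lim⇒FaceAt : ∀ x → Lim I X x → ∃₂ λ l v → l ℕ.≤ L × X v × FaceAt (J l) v x
    Lim⇒FaceAt x lim with searchLevel x L | lim 0z
    ... | inj₂ (j , inf) | _ = ⊥-elim (level0-bounded lim j inf)
    ... | inj₁ (l , h , fin , rest) | v , xv , nr = l , v , h , xv , face
      where
        outer : ∀ rest j → lookup I j ≡ true → l ℕ.< p j → lookup (rv x) j ≡ nothing
        outer (inj₁ refl) j i q = ⊥-elim (ℕₚ.<⇒≱ q (p≤L j))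
        outer (inj₂ (j₀ , inf)) j i q = infinite-above lim j₀ (suc l) inf j i (ℕₚ.≤-trans (proj₁ (proj₂ inf)) q)
        finite1 : ∀ t o {z} → t ≡ true → is-just o ≡ true → near1 t o 0z z → at1 true o z
        finite1 true (just q) _ _ nq = nq
        face : FaceAt (J l) v x
        face j with lookup (J l) j in e
        ... | true with J∈ P {j = j} e
        ... | i , q = finite1 (lookup I j) (lookup (rv x) j) i (fin j i q) (nr j)
        face j | false with lookup I j in ei
        ... | false with lookup (rv x) j | subst (λ t → near1 t (lookup (rv x) j) 0z (lookup v j)) ei (nr j)
        ... | nothing | _ = tt
        face j | false | true with J∉ P {j = j} e
        ... | inj₁ i′ with trans (sym ei) i′
        ... | ()
        face j | false | true | inj₂ q rewrite outer rest j ei q = tt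

    Cl⇔ : ∀ x → Cl (gp I X) x → ∃₂ λ l v → l ℕ.≤ L × X v × FaceAt (J l) v x
    Cl⇔ x c = Lim⇒FaceAt x (Cl⇒Lim I (λ _ s → s) x c)

    FaceAt⇒Cl : ∀ {l v x} → l ℕ.≤ L → X v → FaceAt (J l) v x → Cl (gp I X) x
    FaceAt⇒Cl {x = x} h xv f = Lim⇒Cl I (λ v xv → v , xv , refl) x (FaceAt⇒Lim P h xv f)

    -- Take a point of X in the given neighbourhood of x and send its coordinates outside J l₂ to
    -- +∞; since J l₁ is contained in J l₂, it does not leave the neighbourhood.
    faceLE : ∀ I₁ I₂ {l₁ l₂} → l₁ ℕ.≤ l₂ → l₂ ℕ.≤ L → rv I₁ ≡ J l₁ → rv I₂ ≡ J l₂ → FaceLE (gp I X) I₁ I₂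
    faceLE I₁ I₂ {l₁} {l₂} l₁≤l₂ l₂≤L e₁ e₂ x (cl , s) l u ok with Near⇒In (J l₂) x l u ok
    ... | b , f with Cl⇒Lim I (λ _ s → s) x cl b
    ... | v , xv , nr = faceΩ (J l₂) v , f v nr₂ , FaceAt⇒Cl {l₂} {v} l₂≤L xv (faceΩ-at (J l₂) v) ,
            rv-injective _ _ (trans (FaceAt-supp (J l₂) v (faceΩ (J l₂) v) (faceΩ-at (J l₂) v)) (sym e₂))
      where
        suppx : ∀ j → is-just (lookup (rv x) j) ≡ lookup (J l₁) j
        suppx j = trans (sym (lookup-map j is-just (rv x))) (cong (λ y → lookup y j) (trans (sym (rv-map is-just x)) (trans (cong rv s) e₁)))
        nr₂ : Near (J l₂) x b v
        nr₂ j with lookup (J l₂) j in e | lookup I j in ei | lookup (rv x) j | nr j | suppx j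
        ... | true | true | _ | h | _ = h
        ... | true | false | _ | h | _ = ⊥-elim (case-false (trans (sym ei) (proj₁ (J∈ P {j = j} e))))
          where case-false : false ≡ true → ⊥
                case-false ()
        ... | false | _ | nothing | _ | _ = tt
        ... | false | _ | just q | _ | t = case-false (trans (sym e) (J-mono P j l₁≤l₂ (sym t)))
          where case-false : false ≡ true → ⊥
                case-false ()

    monohedral : Monohedral (gp I X)
    monohedral I₁ I₂ (x₁ , c₁ , s₁) (x₂ , c₂ , s₂) with Cl⇔ x₁ c₁ | Cl⇔ x₂ c₂
    ... | l₁ , v₁ , h₁ , _ , f₁ | l₂ , v₂ , h₂ , _ , f₂ with ℕₚ.≤-total l₁ l₂
    ... | inj₁ q = inj₁ (faceLE I₁ I₂ q h₂ (trans (cong rv (sym s₁)) (FaceAt-supp _ v₁ x₁ f₁)) (trans (cong rv (sym s₂)) (FaceAt-supp _ v₂ x₂ f₂)))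
    ... | inj₂ q = inj₂ (faceLE I₂ I₁ q h₁ (trans (cong rv (sym s₂)) (FaceAt-supp _ v₂ x₂ f₂)) (trans (cong rv (sym s₁)) (FaceAt-supp _ v₁ x₁ f₁)))

    -- For a form that extends to the closure, the limit on the l-th face is finite exactly when g ≤
    -- l.
    record Grade (F : Form m) : Set where
      field
        g : ℕ
        g≤L : g ℕ.≤ L
        pos-slope : ∀ {l r} → (l , r) ∈ rays → l ℕ.< g → 1ℤ ℤ.≤ slope F r
        zero-slope : ∀ {l r} → (l , r) ∈ rays → g ℕ.≤ l → slope F r ≡ 0ℤ

    module _ (F : Form m) (F≥0 : ∀ v → X v → 0z ≤ eval F v) where

      -- X is stable under r, so a negative slope would make F negative far out.
      slope-nonneg : ∀ {l r} → (l , r) ∈ rays → 0ℤ ℤ.≤ slope F r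
      slope-nonneg {l} {r} i = from (1≤or≤0 (ℤ.- slope F r)) inhabited
        where
          s = slope F r
          contra : ∀ v → X v → 1ℤ ℤ.≤ ℤ.- s → ⊥
          contra v xv h = absurd (lin (s ∷ []) (eval F v ∷ eval F (v +[ w ] r) ∷ 1z ∷ []) (λ s x y o →
              ((𝟘 ⊑ y) ∷ (y ⊑ x ⊕ s ⊙ (x ⊕ o)) ∷ (x ⊕ o ⊑ (:- s) ⊙ (x ⊕ o)) ∷ []) ⊢ (o ⊑ 𝟘)) refl
              (F≥0 (v +[ w ] r) (moveX i v w 0≤w xv) , eq (eval-move F v w r) , ·-grow h 0≤w))
            where
              -- With slope at most -1, a step of this length brings F down to at most -1.
              w = eval F v + 1z
              0≤w : 0z ≤ w
              0≤w = lin [] (eval F v ∷ 1z ∷ []) (λ x o → ((𝟘 ⊑ x) ∷ (𝟘 ⊑ o) ∷ []) ⊢ (𝟘 ⊑ x ⊕ o)) refl (F≥0 v xv , 0≤1)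
          from : 1ℤ ℤ.≤ ℤ.- s ⊎ ℤ.- s ℤ.≤ 0ℤ → ∃ X → 0ℤ ℤ.≤ s
          from (inj₂ h) _ = subst (0ℤ ℤ.≤_) (ℤₚ.neg-involutive s) (ℤₚ.neg-mono-≤ h)
          from (inj₁ h) (v , xv) = ⊥-elim (contra v xv h)

      module _ (extF : Ext I X F) where

        -- Moving along r, or along r and r′, leads to the same point of the closure.
        flat-absurd : ∀ {l r l′ r′} → (l , r) ∈ rays → (l′ , r′) ∈ rays → l ℕ.≤ l′ → 1ℤ ℤ.≤ slope F r′ → slope F r ≡ 0ℤ → ∀ v → X v → ⊥
        flat-absurd {l} {r} {l′} {r′} i i′ l≤l′ h s≡0 v xv = go (proj₁ extF x) (proj₂ extF x (FaceAt⇒Lim P (ℕₚ.<⇒≤ (range i)) xv at))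
          where
            x = faceΩ (J l) v
            at : FaceAt (J l) v x
            at = faceΩ-at (J l) v
            flat : ∀ w → eval F (v +[ w ] r) ≡ eval F v
            flat w = trans (eval-move F v w r) (trans (cong (λ k → eval F v + k · w) s≡0)
              (eqn [] (eval F v ∷ w ∷ []) (λ x w → x ⊕ con 0ℤ ⊙ w ⊑ x) refl))
            near₁ : ∀ {b w} → Beyond P l b (v +[ w ] r) → Near I x b (v +[ w ] r)
            near₁ {w = w} B = near-face P {v = v} {v′ = v +[ w ] r} {x = x} at (ray-agree P i v w ℕₚ.≤-refl) B
            near₂ : ∀ {b w} → Beyond P l b (v +[ w ] r) → Near I x b (v +[ w ] r +[ 1z ] r′)
            near₂ {b} {w} B = near-face P {v = v} {v′ = v₁ +[ 1z ] r′} {x = x} at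
                (λ j t → trans (ray-agree P i v w ℕₚ.≤-refl j t) (ray-agree P i′ v₁ 1z l≤l′ j t))
                (λ j t z → subst (b ≤_) (sym (lookup-move v₁ 1z r′ j)) (lin (lookup r′ j ∷ []) (b ∷ lookup v₁ j ∷ 1z ∷ []) (λ ρ b x o →
                     ((b ⊑ x) ∷ (𝟘 ⊑ ρ ⊙ o) ∷ []) ⊢ (b ⊑ x ⊕ ρ ⊙ o)) refl (B j t z , ·-nonneg (ray-nonneg i′ j) 0≤1)))
              where v₁ = v +[ w ] r
            fin : ∀ c b → (∀ u → X u → Near I x b u → eval F u ≡ c) → (∃ λ w₀ → 0z ≤ w₀ × (∀ w → w₀ ≤ w → Beyond P l b (v +[ w ] r))) → ⊥
            fin c b k (w , 0≤w , B) = absurd-< {c} (lin (slope F r′ ∷ []) (eval F v₁ ∷ eval F v₂ ∷ c ∷ 1z ∷ []) (λ s x y c o →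
                    ((c ⊑ x) ∷ (x ⊕ s ⊙ o ⊑ y) ∷ (y ⊑ c) ∷ (con 1ℤ ⊙ o ⊑ s ⊙ o) ∷ []) ⊢ (c ⊕ o ⊑ c)) refl
                    (eq≥ (k v₁ xv₁ (near₁ (B w ≤-refl))) , eq≥ (eval-move F v₁ 1z r′) , eq (k v₂ (moveX i′ v₁ 1z 0≤1 xv₁) (near₂ (B w ≤-refl))) , ·-monoˡ h 0≤1))
              where
                v₁ = v +[ w ] r
                v₂ = v₁ +[ 1z ] r′
                xv₁ = moveX i v w 0≤w xv
            inf : ∀ b → (∀ u → X u → Near I x b u → eval F v + 1z ≤ eval F u) → (∃ λ w₀ → 0z ≤ w₀ × (∀ w → w₀ ≤ w → Beyond P l b (v +[ w ] r))) → ⊥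
            inf b k (w , 0≤w , B) = absurd-< {eval F v} (subst (eval F v + 1z ≤_) (flat w) (k (v +[ w ] r) (moveX i v w 0≤w xv) (near₁ (B w ≤-refl))))
            go : ∀ o → ExtAt I X F x o → ⊥
            go (just c) (b , k) = fin c b k (far P i v b)
            go nothing k = inf (proj₁ (k (eval F v + 1z))) (proj₂ (k (eval F v + 1z))) (far P i v _)

        slope-mono : ∀ {l r l′ r′} → (l , r) ∈ rays → (l′ , r′) ∈ rays → l ℕ.≤ l′ → 1ℤ ℤ.≤ slope F r′ → 1ℤ ℤ.≤ slope F r
        slope-mono {r = r} i i′ l≤l′ h = from (1≤or≤0 (slope F r)) inhabited
          where
            from : 1ℤ ℤ.≤ slope F r ⊎ slope F r ℤ.≤ 0ℤ → ∃ X → 1ℤ ℤ.≤ slope F r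
            from (inj₁ q) _ = q
            from (inj₂ q) (v , xv) = ⊥-elim (flat-absurd i i′ l≤l′ h (ℤₚ.≤-antisym q (slope-nonneg i)) v xv)

        abstract
          grade : Grade F
          grade = search L ℕₚ.≤-refl λ i q → ⊥-elim (ℕₚ.<⇒≱ (range i) q)
            where
              search : ∀ l → l ℕ.≤ L → (∀ {l′ r} → (l′ , r) ∈ rays → l ℕ.≤ l′ → slope F r ≡ 0ℤ) → Grade F
              search zero h z = record { g = 0 ; g≤L = h ; pos-slope = λ _ () ; zero-slope = z }
              search (suc l) h z = from (decideList {P = Z₀} {Q = Z₁} rays λ {lr} → d {lr})
                where
                  Z₀ Z₁ : Ray m → Set
                  Z₀ lr = l ℕ.≤ proj₁ lr → slope F (proj₂ lr) ≡ 0ℤ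
                  Z₁ lr = l ℕ.≤ proj₁ lr × 1ℤ ℤ.≤ slope F (proj₂ lr)
                  d : ∀ {lr} → lr ∈ rays → Z₀ lr ⊎ Z₁ lr
                  d {l′ , r} i with l ℕ.≤? l′ | 1≤or≤0 (slope F r)
                  ... | no q | _ = inj₁ λ q′ → ⊥-elim (q q′)
                  ... | yes q | inj₁ s = inj₂ (q , s)
                  ... | yes q | inj₂ s = inj₁ λ _ → ℤₚ.≤-antisym s (slope-nonneg i)
                  from : (∀ {lr} → lr ∈ rays → Z₀ lr) ⊎ (∃ λ lr → lr ∈ rays × Z₁ lr) → Grade F
                  from (inj₁ z′) = search l (ℕₚ.<⇒≤ h) z′
                  from (inj₂ ((l′ , r′) , i′ , q , s)) = record { g = suc l ; g≤L = h ; zero-slope = z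
                    ; pos-slope = λ i k → slope-mono i i′ (ℕₚ.≤-trans (ℕₚ.≤-pred k) q) s }

  module _ {I : Vec Bool m} {A W K n E} (P : Piece {m} I A W K n E) where
    open Piece P

    module _ {F : Form m} (gr : Grade P F) where
      open Grade gr

      grade-nonneg : ∀ {l r} → (l , r) ∈ rays → 0ℤ ℤ.≤ slope F r
      grade-nonneg {l} i with l ℕ.<? g
      ... | yes q = ℤₚ.≤-trans (ℤ.+≤+ ℕ.z≤n) (pos-slope i q)
      ... | no q = subst (0ℤ ℤ.≤_) (sym (zero-slope i (ℕₚ.≮⇒≥ q))) ℤₚ.≤-refl

      eval-flat : ∀ {l r} → (l , r) ∈ rays → g ℕ.≤ l → ∀ v w → eval F (v +[ w ] r) ≡ eval F v
      eval-flat {l} {r} i h v w = trans (eval-move F v w r) (trans (cong (λ k → eval F v + k · w) (zero-slope i h))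
            (eqn [] (eval F v ∷ w ∷ []) (λ x w → x ⊕ con 0ℤ ⊙ w ⊑ x) refl))

      escape-flat : ∀ l → l ℕ.≤ L → g ℕ.≤ l → ∀ v → X v → ∀ b → ∃ λ v′ → X v′ × AgreeOn (J l) v v′ × Beyond P l b v′ × eval F v′ ≡ eval F v
      escape-flat l l≤L g≤l v xv b = from (ℕₚ.m≤n⇒m<n∨m≡n l≤L)
        where
          along : (∃ λ r → (l , r) ∈ rays) → ∃ λ v′ → X v′ × AgreeOn (J l) v v′ × Beyond P l b v′ × eval F v′ ≡ eval F v
          along (r , i) = let w , 0≤w , B = far P i v b in
            v +[ w ] r , moveX i v w 0≤w xv , ray-agree P i v w ℕₚ.≤-refl , B w ≤-refl , eval-flat i g≤l v w
          from : l ℕ.< L ⊎ l ≡ L → _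
          from (inj₁ l<L) = along (covers l l<L)
          from (inj₂ refl) = v , xv , (λ _ _ → refl) , (λ j _ q → ⊥-elim (ℕₚ.<⇒≱ q (p≤L j))) , refl

      escape-grow : ∀ l → l ℕ.< g → ∀ v → X v → ∀ b c → ∃ λ v′ → X v′ × AgreeOn (J l) v v′ × Beyond P l b v′ × c ≤ eval F v′
      escape-grow l l<g v xv b c = along (covers l (ℕₚ.<-≤-trans l<g g≤L))
        where
          along : (∃ λ r → (l , r) ∈ rays) → ∃ λ v′ → X v′ × AgreeOn (J l) v v′ × Beyond P l b v′ × c ≤ eval F v′
          along (r , i) = pick (far P i v b)
            where
              pick : (∃ λ w₀ → 0z ≤ w₀ × (∀ w → w₀ ≤ w → Beyond P l b (v +[ w ] r))) → _
              pick (w₀ , 0≤w₀ , B) = v +[ w ] r , moveX i v w 0≤w xv , ray-agree P i v w ℕₚ.≤-refl , B w (x≤max w₀ _) ,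
                  lin (slope F r ∷ []) (eval F v ∷ eval F (v +[ w ] r) ∷ c ∷ w ∷ []) (λ s x y c w →
                    ((x ⊕ s ⊙ w ⊑ y) ∷ (w ⊑ s ⊙ w) ∷ (c ⊖ₑ x ⊑ w) ∷ []) ⊢ (c ⊑ y)) refl
                    (eq≥ (eval-move F v w r) , ·-grow (pos-slope i l<g) 0≤w , y≤max w₀ (c + (- eval F v)))
                where
                  w = max w₀ (c + (- eval F v))
                  0≤w = ≤-trans 0≤w₀ (x≤max w₀ (c + (- eval F v)))

  -- Two pieces sharing a point of their l-th and l′-th faces share these faces, with all the data attached to them.
  record SameFace {I : Vec Bool m} {A W K n E} (P P′ : Piece {m} I A W K n E) (l l′ : ℕ) : Set where
    private
      module P = Piece P
      module P′ = Piece P′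
    field
      l≡l′ : l ≡ l′
      p≡p′ : ∀ j → lookup (P.J l) j ≡ true → P.p j ≡ P′.p j
      τ≡τ′ : ∀ v v′ → P.X v → P′.X v′ → AgreeOn (P.J l) v v′ → ∀ i → i ℕ.< l → eval (P.τ i) v ≡ eval (P′.τ i) v′
      to : ∀ v → P.X v → ∃ λ v′ → P′.X v′ × AgreeOn (P.J l) v v′
      from : ∀ v′ → P′.X v′ → ∃ λ v → P.X v × AgreeOn (P.J l) v v′

  Compatible : {I : Vec Bool m} {A : Pt m → Set} {W : ℤ} {K : Z} {n : ℕ} {E : Z} (P P′ : Piece I A W K n E) → Set
  Compatible P P′ = ∀ l l′ → l ℕ.≤ P.L → l′ ℕ.≤ P′.L → ∀ v v′ → P.X v → P′.X v′ → P.J l ≡ P′.J l′ → AgreeOn (P.J l) v v′ → SameFace P P′ l l′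
    where
      module P = Piece P
      module P′ = Piece P′

  module _ {I : Vec Bool m} {A W K n E} (P P′ : Piece {m} I A W K n E) (F : Form m) (extF : Ext I A F) (gr : Grade P F) (gr′ : Grade P′ F) where
    private
      module P = Piece P
      module P′ = Piece P′
      open Grade gr
      open Grade gr′ renaming (g to g′; g≤L to g′≤L)

    -- Both values are the limit of F at the common point of the two faces.
    ext-agree : ∀ l l′ → l ℕ.≤ P.L → l′ ℕ.≤ P′.L → ∀ v v′ → P.X v → P′.X v′ → P.J l ≡ P′.J l′ → AgreeOn (P.J l) v v′ →
                g ℕ.≤ l → g′ ℕ.≤ l′ × eval F v ≡ eval F v′
    ext-agree l l′ l≤L l′≤L v v′ xv xv′ J≡J′ agree g≤l = split (g′ ℕ.≤? l′)
      where
        x = faceΩ (P.J l) v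
        at : FaceAt (P.J l) v x
        at = faceΩ-at (P.J l) v
        at′ : FaceAt (P′.J l′) v′ x
        at′ = subst (λ J → FaceAt J v′ x) J≡J′ (FaceAt-resp {J = P.J l} {v = v} {v′ = v′} {x = x} agree at)
        near : ∀ {u b} → AgreeOn (P.J l) v u → Beyond P l b u → Near I x b u
        near {u} a B = near-face P {v = v} {v′ = u} {x = x} at a B
        near′ : ∀ {u b} → AgreeOn (P′.J l′) v′ u → Beyond P′ l′ b u → Near I x b u
        near′ {u} a B = near-face P′ {v = v′} {v′ = u} {x = x} at′ a B
        limA : Lim I A x
        limA b = let u , xu , n = FaceAt⇒Lim P l≤L xv at b in u , P.X⊆A u xu , n
        val : ∀ o → ExtAt I A F x o → ∃ λ b → ∀ u → A u → Near I x b u → eval F u ≡ eval F v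
        val (just c) (b , h) = b , λ u au n → trans (h u au n) (sym (vc (escape-flat P gr l l≤L g≤l v xv b)))
          where
            vc : (∃ λ v₁ → P.X v₁ × AgreeOn (P.J l) v v₁ × Beyond P l b v₁ × eval F v₁ ≡ eval F v) → eval F v ≡ c
            vc (v₁ , x₁ , a₁ , B₁ , e₁) = trans (sym e₁) (h v₁ (P.X⊆A v₁ x₁) (near {v₁} a₁ B₁))
        val nothing h = ⊥-elim (contra (escape-flat P gr l l≤L g≤l v xv b))
          where
            b = proj₁ (h (eval F v + 1z))
            contra : (∃ λ v₁ → P.X v₁ × AgreeOn (P.J l) v v₁ × Beyond P l b v₁ × eval F v₁ ≡ eval F v) → ⊥
            contra (v₁ , x₁ , a₁ , B₁ , e₁) = absurd-< {eval F v} (subst (eval F v + 1z ≤_) e₁ (proj₂ (h (eval F v + 1z)) v₁ (P.X⊆A v₁ x₁) (near {v₁} a₁ B₁)))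
        const≡ : ∃ λ b → ∀ u → A u → Near I x b u → eval F u ≡ eval F v
        const≡ = val (proj₁ extF x) (proj₂ extF x limA)
        split : Relation.Nullary.Dec (g′ ℕ.≤ l′) → g′ ℕ.≤ l′ × eval F v ≡ eval F v′
        split (yes q) = q , same′ (escape-flat P′ gr′ l′ l′≤L q v′ xv′ (proj₁ const≡))
          where
            same′ : (∃ λ v₁ → P′.X v₁ × AgreeOn (P′.J l′) v′ v₁ × Beyond P′ l′ (proj₁ const≡) v₁ × eval F v₁ ≡ eval F v′) → eval F v ≡ eval F v′
            same′ (v₁ , x₁ , a₁ , B₁ , e₁) = trans (sym (proj₂ const≡ v₁ (P′.X⊆A v₁ x₁) (near′ {v₁} a₁ B₁))) e₁
        split (no q) = ⊥-elim (contra (escape-grow P′ gr′ l′ (ℕₚ.≰⇒> q) v′ xv′ (proj₁ const≡) (eval F v + 1z)))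
          where
            contra : (∃ λ v₁ → P′.X v₁ × AgreeOn (P′.J l′) v′ v₁ × Beyond P′ l′ (proj₁ const≡) v₁ × eval F v + 1z ≤ eval F v₁) → ⊥
            contra (v₁ , x₁ , a₁ , B₁ , e₁) = absurd-< {eval F v} (subst (eval F v + 1z ≤_) (proj₂ const≡ v₁ (P′.X⊆A v₁ x₁) (near′ {v₁} a₁ B₁)) e₁)

  AgreeOn-sym : ∀ {J : Vec Bool m} {v v′} → AgreeOn J v v′ → AgreeOn J v′ v
  AgreeOn-sym a j t = sym (a j t)

  bool-ext : ∀ {a b : Bool} → (a ≡ true → b ≡ true) → (b ≡ true → a ≡ true) → a ≡ b
  bool-ext {true} {b} f g = sym (f refl)
  bool-ext {false} {true} f g = g refl
  bool-ext {false} {false} f g = refl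

  module _ {I : Vec Bool m} {A W K n E} (P P′ : Piece {m} I A W K n E) where
    private
      module P = Piece P
      module P′ = Piece P′

    -- The two maps p agree on the coordinates that are finite on the shared face, and they
    -- determine which of these are finite on the smaller faces.
    J≡below : ∀ {l} → P.J l ≡ P′.J l → SameFace P P′ l l → ∀ k → k ℕ.≤ l → P.J k ≡ P′.J k
    J≡below {l} J≡J′ sf k k≤l = lookup-ext _ _ λ j → bool-ext
        (λ t → let i , q = J∈ P {j = j} t in ∈J P′ i (subst (ℕ._≤ k) (p≡p′ j (J-mono P j k≤l t)) q))
        (λ t → let i , q = J∈ P′ {j = j} t in
               ∈J P i (subst (ℕ._≤ k) (sym (p≡p′ j (trans (cong (λ J → lookup J j) J≡J′) (J-mono P′ j k≤l t)))) q))
      where open SameFace sf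

    -- The face of index g lies below the shared one, hence is shared too. F is finite on it for P,
    -- so `ext-agree` yields g′ ≤ g; the other inequality is symmetric.
    same-grade : ∀ {l} (F : Form m) → Ext I A F → (gr : Grade P F) (gr′ : Grade P′ F) → l ℕ.≤ P.L → l ℕ.≤ P′.L → ∀ v v′ → P.X v → P′.X v′ →
                 P.J l ≡ P′.J l → AgreeOn (P.J l) v v′ → SameFace P P′ l l → Grade.g gr ℕ.≤ l → Grade.g gr ≡ Grade.g gr′
    same-grade {l} F extF gr gr′ l≤L l≤L′ v v′ xv xv′ J≡J′ a sf g≤l = ℕₚ.≤-antisym
        (proj₁ (ext-agree P′ P F extF gr′ gr g′ g′ (ℕₚ.≤-trans g′≤l l≤L′) (ℕₚ.≤-trans g′≤l l≤L) v′ v xv′ xv (sym (J≡below J≡J′ sf g′ g′≤l))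
          (λ j t → sym (a j (J-mono P j g′≤l (trans (cong (λ J → lookup J j) (J≡below J≡J′ sf g′ g′≤l)) t)))) ℕₚ.≤-refl))
        (proj₁ (ext-agree P P′ F extF gr gr′ g g (ℕₚ.≤-trans g≤l l≤L) (ℕₚ.≤-trans g≤l l≤L′) v v′ xv xv′ (J≡below J≡J′ sf g g≤l)
          (λ j t → a j (J-mono P j g≤l t)) ℕₚ.≤-refl))
      where
        g = Grade.g gr
        g′ = Grade.g gr′
        g′≤l : g′ ℕ.≤ l
        g′≤l = proj₁ (ext-agree P P′ F extF gr gr′ l l l≤L l≤L′ v v′ xv xv′ J≡J′ a g≤l)

    -- A common point of the closures lies on one face of each piece, with the same support.
    -- `Compatible` identifies these faces, and a face of a piece is determined by its support.
    commonFaces : Compatible P P′ → CommonFaces (gp I P.X) (gp I P′.X)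
    commonFaces comp x = mk⇔ (λ (c , c′) → forth (Cl⇔ P x c) (Cl⇔ P′ x c′)) back
      where
        FaceP FaceP′ : Set
        FaceP = ∃₂ λ l v → l ℕ.≤ P.L × P.X v × FaceAt (P.J l) v x
        FaceP′ = ∃₂ λ l v → l ℕ.≤ P′.L × P′.X v × FaceAt (P′.J l) v x
        forth : FaceP → FaceP′ → ∃₂ λ I₁ I₂ → (∀ y → Face (gp I P.X) I₁ y ⇔ Face (gp I P′.X) I₂ y) × Face (gp I P.X) I₁ x
        forth (l , v , h , xv , f) (l′ , v′ , h′ , xv′ , f′) =
            supp x , supp x , (λ y → mk⇔ (λ (c , s) → left y s (Cl⇔ P y c) , s) (λ (c , s) → right y s (Cl⇔ P′ y c) , s)) , FaceAt⇒Cl P {l} {v} h xv f , refl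
          where
            J≡J′ : P.J l ≡ P′.J l′
            J≡J′ = trans (sym (FaceAt-supp (P.J l) v x f)) (FaceAt-supp (P′.J l′) v′ x f′)
            open SameFace (comp l l′ h h′ v v′ xv xv′ J≡J′
              (FaceAt-agree {J = P.J l} {v = v} {v′ = v′} {x = x} f (subst (λ J → FaceAt J v′ x) (sym J≡J′) f′)))
            left : ∀ y → supp y ≡ supp x → (∃₂ λ k u → k ℕ.≤ P.L × P.X u × FaceAt (P.J k) u y) → Cl (gp I P′.X) y
            left y s (k , u , _ , xu , fu) = let u′ , xu′ , a = to u xu in
                FaceAt⇒Cl P′ {l′} {u′} h′ xu′ (subst (λ J → FaceAt J u′ y) J≡J′ (FaceAt-resp {J = P.J l} {v = u} {v′ = u′} {x = y} a (subst (λ J → FaceAt J u y) e fu)))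
              where
                e : P.J k ≡ P.J l
                e = trans (sym (FaceAt-supp (P.J k) u y fu)) (trans (cong rv s) (FaceAt-supp (P.J l) v x f))
            right : ∀ y → supp y ≡ supp x → (∃₂ λ k u → k ℕ.≤ P′.L × P′.X u × FaceAt (P′.J k) u y) → Cl (gp I P.X) y
            right y s (k , u , _ , xu , fu) = let u′ , xu′ , a = from u xu in
                FaceAt⇒Cl P {l} {u′} h xu′ (FaceAt-resp {J = P.J l} {v = u} {v′ = u′} {x = y} (AgreeOn-sym {J = P.J l} {v = u′} {v′ = u} a) (subst (λ J → FaceAt J u y) e fu))
              where
                e : P′.J k ≡ P.J l
                e = trans (sym (FaceAt-supp (P′.J k) u y fu)) (trans (cong rv s) (FaceAt-supp (P.J l) v x f))
        back : (∃₂ λ I₁ I₂ → (∀ y → Face (gp I P.X) I₁ y ⇔ Face (gp I P′.X) I₂ y) × Face (gp I P.X) I₁ x) → Cl (gp I P.X) x × Cl (gp I P′.X) x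
        back (_ , _ , h , f) = proj₁ f , proj₁ (Equivalence.to (h x) f)

  -- Decomposing points of a slab along lifted rays

  move-comm : ∀ (v : Pt m) a r b s → v +[ a ] r +[ b ] s ≡ v +[ b ] s +[ a ] r
  move-comm [] a [] b [] = refl
  move-comm (x ∷ v) a (ρ ∷ r) b (σ ∷ s) = cong₂ _∷_
    (eqn [] (x ∷ ρ · a ∷ σ · b ∷ []) (λ x y z → x ⊕ y ⊕ z ⊑ x ⊕ z ⊕ y) refl) (move-comm v a r b s)

  move-+ : ∀ (v : Pt m) a b r → v +[ a ] r +[ b ] r ≡ v +[ a + b ] r
  move-+ [] a b [] = refl
  move-+ (x ∷ v) a b (ρ ∷ r) = cong₂ _∷_
    (eqn (ρ ∷ []) (x ∷ a ∷ b ∷ []) (λ ρ x a b → x ⊕ ρ ⊙ a ⊕ ρ ⊙ b ⊑ x ⊕ ρ ⊙ (a ⊕ b)) refl) (move-+ v a b r)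

  move-0 : ∀ (v : Pt m) r → v +[ 0z ] r ≡ v
  move-0 [] [] = refl
  move-0 (x ∷ v) (ρ ∷ r) = cong₂ _∷_ (eqn (ρ ∷ []) (x ∷ []) (λ ρ x → x ⊕ ρ ⊙ 𝟘 ⊑ x) refl) (move-0 v r)

  move-scale : ∀ (v : Pt m) w S r → v +[ w ] Vec.map (S ℤ.*_) r ≡ v +[ S · w ] r
  move-scale [] w S [] = refl
  move-scale (x ∷ v) w S (ρ ∷ r) = cong₂ _∷_
    (eqn (ρ ∷ S ∷ []) (x ∷ w ∷ []) (λ ρ S x w → x ⊕ (S :* ρ) ⊙ w ⊑ x ⊕ ρ ⊙ S ⊙ w) refl) (move-scale v w S r)

  Dec-move : ∀ {rs : List (Ray m)} {c v} w s → Dec rs c v → Dec rs (c +[ w ] s) (v +[ w ] s)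
  Dec-move w s done = done
  Dec-move {c = c} w s (step {r = r} t 0≤t d) = step t 0≤t (subst (λ u → Dec _ u _) (move-comm c t r w s) (Dec-move w s d))

  -- Divide δ and Δ - δ by g separately: the two remainders cost at most one unit of u. If the
  -- quotients together exceed u, they are cut down to it.
  peel : ∀ g → 0ℤ ℤ.≤ g → ∀ u δ Δ → 0z ≤ u → 0z ≤ δ → δ ≤ Δ → g · u ≤ Δ →
         ∃₂ λ a b → 0z ≤ a × 0z ≤ b × a + b ≤ u × u ≤ a + b + 1z × g · a ≤ δ × g · b ≤ Δ + (- δ)
  peel g 0≤g u δ Δ 0≤u 0≤δ δ≤Δ gu≤Δ = from (1≤or≤0 g)
    where
      Result : Set
      Result = ∃₂ λ a b → 0z ≤ a × 0z ≤ b × a + b ≤ u × u ≤ a + b + 1z × g · a ≤ δ × g · b ≤ Δ + (- δ)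
      0≤Δ-δ : 0z ≤ Δ + (- δ)
      0≤Δ-δ = lin [] (δ ∷ Δ ∷ []) (λ δ Δ → ((δ ⊑ Δ) ∷ []) ⊢ (𝟘 ⊑ Δ ⊖ₑ δ)) refl δ≤Δ
      quotient-nonneg : ∀ {x q} → 0z ≤ x → 1ℤ ℤ.≤ g → x + 1z ≤ g · q + g ‼ → 0z ≤ q
      quotient-nonneg {x} {q} 0≤x 1≤g h = lin [] (q ∷ 1z ∷ []) (λ q o → ((o ⊑ q ⊕ o) ∷ []) ⊢ (𝟘 ⊑ q)) refl
        (≤-trans (eq (eqn [] (1z ∷ []) (λ o → o ⊑ 𝟘 ⊕ o) refl)) (·-cancel-< {g} {0z} {q + 1z} 1≤g
          (lin (g ∷ []) (x ∷ q ∷ 1z ∷ []) (λ g x q o → ((𝟘 ⊑ x) ∷ (x ⊕ o ⊑ g ⊙ q ⊕ g ⊙ o) ∷ []) ⊢ (g ⊙ 𝟘 ⊕ o ⊑ g ⊙ (q ⊕ o))) refl (0≤x , h))))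
      from : 1ℤ ℤ.≤ g ⊎ g ℤ.≤ 0ℤ → Result
      from (inj₂ g≤0) = 0z , u , ≤-refl , 0≤u , eq (+-identityˡ u) ,
          lin [] (u ∷ 1z ∷ []) (λ u o → ((𝟘 ⊑ o) ∷ []) ⊢ (u ⊑ 𝟘 ⊕ u ⊕ o)) refl 0≤1 ,
          ≤-trans (eq (·-zeroʳ g)) 0≤δ ,
          ≤-trans (lin (g ∷ []) (u ∷ []) (λ g u → ((g ⊙ u ⊑ con 0ℤ ⊙ u) ∷ []) ⊢ (g ⊙ u ⊑ 𝟘)) refl (·-monoˡ g≤0 0≤u)) 0≤Δ-δ
      from (inj₁ 1≤g) = choose (divide g 1≤g δ) (divide g 1≤g (Δ + (- δ)))
        where
          choose : (∃ λ q → g · q ≤ δ × δ + 1z ≤ g · q + g ‼) → (∃ λ q → g · q ≤ Δ + (- δ) × Δ + (- δ) + 1z ≤ g · q + g ‼) → Result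
          choose (a , a₁ , a₂) (b , b₁ , b₂) = pick (compare u a)
            where
              0≤a = quotient-nonneg {δ} {a} 0≤δ 1≤g a₂
              0≤b = quotient-nonneg {Δ + (- δ)} {b} 0≤Δ-δ 1≤g b₂
              u≤ : u ≤ a + b + 1z
              u≤ = lin [] (u ∷ a ∷ b ∷ 1z ∷ []) (λ u a b o → ((u ⊕ o ⊑ a ⊕ b ⊕ o ⊕ o) ∷ []) ⊢ (u ⊑ a ⊕ b ⊕ o)) refl
                (·-cancel-< {g} {u} {a + b + 1z + 1z} 1≤g (lin (g ∷ []) (u ∷ δ ∷ Δ ∷ a ∷ b ∷ 1z ∷ []) (λ g u δ Δ a b o →
                  ((g ⊙ u ⊑ Δ) ∷ (δ ⊕ o ⊑ g ⊙ a ⊕ g ⊙ o) ∷ (Δ ⊖ₑ δ ⊕ o ⊑ g ⊙ b ⊕ g ⊙ o) ∷ (𝟘 ⊑ o) ∷ []) ⊢ (g ⊙ u ⊕ o ⊑ g ⊙ (a ⊕ b ⊕ o ⊕ o))) refl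
                  (gu≤Δ , a₂ , b₂ , 0≤1)))
              pick : u ≤ a ⊎ a + 1z ≤ u → Result
              pick (inj₁ h) = u , 0z , 0≤u , ≤-refl , eq (+-identityʳ u) ,
                lin [] (u ∷ 1z ∷ []) (λ u o → ((𝟘 ⊑ o) ∷ []) ⊢ (u ⊑ u ⊕ 𝟘 ⊕ o)) refl 0≤1 ,
                ≤-trans (·-monoʳ 0≤g h) a₁ , ≤-trans (eq (·-zeroʳ g)) 0≤Δ-δ
              pick (inj₂ h) = pick′ (compare c b)
                where
                  c = u + (- a)
                  0≤c : 0z ≤ c
                  0≤c = lin [] (u ∷ a ∷ 1z ∷ []) (λ u a o → ((a ⊕ o ⊑ u) ∷ (𝟘 ⊑ o) ∷ []) ⊢ (𝟘 ⊑ u ⊖ₑ a)) refl (h , 0≤1)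
                  pick′ : c ≤ b ⊎ b + 1z ≤ c → Result
                  pick′ (inj₁ k) = a , c , 0≤a , 0≤c , eq (eqn [] (a ∷ u ∷ []) (λ a u → a ⊕ (u ⊖ₑ a) ⊑ u) refl) ,
                    lin [] (a ∷ u ∷ 1z ∷ []) (λ a u o → ((𝟘 ⊑ o) ∷ []) ⊢ (u ⊑ a ⊕ (u ⊖ₑ a) ⊕ o)) refl 0≤1 ,
                    a₁ , ≤-trans (·-monoʳ 0≤g k) b₁
                  pick′ (inj₂ k) = a , b , 0≤a , 0≤b ,
                    lin [] (a ∷ b ∷ u ∷ 1z ∷ []) (λ a b u o → ((b ⊕ o ⊑ u ⊖ₑ a) ∷ (𝟘 ⊑ o) ∷ []) ⊢ (a ⊕ b ⊑ u)) refl (k , 0≤1) ,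
                    u≤ , a₁ , b₁

  divide-nonneg : ∀ d → (1≤d : 1ℤ ℤ.≤ d) → ∀ x → 0z ≤ x → ∃ λ q → 0z ≤ q × d · q ≤ x × x + 1z ≤ d · q + d ‼
  divide-nonneg d 1≤d x 0≤x = let q , h , k = divide d 1≤d x in q ,
      lin [] (q ∷ 1z ∷ []) (λ q o → ((𝟘 ⊕ o ⊑ q ⊕ o) ∷ []) ⊢ (𝟘 ⊑ q)) refl
        (·-cancel-< {d} {0z} {q + 1z} 1≤d (lin (d ∷ []) (x ∷ q ∷ 1z ∷ []) (λ g x q o →
          ((𝟘 ⊑ x) ∷ (x ⊕ o ⊑ g ⊙ q ⊕ g ⊙ o) ∷ []) ⊢ (g ⊙ 𝟘 ⊕ o ⊑ g ⊙ (q ⊕ o))) refl (0≤x , k))) , h , k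

  -- The smaller of the two quotients; the constraint it comes from is exhausted up to one divisor.
  units : ∀ S T → 1ℤ ℤ.≤ S → 1ℤ ℤ.≤ T → ∀ t H → 0z ≤ t → 0z ≤ H →
          ∃ λ u → 0z ≤ u × S · u ≤ t × T · u ≤ H × (t + 1z ≤ S · u + S ‼ ⊎ H + 1z ≤ T · u + T ‼)
  units S T 1≤S 1≤T t H 0≤t 0≤H = from (divide-nonneg S 1≤S t 0≤t) (divide-nonneg T 1≤T H 0≤H)
    where
      0≤T = ℤₚ.≤-trans (ℤ.+≤+ ℕ.z≤n) 1≤T
      0≤S = ℤₚ.≤-trans (ℤ.+≤+ ℕ.z≤n) 1≤S
      from : (∃ λ q → 0z ≤ q × S · q ≤ t × t + 1z ≤ S · q + S ‼) → (∃ λ q → 0z ≤ q × T · q ≤ H × H + 1z ≤ T · q + T ‼) → _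
      from (a , 0≤a , a₁ , a₂) (b , 0≤b , b₁ , b₂) = pick (compare a b)
        where
          pick : a ≤ b ⊎ b + 1z ≤ a → ∃ λ u → 0z ≤ u × S · u ≤ t × T · u ≤ H × (t + 1z ≤ S · u + S ‼ ⊎ H + 1z ≤ T · u + T ‼)
          pick (inj₁ h) = a , 0≤a , a₁ , ≤-trans (·-monoʳ 0≤T h) b₁ , inj₁ a₂
          pick (inj₂ h) = b , 0≤b , ≤-trans (·-monoʳ 0≤S (lin [] (a ∷ b ∷ 1z ∷ []) (λ a b o → ((b ⊕ o ⊑ a) ∷ (𝟘 ⊑ o) ∷ []) ⊢ (b ⊑ a)) refl (h , 0≤1))) a₁ , b₁ , inj₂ b₂

  module Descent {I : Vec Bool m} {A W K n E} (P : Piece {m} I A W K n E) (lo hi : Form m) (D N : ℤ) (low up : ℕ → ℕ) where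
    open Piece P

    S : ℤ
    S = D ℤ.* N

    -- A step along S r changes `lo` by D times N · slope, so lifting with last entry N · slope
    -- keeps D z - lo constant along `lowRay`, and likewise hi - D z along `upRay`. The factor N
    -- preserves the congruence class of z.
    lowRay upRay : Ray m → Ray (suc m)
    lowRay (l , r) = low l , (N ℤ.* slope lo r) ∷ Vec.map (S ℤ.*_) r
    upRay (l , r) = up l , (N ℤ.* slope hi r) ∷ Vec.map (S ℤ.*_) r

    raysOf : List (Ray m) → List (Ray (suc m))
    raysOf [] = []
    raysOf (lr ∷ rs) = lowRay lr ∷ upRay lr ∷ raysOf rs

    module _ (1≤W : 1ℤ ℤ.≤ W) (1≤D : 1ℤ ℤ.≤ D) (1≤N : 1ℤ ℤ.≤ N) (g : Z)
             (lo≤hi : ∀ {l r} → (l , r) ∈ rays → slope lo r ℤ.≤ slope hi r) where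

      -- What one ray may leave undone, measured by τ: one step of size S for the rounding in
      -- `units` and one for the rounding in `peel`, each worth S W.
      B : Z
      B = (S ℤ.* W) ‼ + (S ℤ.* W) ‼

      1≤* : ∀ {a b} → 1ℤ ℤ.≤ a → 1ℤ ℤ.≤ b → 1ℤ ℤ.≤ a ℤ.* b
      1≤* {a} {b} 1≤a 1≤b = ℤₚ.≤-trans 1≤a (subst (ℤ._≤ a ℤ.* b) (ℤₚ.*-identityʳ a)
        (ℤₚ.*-monoˡ-≤-nonNeg a {{ℤ.nonNegative (ℤₚ.≤-trans (ℤ.+≤+ ℕ.z≤n) 1≤a)}} 1≤b))

      1≤S : 1ℤ ℤ.≤ S
      1≤S = 1≤* 1≤D 1≤N

      1≤SW : 1ℤ ℤ.≤ S ℤ.* W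
      1≤SW = 1≤* 1≤S 1≤W

      0≤B : 0z ≤ B
      0≤B = lin [] ((S ℤ.* W) ‼ ∷ []) (λ x → ((𝟘 ⊑ x) ∷ (𝟘 ⊑ x) ∷ []) ⊢ (𝟘 ⊑ x ⊕ x)) refl (h , h)
        where h = ≤-trans 0≤1 (·-grow 1≤SW 0≤1)

      Deep : Pt m → Set
      Deep v = ∀ i → i ℕ.< L → g ≤ eval (τ i) v

      -- (z, v) is pulled back along lifted rays to a point (z′, y) that can no longer be far out:
      -- each τ at y is within B of the floor g, or within B per ray of its value at b.
      record Descends (rs : List (Ray m)) (b v : Pt m) (z : Z) : Set where
        field
          y : Pt m
          z′ : Z
          dec : Dec (raysOf rs) (z′ ∷ y) (z ∷ v)
          decy : Dec rs b y
          deep : Deep y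
          less : ∀ i → i ℕ.< L → eval (τ i) y ≤ eval (τ i) v
          small : ∀ i → i ℕ.< L → eval (τ i) y ≤ g + B ⊎ eval (τ i) y ≤ eval (τ i) b + pos (length rs) · B
          lo≤ : eval lo y ≤ D · z′
          ≤hi : D · z′ ≤ eval hi y
          z≡ : ∃ λ c → z ≡ z′ + N · c

      0≤S : 0ℤ ℤ.≤ S
      0≤S = ℤₚ.≤-trans (ℤ.+≤+ ℕ.z≤n) 1≤S

      0≤SW : 0ℤ ℤ.≤ S ℤ.* W
      0≤SW = ℤₚ.≤-trans (ℤ.+≤+ ℕ.z≤n) 1≤SW

      τ-move : ∀ {l r} → (l , r) ∈ rays → ∀ v w → eval (τ l) (v +[ w ] r) ≡ eval (τ l) v + W · w
      τ-move {l} {r} i v w = trans (eval-move (τ l) v w r) (cong (λ k → eval (τ l) v + k · w) (slope-τ i))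

      τ-other : ∀ {l r} → (l , r) ∈ rays → ∀ v w i → i ℕ.< L → i ≢ l → eval (τ i) (v +[ w ] r) ≡ eval (τ i) v
      τ-other {l} {r} i∈ v w i i<L i≢l = trans (eval-move (τ i) v w r) (trans (cong (λ k → eval (τ i) v + k · w) (slope-τ₀ i∈ i i<L i≢l))
            (eqn [] (eval (τ i) v ∷ w ∷ []) (λ x w → x ⊕ con 0ℤ ⊙ w ⊑ x) refl))

      back : Pt m → Dir m → Z → Pt m
      back v r u = v +[ - (S · u) ] r

      back-τ : ∀ {l r} → (l , r) ∈ rays → ∀ v u → eval (τ l) (back v r u) ≡ eval (τ l) v + (- ((S ℤ.* W) · u))
      back-τ {l} {r} i v u = trans (τ-move i v (- (S · u)))
        (eqn (S ∷ W ∷ []) (eval (τ l) v ∷ u ∷ []) (λ S W x u → x ⊕ W ⊙ (⊝ (S ⊙ u)) ⊑ x ⊖ₑ (S :* W) ⊙ u) refl)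

      back-cases : ∀ {l r} → (l , r) ∈ rays → ∀ v u (Q : ℕ → Z → Z → Set) → Q l (eval (τ l) v) (eval (τ l) v + (- ((S ℤ.* W) · u))) →
                   (∀ i → i ℕ.< L → Q i (eval (τ i) v) (eval (τ i) v)) → ∀ i → i ℕ.< L → Q i (eval (τ i) v) (eval (τ i) (back v r u))
      back-cases {l} {r} i∈ v u Q q₁ q₂ i i<L = from (i ℕ.≟ l)
        where
          from : Relation.Nullary.Dec (i ≡ l) → Q i (eval (τ i) v) (eval (τ i) (back v r u))
          from (yes i≡l) = subst (λ i → Q i (eval (τ i) v) (eval (τ i) (back v r u))) (sym i≡l)
            (subst (Q l (eval (τ l) v)) (sym (back-τ i∈ v u)) q₁)
          from (no i≢l) = subst (Q i (eval (τ i) v)) (sym (τ-other i∈ v (- (S · u)) i i<L i≢l)) (q₂ i i<L)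

      deep-back : ∀ {l r} → (l , r) ∈ rays → ∀ v u → Deep v → (S ℤ.* W) · u ≤ eval (τ l) v + (- g) → Deep (back v r u)
      deep-back {l} {r} i∈ v u dp h = back-cases i∈ v u (λ _ _ y → g ≤ y)
        (lin [] (eval (τ l) v ∷ g ∷ (S ℤ.* W) · u ∷ []) (λ x g y → ((y ⊑ x ⊖ₑ g) ∷ []) ⊢ (g ⊑ x ⊖ₑ y)) refl h) dp

      less-back : ∀ {l r} → (l , r) ∈ rays → ∀ v u → 0z ≤ u → ∀ i → i ℕ.< L → eval (τ i) (back v r u) ≤ eval (τ i) v
      less-back {l} {r} i∈ v u 0≤u = back-cases i∈ v u (λ _ x y → y ≤ x)
        (lin [] (eval (τ l) v ∷ (S ℤ.* W) · u ∷ []) (λ x y → ((𝟘 ⊑ y) ∷ []) ⊢ (x ⊖ₑ y ⊑ x)) refl (·-nonneg 0≤SW 0≤u)) (λ _ _ → ≤-refl)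

      rem≥0 : ∀ {t u} → S · u ≤ t → 0z ≤ t + (- (S · u))
      rem≥0 {t} {u} h = lin [] (t ∷ S · u ∷ []) (λ t x → ((x ⊑ t) ∷ []) ⊢ (𝟘 ⊑ t ⊖ₑ x)) refl h

      Dec-back : ∀ {rs b v r t} u → Dec rs (b +[ t ] r) v → Dec rs (b +[ t + (- (S · u)) ] r) (back v r u)
      Dec-back {rs} {b} {v} {r} {t} u d = subst (λ c → Dec rs c (back v r u)) (move-+ b t (- (S · u)) r) (Dec-move (- (S · u)) r d)

      -- The next point of the descent: u = a + c units of the ray r are split into a units of upRay and c units of lowRay.
      record Head (l : ℕ) (r : Dir m) (t : Z) (v : Pt m) (z : Z) : Set where
        field
          a c : Z
          0≤a : 0z ≤ a
          0≤c : 0z ≤ c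
          fits : S · (a + c) ≤ t
          deep : (S ℤ.* W) · (a + c) ≤ eval (τ l) v + (- g)
          stop : t + 1z ≤ S · (a + c) + S ‼ + S ‼ ⊎ eval (τ l) v + (- g) + 1z ≤ (S ℤ.* W) · (a + c) + B
          up≤ : (S ℤ.* (slope hi r ℤ.+ ℤ.- slope lo r)) · a ≤ D · z + (- eval lo v)
          low≤ : (S ℤ.* (slope hi r ℤ.+ ℤ.- slope lo r)) · c ≤ eval hi v + (- eval lo v) + (- (D · z + (- eval lo v)))

      head : ∀ {l r} → (l , r) ∈ rays → ∀ t v z → 0z ≤ t → Deep v → eval lo v ≤ D · z → D · z ≤ eval hi v →
             (∀ u → 0z ≤ u → S · u ≤ t → (S ℤ.* W) · u ≤ eval (τ l) v + (- g) → eval lo (back v r u) ≤ eval hi (back v r u)) → Head l r t v z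
      head {l} {r} i∈ t v z 0≤t dp lo≤Dz Dz≤hi ok = from (units S (S ℤ.* W) 1≤S 1≤SW t H 0≤t 0≤H)
        where
          ℓ = slope lo r
          η = slope hi r
          γ = S ℤ.* (η ℤ.+ ℤ.- ℓ)
          H = eval (τ l) v + (- g)
          δ = D · z + (- eval lo v)
          Δ = eval hi v + (- eval lo v)
          0≤H : 0z ≤ H
          0≤H = lin [] (eval (τ l) v ∷ g ∷ []) (λ x g → ((g ⊑ x) ∷ []) ⊢ (𝟘 ⊑ x ⊖ₑ g)) refl (dp l (range i∈))
          0≤γ : 0ℤ ℤ.≤ γ
          0≤γ = subst (ℤ._≤ γ) (ℤₚ.*-zeroʳ S) (ℤₚ.*-monoˡ-≤-nonNeg S {{ℤ.nonNegative 0≤S}} (ℤₚ.i≤j⇒0≤j-i (lo≤hi i∈)))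
          0≤δ : 0z ≤ δ
          0≤δ = lin [] (D · z ∷ eval lo v ∷ []) (λ a b → ((b ⊑ a) ∷ []) ⊢ (𝟘 ⊑ a ⊖ₑ b)) refl lo≤Dz
          δ≤Δ : δ ≤ Δ
          δ≤Δ = lin [] (D · z ∷ eval lo v ∷ eval hi v ∷ []) (λ a b c → ((a ⊑ c) ∷ []) ⊢ (a ⊖ₑ b ⊑ c ⊖ₑ b)) refl Dz≤hi
          -- Moving back by S · u shrinks the gap hi - lo by γ · u; as it is still non-negative
          -- there, it was at least γ · u at v.
          γu≤Δ : ∀ u → eval lo (back v r u) ≤ eval hi (back v r u) → γ · u ≤ Δ
          γu≤Δ u h = lin (S ∷ ℓ ∷ η ∷ []) (eval lo v ∷ eval hi v ∷ eval lo (back v r u) ∷ eval hi (back v r u) ∷ u ∷ []) (λ S ℓ η a b a~ b~ u →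
                  ((a~ ⊑ b~) ∷ (a ⊕ ℓ ⊙ (⊝ (S ⊙ u)) ⊑ a~) ∷ (b~ ⊑ b ⊕ η ⊙ (⊝ (S ⊙ u))) ∷ []) ⊢ ((S :* (η :+ (:- ℓ))) ⊙ u ⊑ b ⊖ₑ a)) refl
                  (h , eq≥ (eval-move lo v (- (S · u)) r) , eq (eval-move hi v (- (S · u)) r))
          weaken : ∀ T x u a c y → 0ℤ ℤ.≤ T → u ≤ a + c + 1z → x ≤ T · u + y → x ≤ T · (a + c) + T ‼ + y
          weaken T x u a c y 0≤T h k = lin (T ∷ []) (x ∷ u ∷ a ∷ c ∷ y ∷ 1z ∷ []) (λ T x u a c y o →
              ((T ⊙ u ⊑ T ⊙ (a ⊕ c ⊕ o)) ∷ (x ⊑ T ⊙ u ⊕ y) ∷ []) ⊢ (x ⊑ T ⊙ (a ⊕ c) ⊕ T ⊙ o ⊕ y)) refl (·-monoʳ 0≤T h , k)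
          from : (∃ λ u → 0z ≤ u × S · u ≤ t × (S ℤ.* W) · u ≤ H × (t + 1z ≤ S · u + S ‼ ⊎ H + 1z ≤ (S ℤ.* W) · u + (S ℤ.* W) ‼)) → Head l r t v z
          from (u , 0≤u , Su≤t , SWu≤H , stop) = split (peel γ 0≤γ u δ Δ 0≤u 0≤δ δ≤Δ (γu≤Δ u (ok u 0≤u Su≤t SWu≤H)))
            where
              split : (∃₂ λ a c → 0z ≤ a × 0z ≤ c × a + c ≤ u × u ≤ a + c + 1z × γ · a ≤ δ × γ · c ≤ Δ + (- δ)) → Head l r t v z
              split (a , c , 0≤a , 0≤c , ac≤u , u≤ac , γa≤δ , γc≤) = record
                { a = a ; c = c ; 0≤a = 0≤a ; 0≤c = 0≤c ; fits = ≤-trans (·-monoʳ 0≤S ac≤u) Su≤t ; deep = ≤-trans (·-monoʳ 0≤SW ac≤u) SWu≤H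
                ; stop = stop′ stop ; up≤ = γa≤δ ; low≤ = γc≤ }
                where
                  stop′ : t + 1z ≤ S · u + S ‼ ⊎ H + 1z ≤ (S ℤ.* W) · u + (S ℤ.* W) ‼ → t + 1z ≤ S · (a + c) + S ‼ + S ‼ ⊎ H + 1z ≤ (S ℤ.* W) · (a + c) + B
                  stop′ (inj₁ h) = inj₁ (weaken S (t + 1z) u a c (S ‼) 0≤S u≤ac h)
                  stop′ (inj₂ h) = inj₂ (≤-trans (weaken (S ℤ.* W) (H + 1z) u a c ((S ℤ.* W) ‼) 0≤SW u≤ac h) (eq (+-assoc _ _ _)))

      module _ {l r t v z} (i∈ : (l , r) ∈ rays) (hd : Head l r t v z) where
        open Head hd
        private
          ℓ = slope lo r
          η = slope hi r

        next : Z
        next = z + (- (N · (η · a + ℓ · c)))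

        next-lo : eval lo (back v r (a + c)) ≤ D · next
        next-lo = lin (D ∷ N ∷ ℓ ∷ η ∷ []) (z ∷ eval lo v ∷ eval lo (back v r (a + c)) ∷ a ∷ c ∷ []) (λ D N ℓ η z x x₁ a c →
            ((x₁ ⊑ x ⊕ ℓ ⊙ (⊝ ((D :* N) ⊙ (a ⊕ c)))) ∷ (((D :* N) :* (η :+ (:- ℓ))) ⊙ a ⊑ D ⊙ z ⊖ₑ x) ∷ []) ⊢
            (x₁ ⊑ D ⊙ (z ⊕ (⊝ (N ⊙ (η ⊙ a ⊕ ℓ ⊙ c)))))) refl (eq (eval-move lo v (- (S · (a + c))) r) , up≤)

        next-hi : D · next ≤ eval hi (back v r (a + c))
        next-hi = lin (D ∷ N ∷ ℓ ∷ η ∷ []) (z ∷ eval lo v ∷ eval hi v ∷ eval hi (back v r (a + c)) ∷ a ∷ c ∷ []) (λ D N ℓ η z x y y₁ a c →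
            ((y ⊕ η ⊙ (⊝ ((D :* N) ⊙ (a ⊕ c))) ⊑ y₁) ∷ (((D :* N) :* (η :+ (:- ℓ))) ⊙ c ⊑ (y ⊖ₑ x) ⊖ₑ (D ⊙ z ⊖ₑ x)) ∷ []) ⊢
            (D ⊙ (z ⊕ (⊝ (N ⊙ (η ⊙ a ⊕ ℓ ⊙ c)))) ⊑ y₁)) refl (eq≥ (eval-move hi v (- (S · (a + c))) r) , low≤)

        restore : (next ∷ back v r (a + c)) +[ c ] proj₂ (lowRay (l , r)) +[ a ] proj₂ (upRay (l , r)) ≡ z ∷ v
        restore = cong₂ _∷_
          (eqn (N ∷ η ∷ ℓ ∷ []) (z ∷ a ∷ c ∷ []) (λ N η ℓ z a c → z ⊕ (⊝ (N ⊙ (η ⊙ a ⊕ ℓ ⊙ c))) ⊕ (N :* ℓ) ⊙ c ⊕ (N :* η) ⊙ a ⊑ z) refl)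
          tail
          where
            w = - (S · (a + c))
            tail : back v r (a + c) +[ c ] Vec.map (S ℤ.*_) r +[ a ] Vec.map (S ℤ.*_) r ≡ v
            tail = trans (cong (λ u → u +[ a ] Vec.map (S ℤ.*_) r) (move-scale (back v r (a + c)) c S r))
              (trans (move-scale (back v r (a + c) +[ S · c ] r) a S r)
              (trans (cong (λ u → u +[ S · a ] r) (move-+ v w (S · c) r))
              (trans (move-+ v (w + S · c) (S · a) r)
              (trans (cong (λ w → v +[ w ] r) (eqn (S ∷ []) (a ∷ c ∷ []) (λ S a c → ⊝ (S ⊙ (a ⊕ c)) ⊕ S ⊙ c ⊕ S ⊙ a ⊑ 𝟘) refl)) (move-0 v r)))))

        next≡ : ∀ {z′} → (∃ λ k → next ≡ z′ + N · k) → ∃ λ k → z ≡ z′ + N · k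
        next≡ {z′} (k , e) = k + (η · a + ℓ · c) , trans
            (eqn (N ∷ η ∷ ℓ ∷ []) (z ∷ a ∷ c ∷ []) (λ N η ℓ z a c → z ⊑ (z ⊖ₑ N ⊙ (η ⊙ a ⊕ ℓ ⊙ c)) ⊕ N ⊙ (η ⊙ a ⊕ ℓ ⊙ c)) refl)
            (trans (cong (_+ N · (η · a + ℓ · c)) e)
              (eqn (N ∷ η ∷ ℓ ∷ []) (z′ ∷ k ∷ a ∷ c ∷ []) (λ N η ℓ z k a c → z ⊕ N ⊙ k ⊕ N ⊙ (η ⊙ a ⊕ ℓ ⊙ c) ⊑ z ⊕ N ⊙ (k ⊕ (η ⊙ a ⊕ ℓ ⊙ c))) refl))

        Stopped : ℕ → Z → Pt m → Set
        Stopped i x b = x ≤ g + B ⊎ eval (τ i) (b +[ t + (- (S · (a + c))) ] r) ≤ eval (τ i) b + B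

        stopped : ∀ b x i → i ℕ.< L → x ≤ eval (τ i) (back v r (a + c)) → Stopped i x b
        stopped b x i i<L h = from (i ℕ.≟ l)
          where
            head-case : t + 1z ≤ S · (a + c) + S ‼ + S ‼ ⊎ eval (τ l) v + (- g) + 1z ≤ (S ℤ.* W) · (a + c) + B →
                        x ≤ eval (τ l) (back v r (a + c)) → Stopped l x b
            head-case (inj₁ k) h = inj₂ (lin (S ∷ W ∷ []) (eval (τ l) b ∷ eval (τ l) (b +[ t + (- (S · (a + c))) ] r) ∷ t ∷ a ∷ c ∷ 1z ∷ []) (λ S W x y t a c o →
                ((y ⊑ x ⊕ W ⊙ (t ⊖ₑ S ⊙ (a ⊕ c))) ∷ (W ⊙ (t ⊕ o) ⊑ W ⊙ (S ⊙ (a ⊕ c) ⊕ S ⊙ o ⊕ S ⊙ o)) ∷ (𝟘 ⊑ W ⊙ o) ∷ []) ⊢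
                (y ⊑ x ⊕ ((S :* W) ⊙ o ⊕ (S :* W) ⊙ o))) refl
                (eq (τ-move i∈ b (t + (- (S · (a + c))))) , ·-monoʳ 0≤W k , ·-nonneg 0≤W 0≤1))
              where 0≤W = ℤₚ.≤-trans (ℤ.+≤+ ℕ.z≤n) 1≤W
            head-case (inj₂ k) h = inj₁ (lin [] (x ∷ eval (τ l) v ∷ eval (τ l) (back v r (a + c)) ∷ g ∷ (S ℤ.* W) · (a + c) ∷ B ∷ 1z ∷ []) (λ x v v₁ g u B o →
                ((x ⊑ v₁) ∷ (v₁ ⊑ v ⊖ₑ u) ∷ (v ⊖ₑ g ⊕ o ⊑ u ⊕ B) ∷ (𝟘 ⊑ o) ∷ []) ⊢ (x ⊑ g ⊕ B)) refl
                (h , eq (back-τ i∈ v (a + c)) , k , 0≤1))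
            from : Relation.Nullary.Dec (i ≡ l) → Stopped i x b
            from (yes i≡l) = subst (λ i → Stopped i x b) (sym i≡l) (head-case stop (subst (λ i → x ≤ eval (τ i) (back v r (a + c))) i≡l h))
            from (no i≢l) = inj₂ (lin [] (eval (τ i) b ∷ eval (τ i) (b +[ t + (- (S · (a + c))) ] r) ∷ B ∷ []) (λ x y B → ((y ⊑ x) ∷ (𝟘 ⊑ B) ∷ []) ⊢ (y ⊑ x ⊕ B)) refl
                (eq (τ-other i∈ b (t + (- (S · (a + c)))) i i<L i≢l) , 0≤B))

        assemble : ∀ {rs b} → Descends rs (b +[ t + (- (S · (a + c))) ] r) (back v r (a + c)) next → Descends ((l , r) ∷ rs) b v z
        assemble {rs} {b} R = record
            { y = R.y ; z′ = R.z′
            ; dec = step c 0≤c (step a 0≤a (subst (Dec (raysOf rs) ((R.z′ ∷ R.y) +[ c ] proj₂ (lowRay (l , r)) +[ a ] proj₂ (upRay (l , r)))) restore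
                (Dec-move a (proj₂ (upRay (l , r))) (Dec-move c (proj₂ (lowRay (l , r))) R.dec))))
            ; decy = step (t + (- (S · (a + c)))) (rem≥0 fits) R.decy
            ; deep = R.deep
            ; less = λ i i<L → ≤-trans (R.less i i<L) (less-back i∈ v (a + c) 0≤ac i i<L)
            ; small = λ i i<L → combine i (stopped b (eval (τ i) R.y) i i<L (R.less i i<L)) (R.small i i<L)
            ; lo≤ = R.lo≤ ; ≤hi = R.≤hi ; z≡ = next≡ R.z≡ }
          where
            module R = Descends R
            0≤ac : 0z ≤ a + c
            0≤ac = ≤-trans (eq (sym (+-identityˡ 0z))) (≤-mono 0≤a 0≤c)
            combine : ∀ i → Stopped i (eval (τ i) R.y) b →
                      eval (τ i) R.y ≤ g + B ⊎ eval (τ i) R.y ≤ eval (τ i) (b +[ t + (- (S · (a + c))) ] r) + pos (length rs) · B →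
                      eval (τ i) R.y ≤ g + B ⊎ eval (τ i) R.y ≤ eval (τ i) b + pos (suc (length rs)) · B
            combine i (inj₁ h) _ = inj₁ h
            combine i (inj₂ _) (inj₁ h) = inj₁ h
            combine i (inj₂ k) (inj₂ h) = inj₂ (lin (pos (length rs) ∷ []) (eval (τ i) R.y ∷ eval (τ i) b ∷ eval (τ i) (b +[ t + (- (S · (a + c))) ] r) ∷ B ∷ []) (λ n x y y₁ B →
                ((x ⊑ y₁ ⊕ n ⊙ B) ∷ (y₁ ⊑ y ⊕ B) ∷ []) ⊢ (x ⊑ y ⊕ (con 1ℤ :+ n) ⊙ B)) refl (h , k))

      -- What remains of a ray is absorbed into the base point. Unless the τ of its level has come
      -- within B of g, this raises the τ of the base point by at most B.
      descend : ∀ rs → (∀ {lr} → lr ∈ rs → lr ∈ rays) → ∀ b v z → Dec rs b v → Deep v → eval lo v ≤ D · z → D · z ≤ eval hi v →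
                (∀ y → Dec rs b y → Deep y → eval lo y ≤ eval hi y) → Descends rs b v z
      descend [] sub b .b z done dp l h ok = record { y = b ; z′ = z ; dec = done ; decy = done ; deep = dp ; less = λ _ _ → ≤-refl
        ; small = λ i _ → inj₂ (lin [] (eval (τ i) b ∷ B ∷ []) (λ x B → [] ⊢ (x ⊑ x ⊕ con 0ℤ ⊙ B)) refl tt)
        ; lo≤ = l ; ≤hi = h ; z≡ = 0z , eqn (N ∷ []) (z ∷ []) (λ N z → z ⊑ z ⊕ N ⊙ 𝟘) refl }
      descend ((l , r) ∷ rs) sub b v z (step t 0≤t d) dp lo≤Dz Dz≤hi ok = assemble i∈ hd
          (descend rs (λ i → sub (there i)) (b +[ t + (- (S · u)) ] r) (back v r u) (next i∈ hd) (Dec-back u d) (deep-back i∈ v u dp (Head.deep hd))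
            (next-lo i∈ hd) (next-hi i∈ hd) (λ y dy → ok y (step (t + (- (S · u))) (rem≥0 (Head.fits hd)) dy)))
        where
          i∈ : (l , r) ∈ rays
          i∈ = sub (here refl)
          hd : Head l r t v z
          hd = head i∈ t v z 0≤t dp lo≤Dz Dz≤hi (λ u 0≤u h k → ok (back v r u) (step (t + (- (S · u))) (rem≥0 h) (Dec-back u d)) (deep-back i∈ v u dp k))
          u = Head.a hd + Head.c hd

  -- Slices between two forms and the common part of new pieces

  restrict : Form (suc m) → Form m
  restrict (const c) = const c
  restrict top = const 0z
  restrict (up F) = F
  restrict (F ⊞ F′) = restrict F ⊞ restrict F′
  restrict (k ⊡ F) = k ⊡ restrict F

  lead : Form (suc m) → ℤ
  lead (const c) = 0ℤ
  lead top = 1ℤ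
  lead (up F) = 0ℤ
  lead (F ⊞ F′) = lead F ℤ.+ lead F′
  lead (k ⊡ F) = k ℤ.* lead F

  eval-restrict : ∀ (F : Form (suc m)) z v → eval F (z ∷ v) ≡ eval (restrict F) v + lead F · z
  eval-restrict (const c) z v = eqn [] (c ∷ z ∷ []) (λ c z → c ⊑ c ⊕ con 0ℤ ⊙ z) refl
  eval-restrict top z v = eqn [] (z ∷ []) (λ z → z ⊑ 𝟘 ⊕ con 1ℤ ⊙ z) refl
  eval-restrict (up F) z v = eqn [] (eval F v ∷ z ∷ []) (λ c z → c ⊑ c ⊕ con 0ℤ ⊙ z) refl
  eval-restrict (F ⊞ F′) z v = trans (cong₂ _+_ (eval-restrict F z v) (eval-restrict F′ z v))
    (eqn (lead F ∷ lead F′ ∷ []) (eval (restrict F) v ∷ eval (restrict F′) v ∷ z ∷ []) (λ a b x y z → x ⊕ a ⊙ z ⊕ (y ⊕ b ⊙ z) ⊑ x ⊕ y ⊕ (a :+ b) ⊙ z) refl)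
  eval-restrict (k ⊡ F) z v = trans (cong (k ·_) (eval-restrict F z v))
    (eqn (k ∷ lead F ∷ []) (eval (restrict F) v ∷ z ∷ []) (λ k a x z → k ⊙ (x ⊕ a ⊙ z) ⊑ k ⊙ x ⊕ (k :* a) ⊙ z) refl)

  slope-scale : ∀ S (F : Form m) r → slope F (Vec.map (S ℤ.*_) r) ≡ S ℤ.* slope F r
  slope-scale S (const c) r = sym (ℤₚ.*-zeroʳ S)
  slope-scale S top (ρ ∷ r) = refl
  slope-scale S (up F) (ρ ∷ r) = slope-scale S F r
  slope-scale S (F ⊞ F′) r = trans (cong₂ ℤ._+_ (slope-scale S F r) (slope-scale S F′ r)) (sym (ℤₚ.*-distribˡ-+ S _ _))
  slope-scale S (k ⊡ F) r = trans (cong (k ℤ.*_) (slope-scale S F r))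
    (trans (sym (ℤₚ.*-assoc k S _)) (trans (cong (ℤ._* slope F r) (ℤₚ.*-comm k S)) (ℤₚ.*-assoc S k _)))

  Dec-++ : ∀ {rs es : List (Ray m)} {a b c} → Dec rs a b → Dec es b c → Dec (rs List.++ es) a c
  Dec-++ done e = e
  Dec-++ (step t h d) e = step t h (Dec-++ d e)

  -- The absent form stands for the upper bound +∞.
  Below : Maybe (Form m) → Pt m → Z → Set
  Below nothing v x = ⊤
  Below (just F) v x = x ≤ eval F v

  SlopeBelow : Maybe (Form m) → Dir m → ℤ → Set
  SlopeBelow nothing r x = ⊤
  SlopeBelow (just F) r x = x ℤ.≤ slope F r

  SlopeIs : Maybe (Form m) → Dir m → ℤ → Set
  SlopeIs nothing r x = ⊤
  SlopeIs (just F) r x = slope F r ≡ x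

  SlopeIs⇒Below : ∀ (F : Maybe (Form m)) {r x} → SlopeIs F r x → SlopeBelow F r x
  SlopeIs⇒Below nothing _ = tt
  SlopeIs⇒Below (just F) e = ℤₚ.≤-reflexive (sym e)

  Below-≤ : ∀ (F : Maybe (Form m)) {v x y} → x ≤ y → Below F v y → Below F v x
  Below-≤ nothing _ _ = tt
  Below-≤ (just F) h k = ≤-trans h k

  module Fibre (D N : ℤ) (ρ : Z) where

    Cong : Z → Set
    Cong z = ∃ λ k → z ≡ ρ + N · k

    Cong-shift : ∀ {z w} c → Cong z → w ≡ z + N · c → Cong w
    Cong-shift c (k , refl) refl = k + c , eqn (N ∷ []) (ρ ∷ k ∷ c ∷ []) (λ N ρ k c → ρ ⊕ N ⊙ k ⊕ N ⊙ c ⊑ ρ ⊕ N ⊙ (k ⊕ c)) refl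

    Cong-back : ∀ {z w} → Cong z → (∃ λ c → z ≡ w + N · c) → Cong w
    Cong-back {z} {w} (k , e) (c , f) = k + (- c) , trans (eqn (N ∷ []) (w ∷ c ∷ []) (λ N w c → w ⊑ w ⊕ N ⊙ c ⊖ₑ N ⊙ c) refl)
      (trans (cong (_+ (- (N · c))) (trans (sym f) e)) (eqn (N ∷ []) (ρ ∷ k ∷ c ∷ []) (λ N ρ k c → ρ ⊕ N ⊙ k ⊖ₑ N ⊙ c ⊑ ρ ⊕ N ⊙ (k ⊖ₑ c)) refl))

    Slice : Form m → Maybe (Form m) → (Pt m → Set) → Pt (suc m) → Set
    Slice lo hi B (z ∷ v) = B v × eval lo v ≤ D · z × Below hi v (D · z) × Cong z

    fibre-point : 1ℤ ℤ.≤ D → 1ℤ ℤ.≤ N → ∀ x → ∃ λ z → x ≤ D · z × D · z + 1z ≤ x + (D ℤ.* N) ‼ × Cong z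
    fibre-point 1≤D 1≤N x = from (divide (D ℤ.* N) 1≤DN (D · ρ + (- x)))
      where
        1≤DN : 1ℤ ℤ.≤ D ℤ.* N
        1≤DN = ℤₚ.≤-trans 1≤D (subst (ℤ._≤ D ℤ.* N) (ℤₚ.*-identityʳ D) (ℤₚ.*-monoˡ-≤-nonNeg D {{ℤ.nonNegative (ℤₚ.≤-trans (ℤ.+≤+ ℕ.z≤n) 1≤D)}} 1≤N))
        from : (∃ λ q → (D ℤ.* N) · q ≤ D · ρ + (- x) × D · ρ + (- x) + 1z ≤ (D ℤ.* N) · q + (D ℤ.* N) ‼) →
               ∃ λ z → x ≤ D · z × D · z + 1z ≤ x + (D ℤ.* N) ‼ × Cong z
        -- Rounding D ρ - x down to a multiple of D N rounds D z up from x to the next value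
        -- available in the class of ρ.
        from (q , h , k) = ρ + N · (- q)
          , lin (D ∷ N ∷ []) (x ∷ ρ ∷ q ∷ []) (λ D N x ρ q → (((D :* N) ⊙ q ⊑ D ⊙ ρ ⊖ₑ x) ∷ []) ⊢ (x ⊑ D ⊙ (ρ ⊕ N ⊙ (⊝ q)))) refl h
          , lin (D ∷ N ∷ []) (x ∷ ρ ∷ q ∷ 1z ∷ []) (λ D N x ρ q o → ((D ⊙ ρ ⊖ₑ x ⊕ o ⊑ (D :* N) ⊙ q ⊕ (D :* N) ⊙ o) ∷ []) ⊢ (D ⊙ (ρ ⊕ N ⊙ (⊝ q)) ⊕ o ⊑ x ⊕ (D :* N) ⊙ o)) refl k
          , - q , refl

    -- The lower bound grows at most, the upper bound at least, with slope κ, so a last coordinate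
    -- of slope κ stays between them; the factors D and N take care of the denominator and of the
    -- congruence.
    Slice-move : ∀ (lo : Form m) (hi : Maybe (Form m)) {B : Pt m → Set} r κ →
                 (∀ v w → 0z ≤ w → B v → B (v +[ w ] r)) → slope lo r ℤ.≤ κ → SlopeBelow hi r κ → 1ℤ ℤ.≤ D ℤ.* N →
                 ∀ u w → 0z ≤ w → Slice lo hi B u → Slice lo hi B (u +[ w ] ((N ℤ.* κ) ∷ Vec.map ((D ℤ.* N) ℤ.*_) r))
    Slice-move lo hi {B} r κ mv lo≤ ≤hi 1≤S (z ∷ v) w 0≤w (b , l , h , c) =
        subst B (sym (move-scale v w S r)) (mv v (S · w) 0≤Sw b)
      , subst (λ u → eval lo u ≤ D · (z + (N ℤ.* κ) · w)) (sym (move-scale v w S r))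
          (lin (D ∷ N ∷ slope lo r ∷ κ ∷ []) (eval lo v ∷ eval lo (v +[ S · w ] r) ∷ z ∷ w ∷ []) (λ D N s κ x y z w →
            ((y ⊑ x ⊕ s ⊙ (D :* N) ⊙ w) ∷ (x ⊑ D ⊙ z) ∷ (s ⊙ (D :* N) ⊙ w ⊑ κ ⊙ (D :* N) ⊙ w) ∷ []) ⊢ (y ⊑ D ⊙ (z ⊕ (N :* κ) ⊙ w))) refl
            (eq (eval-move lo v (S · w) r) , l , ·-monoˡ lo≤ 0≤Sw))
      , subst (λ u → Below hi u (D · (z + (N ℤ.* κ) · w))) (sym (move-scale v w S r)) (upper hi ≤hi h)
      , Cong-shift (κ · w) c (cong (z +_) (eqn (N ∷ κ ∷ []) (w ∷ []) (λ N κ w → (N :* κ) ⊙ w ⊑ N ⊙ κ ⊙ w) refl))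
      where
        S = D ℤ.* N
        0≤Sw : 0z ≤ S · w
        0≤Sw = ·-nonneg (ℤₚ.≤-trans (ℤ.+≤+ ℕ.z≤n) 1≤S) 0≤w
        upper : ∀ hi → SlopeBelow hi r κ → Below hi v (D · z) → Below hi (v +[ S · w ] r) (D · (z + (N ℤ.* κ) · w))
        upper nothing _ _ = tt
        upper (just H) κ≤ h = lin (D ∷ N ∷ slope H r ∷ κ ∷ []) (eval H v ∷ eval H (v +[ S · w ] r) ∷ z ∷ w ∷ []) (λ D N s κ x y z w →
            ((x ⊕ s ⊙ (D :* N) ⊙ w ⊑ y) ∷ (D ⊙ z ⊑ x) ∷ (κ ⊙ (D :* N) ⊙ w ⊑ s ⊙ (D :* N) ⊙ w) ∷ []) ⊢ (D ⊙ (z ⊕ (N :* κ) ⊙ w) ⊑ y)) refl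
            (eq≥ (eval-move H v (S · w) r) , h , ·-monoˡ κ≤ 0≤Sw)

  module _ {I : Vec Bool m} {A W K n E} (P : Piece {m} I A W K n E) (1≤W : 1ℤ ℤ.≤ W) where
    open Piece P

    sumτ : ℕ → Form m
    sumτ zero = const 0z
    sumτ (suc k) = sumτ k ⊞ τ k

    slope-sumτ₀ : ∀ {l r} → (l , r) ∈ rays → ∀ k → k ℕ.≤ l → slope (sumτ k) r ≡ 0ℤ
    slope-sumτ₀ i zero _ = refl
    slope-sumτ₀ i (suc k) h = cong₂ ℤ._+_ (slope-sumτ₀ i k (ℕₚ.<⇒≤ h)) (slope-τ₀ i k (ℕₚ.<-trans h (range i)) (ℕₚ.<⇒≢ h))

    slope-sumτ : ∀ {l r} → (l , r) ∈ rays → ∀ k → l ℕ.< k → k ℕ.≤ L → slope (sumτ k) r ≡ W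
    slope-sumτ {l} {r} i (suc k) h k≤L = from (ℕₚ.m≤n⇒m<n∨m≡n (ℕₚ.≤-pred h))
      where
        from : l ℕ.< k ⊎ l ≡ k → slope (sumτ k) r ℤ.+ slope (τ k) r ≡ W
        from (inj₁ q) = trans (cong₂ ℤ._+_ (slope-sumτ i k q (ℕₚ.<⇒≤ k≤L)) (slope-τ₀ i k k≤L (λ e → ℕₚ.<⇒≢ q (sym e)))) (ℤₚ.+-identityʳ W)
        from (inj₂ refl) = trans (cong₂ ℤ._+_ (slope-sumτ₀ i k ℕₚ.≤-refl) (slope-τ i)) (ℤₚ.+-identityˡ W)

    sumτ-≤ : ∀ T v → (∀ i → i ℕ.< L → eval (τ i) v ≤ T) → ∀ k → k ℕ.≤ L → eval (sumτ k) v ≤ pos k · T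
    sumτ-≤ T v h zero _ = eq≥ (·-zeroˡ T)
    sumτ-≤ T v h (suc k) k<L = lin (pos k ∷ []) (eval (sumτ k) v ∷ eval (τ k) v ∷ T ∷ []) (λ k s t T →
        ((s ⊑ k ⊙ T) ∷ (t ⊑ T) ∷ []) ⊢ (s ⊕ t ⊑ (con 1ℤ :+ k) ⊙ T)) refl (sumτ-≤ T v h k (ℕₚ.<⇒≤ k<L) , h k k<L)

    Reach : Z → Pt m → Set
    Reach T y = ∃ λ c → core c × Dec rays c y × (∀ i → i ℕ.< L → eval (τ i) y ≤ T)

    -- All rays have slope W ≥ 1 on the sum of the τ. Subtracting a large multiple of this sum makes
    -- all slopes of F non-positive, so the difference is bounded by its values on the core, and the
    -- sum itself by L · T.
    reach-bounded : ∀ T → ∀ F → ∃ λ C → ∀ y → Reach T y → eval F y ≤ C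
    reach-bounded T F = from (slopeBound P F rays)
      where
        from : (∃ λ κ → 0ℤ ℤ.≤ κ × (∀ {l r} → (l , r) ∈ rays → slope F r ℤ.≤ κ)) → ∃ λ C → ∀ y → Reach T y → eval F y ≤ C
        from (κ , 0≤κ , h) = proj₁ bd + κ · pos L · T , λ where
            y (c , cc , d , t≤T) → lin (κ ∷ pos L ∷ []) (eval F y ∷ eval (sumτ L) y ∷ eval H c ∷ proj₁ bd ∷ T ∷ []) (λ κ L f s hc C T →
              ((f ⊕ con ℤ.-1ℤ ⊙ κ ⊙ s ⊑ hc) ∷ (hc ⊑ C) ∷ (κ ⊙ s ⊑ κ ⊙ L ⊙ T) ∷ []) ⊢ (f ⊑ C ⊕ κ ⊙ L ⊙ T)) refl
              (eval-Dec H rays neg d , proj₂ bd c cc , ·-monoʳ 0≤κ (sumτ-≤ T y t≤T L ℕₚ.≤-refl))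
          where
            H = F ⊟ κ ⊡ sumτ L
            bd = bounded H
            neg : ∀ {l r} → (l , r) ∈ rays → slope H r ℤ.≤ 0ℤ
            neg {l} {r} i = subst (ℤ._≤ 0ℤ) (cong (λ k → slope F r ℤ.+ k) (sym (ℤₚ.-1*i≡-i _))) (ℤₚ.i≤j⇒i-j≤0
              (ℤₚ.≤-trans (h i) (subst (κ ℤ.≤_) (cong (κ ℤ.*_) (sym (slope-sumτ i L (range i) ℕₚ.≤-refl)))
                (subst (ℤ._≤ κ ℤ.* W) (ℤₚ.*-identityʳ κ) (ℤₚ.*-monoˡ-≤-nonNeg κ {{ℤ.nonNegative 0≤κ}} 1≤W)))))

  SlopeBelow-≤ : ∀ (F : Maybe (Form m)) {r x y} → x ℤ.≤ y → SlopeBelow F r y → SlopeBelow F r x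
  SlopeBelow-≤ nothing _ _ = tt
  SlopeBelow-≤ (just F) h k = ℤₚ.≤-trans h k

  -- The part of a new piece over P that does not depend on the arrangement of the levels. The slice between lo and
  -- hi is the piece; its core lies between loᵢ and hiᵢ, over points of P where every τ is at least g.
  module Base {I : Vec Bool m} {A W K n E} (P : Piece {m} I A W K n E) (1≤W : 1ℤ ℤ.≤ W) (0≤K : 0z ≤ K)
              (D N : ℤ) (ρ : Z) (1≤D : 1ℤ ℤ.≤ D) (1≤N : 1ℤ ℤ.≤ N) (Mu : Form m) (Nu : Maybe (Form m)) (g : Z) (0≤g : 0z ≤ g)
              (lo : Form m) (hi : Maybe (Form m)) (loᵢ hiᵢ : Form m) (low up′ : ℕ → ℕ) (extra : List (Ray (suc m))) where
    open Piece P
    open Fibre D N ρ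
    open Descent P loᵢ hiᵢ D N low up′

    X′ A′ : Pt (suc m) → Set
    X′ = Slice lo hi X
    A′ = Slice Mu Nu A

    newRays : List (Ray (suc m))
    newRays = raysOf rays List.++ extra

    unit : Z
    unit = (S ℤ.* W) ‼ + (S ℤ.* W) ‼

    record Conditions : Set where
      field
        slope-lo : ∀ {l r} → (l , r) ∈ rays → slope lo r ≡ slope loᵢ r
        slope-hi : ∀ {l r} → (l , r) ∈ rays → SlopeIs hi r (slope hiᵢ r)
        slope-Mu : ∀ {l r} → (l , r) ∈ rays → slope Mu r ℤ.≤ slope loᵢ r
        slope-mid : ∀ {l r} → (l , r) ∈ rays → slope loᵢ r ℤ.≤ slope hiᵢ r
        slope-Nu : ∀ {l r} → (l , r) ∈ rays → SlopeBelow Nu r (slope hiᵢ r)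
        move-extra : ∀ {lr} → lr ∈ extra → ∀ u w → 0z ≤ w → (X′ u → X′ (u +[ w ] proj₂ lr)) × (A′ u → A′ (u +[ w ] proj₂ lr))
        deepX : ∀ v → X v → ∀ i → i ℕ.< L → g ≤ eval (τ i) v
        -- The descent stays among such points: reached from the core, with every τ at least g.
        inner : ∀ y c → core c → Dec rays c y → (∀ i → i ℕ.< L → g ≤ eval (τ i) y) → eval Mu y ≤ eval loᵢ y × eval loᵢ y ≤ eval hiᵢ y × Below Nu y (eval hiᵢ y)
        onX : ∀ v → X v → eval Mu v ≤ eval lo v × (∀ x → Below hi v x → Below Nu v x)
        fibre : ∀ v → X v → ∃ λ z → eval lo v ≤ D · z × Below hi v (D · z) × Cong z
        -- Undoes the extra ray before the descent; in an unbounded slab this lowers D z into the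
        -- range between `loᵢ` and `hiᵢ`.
        start : ∀ z v → X′ (z ∷ v) → ∃ λ z₀ → Dec extra (z₀ ∷ v) (z ∷ v) × eval loᵢ v ≤ D · z₀ × D · z₀ ≤ eval hiᵢ v × (∃ λ k → z ≡ z₀ + N · k)

    ∈raysOf : ∀ rs {x} → x ∈ raysOf rs → ∃ λ lr → lr ∈ rs × (x ≡ lowRay lr ⊎ x ≡ upRay lr)
    ∈raysOf (lr ∷ rs) (here refl) = lr , here refl , inj₁ refl
    ∈raysOf (lr ∷ rs) (there (here refl)) = lr , here refl , inj₂ refl
    ∈raysOf (lr ∷ rs) (there (there i)) = let lr′ , j , e = ∈raysOf rs i in lr′ , there j , e

    raysOf∋ : ∀ rs {lr} → lr ∈ rs → lowRay lr ∈ raysOf rs × upRay lr ∈ raysOf rs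
    raysOf∋ (lr ∷ rs) (here refl) = here refl , there (here refl)
    raysOf∋ (lr ∷ rs) (there i) = let a , b = raysOf∋ rs i in there (there a) , there (there b)

    length-raysOf : ∀ rs → length (raysOf rs) ≡ length rs ℕ.+ length rs
    length-raysOf [] = refl
    length-raysOf (_ ∷ rs) = trans (cong (λ k → suc (suc k)) (length-raysOf rs)) (cong suc (sym (ℕₚ.+-suc (length rs) (length rs))))

    module _ (cond : Conditions) where
      open Conditions cond

      1≤S′ : 1ℤ ℤ.≤ S
      1≤S′ = 1≤S 1≤W 1≤D 1≤N g slope-mid

      inhabited′ : ∃ X′
      inhabited′ = let v , xv = inhabited ; z , l , h , c = fibre v xv in z ∷ v , xv , l , h , c

      X′⊆A′ : ∀ v → X′ v → A′ v
      X′⊆A′ (z ∷ v) (xv , l , h , c) = X⊆A v xv , ≤-trans (proj₁ (onX v xv)) l , proj₂ (onX v xv) (D · z) h , c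

      Moves : Dir (suc m) → Set
      Moves r = ∀ u w → 0z ≤ w → (X′ u → X′ (u +[ w ] r)) × (A′ u → A′ (u +[ w ] r))

      moves : ∀ {lr} → lr ∈ newRays → Moves (proj₂ lr)
      moves {lr} i = from (∈-++⁻ (raysOf rays) i)
        where
          lower : ∀ {l r} → (l , r) ∈ rays → Moves (proj₂ (lowRay (l , r)))
          lower {l} {r} i u w 0≤w =
              Slice-move lo hi r (slope loᵢ r) (moveX i) (ℤₚ.≤-reflexive (slope-lo i)) (SlopeBelow-≤ hi (slope-mid i) (SlopeIs⇒Below hi (slope-hi i))) 1≤S′ u w 0≤w
            , Slice-move Mu Nu r (slope loᵢ r) (moveA i) (slope-Mu i) (SlopeBelow-≤ Nu (slope-mid i) (slope-Nu i)) 1≤S′ u w 0≤w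
          upper : ∀ {l r} → (l , r) ∈ rays → Moves (proj₂ (upRay (l , r)))
          upper {l} {r} i u w 0≤w =
              Slice-move lo hi r (slope hiᵢ r) (moveX i) (ℤₚ.≤-trans (ℤₚ.≤-reflexive (slope-lo i)) (slope-mid i)) (SlopeIs⇒Below hi (slope-hi i)) 1≤S′ u w 0≤w
            , Slice-move Mu Nu r (slope hiᵢ r) (moveA i) (ℤₚ.≤-trans (slope-Mu i) (slope-mid i)) (slope-Nu i) 1≤S′ u w 0≤w
          old : (∃ λ lr′ → lr′ ∈ rays × (lr ≡ lowRay lr′ ⊎ lr ≡ upRay lr′)) → Moves (proj₂ lr)
          old ((l , r) , j , inj₁ e) = subst (λ x → Moves (proj₂ x)) (sym e) (lower j)
          old ((l , r) , j , inj₂ e) = subst (λ x → Moves (proj₂ x)) (sym e) (upper j)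
          from : lr ∈ raysOf rays ⊎ lr ∈ extra → Moves (proj₂ lr)
          from (inj₁ j) = old (∈raysOf rays j)
          from (inj₂ j) = move-extra j

      -- Large enough for both alternatives of `Descends.small`: g plus one unit, and K plus one
      -- unit for each ray.
      T : Z
      T = g + unit + K + pos n · unit

      0≤unit : 0z ≤ unit
      0≤unit = 0≤B 1≤W 1≤D 1≤N g slope-mid

      -- The descent leaves remainders along the old rays, so the base point y is not in the old
      -- core but only reachable from it, with each τ confined to a fixed range.
      core′ : Pt (suc m) → Set
      core′ (z ∷ y) = ∃ λ c → core c × Dec rays c y × (∀ i → i ℕ.< L → g ≤ eval (τ i) y × eval (τ i) y ≤ T) ×
                              eval loᵢ y ≤ D · z × D · z ≤ eval hiᵢ y × Cong z

      moveA-Dec : ∀ rs → (∀ {lr} → lr ∈ rs → lr ∈ rays) → ∀ {c y} → Dec rs c y → A c → A y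
      moveA-Dec [] s done a = a
      moveA-Dec ((l , r) ∷ rs) s (step t 0≤t d) a = moveA-Dec rs (λ i → s (there i)) d (moveA (s (here refl)) _ t 0≤t a)

      core′⊆A′ : ∀ v → core′ v → A′ v
      core′⊆A′ (z ∷ y) (c , cc , d , t , l , h , cz) = let a , b , e = inner y c cc d (λ i q → proj₁ (t i q)) in
          moveA-Dec rays (λ i → i) d (core⊆A c cc) , ≤-trans a l , Below-≤ Nu h e , cz

      descends : ∀ c v z → core c → Dec rays c v → (∀ i → i ℕ.< L → g ≤ eval (τ i) v) → eval loᵢ v ≤ D · z → D · z ≤ eval hiᵢ v → Cong z →
                 ∃ λ u → core′ u × Dec (raysOf rays) u (z ∷ v)
      descends c v z cc d dp l h cz = R.z′ ∷ R.y ,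
          (c , cc , R.decy , (λ i q → R.deep i q , small i q (R.small i q)) , R.lo≤ , R.≤hi , Cong-back cz R.z≡) , R.dec
        where
          module R = Descends (descend 1≤W 1≤D 1≤N g slope-mid rays (λ i → i) c v z d dp l h (λ y dy dpy → proj₁ (proj₂ (inner y c cc dy dpy))))
          small : ∀ i → i ℕ.< L → eval (τ i) R.y ≤ g + unit ⊎ eval (τ i) R.y ≤ eval (τ i) c + pos (length rays) · unit → eval (τ i) R.y ≤ T
          small i q (inj₁ h) = lin (pos n ∷ []) (eval (τ i) R.y ∷ g ∷ unit ∷ K ∷ []) (λ n x g u K →
              ((x ⊑ g ⊕ u) ∷ (𝟘 ⊑ K) ∷ (𝟘 ⊑ n ⊙ u) ∷ []) ⊢ (x ⊑ g ⊕ u ⊕ K ⊕ n ⊙ u)) refl (h , 0≤K , ·-nonneg 0≤pos 0≤unit)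
          small i q (inj₂ h) = lin (pos n ∷ pos (length rays) ∷ []) (eval (τ i) R.y ∷ eval (τ i) c ∷ g ∷ unit ∷ K ∷ []) (λ n k x y g u K →
              ((x ⊑ y ⊕ k ⊙ u) ∷ (y ⊑ K) ∷ (k ⊙ u ⊑ n ⊙ u) ∷ (𝟘 ⊑ g) ∷ (𝟘 ⊑ u) ∷ []) ⊢ (x ⊑ g ⊕ u ⊕ K ⊕ n ⊙ u)) refl
              (h , proj₂ (τ-core c cc i q) , ·-monoˡ (ℤ.+≤+ len) 0≤unit , 0≤g , 0≤unit)

      decompose′ : ∀ v → X′ v → ∃ λ c → core′ c × Dec newRays c v
      decompose′ (z ∷ v) x@(xv , l , h , cz) = from (start z v x) (decompose v xv)
        where
          from : (∃ λ z₀ → Dec extra (z₀ ∷ v) (z ∷ v) × eval loᵢ v ≤ D · z₀ × D · z₀ ≤ eval hiᵢ v × (∃ λ k → z ≡ z₀ + N · k)) →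
                 (∃ λ c → core c × Dec rays c v) → ∃ λ c → core′ c × Dec newRays c (z ∷ v)
          from (z₀ , e , l₀ , h₀ , z≡) (c , cc , d) = let u , cu , du = descends c v z₀ cc d (deepX v xv) l₀ h₀ (Cong-back cz z≡) in u , cu , Dec-++ du e

      -- According to the sign of the leading coefficient, D z is replaced by its upper or lower
      -- bound over y. There remains a form in y, bounded by `reach-bounded`.
      bounded′ : ∀ F → ∃ λ C → ∀ v → core′ v → eval F v ≤ C
      bounded′ F = from (ℤₚ.≤-total 0ℤ (lead F))
        where
          H : Form m → Form m
          H b = D ⊡ restrict F ⊞ lead F ⊡ b
          reach : ∀ z y → core′ (z ∷ y) → Reach P 1≤W T y
          reach z y (c , cc , d , t , _) = c , cc , d , λ i q → proj₂ (t i q)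
          bound : ∀ b → (∀ z y → core′ (z ∷ y) → lead F · D · z ≤ lead F · eval b y) → ∃ λ C → ∀ v → core′ v → eval F v ≤ C
          bound b h = max 0z (proj₁ rb) , λ { (z ∷ y) c → small z y c (compare (eval F (z ∷ y)) 0z) }
            where
              rb = reach-bounded P 1≤W T (H b)
              small : ∀ z y → core′ (z ∷ y) → eval F (z ∷ y) ≤ 0z ⊎ 0z + 1z ≤ eval F (z ∷ y) → eval F (z ∷ y) ≤ max 0z (proj₁ rb)
              small z y c (inj₁ q) = ≤-trans q (x≤max 0z (proj₁ rb))
              small z y c (inj₂ q) = ≤-trans (≤-trans (·-grow 1≤D (≤-trans 0≤1 (≤-trans (eq (sym (+-identityˡ 1z))) q)))
                  (lin (D ∷ lead F ∷ []) (eval F (z ∷ y) ∷ eval (restrict F) y ∷ z ∷ eval b y ∷ []) (λ D c f r z b →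
                    ((D ⊙ f ⊑ D ⊙ (r ⊕ c ⊙ z)) ∷ (c ⊙ D ⊙ z ⊑ c ⊙ b) ∷ []) ⊢ (D ⊙ f ⊑ D ⊙ r ⊕ c ⊙ b)) refl
                    (eq (cong (D ·_) (eval-restrict F z y)) , h z y c)))
                (≤-trans (proj₂ rb y (reach z y c)) (y≤max 0z (proj₁ rb)))
          from : 0ℤ ℤ.≤ lead F ⊎ lead F ℤ.≤ 0ℤ → ∃ λ C → ∀ v → core′ v → eval F v ≤ C
          from (inj₁ 0≤) = bound hiᵢ λ { z y (_ , _ , _ , _ , _ , h , _) → ·-monoʳ 0≤ h }
          from (inj₂ ≤0) = bound loᵢ λ { z y (_ , _ , _ , _ , l , _ , _) →
              lin (lead F ∷ []) (D · z ∷ eval loᵢ y ∷ []) (λ c x l → (((:- c) ⊙ l ⊑ (:- c) ⊙ x) ∷ []) ⊢ (c ⊙ x ⊑ c ⊙ l)) refl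
                (·-monoʳ (ℤₚ.neg-mono-≤ ≤0) l) }

  combination-++ : ∀ (fs gs : List (ℤ × Form m)) v → combination (fs List.++ gs) v ≡ combination fs v + combination gs v
  combination-++ [] gs v = sym (+-identityˡ _)
  combination-++ ((κ , F) ∷ fs) gs v = trans (cong (κ · eval F v +_) (combination-++ fs gs v)) (sym (+-assoc _ _ _))

  Rep-mono : ∀ {I : Vec Bool m} {X rays k k′ F} → k ℕ.≤ k′ → Rep I X rays k F → Rep I X rays k′ F
  Rep-mono h (c , fs , es , e) = c , fs , All.map (λ xv → proj₁ xv , λ {l} {r} i q → proj₂ xv i (ℕₚ.≤-trans h q)) es , e

  Rep-⊞ : ∀ {I : Vec Bool m} {X rays k F F′} → Rep I X rays k F → Rep I X rays k F′ → Rep I X rays k (F ⊞ F′)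
  Rep-⊞ (c , fs , es , e) (c′ , fs′ , es′ , e′) = c + c′ , fs List.++ fs′ , Allₚ.++⁺ es es′ , λ v → trans (cong₂ _+_ (e v) (e′ v))
    (trans (+-interchange _ _ _ _) (cong (c + c′ +_) (sym (combination-++ fs fs′ v))))

  Rep-const : ∀ {I : Vec Bool m} {X rays k} c → Rep I X rays k (const c)
  Rep-const c = c , [] , [] , λ v → sym (+-identityʳ c)

  Rep-Ext : ∀ {I : Vec Bool m} {X rays k F} κ → Ext I X F → Vanishes rays k F → Rep I X rays k (κ ⊡ F)
  Rep-Ext {F = F} κ x v = 0z , (κ , F) ∷ [] , (x , v) ∷ [] , λ u → eqn [] (κ · eval F u ∷ []) (λ a → a ⊑ 𝟘 ⊕ (a ⊕ 𝟘)) refl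

  Rep-≗ : ∀ {I : Vec Bool m} {X rays k F F′} → (∀ v → eval F′ v ≡ eval F v) → Rep I X rays k F → Rep I X rays k F′
  Rep-≗ h (c , fs , es , e) = c , fs , es , λ v → trans (h v) (e v)

  1≤⇒0≤ : ∀ {k} → 1ℤ ℤ.≤ k → 0ℤ ℤ.≤ k
  1≤⇒0≤ h = ℤₚ.≤-trans (ℤ.+≤+ ℕ.z≤n) h

  Ext-up : ∀ {t} {I : Vec Bool m} {X : Pt m → Set} {Y : Pt (suc m) → Set} (F : Form m) → (∀ z v → Y (z ∷ v) → X v) → Ext I X F → Ext (t ∷ I) Y (up F)
  Ext-up {m = m} {t} {I} {X} {Y} F sub (g , h) = (λ x → g (init x)) , λ x lim → lift x (g (init x)) (h (init x) (limInit x lim))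
    where
      limInit : ∀ x → Lim (t ∷ I) Y x → Lim I X (init x)
      limInit x lim b with lim b
      ... | z ∷ v , yv , n = v , sub z v yv , λ j → n (suc j)
      lift : ∀ x o → ExtAt I X F (init x) o → ExtAt (t ∷ I) Y (up F) x o
      lift x (just c) (b , k) = b , λ { (z ∷ v) yv n → k v (sub z v yv) (λ j → n (suc j)) }
      lift x nothing k c = let b , f = k c in b , λ { (z ∷ v) yv n → f v (sub z v yv) (λ j → n (suc j)) }

  Ext-top : ∀ {I : Vec Bool m} {Y : Pt (suc m) → Set} → Ext (true ∷ I) Y top
  Ext-top {m = m} {I} {Y} = (λ x → Maybe.map (floor 0) (last x)) , λ x _ → at x
    where
      one : ∀ x o → last x ≡ o → ExtAt (true ∷ I) Y top x (Maybe.map (floor 0) o)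
      one x (just q) e = 0z , λ { (z ∷ v) _ n → sym (floor-≈ 0 q z (subst (λ o → near1 true o 0z z) e (n zero))) }
      one x nothing e c = c , λ { (z ∷ v) _ n → subst (λ o → near1 true o c z) e (n zero) }
      at : ∀ x → ExtAt (true ∷ I) Y top x (Maybe.map (floor 0) (last x))
      at x = one x (last x) refl

  -- Levels of the rays of a slab

  slope-zeros : ∀ (F : Form m) → slope F zeros ≡ 0ℤ
  slope-zeros (const c) = refl
  slope-zeros top = refl
  slope-zeros (up F) = slope-zeros F
  slope-zeros (F ⊞ F′) = cong₂ ℤ._+_ (slope-zeros F) (slope-zeros F′)
  slope-zeros (k ⊡ F) = trans (cong (k ℤ.*_) (slope-zeros F)) (ℤₚ.*-zeroʳ k)

  lookup-zeros : ∀ (j : Fin m) → lookup zeros j ≡ 0ℤ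
  lookup-zeros zero = refl
  lookup-zeros (suc j) = lookup-zeros j

  move-zeros : ∀ (v : Pt m) w → v +[ w ] zeros ≡ v
  move-zeros [] w = refl
  move-zeros (x ∷ v) w = cong₂ _∷_ (eqn [] (x ∷ w ∷ []) (λ x w → x ⊕ con 0ℤ ⊙ w ⊑ x) refl) (move-zeros v w)

  -- A new level k is inserted below the old level k; the old levels ≥ k are raised by one.
  raise raise′ : ℕ → ℕ → ℕ
  raise k l = if l ℕ.<ᵇ k then l else suc l
  raise′ k l = if l ℕ.≤ᵇ k then l else suc l

  -- The graph of `raise k`, and of `raise′ k` when k is replaced by its successor; proofs match on
  -- it instead of on Boolean tests.
  data Raise (k l : ℕ) : ℕ → Set where
    same : l ℕ.< k → Raise k l l
    more : k ℕ.≤ l → Raise k l (suc l)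

  raise? : ∀ k l → Raise k l (raise k l)
  raise? k l with l ℕ.<ᵇ k in e
  ... | true = same (ℕₚ.<ᵇ⇒< l k (subst IsTrue (sym e) tt))
  ... | false = more (ℕₚ.≮⇒≥ λ q → subst IsTrue e (ℕₚ.<⇒<ᵇ q))

  raise′? : ∀ k l → Raise (suc k) l (raise′ k l)
  raise′? k l with l ℕ.≤ᵇ k in e
  ... | true = same (ℕ.s≤s (ℕₚ.≤ᵇ⇒≤ l k (subst IsTrue (sym e) tt)))
  ... | false = more (ℕₚ.≰⇒> λ q → subst IsTrue e (ℕₚ.≤⇒≤ᵇ q))

  Raise-unique : ∀ {k l a b} → Raise k l a → Raise k l b → a ≡ b
  Raise-unique (same _) (same _) = refl
  Raise-unique (same p) (more q) = ⊥-elim (ℕₚ.<⇒≱ p q)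
  Raise-unique (more q) (same p) = ⊥-elim (ℕₚ.<⇒≱ p q)
  Raise-unique (more _) (more _) = refl

  raise-same : ∀ {k l} → l ℕ.< k → raise k l ≡ l
  raise-same h = Raise-unique (raise? _ _) (same h)

  raise-more : ∀ {k l} → k ℕ.≤ l → raise k l ≡ suc l
  raise-more h = Raise-unique (raise? _ _) (more h)

  raise′-same : ∀ {k l} → l ℕ.≤ k → raise′ k l ≡ l
  raise′-same h = Raise-unique (raise′? _ _) (same (ℕ.s≤s h))

  -- Origin of a level after the insertion: `under` and `over` stem from an old level, `onto` and
  -- `next` belong to the distances from the lower and from the upper bound of the slab.
  data Place (k : ℕ) : ℕ → Set where
    under : ∀ {i} → i ℕ.< k → Place k i
    onto : Place k k
    next : Place k (suc k)
    over : ∀ {i} → k ℕ.< i → Place k (suc i)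

  place : ∀ k i → Place k i
  place k i with ℕₚ.<-cmp i k
  place k i | tri< h _ _ = under h
  place k .k | tri≈ _ refl _ = onto
  place k (suc i) | tri> _ _ h with ℕₚ.m≤n⇒m<n∨m≡n (ℕₚ.≤-pred h)
  ... | inj₁ q = over q
  ... | inj₂ refl = next

  1≤*′ : ∀ {a b} → 1ℤ ℤ.≤ a → 1ℤ ℤ.≤ b → 1ℤ ℤ.≤ a ℤ.* b
  1≤*′ {a} {b} 1≤a 1≤b = ℤₚ.≤-trans 1≤a (subst (ℤ._≤ a ℤ.* b) (ℤₚ.*-identityʳ a)
      (ℤₚ.*-monoˡ-≤-nonNeg a {{ℤ.nonNegative (ℤₚ.≤-trans (ℤ.+≤+ ℕ.z≤n) 1≤a)}} 1≤b))

  Place-unique : ∀ {k i} (a b : Place k i) → a ≡ b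
  Place-unique (under p) (under q) = cong under (ℕₚ.<-irrelevant p q)
  Place-unique (under p) onto = ⊥-elim (ℕₚ.<-irrefl refl p)
  Place-unique (under p) next = ⊥-elim (ℕₚ.<-irrefl refl (ℕₚ.<-trans (ℕₚ.n<1+n _) p))
  Place-unique (under p) (over q) = ⊥-elim (ℕₚ.<-irrefl refl (ℕₚ.<-trans q (ℕₚ.<-trans (ℕₚ.n<1+n _) p)))
  Place-unique onto (under p) = ⊥-elim (ℕₚ.<-irrefl refl p)
  Place-unique onto onto = refl
  Place-unique onto (over q) = ⊥-elim (ℕₚ.<-irrefl refl (ℕₚ.<-trans q (ℕₚ.n<1+n _)))
  Place-unique next (under p) = ⊥-elim (ℕₚ.<-irrefl refl (ℕₚ.<-trans (ℕₚ.n<1+n _) p))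
  Place-unique next next = refl
  Place-unique next (over q) = ⊥-elim (ℕₚ.<-irrefl refl q)
  Place-unique (over q) (under p) = ⊥-elim (ℕₚ.<-irrefl refl (ℕₚ.<-trans q (ℕₚ.<-trans (ℕₚ.n<1+n _) p)))
  Place-unique (over q) onto = ⊥-elim (ℕₚ.<-irrefl refl (ℕₚ.<-trans q (ℕₚ.n<1+n _)))
  Place-unique (over q) next = ⊥-elim (ℕₚ.<-irrefl refl q)
  Place-unique (over p) (over q) = cong over (ℕₚ.<-irrelevant p q)

  raise-<⇒ : ∀ {k l q} → raise k l ℕ.< raise′ k q → l ℕ.< q
  raise-<⇒ {k} {l} {q} = from (raise? k l) (raise′? k q)
    where
      from : ∀ {a b} → Raise k l a → Raise (suc k) q b → a ℕ.< b → l ℕ.< q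
      from (same _) (same _) h = h
      from (same r) (more s) h = ℕₚ.<-trans r s
      from (more r) (same s) h = ℕₚ.≤-trans (ℕₚ.n≤1+n _) h
      from (more r) (more s) h = ℕₚ.≤-pred h

  raise-≤⇒ : ∀ {k l q} → raise′ k q ℕ.≤ raise k l → q ℕ.≤ l
  raise-≤⇒ {k} {l} {q} = from (raise? k l) (raise′? k q)
    where
      from : ∀ {a b} → Raise k l a → Raise (suc k) q b → b ℕ.≤ a → q ℕ.≤ l
      from (same _) (same _) h = h
      from (same r) (more s) h = ℕₚ.≤-trans (ℕₚ.n≤1+n _) h
      from (more r) (same s) h = ℕₚ.≤-trans (ℕₚ.≤-pred s) r
      from (more r) (more s) h = ℕₚ.≤-pred h

  raise′-<⇒ : ∀ {k l q} → raise′ k l ℕ.< raise′ k q → l ℕ.< q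
  raise′-<⇒ {k} {l} {q} = from (raise′? k l) (raise′? k q)
    where
      from : ∀ {a b} → Raise (suc k) l a → Raise (suc k) q b → a ℕ.< b → l ℕ.< q
      from (same _) (same _) h = h
      from (same r) (more s) h = ℕₚ.≤-trans r s
      from (more r) (same s) h = ℕₚ.≤-trans (ℕₚ.n≤1+n _) h
      from (more r) (more s) h = ℕₚ.≤-pred h

  raise′-≤⇒ : ∀ {k l q} → raise′ k q ℕ.≤ raise′ k l → q ℕ.≤ l
  raise′-≤⇒ {k} {l} {q} = from (raise′? k l) (raise′? k q)
    where
      from : ∀ {a b} → Raise (suc k) l a → Raise (suc k) q b → b ℕ.≤ a → q ℕ.≤ l
      from (same _) (same _) h = h
      from (same r) (more s) h = ℕₚ.≤-trans (ℕₚ.n≤1+n _) h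
      from (more r) (same s) h = ℕₚ.≤-trans (ℕₚ.≤-pred s) (ℕₚ.<⇒≤ r)
      from (more r) (more s) h = ℕₚ.≤-pred h

  Raise-≤ : ∀ {k l b L} → Raise k l b → l ℕ.≤ L → b ℕ.≤ suc L
  Raise-≤ (same _) h = ℕₚ.m≤n⇒m≤1+n h
  Raise-≤ (more _) h = ℕ.s≤s h

  -- Compatible collections and the indexing of their faces

  Disjoint : {I : Vec Bool m} {A : Pt m → Set} {W : ℤ} {K : Z} {n : ℕ} {E : Z} → Piece I A W K n E → Piece I A W K n E → Set
  Disjoint P P′ = ∀ v → Piece.X P v → Piece.X P′ v → ⊥

  record Collection (I : Vec Bool m) (A : Pt m → Set) (W : ℤ) (K : Z) (n : ℕ) (E : Z) (Q : (Pt m → Set) → Set) : Set₁ where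
    field
      list : List (Piece I A W K n E)
      disjoint : AllPairs Disjoint list
      compatible : ∀ {P P′} → P ∈ list → P′ ∈ list → Compatible P P′
      holds : ∀ {P} → P ∈ list → Q (Piece.X P)
      cover : ∀ v → A v → Any (λ P → Piece.X P v) list

  SameFace-sym : {I : Vec Bool m} {A : Pt m → Set} {W : ℤ} {K : Z} {n : ℕ} {E : Z} (P P′ : Piece I A W K n E) → ∀ {l l′} → Piece.J P l ≡ Piece.J P′ l′ →
                 SameFace P P′ l l′ → SameFace P′ P l′ l
  SameFace-sym P P′ {l} {l′} e sf = record
      { l≡l′ = sym l≡l′
      ; p≡p′ = λ j t → sym (p≡p′ j (trans (cong (λ J → lookup J j) e) t))
      ; τ≡τ′ = λ v v′ xv xv′ a i h → sym (τ≡τ′ v′ v xv′ xv (flip v v′ a) i (subst (i ℕ.<_) (sym l≡l′) h))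
      ; to = λ v xv → let v′ , x , a = from v xv in v′ , x , flip′ v v′ a
      ; from = λ v′ xv′ → let v , x , a = to v′ xv′ in v , x , flip′ v v′ a }
    where
      open SameFace sf
      flip : ∀ v v′ → AgreeOn (Piece.J P′ l′) v v′ → AgreeOn (Piece.J P l) v′ v
      flip v v′ a j t = sym (a j (trans (sym (cong (λ J → lookup J j) e)) t))
      flip′ : ∀ v v′ → AgreeOn (Piece.J P l) v′ v → AgreeOn (Piece.J P′ l′) v v′
      flip′ v v′ a j t = sym (a j (trans (cong (λ J → lookup J j) e) t))

  -- Drop k b l l̂ t: the l-th face of a slab of index (k, b) lies over the l̂-th face of its base; t tells whether
  -- the new coordinate is finite on it.
  data Drop (k : ℕ) : Bool → ℕ → ℕ → Bool → Set where
    flat< : ∀ {l} → l ℕ.< k → Drop k false l l false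
    flat≥ : ∀ {l} → k ℕ.≤ l → Drop k false l l true
    split≤ : ∀ {l} → l ℕ.≤ k → Drop k true l l false
    split> : ∀ {l} → k ℕ.≤ l → Drop k true (suc l) l true

  drop? : ∀ k b l → ∃₂ (Drop k b l)
  drop? k false l with l ℕ.<? k
  ... | yes q = l , false , flat< q
  ... | no q = l , true , flat≥ (ℕₚ.≮⇒≥ q)
  drop? k true l with l ℕ.≤? k
  ... | yes q = l , false , split≤ q
  drop? k true zero | no q = ⊥-elim (q ℕ.z≤n)
  drop? k true (suc l) | no q = l , true , split> (ℕₚ.≤-pred (ℕₚ.≰⇒> q))

  raised : Bool → ℕ → ℕ → ℕ
  raised false k q = q
  raised true k q = raise′ k q

  raised≤⇒ : ∀ {k b l l̂ t q} → Drop k b l l̂ t → raised b k q ℕ.≤ l → q ℕ.≤ l̂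
  raised≤⇒ (flat< _) h = h
  raised≤⇒ (flat≥ _) h = h
  raised≤⇒ {k} {q = q} (split≤ a) h = from (raise′? k q) h
    where
      from : ∀ {x l} → Raise (suc k) q x → x ℕ.≤ l → q ℕ.≤ l
      from (same _) h = h
      from (more _) h = ℕₚ.<⇒≤ h
  raised≤⇒ {k} {q = q} (split> {l} a) h = from (raise′? k q) h
    where
      from : ∀ {x} → Raise (suc k) q x → x ℕ.≤ suc l → q ℕ.≤ l
      from (same p) _ = ℕₚ.≤-trans (ℕₚ.≤-pred p) a
      from (more _) h = ℕₚ.≤-pred h

  raised-hidden : ∀ {k b l l̂ q} → Drop k b l l̂ false → q ℕ.≤ l̂ → raised b k q ≡ q
  raised-hidden (flat< _) _ = refl
  raised-hidden (split≤ a) h = raise′-same (ℕₚ.≤-trans h a)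

  ⇒raised≤ : ∀ {k b l l̂ t q} → Drop k b l l̂ t → q ℕ.≤ l̂ → raised b k q ℕ.≤ l
  ⇒raised≤ (flat< _) h = h
  ⇒raised≤ (flat≥ _) h = h
  ⇒raised≤ {q = q} (split≤ {l} a) h = subst (ℕ._≤ l) (sym (raised-hidden (split≤ a) h)) h
  ⇒raised≤ {k} {q = q} (split> {l} a) h = from (raise′? k q)
    where
      from : ∀ {x} → Raise (suc k) q x → x ℕ.≤ suc l
      from (same p) = ℕₚ.m≤n⇒m≤1+n h
      from (more _) = ℕ.s≤s h

  Drop-hidden : ∀ {k b l l̂} → Drop k b l l̂ false → l ≡ l̂
  Drop-hidden (flat< _) = refl
  Drop-hidden (split≤ _) = refl

  Drop-visible : ∀ {k b l l̂} → Drop k b l l̂ true → k ℕ.≤ l̂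
  Drop-visible (flat≥ h) = h
  Drop-visible (split> h) = h

  Drop-visible-unique : ∀ {k b l l′ l̂} → Drop k b l l̂ true → Drop k b l′ l̂ true → l ≡ l′
  Drop-visible-unique (flat≥ _) (flat≥ _) = refl
  Drop-visible-unique (split> _) (split> _) = refl

  -- The coordinate +∞ is encoded by 0z.
  Flat : (Pt m → Set) → Pt (suc m) → Set
  Flat X (z ∷ v) = z ≡ 0z × X v

  flatRay : Ray m → Ray (suc m)
  flatRay (l , r) = l , 0ℤ ∷ r

  flatRay∈ : (Q : ℕ → Dir (suc m) → Set) (rs : List (Ray m)) → (∀ {l r} → (l , r) ∈ rs → Q l (0ℤ ∷ r)) → ∀ {l r} → (l , r) ∈ List.map flatRay rs → Q l r
  flatRay∈ Q rs h i with ∈-map⁻ flatRay i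
  ... | _ , j , refl = h j

  +0· : ∀ z t → z + 0ℤ · t ≡ z
  +0· z t = eqn [] (z ∷ t ∷ []) (λ z t → z ⊕ con 0ℤ ⊙ t ⊑ z) refl

  Dec-flat : ∀ (rs : List (Ray m)) {c v} z → Dec rs c v → Dec (List.map flatRay rs) (z ∷ c) (z ∷ v)
  Dec-flat [] z done = done
  Dec-flat ((l , r) ∷ rs) {c} {v} z (step t 0≤t d) = step t 0≤t (subst (λ x → Dec (List.map flatRay rs) (x ∷ (c +[ t ] r)) (z ∷ v)) (sym (+0· z t)) (Dec-flat rs z d))

  Rep-flat : ∀ {I : Vec Bool m} {X rays k F} → Rep I X rays k F → Rep (false ∷ I) (Flat X) (List.map flatRay rays) k (up F)
  Rep-flat {I = I} {X} {rays} {k} {F} (c , fs , es , e) = c , List.map upper fs , Allₚ.map⁺ (All.map (λ {f} → lift f) es) , λ { (z ∷ v) → trans (e v) (cong (c +_) (comb fs z v)) }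
    where
      upper : ℤ × Form _ → ℤ × Form _
      upper (κ , F) = κ , up F
      lift : ∀ f → Ext I X (proj₂ f) × Vanishes rays k (proj₂ f) → Ext (false ∷ I) (Flat X) (up (proj₂ f)) × Vanishes (List.map flatRay rays) k (up (proj₂ f))
      lift (κ , F) (x , h) = Ext-up F (λ z v y → proj₂ y) x , λ {l} {r} → flatRay∈ (λ l r → k ℕ.≤ l → slope (up F) r ≡ 0ℤ) rays h
      comb : ∀ fs z v → combination fs v ≡ combination (List.map upper fs) (z ∷ v)
      comb [] z v = refl
      comb ((κ , F) ∷ fs) z v = cong (κ · eval F v +_) (comb fs z v)

  flatPiece : ∀ {I : Vec Bool m} {A W K n E} → Piece I A W K n E → Piece (false ∷ I) (Flat A) W K n E
  flatPiece {m} {I} {A} {W} {K} {n} {E} P = record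
      { X = Flat X ; core = Flat core ; L = L ; p = p↑ ; rays = List.map flatRay rays ; τ = λ i → up (τ i)
      ; inhabited = 0z ∷ proj₁ inhabited , refl , proj₂ inhabited
      ; X⊆A = λ { (z ∷ v) (e , x) → e , X⊆A v x }
      ; core⊆A = λ { (z ∷ v) (e , x) → e , core⊆A v x }
      ; len = subst (ℕ._≤ n) (sym (length-map flatRay rays)) len
      ; p≤L = λ { zero → ℕ.z≤n ; (suc j) → p≤L j }
      ; range = flatRay∈ (λ l _ → l ℕ.< L) rays range
      ; covers = λ l h → let r , i = covers l h in 0ℤ ∷ r , ∈-map⁺ flatRay i
      ; positive = flatRay∈ (λ l r → ∀ j → lookup (false ∷ I) j ≡ true → l ℕ.< p↑ j → 1ℤ ℤ.≤ lookup r j) rays (λ { i (suc j) → positive i j })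
      ; vanishing = flatRay∈ (λ l r → ∀ j → lookup (false ∷ I) j ≡ false ⊎ p↑ j ℕ.≤ l → lookup r j ≡ 0ℤ) rays (λ { i zero _ → refl ; i (suc j) → vanishing i j })
      ; moveX = flatRay∈ (λ l r → ∀ v w → 0z ≤ w → Flat X v → Flat X (v +[ w ] r)) rays (λ { i (z ∷ v) w 0≤w (e , x) → trans (+0· z w) e , moveX i v w 0≤w x })
      ; moveA = flatRay∈ (λ l r → ∀ v w → 0z ≤ w → Flat A v → Flat A (v +[ w ] r)) rays (λ { i (z ∷ v) w 0≤w (e , x) → trans (+0· z w) e , moveA i v w 0≤w x })
      ; slope-τ = flatRay∈ (λ l r → slope (up (τ l)) r ≡ W) rays slope-τ
      ; slope-τ₀ = flatRay∈ (λ l r → ∀ i → i ℕ.< L → i ≢ l → slope (up (τ i)) r ≡ 0ℤ) rays slope-τ₀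
      ; τ≥E = λ { (z ∷ v) (_ , x) → τ≥E v x }
      ; τ-core = λ { (z ∷ v) (_ , x) → τ-core v x }
      ; bounded = λ F → let C , h = bounded (restrict F) in C , λ { (z ∷ v) (refl , c) → subst (_≤ C) (sym (trans (eval-restrict F 0z v) (trans (cong (eval (restrict F) v +_) (·-zeroʳ (lead F))) (+-identityʳ _)))) (h v c) }
      ; decompose = λ { (z ∷ v) (e , x) → let c , cc , d = decompose v x in z ∷ c , (e , cc) , Dec-flat rays z d }
      ; rep = λ i h → Rep-flat {F = τ i} (rep i h)
      }
    where
      open Piece P
      p↑ : Fin (suc m) → ℕ
      p↑ zero = 0
      p↑ (suc j) = p j

  module _ {I : Vec Bool m} {A : Pt m → Set} {W : ℤ} {K : Z} {n : ℕ} {E : Z} where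
    agree-flat : ∀ {J : Vec Bool m} {z z′ v v′} → AgreeOn J v v′ → AgreeOn (false ∷ J) (z ∷ v) (z′ ∷ v′)
    agree-flat a (suc j) = a j

    flat-compatible : (P P′ : Piece I A W K n E) → Compatible P P′ → Compatible (flatPiece P) (flatPiece P′)
    flat-compatible P P′ comp l l′ h h′ (z ∷ v) (z′ ∷ v′) (_ , x) (_ , x′) J≡ a = record
        { l≡l′ = l≡l′
        ; p≡p′ = λ { (suc j) → p≡p′ j }
        ; τ≡τ′ = λ { (z ∷ v) (z′ ∷ v′) (_ , x) (_ , x′) a → τ≡τ′ v v′ x x′ (λ j → a (suc j)) }
        ; to = λ { (z ∷ v) (e , x) → let v′ , x′ , a = to v x in z ∷ v′ , (e , x′) , agree-flat {J = Piece.J P l} {z} {z} {v} {v′} a }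
        ; from = λ { (z ∷ v′) (e , x′) → let v , x , a = from v′ x′ in z ∷ v , (e , x) , agree-flat {J = Piece.J P l} {z} {z} {v} {v′} a } }
      where open SameFace (comp l l′ h h′ v v′ x x′ (cong Vec.tail J≡) (λ j → a (suc j)))

    flat-collection : ∀ {Q Q′} → (∀ {X} → Q X → Q′ (Flat X)) → Collection I A W K n E Q → Collection (false ∷ I) (Flat A) W K n E Q′
    flat-collection {Q} {Q′} inh C = record
        { list = List.map flatPiece list
        ; disjoint = AllPairsₚ.map⁺ (AllPairs.map (λ d → λ { (z ∷ v) (_ , x) (_ , x′) → d v x x′ }) disjoint)
        ; compatible = comp
        ; holds = hold
        ; cover = λ { (z ∷ v) (e , a) → Anyₚ.map⁺ (Any.map (e ,_) (cover v a)) } }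
      where
        open Collection C
        comp : ∀ {R R′} → R ∈ List.map flatPiece list → R′ ∈ List.map flatPiece list → Compatible R R′
        comp i i′ with ∈-map⁻ flatPiece i | ∈-map⁻ flatPiece i′
        ... | P , j , refl | P′ , j′ , refl = flat-compatible P P′ (compatible j j′)
        hold : ∀ {R} → R ∈ List.map flatPiece list → Q′ (Piece.X R)
        hold i with ∈-map⁻ flatPiece i
        ... | P , j , refl = inh (holds j)

  -- Precells over a socle

  Cl-mono : ∀ {S T : Pred (GPt m) 0ℓ} → (∀ a → S a → T a) → ∀ x → Cl S x → Cl T x
  Cl-mono h x c l u ok = let y , i , a , s , e = c l u ok in y , i , a , h a s , e

  LargelyCont-resp : ∀ {S T : Pred (GPt m) 0ℓ} {f} → (∀ a → S a → T a) → (∀ a → T a → S a) → LargelyCont S f → LargelyCont T f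
  LargelyCont-resp s t (g , agree , cont) = g , (λ a ta → agree a (t a ta)) , λ x cl l u ok →
    let l′ , u′ , ok′ , h = cont x (Cl-mono t x cl) l u ok in l′ , u′ , ok′ , λ y cy → h y (Cl-mono t y cy)

  Soc-mono : ∀ {S T : Pred (GPt (suc m)) 0ℓ} → (∀ a → S a → T a) → ∀ b → Soc S b → Soc T b
  Soc-mono h b (z , s) = z , h (b ∷ʳ z) s

  IsLCPrecell-resp : ∀ m (N : Vec ℕ m) I {S T : Pred (GPt m) 0ℓ} → (∀ a → S a → T a) → (∀ a → T a → S a) → IsLCPrecell m N I S → IsLCPrecell m N I T
  IsLCPrecell-resp zero N I s t h a = s a (h a)
  IsLCPrecell-resp (suc m) N I {S} {T} s t (soc , p , lμ , lν) = IsLCPrecell-resp m (init N) (init I) sS sT soc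
      , record { μ = μ ; ν = ν ; ρ = ρ ; ρ<N = ρ<N ; μ≥0 = λ b h → μ≥0 b (sT b h) ; ν≥0 = λ b h → ν≥0 b (sT b h)
               ; shape = λ b z → mk⇔ (λ h → let q , r , k = Equivalence.to (shape b z) (t _ h) in q , sS b r , k)
                                     (λ (q , r , k) → s _ (Equivalence.from (shape b z) (q , sT b r , k))) }
      , LargelyCont-resp sS sT lμ , LargelyCont-resp sS sT lν
    where
      open Presentation p
      sS = Soc-mono {S = S} {T = T} s
      sT = Soc-mono {S = T} {T = S} t

  LargelyCont-∞ : (S : Pred (GPt m) 0ℓ) → LargelyCont S (λ _ → nothing)
  LargelyCont-∞ S = (λ _ → nothing) , (λ _ _ → tt) , λ x _ l u _ →
    let l′ , u′ , ok , _ = In⇒Near (supp x) x 0z in l′ , u′ , ok , λ _ _ _ → tt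

  last-supp : ∀ (b : GPt m) z → last (supp (b ∷ʳ z)) ≡ is-just z
  last-supp b z = trans (cong last (map-∷ʳ is-just z b)) (last-∷ʳ (is-just z) (supp b))

  init-supp : ∀ (b : GPt m) z → init (supp (b ∷ʳ z)) ≡ supp b
  init-supp b z = trans (cong init (map-∷ʳ is-just z b)) (init-∷ʳ (is-just z) (supp b))

  toAffΩ : ℕ → Maybe (Form m) → Aff m
  toAffΩ d nothing = infA
  toAffΩ d (just F) = toAff F d

  module LastCoordinate {m} (N : Vec ℕ (suc m)) (I : Subset (suc m)) where
    J : Vec Bool m
    J = rv (init I)

    ZeroTail : (Pt m → Set) → Set
    ZeroTail X = ∀ v → X v → ZeroOff J v

    supp-toG : ∀ {t} → last I ≡ t → ∀ u → supp (toG (t ∷ J) u) ≡ I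
    supp-toG {t} e u = rv-injective _ _ (trans (rv-supp-toG (t ∷ J) u) (cong (_∷ J) (sym e)))

    module _ {t : Bool} {X : Pt m → Set} {Y : Pt (suc m) → Set} (below : ∀ z v → Y (z ∷ v) → X v) (fibre : ∀ v → X v → ∃ λ z → Y (z ∷ v)) where
      Soc⇒ : ∀ b → Soc (gp (t ∷ J) Y) b → gp J X b
      Soc⇒ b (_ , (z ∷ v) , y , e) = v , below z v y , proj₁ (∷ʳ-injective _ _ e)

      Soc⇐ : ∀ b → gp J X b → Soc (gp (t ∷ J) Y) b
      Soc⇐ b (v , xv , refl) = let z , y = fibre v xv in mk t z , (z ∷ v) , y , refl

    finite-precell : last I ≡ true → ∀ d ρ → ρ ℕ.< last N → ∀ {X Y} (lo : Form m) (hi : Maybe (Form m)) → ZeroTail X → IsLCPrecell m (init N) (init I) (gp J X) →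
      (∀ u → Y u → Fibre.Slice (pos (suc d)) (pos (last N)) (times ρ 1z) lo hi X u) → (∀ u → Fibre.Slice (pos (suc d)) (pos (last N)) (times ρ 1z) lo hi X u → Y u) →
      (∀ v → X v → ∃ λ z → Y (z ∷ v)) → Ext J X lo → (∀ F → hi ≡ just F → Ext J X F) → (∀ v → X v → 0z ≤ eval lo v) → IsLCPrecell (suc m) N I (gp (true ∷ J) Y)
    finite-precell e d ρ ρ<N {X} {Y} lo hi zt pre Y⇒ Y⇐ fibre ext-lo ext-hi lo≥0 =
        IsLCPrecell-resp m (init N) (init I) soc⇐ soc⇒ pre
      , record { μ = toAff lo d ; ν = toAffΩ d hi ; ρ = ρ ; ρ<N = ρ<N
               ; μ≥0 = λ b h → at b (soc⇒ b h) (λ v xv → ⇒0≤Ω (evalAff (init I) (toAff lo d) (toG J v)) d (val lo v xv) (lo≥0 v xv))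
               ; ν≥0 = λ b h → at b (soc⇒ b h) (λ v xv → hi≥0 hi v xv (bounds v xv))
               ; shape = λ b z → mk⇔ (forth b z) (back b z) }
      , Ext⇒LC J lo d (evalAff (init I) (toAff lo d)) (λ v xv → soc⇐ _ (v , xv , refl)) soc⇒ (val lo) ext-lo
      , lc-hi hi ext-hi
      where
        D = pos (suc d)
        S = Soc (gp (true ∷ J) Y)
        soc⇒ = Soc⇒ {true} {X} {Y} (λ z v y → proj₁ (Y⇒ (z ∷ v) y)) fibre
        soc⇐ = Soc⇐ {true} {X} {Y} (λ z v y → proj₁ (Y⇒ (z ∷ v) y)) fibre
        at : ∀ {P : GPt m → Set} b → gp J X b → (∀ v → X v → P (toG J v)) → P b
        at b (v , xv , refl) h = h v xv
        val : ∀ (F : Form m) v → X v → evalAff (init I) (toAff F d) (toG J v) ≈Ω just (eval F v // d)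
        val F v xv = eval-toAff F d (init I) v (zt v xv)
        bounds : ∀ v → X v → ∃ λ x → 0z ≤ x × Below hi v x
        bounds v xv = let z , y = fibre v xv ; _ , l , h , _ = Y⇒ (z ∷ v) y in D · z , ≤-trans (lo≥0 v xv) l , h
        hi≥0 : ∀ h v → X v → (∃ λ x → 0z ≤ x × Below h v x) → just 0Q ≤Ω evalAff (init I) (toAffΩ d h) (toG J v)
        hi≥0 nothing v xv _ = tt
        hi≥0 (just F) v xv (x , p , q) = ⇒0≤Ω (evalAff (init I) (toAff F d) (toG J v)) d (val F v xv) (≤-trans p q)
        lc-hi : ∀ h → (∀ F → h ≡ just F → Ext J X F) → LargelyCont S (evalAff (init I) (toAffΩ d h))
        lc-hi nothing _ = LargelyCont-∞ S
        lc-hi (just F) ex = Ext⇒LC J F d (evalAff (init I) (toAff F d)) (λ v xv → soc⇐ _ (v , xv , refl)) soc⇒ (val F) (ex F refl)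
        ⇒hi : ∀ h {v} z → X v → Below h v (D · z) → just (embQ z) ≤Ω evalAff (init I) (toAffΩ d h) (toG J v)
        ⇒hi nothing z _ _ = tt
        ⇒hi (just F) {v} z xv b = ⇒≤Ω (evalAff (init I) (toAff F d) (toG J v)) d z (val F v xv) b
        hi⇒ : ∀ h {v} z → X v → just (embQ z) ≤Ω evalAff (init I) (toAffΩ d h) (toG J v) → Below h v (D · z)
        hi⇒ nothing z _ _ = tt
        hi⇒ (just F) {v} z xv b = ≤Ω⇒ (evalAff (init I) (toAff F d) (toG J v)) d z (val F v xv) b
        forth : ∀ b z → gp (true ∷ J) Y (b ∷ʳ z) → supp (b ∷ʳ z) ≡ I × S b × evalAff (init I) (toAff lo d) b ≤Ω embΓ z × embΓ z ≤Ω evalAff (init I) (toAffΩ d hi) b × CongΓ z ρ (last N)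
        forth b z (z′ ∷ v , y , q) with ∷ʳ-injective _ _ q
        ... | refl , refl = let xv , l , h , c = Y⇒ (z′ ∷ v) y in supp-toG e (z′ ∷ v) , (just z′ , (z′ ∷ v) , y , refl)
            , ⇒Ω≤ (evalAff (init I) (toAff lo d) (toG J v)) d z′ (val lo v xv) l , ⇒hi hi z′ xv h , ·-cong {z′} {times ρ 1z} {last N} (proj₁ c) (proj₂ c)
        back : ∀ b z → supp (b ∷ʳ z) ≡ I × S b × evalAff (init I) (toAff lo d) b ≤Ω embΓ z × embΓ z ≤Ω evalAff (init I) (toAffΩ d hi) b × CongΓ z ρ (last N) → gp (true ∷ J) Y (b ∷ʳ z)
        back b nothing (q , _) = ⊥-elim (false≢true (trans (sym (last-supp b nothing)) (trans (cong last q) e)))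
          where
            false≢true : false ≡ true → ⊥
            false≢true ()
        back b (just z) (q , sb , l , h , c) with soc⇒ b sb
        ... | v , xv , refl = (z ∷ v) , Y⇐ (z ∷ v) (xv , Ω≤⇒ (evalAff (init I) (toAff lo d) (toG J v)) d z (val lo v xv) l , hi⇒ hi z xv h , cong-· {z} {times ρ 1z} {last N} c) , refl

    infinite-precell : last I ≡ false → 0 ℕ.< last N → ∀ {X Y} → IsLCPrecell m (init N) (init I) (gp J X) →
      (∀ z v → Y (z ∷ v) → X v) → (∀ v → X v → ∃ λ z → Y (z ∷ v)) → IsLCPrecell (suc m) N I (gp (false ∷ J) Y)
    infinite-precell e 0<N {X} {Y} pre below fibre = IsLCPrecell-resp m (init N) (init I) soc⇐ soc⇒ pre
      , record { μ = infA ; ν = infA ; ρ = 0 ; ρ<N = 0<N ; μ≥0 = λ _ _ → tt ; ν≥0 = λ _ _ → tt ; shape = λ b z → mk⇔ (forth b z) (back b z) }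
      , LargelyCont-∞ S , LargelyCont-∞ S
      where
        S = Soc (gp (false ∷ J) Y)
        soc⇒ = Soc⇒ {false} {X} {Y} below fibre
        soc⇐ = Soc⇐ {false} {X} {Y} below fibre
        forth : ∀ b z → gp (false ∷ J) Y (b ∷ʳ z) → supp (b ∷ʳ z) ≡ I × S b × nothing ≤Ω embΓ z × embΓ z ≤Ω nothing × CongΓ z 0 (last N)
        forth b z (z′ ∷ v , y , q) with ∷ʳ-injective _ _ q
        ... | refl , refl = supp-toG e (z′ ∷ v) , (nothing , (z′ ∷ v) , y , refl) , tt , tt , tt
        back : ∀ b z → supp (b ∷ʳ z) ≡ I × S b × nothing ≤Ω embΓ z × embΓ z ≤Ω nothing × CongΓ z 0 (last N) → gp (false ∷ J) Y (b ∷ʳ z)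
        back b nothing (q , sb , _) with soc⇒ b sb
        ... | v , xv , refl = let z , y = fibre v xv in (z ∷ v) , y , refl
        back b (just z) (q , _) = ⊥-elim (true≢false (trans (sym (last-supp b (just z))) (trans (cong last q) e)))
          where
            true≢false : true ≡ false → ⊥
            true≢false ()

  -- Slabs over a piece

  nothing≢just : ∀ {A : Set} {x : A} → nothing ≡ just x → ⊥
  nothing≢just ()

  byMaybe : ∀ {A : Set} (N : Maybe A) (Q : Maybe A → Set) → Q nothing → (∀ a → N ≡ just a → Q (just a)) → Q N
  byMaybe nothing Q a b = a
  byMaybe (just x) Q a b = b x refl

  record Setting (m : ℕ) : Set₁ where
    field
      I : Vec Bool m
      A : Pt m → Set
      W : ℤ
      K : Z
      n : ℕ
      D N : ℤ
      ρ E : Z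
      1≤D : 1ℤ ℤ.≤ D
      1≤N : 1ℤ ℤ.≤ N
      1≤W : 1ℤ ℤ.≤ W
      0≤K : 0z ≤ K
      Mu : Form m
      Nu : Maybe (Form m)
      -- The values D z with z in one class mod N are D N apart, so a slab of width E meets each
      -- class.
      S≤E : (D ℤ.* N) ‼ ≤ E
      extMu : Ext I A Mu
      Mu≥0 : ∀ v → A v → 0z ≤ eval Mu v
      extNu : ∀ ν → Nu ≡ just ν → Ext I A ν
      Mu≤Nu : ∀ ν → Nu ≡ just ν → ∀ v → A v → eval Mu v ≤ eval ν v
      W≤Nu : ∀ ν → Nu ≡ just ν → ∀ r → 1ℤ ℤ.≤ slope ν r → W ℤ.≤ slope ν r
      fibreA : ∀ v → A v → ∃ λ z → eval Mu v ≤ D · z × Below Nu v (D · z) × Fibre.Cong D N ρ z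

  module Step {m} (σ : Setting m) where
    open Setting σ

    S : ℤ
    S = D ℤ.* N

    W′ : ℤ
    W′ = S ℤ.* W

    -- `unit` is the loss per ray in the descent. From g on, consecutive Ψ differ by τ - K. If τ ≥
    -- `depth` this is at least 2E + W′, enough to separate the inner bounds Ψ k + E and Ψ (k + 1) -
    -- E. If τ ≥ `Ê` it is at least 4E + W′, so that a point of the right class fits between Ψ k +
    -- 2E and Ψ (k + 1) - 2E - 1. With T the bound of the old τ on the new core, K′ bounds both T -
    -- `depth`, for the shifted old τ, and T - K - 2E, for the two distances.
    unit K′ depth Ê : Z
    unit = W′ ‼ + W′ ‼
    K′ = W′ ‼ + K + unit + pos n · unit
    depth = K + (E + E) + W′ ‼
    Ê = K + (E + E + (E + E)) + W′ ‼

    open Fibre D N ρ public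

    newI : Vec Bool (suc m)
    newI = true ∷ I

    A′ : Pt (suc m) → Set
    A′ = Slice Mu Nu A

    1≤S : 1ℤ ℤ.≤ S
    1≤S = 1≤*′ 1≤D 1≤N

    1≤W′ : 1ℤ ℤ.≤ W′
    1≤W′ = 1≤*′ 1≤S 1≤W

    0≤W′ : 0z ≤ W′ ‼
    0≤W′ = ≤-trans 0≤1 (·-grow 1≤W′ 0≤1)

    0≤unit : 0z ≤ unit
    0≤unit = ≤-trans (eq (sym (+-identityˡ 0z))) (≤-mono 0≤W′ 0≤W′)

    0≤K′ : 0z ≤ K′
    0≤K′ = lin (pos n ∷ []) (W′ ‼ ∷ K ∷ unit ∷ []) (λ n w K u → ((𝟘 ⊑ w) ∷ (𝟘 ⊑ K) ∷ (𝟘 ⊑ u) ∷ (𝟘 ⊑ n ⊙ u) ∷ []) ⊢ (𝟘 ⊑ w ⊕ K ⊕ u ⊕ n ⊙ u)) refl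
      (0≤W′ , 0≤K , 0≤unit , ·-nonneg 0≤pos 0≤unit)

    NewPiece : Set₁
    NewPiece = Piece newI A′ W′ K′ (suc (n ℕ.+ n)) E

    0≤E : 0z ≤ E
    0≤E = ≤-trans (≤-trans 0≤1 (·-grow 1≤S 0≤1)) S≤E

    1≤E : 1z ≤ E
    1≤E = ≤-trans (·-grow 1≤S 0≤1) S≤E

    OldPiece : Set₁
    OldPiece = Piece I A W K n Ê

    gradeMu : (P : OldPiece) → Grade P Mu
    gradeMu P = grade P Mu (λ v x → Mu≥0 v (Piece.X⊆A P v x)) (Ext-⊆ {F = Mu} (Piece.X⊆A P) extMu)

    gradeNu : (P : OldPiece) → ∀ ν → Nu ≡ just ν → Grade P ν
    gradeNu P ν e = grade P ν (λ v x → ≤-trans (Mu≥0 v (Piece.X⊆A P v x)) (Mu≤Nu ν e v (Piece.X⊆A P v x))) (Ext-⊆ {F = ν} (Piece.X⊆A P) (extNu ν e))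

    -- The cutting forms Ψ and their slopes

    module At (P : OldPiece) where
      open Piece P public

      extX : Ext I X Mu
      extX = Ext-⊆ {F = Mu} X⊆A extMu

      gradeX : Grade P Mu
      gradeX = gradeMu P

      open Grade gradeX public

      add : Bool → ℕ → Form m → Form m
      add t k F = if t then F ⊞ (τ k ⊟ const K) else F

      -- Constant up to index g, since μ itself already grows along the levels below g. The -K in
      -- each summand keeps Ψ k below μ on the core, see `Ψ-core`.
      Ψ : ℕ → Form m
      Ψ zero = Mu
      Ψ (suc k) = add (g ℕ.≤ᵇ k) k (Ψ k)

      ≤ᵇ-yes : ∀ {a b} → a ℕ.≤ b → (a ℕ.≤ᵇ b) ≡ true
      ≤ᵇ-yes {a} {b} h with a ℕ.≤ᵇ b | ℕₚ.≤⇒≤ᵇ h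
      ... | true | _ = refl

      ≤ᵇ-no : ∀ {a b} → b ℕ.< a → (a ℕ.≤ᵇ b) ≡ false
      ≤ᵇ-no {a} {b} h with a ℕ.≤ᵇ b in e
      ... | false = refl
      ... | true = ⊥-elim (ℕₚ.<⇒≱ h (ℕₚ.≤ᵇ⇒≤ a b (subst IsTrue (sym e) tt)))

      Ψ-suc : ∀ {k} → g ℕ.≤ k → Ψ (suc k) ≡ Ψ k ⊞ (τ k ⊟ const K)
      Ψ-suc {k} h = cong (λ t → add t k (Ψ k)) (≤ᵇ-yes h)

      Ψ-low : ∀ k → k ℕ.≤ g → Ψ k ≡ Mu
      Ψ-low zero _ = refl
      Ψ-low (suc k) h = trans (cong (λ t → add t k (Ψ k)) (≤ᵇ-no h)) (Ψ-low k (ℕₚ.<⇒≤ h))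

      slope-τ≥0 : ∀ {l r} → (l , r) ∈ rays → ∀ k → k ℕ.< L → 0ℤ ℤ.≤ slope (τ k) r
      slope-τ≥0 {l} i k k<L with k ℕ.≟ l
      ... | yes refl = subst (0ℤ ℤ.≤_) (sym (slope-τ i)) (1≤⇒0≤ 1≤W)
      ... | no q = ℤₚ.≤-reflexive (sym (slope-τ₀ i k k<L q))

      slope-step : ∀ {k} → g ℕ.≤ k → ∀ r → slope (Ψ (suc k)) r ≡ slope (Ψ k) r ℤ.+ slope (τ k) r
      slope-step {k} h r = trans (cong (λ F → slope F r) (Ψ-suc h)) (cong (λ x → slope (Ψ k) r ℤ.+ x) (ℤₚ.+-identityʳ _))

      slope-Ψ-old : ∀ {l r} → (l , r) ∈ rays → l ℕ.< g → ∀ k → k ℕ.≤ L → slope (Ψ k) r ≡ slope Mu r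
      slope-Ψ-old i l<g zero _ = refl
      slope-Ψ-old {l} {r} i l<g (suc k) k<L with g ℕ.≤? k
      ... | yes h = trans (slope-step h r) (trans (cong₂ ℤ._+_ (slope-Ψ-old i l<g k (ℕₚ.<⇒≤ k<L))
            (slope-τ₀ i k k<L (λ e → ℕₚ.<⇒≢ (ℕₚ.<-≤-trans l<g h) (sym e)))) (ℤₚ.+-identityʳ _))
      ... | no h = cong (λ F → slope F r) (Ψ-low (suc k) (ℕₚ.≰⇒> h))

      slope-Ψ-zero : ∀ {l r} → (l , r) ∈ rays → ∀ k → g ℕ.≤ k → k ℕ.≤ l → slope (Ψ k) r ≡ 0ℤ
      slope-Ψ-zero {l} {r} i k g≤k k≤l = from (ℕₚ.m≤n⇒m<n∨m≡n g≤k) k≤l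
        where
          from : ∀ {k} → g ℕ.< k ⊎ g ≡ k → k ℕ.≤ l → slope (Ψ k) r ≡ 0ℤ
          from {suc k} (inj₁ q) h = trans (slope-step (ℕₚ.≤-pred q) r) (cong₂ ℤ._+_ (from {k} (ℕₚ.m≤n⇒m<n∨m≡n (ℕₚ.≤-pred q)) (ℕₚ.<⇒≤ h))
            (slope-τ₀ i k (ℕₚ.<-trans h (range i)) (ℕₚ.<⇒≢ h)))
          from {k} (inj₂ e) h = trans (cong (λ F → slope F r) (Ψ-low k (ℕₚ.≤-reflexive (sym e)))) (zero-slope i (subst (ℕ._≤ l) (sym e) h))

      slope-Ψ-new : ∀ {l r} → (l , r) ∈ rays → g ℕ.≤ l → ∀ k → l ℕ.< k → k ℕ.≤ L → slope (Ψ k) r ≡ W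
      slope-Ψ-new {l} {r} i g≤l (suc k) l<k k≤L = from (ℕₚ.m≤n⇒m<n∨m≡n (ℕₚ.≤-pred l<k))
        where
          from : l ℕ.< k ⊎ l ≡ k → slope (Ψ (suc k)) r ≡ W
          from (inj₁ q) = trans (slope-step (ℕₚ.≤-trans g≤l (ℕₚ.<⇒≤ q)) r) (trans (cong₂ ℤ._+_ (slope-Ψ-new i g≤l k q (ℕₚ.<⇒≤ k≤L))
            (slope-τ₀ i k k≤L (λ e → ℕₚ.<⇒≢ q (sym e)))) (ℤₚ.+-identityʳ W))
          from (inj₂ refl) = trans (slope-step g≤l r) (trans (cong₂ ℤ._+_ (slope-Ψ-zero i k g≤l ℕₚ.≤-refl) (slope-τ i)) (ℤₚ.+-identityˡ W))

      slope-Ψ-mono : ∀ {l r} → (l , r) ∈ rays → ∀ {k k′} → k ℕ.≤ k′ → k′ ℕ.≤ L → slope (Ψ k) r ℤ.≤ slope (Ψ k′) r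
      slope-Ψ-mono {l} {r} i {k} {k′} h k′≤L = from k′ h k′≤L
        where
          one : ∀ k → k ℕ.< L → slope (Ψ k) r ℤ.≤ slope (Ψ (suc k)) r
          one k k<L with g ℕ.≤? k
          ... | yes q = subst (slope (Ψ k) r ℤ.≤_) (sym (slope-step q r)) (ℤₚ.i≤i+j (slope (Ψ k) r) (slope (τ k) r) {{ℤ.nonNegative (slope-τ≥0 i k k<L)}})
          ... | no q = ℤₚ.≤-reflexive (cong (λ F → slope F r) (trans (Ψ-low k (ℕₚ.<⇒≤ (ℕₚ.≰⇒> q))) (sym (Ψ-low (suc k) (ℕₚ.≰⇒> q)))))
          from : ∀ k′ → k ℕ.≤ k′ → k′ ℕ.≤ L → slope (Ψ k) r ℤ.≤ slope (Ψ k′) r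
          from k′ h k′≤L with ℕₚ.m≤n⇒m<n∨m≡n h
          ... | inj₂ refl = ℤₚ.≤-refl
          from (suc k′) h k′≤L | inj₁ q = ℤₚ.≤-trans (from k′ (ℕₚ.≤-pred q) (ℕₚ.<⇒≤ k′≤L)) (one k′ k′≤L)

      slope-Ψ-pos : ∀ {l r} → (l , r) ∈ rays → ∀ k → l ℕ.< k → k ℕ.≤ L → 1ℤ ℤ.≤ slope (Ψ k) r
      slope-Ψ-pos {l} {r} i k l<k k≤L with l ℕ.<? g
      ... | yes q = subst (1ℤ ℤ.≤_) (sym (slope-Ψ-old i q k k≤L)) (pos-slope i q)
      ... | no q = subst (1ℤ ℤ.≤_) (sym (slope-Ψ-new i (ℕₚ.≮⇒≥ q) k l<k k≤L)) 1≤W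

      slope-Ψ≥0 : ∀ {l r} → (l , r) ∈ rays → ∀ k → k ℕ.≤ L → 0ℤ ℤ.≤ slope (Ψ k) r
      slope-Ψ≥0 i k k≤L = ℤₚ.≤-trans (grade-nonneg P gradeX i) (slope-Ψ-mono i ℕ.z≤n k≤L)

      Rep-Ψ : ∀ k → g ℕ.≤ k → k ℕ.≤ L → Rep I X rays k (Ψ k)
      Rep-Ψ k g≤k k≤L with ℕₚ.m≤n⇒m<n∨m≡n g≤k
      ... | inj₂ e = subst (Rep I X rays k) (sym (Ψ-low k (ℕₚ.≤-reflexive (sym e)))) (Rep-≗ {F = 1ℤ ⊡ Mu} {F′ = Mu} (λ v → eqn [] (eval Mu v ∷ []) (λ x → x ⊑ con 1ℤ ⊙ x) refl) (Rep-Ext {F = Mu} 1ℤ extX (λ i q → zero-slope i (subst (ℕ._≤ _) (sym e) q))))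
      Rep-Ψ (suc k) g≤k k≤L | inj₁ q = subst (Rep I X rays (suc k)) (sym (Ψ-suc (ℕₚ.≤-pred q)))
          (Rep-⊞ {F = Ψ k} {F′ = τ k ⊟ const K} (Rep-mono {F = Ψ k} (ℕₚ.n≤1+n k) (Rep-Ψ k (ℕₚ.≤-pred q) (ℕₚ.<⇒≤ k≤L)))
            (Rep-⊞ {F = τ k} {F′ = ℤ.-1ℤ ⊡ const K} (rep k k≤L) (Rep-≗ {F = const (ℤ.-1ℤ · K)} {F′ = ℤ.-1ℤ ⊡ const K} (λ v → refl) (Rep-const (ℤ.-1ℤ · K)))))

      -- The τ i are combinations with coefficients of either sign and can lack limits. Ψ k has them
      -- because it grows along every ray of level below k, hence dominates each form it is composed
      -- of.
      Ext-Ψ : ∀ k → g ℕ.≤ k → k ℕ.≤ L → Ext I X (Ψ k)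
      Ext-Ψ k g≤k k≤L = Rep⇒Ext P k (Ψ k) (Rep-Ψ k g≤k k≤L) (λ i q → slope-Ψ-pos i k q k≤L) (λ i → slope-Ψ≥0 i k k≤L)

      eval-Ψ-suc : ∀ {k} → g ℕ.≤ k → ∀ v → eval (Ψ (suc k)) v ≡ eval (Ψ k) v + eval (τ k) v + (- K)
      eval-Ψ-suc {k} h v = trans (cong (λ F → eval F v) (Ψ-suc h)) (eqn [] (eval (Ψ k) v ∷ eval (τ k) v ∷ K ∷ []) (λ x t K → x ⊕ (t ⊕ con ℤ.-1ℤ ⊙ K) ⊑ x ⊕ t ⊖ₑ K) refl)

      eval-Ψ-mono : ∀ v → (∀ i → i ℕ.< L → K ≤ eval (τ i) v) → ∀ {k k′} → k ℕ.≤ k′ → k′ ℕ.≤ L → eval (Ψ k) v ≤ eval (Ψ k′) v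
      eval-Ψ-mono v h {k} k≤k′ k′≤L = from _ k≤k′ k′≤L
        where
          one : ∀ k → k ℕ.< L → eval (Ψ k) v ≤ eval (Ψ (suc k)) v
          one k k<L with g ℕ.≤? k
          ... | yes q = lin [] (eval (Ψ k) v ∷ eval (Ψ (suc k)) v ∷ eval (τ k) v ∷ K ∷ []) (λ x y t K → ((x ⊕ t ⊖ₑ K ⊑ y) ∷ (K ⊑ t) ∷ []) ⊢ (x ⊑ y)) refl
                  (eq≥ (eval-Ψ-suc q v) , h k k<L)
          ... | no q = eq (cong (λ F → eval F v) (trans (Ψ-low k (ℕₚ.<⇒≤ (ℕₚ.≰⇒> q))) (sym (Ψ-low (suc k) (ℕₚ.≰⇒> q)))))
          from : ∀ k′ → k ℕ.≤ k′ → k′ ℕ.≤ L → eval (Ψ k) v ≤ eval (Ψ k′) v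
          from k′ h k′≤L with ℕₚ.m≤n⇒m<n∨m≡n h
          ... | inj₂ refl = ≤-refl
          from (suc k′) h k′≤L | inj₁ q = ≤-trans (from k′ (ℕₚ.≤-pred q) (ℕₚ.<⇒≤ k′≤L)) (one k′ k′≤L)

      eval-Ψ-gap : ∀ v e → (∀ i → i ℕ.< L → K + e ≤ eval (τ i) v) → 0z ≤ e → ∀ {k k′} → g ℕ.≤ k → k ℕ.< k′ → k′ ℕ.≤ L → eval (Ψ k) v + e ≤ eval (Ψ k′) v
      eval-Ψ-gap v e h 0≤e {k} g≤k k<k′ k′≤L = ≤-trans (lin [] (eval (Ψ k) v ∷ eval (Ψ (suc k)) v ∷ eval (τ k) v ∷ K ∷ e ∷ []) (λ x y t K e →
          ((x ⊕ t ⊖ₑ K ⊑ y) ∷ (K ⊕ e ⊑ t) ∷ []) ⊢ (x ⊕ e ⊑ y)) refl (eq≥ (eval-Ψ-suc g≤k v) , h k (ℕₚ.<-≤-trans k<k′ k′≤L)))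
          (eval-Ψ-mono v (λ i q → lin [] (K ∷ e ∷ eval (τ i) v ∷ []) (λ K e t → ((K ⊕ e ⊑ t) ∷ (𝟘 ⊑ e) ∷ []) ⊢ (K ⊑ t)) refl (h i q , 0≤e)) k<k′ k′≤L)

      Ψ-core : ∀ c → core c → ∀ k → k ℕ.≤ L → eval (Ψ k) c ≤ eval Mu c
      Ψ-core c cc zero _ = ≤-refl
      Ψ-core c cc (suc k) k<L with g ℕ.≤? k
      ... | yes q = lin [] (eval (Ψ k) c ∷ eval (Ψ (suc k)) c ∷ eval (τ k) c ∷ K ∷ eval Mu c ∷ []) (λ x y t K μ →
              ((y ⊑ x ⊕ t ⊖ₑ K) ∷ (t ⊑ K) ∷ (x ⊑ μ) ∷ []) ⊢ (y ⊑ μ)) refl (eq (eval-Ψ-suc q c) , proj₂ (τ-core c cc k k<L) , Ψ-core c cc k (ℕₚ.<⇒≤ k<L))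
      ... | no q = eq (cong (λ F → eval F c) (Ψ-low (suc k) (ℕₚ.≰⇒> q)))

      module WithNu (Nu : Form m) (grν : Grade P Nu) (slope-Mu≤Nu : ∀ {l r} → (l , r) ∈ rays → slope Mu r ℤ.≤ slope Nu r)
                    (W≤ : ∀ {l r} → (l , r) ∈ rays → l ℕ.< Grade.g grν → W ℤ.≤ slope Nu r) (Mu≤Nu : ∀ v → A v → eval Mu v ≤ eval Nu v) where
        open Grade grν using () renaming (g to gν; g≤L to gν≤L)

        slope-Ψ≤Nu : ∀ {l r} → (l , r) ∈ rays → ∀ k → g ℕ.≤ k → k ℕ.≤ gν → slope (Ψ k) r ℤ.≤ slope Nu r
        slope-Ψ≤Nu {l} {r} i k g≤k k≤gν with l ℕ.<? g
        ... | yes q = subst (ℤ._≤ slope Nu r) (sym (slope-Ψ-old i q k (ℕₚ.≤-trans k≤gν gν≤L))) (slope-Mu≤Nu i)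
        ... | no q with l ℕ.<? k
        ... | yes q′ = subst (ℤ._≤ slope Nu r) (sym (slope-Ψ-new i (ℕₚ.≮⇒≥ q) k q′ (ℕₚ.≤-trans k≤gν gν≤L))) (W≤ i (ℕₚ.<-≤-trans q′ k≤gν))
        ... | no q′ = subst (ℤ._≤ slope Nu r) (sym (slope-Ψ-zero i k g≤k (ℕₚ.≮⇒≥ q′))) (grade-nonneg P grν i)

        -- It holds on the core, where Ψ ≤ μ ≤ ν, and is preserved along the rays because the slopes
        -- compare.
        Ψ≤Nu : g ℕ.≤ gν → ∀ c y → core c → Dec rays c y → eval (Ψ gν) y ≤ eval Nu y
        Ψ≤Nu g≤gν c y cc d = lin [] (eval (Ψ gν) y ∷ eval Nu y ∷ eval (Ψ gν) c ∷ eval Nu c ∷ eval Mu c ∷ []) (λ a b a′ b′ μ →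
            ((b′ ⊕ con ℤ.-1ℤ ⊙ a′ ⊑ b ⊕ con ℤ.-1ℤ ⊙ a) ∷ (a′ ⊑ μ) ∷ (μ ⊑ b′) ∷ []) ⊢ (a ⊑ b)) refl
            (eval-Dec-≥ (Nu ⊟ Ψ gν) rays (λ {l} {r} i → subst (0ℤ ℤ.≤_) (cong (λ k → slope Nu r ℤ.+ k) (sym (ℤₚ.-1*i≡-i _))) (ℤₚ.i≤j⇒0≤j-i (slope-Ψ≤Nu i gν g≤gν ℕₚ.≤-refl))) d
            , Ψ-core c cc gν gν≤L , Mu≤Nu c (core⊆A c cc))

      deepX : ∀ v → X v → ∀ i → i ℕ.< L → depth ≤ eval (τ i) v
      deepX v xv i q = lin [] (eval (τ i) v ∷ K ∷ E ∷ W′ ‼ ∷ []) (λ t K E w → ((K ⊕ (E ⊕ E ⊕ (E ⊕ E)) ⊕ w ⊑ t) ∷ (𝟘 ⊑ E) ∷ (𝟘 ⊑ E) ∷ []) ⊢ (K ⊕ (E ⊕ E) ⊕ w ⊑ t)) refl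
        (τ≥E v xv i q , 0≤E , 0≤E)

      0≤depth : 0z ≤ depth
      0≤depth = lin [] (K ∷ E ∷ W′ ‼ ∷ []) (λ K E w → ((𝟘 ⊑ K) ∷ (𝟘 ⊑ E) ∷ (𝟘 ⊑ E) ∷ (𝟘 ⊑ w) ∷ []) ⊢ (𝟘 ⊑ K ⊕ (E ⊕ E) ⊕ w)) refl (0≤K , 0≤E , 0≤E , 0≤W′)

      module Rays (lo : Form m) (hi : Maybe (Form m)) (loᵢ hiᵢ : Form m) (low up′ : ℕ → ℕ) (extra : List (Ray (suc m))) where
        open Base P 1≤W 0≤K D N ρ 1≤D 1≤N Mu Nu depth 0≤depth lo hi loᵢ hiᵢ low up′ extra public hiding (A′; unit; 0≤unit; 1≤S′)
        open Descent P loᵢ hiᵢ D N low up′ public using (raysOf; lowRay; upRay)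

        elim : (Q : ℕ → Dir (suc m) → Set) → (∀ {l r} → (l , r) ∈ rays → Q (low l) ((N ℤ.* slope loᵢ r) ∷ Vec.map (S ℤ.*_) r)) →
               (∀ {l r} → (l , r) ∈ rays → Q (up′ l) ((N ℤ.* slope hiᵢ r) ∷ Vec.map (S ℤ.*_) r)) →
               (∀ {l r} → (l , r) ∈ extra → Q l r) → ∀ {l r} → (l , r) ∈ newRays → Q l r
        elim Q a b c {l} {r} i = from (∈-++⁻ (raysOf rays) i)
          where
            old : (∃ λ lr → lr ∈ rays × ((l , r) ≡ lowRay lr ⊎ (l , r) ≡ upRay lr)) → Q l r
            old (_ , j , inj₁ refl) = a j
            old (_ , j , inj₂ refl) = b j
            from : (l , r) ∈ raysOf rays ⊎ (l , r) ∈ extra → Q l r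
            from (inj₁ j) = old (∈raysOf rays j)
            from (inj₂ j) = c j

        low∈ : ∀ {l r} → (l , r) ∈ rays → (low l , (N ℤ.* slope loᵢ r) ∷ Vec.map (S ℤ.*_) r) ∈ newRays
        low∈ i = ∈-++⁺ˡ (proj₁ (raysOf∋ rays i))

        up∈ : ∀ {l r} → (l , r) ∈ rays → (up′ l , (N ℤ.* slope hiᵢ r) ∷ Vec.map (S ℤ.*_) r) ∈ newRays
        up∈ i = ∈-++⁺ˡ (proj₂ (raysOf∋ rays i))

        extra∈ : ∀ {l r} → (l , r) ∈ extra → (l , r) ∈ newRays
        extra∈ i = ∈-++⁺ʳ (raysOf rays) i

        length-new : length extra ℕ.≤ 1 → length newRays ℕ.≤ suc (n ℕ.+ n)
        length-new h = ℕₚ.≤-trans (ℕₚ.≤-reflexive (trans (length-++ (raysOf rays)) (trans (cong (ℕ._+ length extra) (length-raysOf rays)) (ℕₚ.+-comm _ (length extra)))))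
          (ℕₚ.+-mono-≤ h (ℕₚ.+-mono-≤ len len))

        Vertical : Set
        Vertical = ∀ {l r} → (l , r) ∈ extra → ∃ λ c → r ≡ c ∷ zeros

        Rep-up : Vertical → ∀ {k k′} F → (∀ {l} → k′ ℕ.≤ low l → k ℕ.≤ l) → (∀ {l} → k′ ℕ.≤ up′ l → k ℕ.≤ l) →
                 Rep I X rays k F → Rep newI X′ newRays k′ (up F)
        Rep-up vert {k} {k′} F hl hu (c , fs , es , e) = c , List.map (λ f → proj₁ f , up (proj₂ f)) fs , Allₚ.map⁺ (All.map (λ {f} xv → lift {f} xv) es) , comb
          where
            scaled : ∀ F r → slope F r ≡ 0ℤ → slope F (Vec.map (S ℤ.*_) r) ≡ 0ℤ
            scaled F r h = trans (slope-scale S F r) (trans (cong (S ℤ.*_) h) (ℤₚ.*-zeroʳ S))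
            van : ∀ F → Vanishes rays k F → Vanishes newRays k′ (up F)
            van F h i q = elim (λ l r → k′ ℕ.≤ l → slope (up F) r ≡ 0ℤ)
              (λ {l} {r} j q → scaled F r (h j (hl q))) (λ {l} {r} j q → scaled F r (h j (hu q)))
              (λ {l} {r} j _ → trans (cong (slope (up F)) (proj₂ (vert {l} {r} j))) (slope-zeros F)) i q
            lift : ∀ {f : ℤ × Form m} → Ext I X (proj₂ f) × Vanishes rays k (proj₂ f) → Ext newI X′ (up (proj₂ f)) × Vanishes newRays k′ (up (proj₂ f))
            lift {_ , F} (x , h) = Ext-up F (λ z v y → proj₁ y) x , (λ {l} {r} → van F h {l} {r})
            comb′ : ∀ fs z v → combination (List.map (λ f → proj₁ f , up (proj₂ f)) fs) (z ∷ v) ≡ combination fs v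
            comb′ [] z v = refl
            comb′ ((κ , F) ∷ fs) z v = cong (κ · eval F v +_) (comb′ fs z v)
            comb : ∀ v → eval (up F) v ≡ c + combination (List.map (λ f → proj₁ f , up (proj₂ f)) fs) v
            comb (z ∷ v) = trans (e v) (cong (c +_) (sym (comb′ fs z v)))

        Rep-shift : ∀ {k} (F : Form (suc m)) c → Rep newI X′ newRays k F → Rep newI X′ newRays k (F ⊟ const c)
        Rep-shift {k} F c h = Rep-⊞ {F = F} {F′ = ℤ.-1ℤ ⊡ const c} h (Rep-≗ {F = const (ℤ.-1ℤ · c)} {F′ = ℤ.-1ℤ ⊡ const c} (λ v → refl) (Rep-const (ℤ.-1ℤ · c)))

        1≤S* : ∀ {x} → 1ℤ ℤ.≤ x → 1ℤ ℤ.≤ S ℤ.* x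
        1≤S* = 1≤*′ 1≤S

        *0 : ∀ a {x} → x ≡ 0ℤ → a ℤ.* x ≡ 0ℤ
        *0 a refl = ℤₚ.*-zeroʳ a

        old-positive : ∀ {l r} → (l , r) ∈ rays → ∀ j → lookup I j ≡ true → l ℕ.< p j → 1ℤ ℤ.≤ lookup (Vec.map (S ℤ.*_) r) j
        old-positive {l} {r} i j t q = subst (1ℤ ℤ.≤_) (sym (lookup-map j (S ℤ.*_) r)) (1≤S* (positive i j t q))

        old-vanishing : ∀ {l r} → (l , r) ∈ rays → ∀ j → lookup I j ≡ false ⊎ p j ℕ.≤ l → lookup (Vec.map (S ℤ.*_) r) j ≡ 0ℤ
        old-vanishing {l} {r} i j h = trans (lookup-map j (S ℤ.*_) r) (*0 S (vanishing i j h))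

        shift-slope : ∀ (F : Form m) c κ r → slope (up F ⊟ const c) (κ ∷ r) ≡ slope F r
        shift-slope F c κ r = ℤₚ.+-identityʳ (slope F r)

        old-τ : ∀ {l r} c κ → (l , r) ∈ rays → slope (up (τ l) ⊟ const c) (κ ∷ Vec.map (S ℤ.*_) r) ≡ W′
        old-τ {l} {r} c κ i = trans (shift-slope (τ l) c κ (Vec.map (S ℤ.*_) r)) (trans (slope-scale S (τ l) r) (cong (S ℤ.*_) (slope-τ i)))

        old-τ₀ : ∀ {l r} c κ → (l , r) ∈ rays → ∀ i → i ℕ.< L → i ≢ l → slope (up (τ i) ⊟ const c) (κ ∷ Vec.map (S ℤ.*_) r) ≡ 0ℤ
        old-τ₀ {l} {r} c κ j i i<L i≢l = trans (shift-slope (τ i) c κ (Vec.map (S ℤ.*_) r)) (trans (slope-scale S (τ i) r) (*0 S (slope-τ₀ j i i<L i≢l)))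

        shift-τ≥ : ∀ z v → X v → ∀ i → i ℕ.< L → E ≤ eval (up (τ i) ⊟ const depth) (z ∷ v)
        shift-τ≥ z v xv i q = lin [] (eval (τ i) v ∷ K ∷ E ∷ W′ ‼ ∷ []) (λ t K E w → ((K ⊕ (E ⊕ E ⊕ (E ⊕ E)) ⊕ w ⊑ t) ∷ (𝟘 ⊑ E) ∷ []) ⊢
            (E ⊑ t ⊕ con ℤ.-1ℤ ⊙ (K ⊕ (E ⊕ E) ⊕ w))) refl (τ≥E v xv i q , 0≤E)

        shift-τ-core : (cd : Conditions) → ∀ z v → core′ cd (z ∷ v) → ∀ i → i ℕ.< L →
                       0z ≤ eval (up (τ i) ⊟ const depth) (z ∷ v) × eval (up (τ i) ⊟ const depth) (z ∷ v) ≤ K′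
        shift-τ-core cd z v (_ , _ , _ , t , _) i q =
            lin [] (eval (τ i) v ∷ depth ∷ []) (λ t d → ((d ⊑ t) ∷ []) ⊢ (𝟘 ⊑ t ⊕ con ℤ.-1ℤ ⊙ d)) refl (proj₁ (t i q))
          , lin (pos n ∷ []) (eval (τ i) v ∷ depth ∷ K ∷ W′ ‼ ∷ unit ∷ []) (λ n t d K w u → ((t ⊑ d ⊕ u ⊕ K ⊕ n ⊙ u) ∷ (𝟘 ⊑ w) ∷ []) ⊢
              (t ⊕ con ℤ.-1ℤ ⊙ d ⊑ w ⊕ K ⊕ u ⊕ n ⊙ u)) refl (proj₂ (t i q) , 0≤W′)

      -- A slab whose bounds have the same level k.
      module Flat (k : ℕ) (lo hi : Form m) where
        open Rays lo (just hi) lo hi (λ l → l) (λ l → l) [] public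

        record FlatConditions : Set where
          field
            k≤L : k ℕ.≤ L
            lo-pos : ∀ {l r} → (l , r) ∈ rays → l ℕ.< k → 1ℤ ℤ.≤ slope lo r
            lo-zero : ∀ {l r} → (l , r) ∈ rays → k ℕ.≤ l → slope lo r ≡ 0ℤ
            hi-zero : ∀ {l r} → (l , r) ∈ rays → k ℕ.≤ l → slope hi r ≡ 0ℤ
            slope-mid : ∀ {l r} → (l , r) ∈ rays → slope lo r ℤ.≤ slope hi r
            slope-Mu : ∀ {l r} → (l , r) ∈ rays → slope Mu r ℤ.≤ slope lo r
            slope-Nu : ∀ {l r} → (l , r) ∈ rays → SlopeBelow Nu r (slope hi r)
            inner : ∀ y c → core c → Dec rays c y → (∀ i → i ℕ.< L → depth ≤ eval (τ i) y) → eval Mu y ≤ eval lo y × eval lo y ≤ eval hi y × Below Nu y (eval hi y)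
            onX : ∀ v → X v → eval Mu v ≤ eval lo v × (∀ x → x ≤ eval hi v → Below Nu v x)
            fibre : ∀ v → X v → ∃ λ z → eval lo v ≤ D · z × D · z ≤ eval hi v × Cong z

        module _ (fc : FlatConditions) where
          open FlatConditions fc

          conditions : Conditions
          conditions = record { slope-lo = λ _ → refl ; slope-hi = λ _ → refl ; slope-Mu = slope-Mu ; slope-mid = slope-mid ; slope-Nu = slope-Nu
            ; move-extra = λ () ; deepX = deepX ; inner = inner ; onX = onX ; fibre = fibre
            ; start = λ z v x → z , done , proj₁ (proj₂ x) , proj₁ (proj₂ (proj₂ x)) , 0z , eqn (N ∷ []) (z ∷ []) (λ N z → z ⊑ z ⊕ N ⊙ 𝟘) refl }

          flatP : Fin (suc m) → ℕ
          flatP zero = k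
          flatP (suc j) = p j

          flat : NewPiece
          flat = record
            -- On the new core the old τ start at `depth`; the shift makes them start at 0 again.
            { X = X′ ; core = core′ conditions ; L = L ; p = flatP ; rays = newRays ; τ = λ i → up (τ i) ⊟ const depth
            ; inhabited = inhabited′ conditions ; X⊆A = X′⊆A′ conditions ; core⊆A = core′⊆A′ conditions
            ; len = length-new ℕ.z≤n
            ; p≤L = λ { zero → k≤L ; (suc j) → p≤L j }
            ; range = elim (λ l _ → l ℕ.< L) range range (λ ())
            ; covers = λ l h → let r , i = covers l h in _ , low∈ i
            ; positive = λ i → elim (λ l r → ∀ j → lookup newI j ≡ true → l ℕ.< flatP j → 1ℤ ℤ.≤ lookup r j)
                (λ { i zero _ h → 1≤*′ 1≤N (lo-pos i h) ; i (suc j) t h → old-positive i j t h })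
                (λ { i zero _ h → 1≤*′ 1≤N (ℤₚ.≤-trans (lo-pos i h) (slope-mid i)) ; i (suc j) t h → old-positive i j t h }) (λ ()) i
            ; vanishing = λ i → elim (λ l r → ∀ j → lookup newI j ≡ false ⊎ flatP j ℕ.≤ l → lookup r j ≡ 0ℤ)
                (λ { i zero (inj₂ h) → *0 N (lo-zero i h) ; i (suc j) h → old-vanishing i j h })
                (λ { i zero (inj₂ h) → *0 N (hi-zero i h) ; i (suc j) h → old-vanishing i j h }) (λ ()) i
            ; moveX = λ i v w 0≤w → proj₁ (moves conditions i v w 0≤w)
            ; moveA = λ i v w 0≤w → proj₂ (moves conditions i v w 0≤w)
            ; slope-τ = elim (λ l r → slope (up (τ l) ⊟ const depth) r ≡ W′) (λ {l} {r} i → old-τ depth (N ℤ.* slope lo r) i) (λ {l} {r} i → old-τ depth (N ℤ.* slope hi r) i) (λ ())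
            ; slope-τ₀ = λ i → elim (λ l r → ∀ i → i ℕ.< L → i ≢ l → slope (up (τ i) ⊟ const depth) r ≡ 0ℤ) (λ {l} {r} i → old-τ₀ depth (N ℤ.* slope lo r) i) (λ {l} {r} i → old-τ₀ depth (N ℤ.* slope hi r) i) (λ ()) i
            ; τ≥E = λ { (z ∷ v) x → shift-τ≥ z v (proj₁ x) }
            ; τ-core = λ { (z ∷ v) c → shift-τ-core conditions z v c }
            ; bounded = bounded′ conditions
            ; decompose = decompose′ conditions
            ; rep = λ i h → Rep-shift (up (τ i)) depth (Rep-up (λ ()) (τ i) (λ q → q) (λ q → q) (rep i h))
            }

      -- In a split slab the old τ k is replaced by the distances D z - Ψ k and Ψ (k + 1) - D z,
      -- whose sum is τ k up to a constant.
      tauAt : ∀ {k i} → Place k i → Form (suc m)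
      tauAt (under {i} _) = up (τ i) ⊟ const depth
      tauAt {k} onto = (D ⊡ top ⊞ ℤ.-1ℤ ⊡ up (Ψ k)) ⊟ const E
      tauAt {k} next = (1ℤ ⊡ up (Ψ (suc k)) ⊞ (ℤ.- D) ⊡ top) ⊟ const E
      tauAt (over {i} _) = up (τ i) ⊟ const depth

      -- The inserted face is the one where the new coordinate is already finite while the old
      -- coordinates of level above k are still infinite.
      splitP : ℕ → Fin (suc m) → ℕ
      splitP k zero = suc k
      splitP k (suc j) = raise′ k (p j)

      slope-onto : ∀ k x r → slope (tauAt {k} onto) ((N ℤ.* x) ∷ Vec.map (S ℤ.*_) r) ≡ S ℤ.* (x ℤ.+ ℤ.- slope (Ψ k) r)
      slope-onto k x r = trans (cong (λ s → D ℤ.* (N ℤ.* x) ℤ.+ ℤ.-1ℤ ℤ.* s ℤ.+ 0ℤ) (slope-scale S (Ψ k) r))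
        (onto-identity D N x (slope (Ψ k) r))

      slope-next : ∀ k x r → slope (tauAt {k} next) ((N ℤ.* x) ∷ Vec.map (S ℤ.*_) r) ≡ S ℤ.* (slope (Ψ (suc k)) r ℤ.+ ℤ.- x)
      slope-next k x r = trans (cong (λ s → 1ℤ ℤ.* s ℤ.+ (ℤ.- D) ℤ.* (N ℤ.* x) ℤ.+ 0ℤ) (slope-scale S (Ψ (suc k)) r))
        (next-identity D N x (slope (Ψ (suc k)) r))

      +0 : ∀ (F : Form m) c r → slope (F ⊞ const c) r ≡ slope F r
      +0 F c r = ℤₚ.+-identityʳ (slope F r)

      module Inserted (k : ℕ) (g≤k : g ℕ.≤ k) (hi : Maybe (Form m)) (hiᵢ : Form m) (extra : List (Ray (suc m))) where
        loᵢ lo : Form m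
        -- The core may reach down to Ψ k + E, the slab only to Ψ k + 2E: thus D z - Ψ k - E is at
        -- least 0 on the core and at least E on the slab.
        loᵢ = Ψ k ⊞ const E
        lo = Ψ k ⊞ const (E + E)

        open Rays lo hi loᵢ hiᵢ (raise k) (raise′ k) extra public

        τ′ : ℕ → Form (suc m)
        τ′ i = tauAt (place k i)

        τ′-at : ∀ {i} (pl : Place k i) → τ′ i ≡ tauAt pl
        τ′-at pl = cong tauAt (Place-unique (place k _) pl)

        module AtMost (k≤L : k ℕ.≤ L) where

          low-slope : ∀ {l r} → (l , r) ∈ rays → l ℕ.< k → 1ℤ ℤ.≤ slope loᵢ r
          low-slope {l} {r} i h = subst (1ℤ ℤ.≤_) (sym (+0 (Ψ k) E r)) (slope-Ψ-pos i k h k≤L)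

          low-zero : ∀ {l r} → (l , r) ∈ rays → k ℕ.≤ l → slope loᵢ r ≡ 0ℤ
          low-zero {l} {r} i h = trans (+0 (Ψ k) E r) (slope-Ψ-zero i k g≤k h)

          low-positive : ∀ {l r} → (l , r) ∈ rays → ∀ j → lookup newI j ≡ true → raise k l ℕ.< splitP k j → 1ℤ ℤ.≤ lookup ((N ℤ.* slope loᵢ r) ∷ Vec.map (S ℤ.*_) r) j
          low-positive {l} {r} i zero _ h = from (raise? k l) h
            where
              from : ∀ {b} → Raise k l b → b ℕ.< suc k → 1ℤ ℤ.≤ N ℤ.* slope loᵢ r
              from (same q) _ = 1≤*′ 1≤N (low-slope i q)
              from (more q) h = ⊥-elim (ℕₚ.<⇒≱ h (ℕ.s≤s q))
          low-positive i (suc j) t h = old-positive i j t (raise-<⇒ {k} h)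

          low-vanishing : ∀ {l r} → (l , r) ∈ rays → ∀ j → lookup newI j ≡ false ⊎ splitP k j ℕ.≤ raise k l → lookup ((N ℤ.* slope loᵢ r) ∷ Vec.map (S ℤ.*_) r) j ≡ 0ℤ
          low-vanishing {l} {r} i zero (inj₂ h) = from (raise? k l) h
            where
              from : ∀ {b} → Raise k l b → suc k ℕ.≤ b → N ℤ.* slope loᵢ r ≡ 0ℤ
              from (same q) h = ⊥-elim (ℕₚ.<⇒≱ h (ℕₚ.<⇒≤ q))
              from (more q) _ = *0 N (low-zero i q)
          low-vanishing i (suc j) (inj₁ h) = old-vanishing i j (inj₁ h)
          low-vanishing i (suc j) (inj₂ h) = old-vanishing i j (inj₂ (raise-≤⇒ {k} h))

          low-onto : ∀ {r} → slope (tauAt {k} onto) ((N ℤ.* slope loᵢ r) ∷ Vec.map (S ℤ.*_) r) ≡ 0ℤ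
          low-onto {r} = trans (slope-onto k (slope loᵢ r) r) (*0 S (trans (cong (λ x → x ℤ.+ ℤ.- slope (Ψ k) r) (+0 (Ψ k) E r)) (ℤₚ.+-inverseʳ (slope (Ψ k) r))))

          low-next : ∀ {r} → slope (tauAt {k} next) ((N ℤ.* slope loᵢ r) ∷ Vec.map (S ℤ.*_) r) ≡ S ℤ.* slope (τ k) r
          low-next {r} = trans (slope-next k (slope loᵢ r) r) (cong (S ℤ.*_) (trans (cong₂ (λ a b → a ℤ.+ ℤ.- b) (slope-step g≤k r) (+0 (Ψ k) E r))
              (trans (cong (ℤ._+ ℤ.- ψ) (ℤₚ.+-comm ψ t)) (trans (ℤₚ.+-assoc t ψ (ℤ.- ψ)) (trans (cong (λ x → t ℤ.+ x) (ℤₚ.+-inverseʳ ψ)) (ℤₚ.+-identityʳ t))))))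
            where
              ψ = slope (Ψ k) r
              t = slope (τ k) r

          low-τ : ∀ {l r} → (l , r) ∈ rays → ∀ {b} → Raise k l b → (pl : Place k b) → slope (tauAt pl) ((N ℤ.* slope loᵢ r) ∷ Vec.map (S ℤ.*_) r) ≡ W′
          low-τ {l} {r} i (same q) (under h) = old-τ depth (N ℤ.* slope loᵢ r) i
          low-τ i (same q) onto = ⊥-elim (ℕₚ.<-irrefl refl q)
          low-τ i (same q) next = ⊥-elim (ℕₚ.<-irrefl refl (ℕₚ.<-trans (ℕₚ.n<1+n _) q))
          low-τ i (same q) (over h) = ⊥-elim (ℕₚ.<-irrefl refl (ℕₚ.<-trans h (ℕₚ.<-trans (ℕₚ.n<1+n _) q)))
          low-τ i (more q) (under h) = ⊥-elim (ℕₚ.<-irrefl refl (ℕₚ.≤-trans h (ℕₚ.≤-trans q (ℕₚ.n≤1+n _))))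
          low-τ i (more q) onto = ⊥-elim (ℕₚ.<-irrefl refl q)
          low-τ i (more q) next = trans low-next (cong (S ℤ.*_) (slope-τ i))
          low-τ {l} {r} i (more q) (over h) = old-τ depth (N ℤ.* slope loᵢ r) i

          low-τ₀ : ∀ {l r} → (l , r) ∈ rays → ∀ {b} → Raise k l b → ∀ i → (pl : Place k i) → i ℕ.< suc L → i ≢ b → slope (tauAt pl) ((N ℤ.* slope loᵢ r) ∷ Vec.map (S ℤ.*_) r) ≡ 0ℤ
          low-τ₀ {l} {r} j (same q) i (under h) _ ne = old-τ₀ depth (N ℤ.* slope loᵢ r) j i (ℕₚ.<-≤-trans h k≤L) ne
          low-τ₀ {l} {r} j (more q) i (under h) _ ne = old-τ₀ depth (N ℤ.* slope loᵢ r) j i (ℕₚ.<-≤-trans h k≤L) (λ e → ℕₚ.<⇒≱ h (subst (k ℕ.≤_) (sym e) q))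
          low-τ₀ {l} {r} j _ i onto _ _ = low-onto {r}
          low-τ₀ {l} j ra i next h ne = trans low-next (*0 S (slope-τ₀ j k (ℕₚ.≤-pred h) (λ e → ne (at-next e ra))))
            where
              at-next : ∀ {b} → k ≡ l → Raise k l b → suc k ≡ b
              at-next refl (same q) = ⊥-elim (ℕₚ.<-irrefl refl q)
              at-next refl (more q) = refl
          low-τ₀ {l} {r} j (same q) i (over h) h′ ne = old-τ₀ depth (N ℤ.* slope loᵢ r) j _ (ℕₚ.≤-pred h′) (λ e → ℕₚ.<⇒≱ (ℕₚ.<-trans q h) (ℕₚ.≤-reflexive e))
          low-τ₀ {l} {r} j (more q) i (over h) h′ ne = old-τ₀ depth (N ℤ.* slope loᵢ r) j _ (ℕₚ.≤-pred h′) (λ e → ne (cong suc e))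

          rep-under : ∀ i → i ℕ.< k → Vertical → Rep newI X′ newRays (suc i) (up (τ i) ⊟ const depth)
          rep-under i h vert = Rep-shift (up (τ i)) depth (Rep-up vert (τ i) (λ {l} → from (raise? k l)) (λ {l} → from′ (raise′? k l)) (rep i (ℕₚ.<-≤-trans h k≤L)))
            where
              from : ∀ {l b} → Raise k l b → suc i ℕ.≤ b → suc i ℕ.≤ l
              from (same _) q = q
              from (more q) _ = ℕₚ.≤-trans h q
              from′ : ∀ {l b} → Raise (suc k) l b → suc i ℕ.≤ b → suc i ℕ.≤ l
              from′ (same _) q = q
              from′ (more q) _ = ℕₚ.≤-trans h (ℕₚ.<⇒≤ q)

          rep-over : ∀ i → k ℕ.< i → i ℕ.< L → Vertical → Rep newI X′ newRays (suc (suc i)) (up (τ i) ⊟ const depth)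
          rep-over i h i<L vert = Rep-shift (up (τ i)) depth (Rep-up vert (τ i) (λ {l} → from (raise? k l)) (λ {l} → from (raise′? k l)) (rep i i<L))
            where
              from : ∀ {l b k} → Raise k l b → suc (suc i) ℕ.≤ b → suc i ℕ.≤ l
              from (same _) q = ℕₚ.≤-trans (ℕₚ.n≤1+n _) q
              from (more _) q = ℕₚ.≤-pred q

          Ext-upΨ : ∀ q → g ℕ.≤ q → q ℕ.≤ L → Ext newI X′ (up (Ψ q))
          Ext-upΨ q h h′ = Ext-up (Ψ q) (λ z v y → proj₁ y) (Ext-Ψ q h h′)

          upΨ-zero : ∀ q → g ℕ.≤ q → ∀ {l r κ} → (l , r) ∈ rays → q ℕ.≤ l → slope (up (Ψ q)) (κ ∷ Vec.map (S ℤ.*_) r) ≡ 0ℤ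
          upΨ-zero q h {l} {r} i h′ = trans (slope-scale S (Ψ q) r) (*0 S (slope-Ψ-zero i q h h′))

          -- D z - Ψ k can lack a limit where both terms are infinite, but the two terms extend
          -- separately and are flat from level k + 1 on, which is all that a representation
          -- demands.
          rep-onto : Vertical → (∀ {l r} → (l , r) ∈ newRays → suc k ℕ.≤ l → slope top r ≡ 0ℤ) → Rep newI X′ newRays (suc k) (tauAt {k} onto)
          rep-onto vert zeroTop = Rep-shift (D ⊡ top ⊞ ℤ.-1ℤ ⊡ up (Ψ k)) E (Rep-⊞ {F = D ⊡ top} {F′ = ℤ.-1ℤ ⊡ up (Ψ k)} (Rep-Ext {F = top} D Ext-top zeroTop) (Rep-Ext {F = up (Ψ k)} ℤ.-1ℤ (Ext-upΨ k g≤k k≤L) van))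
            where
              van : Vanishes newRays (suc k) (up (Ψ k))
              van i q = elim (λ l r → suc k ℕ.≤ l → slope (up (Ψ k)) r ≡ 0ℤ)
                (λ {l} {r} j q → upΨ-zero k g≤k {κ = N ℤ.* slope loᵢ r} j (from (raise? k l) q)) (λ {l} {r} j q → upΨ-zero k g≤k {κ = N ℤ.* slope hiᵢ r} j (from (raise′? k l) q))
                (λ {l} {r} j _ → trans (cong (slope (up (Ψ k))) (proj₂ (vert {l} {r} j))) (slope-zeros (Ψ k))) i q
                where
                  from : ∀ {l b k′} → Raise k′ l b → suc k ℕ.≤ b → k ℕ.≤ l
                  from (same _) q = ℕₚ.<⇒≤ q
                  from (more _) q = ℕₚ.≤-pred q

          onto≥E : ∀ z v → X′ (z ∷ v) → E ≤ eval (tauAt {k} onto) (z ∷ v)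
          onto≥E z v (_ , l , _) = lin (D ∷ []) (z ∷ eval (Ψ k) v ∷ E ∷ []) (λ D z ψ E → ((ψ ⊕ (E ⊕ E) ⊑ D ⊙ z) ∷ []) ⊢ (E ⊑ D ⊙ z ⊕ con ℤ.-1ℤ ⊙ ψ ⊕ con ℤ.-1ℤ ⊙ E)) refl l

          onto-core≥0 : (cd : Conditions) → ∀ z v → core′ cd (z ∷ v) → 0z ≤ eval (tauAt {k} onto) (z ∷ v)
          onto-core≥0 cd z v (_ , _ , _ , _ , l , _) = lin (D ∷ []) (z ∷ eval (Ψ k) v ∷ E ∷ []) (λ D z ψ E → ((ψ ⊕ E ⊑ D ⊙ z) ∷ []) ⊢ (𝟘 ⊑ D ⊙ z ⊕ con ℤ.-1ℤ ⊙ ψ ⊕ con ℤ.-1ℤ ⊙ E)) refl l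

      K≤depth : K ≤ depth
      K≤depth = lin [] (K ∷ E ∷ W′ ‼ ∷ []) (λ K E w → ((𝟘 ⊑ E) ∷ (𝟘 ⊑ E) ∷ (𝟘 ⊑ w) ∷ []) ⊢ (K ⊑ K ⊕ (E ⊕ E) ⊕ w)) refl (0≤E , 0≤E , 0≤W′)

      S≤W′ : S ‼ ≤ W′ ‼
      S≤W′ = ·-monoˡ (subst (ℤ._≤ W′) (ℤₚ.*-identityʳ S) (ℤₚ.*-monoˡ-≤-nonNeg S {{ℤ.nonNegative (1≤⇒0≤ 1≤S)}} 1≤W)) 0≤1

      Ψ≥Mu : ∀ k → k ℕ.≤ L → ∀ v → (∀ i → i ℕ.< L → depth ≤ eval (τ i) v) → eval Mu v ≤ eval (Ψ k) v
      Ψ≥Mu k k≤L v h = eval-Ψ-mono v (λ i q → ≤-trans K≤depth (h i q)) {0} {k} ℕ.z≤n k≤L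

      -- A slab between Ψ k and Ψ (k + 1): the ray directions of level k are split into those that follow the upper
      -- bound, which form the new level k, and those that follow the lower bound, which form the new level k + 1.
      module Split (k : ℕ) (g≤k : g ℕ.≤ k) where
        hiᵢ hi : Form m
        hiᵢ = Ψ (suc k) ⊞ const (- E)
        -- The 1 leaves the value Ψ (k + 1) - 2E to the next slab.
        hi = Ψ (suc k) ⊞ const (- (E + E + 1z))

        open Inserted k g≤k (just hi) hiᵢ [] public

        record SplitConditions : Set where
          field
            k<L : k ℕ.< L
            slope-Nu : ∀ {l r} → (l , r) ∈ rays → SlopeBelow Nu r (slope (Ψ (suc k)) r)
            inner-Nu : ∀ y c → core c → Dec rays c y → (∀ i → i ℕ.< L → depth ≤ eval (τ i) y) → Below Nu y (eval (Ψ (suc k)) y)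
            onX-Nu : ∀ v → X v → Below Nu v (eval (Ψ (suc k)) v)

        module _ (sc : SplitConditions) where
          open SplitConditions sc
          k≤L : k ℕ.≤ L
          k≤L = ℕₚ.<⇒≤ k<L
          open AtMost k≤L

          up-≡ : ∀ r → slope hiᵢ r ≡ slope (Ψ (suc k)) r
          up-≡ r = +0 (Ψ (suc k)) (- E) r

          gap : ∀ v e → (∀ i → i ℕ.< L → K + e ≤ eval (τ i) v) → 0z ≤ e → eval (Ψ k) v + e ≤ eval (Ψ (suc k)) v
          gap v e h 0≤e = eval-Ψ-gap v e h 0≤e g≤k (ℕₚ.n<1+n k) k<L

          deep-gap : ∀ v → (∀ i → i ℕ.< L → depth ≤ eval (τ i) v) → eval (Ψ k) v + (E + E) ≤ eval (Ψ (suc k)) v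
          deep-gap v h = gap v (E + E) (λ i q → lin [] (K ∷ E ∷ W′ ‼ ∷ eval (τ i) v ∷ []) (λ K E w t → ((K ⊕ (E ⊕ E) ⊕ w ⊑ t) ∷ (𝟘 ⊑ w) ∷ []) ⊢ (K ⊕ (E ⊕ E) ⊑ t)) refl (h i q , 0≤W′))
              (lin [] (E ∷ []) (λ E → ((𝟘 ⊑ E) ∷ (𝟘 ⊑ E) ∷ []) ⊢ (𝟘 ⊑ E ⊕ E)) refl (0≤E , 0≤E))

          conditions : Conditions
          conditions = record
            { slope-lo = λ _ → refl ; slope-hi = λ _ → refl
            ; slope-Mu = λ {l} {r} i → subst (slope Mu r ℤ.≤_) (sym (+0 (Ψ k) E r)) (slope-Ψ-mono i {0} {k} ℕ.z≤n k≤L)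
            ; slope-mid = λ {l} {r} i → subst₂ ℤ._≤_ (sym (+0 (Ψ k) E r)) (sym (up-≡ r)) (slope-Ψ-mono i (ℕₚ.n≤1+n k) k<L)
            ; slope-Nu = λ {l} {r} i → subst (SlopeBelow Nu r) (sym (up-≡ r)) (slope-Nu i)
            ; move-extra = λ () ; deepX = deepX
            ; inner = λ y c cc d h →
                lin [] (eval Mu y ∷ eval (Ψ k) y ∷ E ∷ []) (λ μ ψ E → ((μ ⊑ ψ) ∷ (𝟘 ⊑ E) ∷ []) ⊢ (μ ⊑ ψ ⊕ E)) refl (Ψ≥Mu k k≤L y h , 0≤E)
              , lin [] (eval (Ψ k) y ∷ eval (Ψ (suc k)) y ∷ E ∷ []) (λ ψ φ E → ((ψ ⊕ (E ⊕ E) ⊑ φ) ∷ []) ⊢ (ψ ⊕ E ⊑ φ ⊖ₑ E)) refl (deep-gap y h)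
              , Below-≤ Nu (lin [] (eval (Ψ (suc k)) y ∷ E ∷ []) (λ φ E → ((𝟘 ⊑ E) ∷ []) ⊢ (φ ⊖ₑ E ⊑ φ)) refl 0≤E) (inner-Nu y c cc d h)
            ; onX = λ v xv →
                lin [] (eval Mu v ∷ eval (Ψ k) v ∷ E ∷ []) (λ μ ψ E → ((μ ⊑ ψ) ∷ (𝟘 ⊑ E) ∷ (𝟘 ⊑ E) ∷ []) ⊢ (μ ⊑ ψ ⊕ (E ⊕ E))) refl (Ψ≥Mu k k≤L v (deepX v xv) , 0≤E , 0≤E)
              , λ x h → Below-≤ Nu (lin [] (x ∷ eval (Ψ (suc k)) v ∷ E ∷ 1z ∷ []) (λ x φ E o → ((x ⊑ φ ⊕ (⊝ (E ⊕ E ⊕ o))) ∷ (𝟘 ⊑ E) ∷ (𝟘 ⊑ E) ∷ (𝟘 ⊑ o) ∷ []) ⊢ (x ⊑ φ)) refl (h , 0≤E , 0≤E , 0≤1)) (onX-Nu v xv)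
            -- The least admissible D z is below Ψ k + 2E + S; since S ≤ W′ and the gap on X is at
            -- least 4E + W′, it remains under the upper bound.
            ; fibre = λ v xv → let z , h₁ , h₂ , c = fibre-point 1≤D 1≤N (eval lo v) in z , h₁ ,
                lin (D ∷ []) (z ∷ eval (Ψ k) v ∷ eval (Ψ (suc k)) v ∷ E ∷ W′ ‼ ∷ S ‼ ∷ 1z ∷ []) (λ D z ψ φ E w s o →
                  ((D ⊙ z ⊕ o ⊑ ψ ⊕ (E ⊕ E) ⊕ s) ∷ (s ⊑ w) ∷ (ψ ⊕ ((E ⊕ E ⊕ (E ⊕ E)) ⊕ w) ⊑ φ) ∷ []) ⊢ (D ⊙ z ⊑ φ ⊕ (⊝ (E ⊕ E ⊕ o)))) refl
                  (h₂ , S≤W′ , gap v (E + E + (E + E) + W′ ‼) (λ i q → ≤-trans (eq (sym (+-assoc K _ _))) (τ≥E v xv i q))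
                    (lin [] (E ∷ W′ ‼ ∷ []) (λ E w → ((𝟘 ⊑ E) ∷ (𝟘 ⊑ E) ∷ (𝟘 ⊑ E) ∷ (𝟘 ⊑ E) ∷ (𝟘 ⊑ w) ∷ []) ⊢ (𝟘 ⊑ E ⊕ E ⊕ (E ⊕ E) ⊕ w)) refl (0≤E , 0≤E , 0≤E , 0≤E , 0≤W′))) , c
            ; start = λ z v x → z , done ,
                ≤-trans (lin [] (eval (Ψ k) v ∷ E ∷ []) (λ ψ E → ((𝟘 ⊑ E) ∷ []) ⊢ (ψ ⊕ E ⊑ ψ ⊕ (E ⊕ E))) refl 0≤E) (proj₁ (proj₂ x)) ,
                ≤-trans (proj₁ (proj₂ (proj₂ x))) (lin [] (eval (Ψ (suc k)) v ∷ E ∷ 1z ∷ []) (λ φ E o → ((𝟘 ⊑ E) ∷ (𝟘 ⊑ o) ∷ []) ⊢ (φ ⊕ (⊝ (E ⊕ E ⊕ o)) ⊑ φ ⊖ₑ E)) refl (0≤E , 0≤1)) ,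
                0z , eqn (N ∷ []) (z ∷ []) (λ N z → z ⊑ z ⊕ N ⊙ 𝟘) refl
            }

          up-zero : ∀ {l r} → (l , r) ∈ rays → suc k ℕ.≤ l → slope hiᵢ r ≡ 0ℤ
          up-zero {l} {r} i h = trans (up-≡ r) (slope-Ψ-zero i (suc k) (ℕₚ.m≤n⇒m≤1+n g≤k) h)

          up-positive : ∀ {l r} → (l , r) ∈ rays → ∀ j → lookup newI j ≡ true → raise′ k l ℕ.< splitP k j → 1ℤ ℤ.≤ lookup ((N ℤ.* slope hiᵢ r) ∷ Vec.map (S ℤ.*_) r) j
          up-positive {l} {r} i zero _ h = from (raise′? k l) h
            where
              from : ∀ {b} → Raise (suc k) l b → b ℕ.< suc k → 1ℤ ℤ.≤ N ℤ.* slope hiᵢ r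
              from (same q) _ = 1≤*′ 1≤N (subst (1ℤ ℤ.≤_) (sym (up-≡ r)) (slope-Ψ-pos i (suc k) q k<L))
              from (more q) h = ⊥-elim (ℕₚ.<⇒≱ h (ℕₚ.m≤n⇒m≤1+n q))
          up-positive i (suc j) t h = old-positive i j t (raise′-<⇒ {k} h)

          up-vanishing : ∀ {l r} → (l , r) ∈ rays → ∀ j → lookup newI j ≡ false ⊎ splitP k j ℕ.≤ raise′ k l → lookup ((N ℤ.* slope hiᵢ r) ∷ Vec.map (S ℤ.*_) r) j ≡ 0ℤ
          up-vanishing {l} {r} i zero (inj₂ h) = from (raise′? k l) h
            where
              from : ∀ {b} → Raise (suc k) l b → suc k ℕ.≤ b → N ℤ.* slope hiᵢ r ≡ 0ℤ
              from (same q) h = ⊥-elim (ℕₚ.<⇒≱ q h)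
              from (more q) _ = *0 N (up-zero i q)
          up-vanishing i (suc j) (inj₁ h) = old-vanishing i j (inj₁ h)
          up-vanishing i (suc j) (inj₂ h) = old-vanishing i j (inj₂ (raise′-≤⇒ {k} h))

          up-onto : ∀ {r} → slope (tauAt {k} onto) ((N ℤ.* slope hiᵢ r) ∷ Vec.map (S ℤ.*_) r) ≡ S ℤ.* slope (τ k) r
          up-onto {r} = trans (slope-onto k (slope hiᵢ r) r) (cong (S ℤ.*_) (trans (cong (λ x → x ℤ.+ ℤ.- ψ) (trans (up-≡ r) (slope-step g≤k r)))
              (trans (cong (ℤ._+ ℤ.- ψ) (ℤₚ.+-comm ψ t)) (trans (ℤₚ.+-assoc t ψ (ℤ.- ψ)) (trans (cong (λ x → t ℤ.+ x) (ℤₚ.+-inverseʳ ψ)) (ℤₚ.+-identityʳ t))))))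
            where
              ψ = slope (Ψ k) r
              t = slope (τ k) r

          up-next : ∀ {r} → slope (tauAt {k} next) ((N ℤ.* slope hiᵢ r) ∷ Vec.map (S ℤ.*_) r) ≡ 0ℤ
          up-next {r} = trans (slope-next k (slope hiᵢ r) r) (*0 S (trans (cong (λ x → slope (Ψ (suc k)) r ℤ.+ ℤ.- x) (up-≡ r)) (ℤₚ.+-inverseʳ (slope (Ψ (suc k)) r))))

          up-τ : ∀ {l r} → (l , r) ∈ rays → ∀ {b} → Raise (suc k) l b → (pl : Place k b) → slope (tauAt pl) ((N ℤ.* slope hiᵢ r) ∷ Vec.map (S ℤ.*_) r) ≡ W′
          up-τ {l} {r} i (same q) (under h) = old-τ depth (N ℤ.* slope hiᵢ r) i
          up-τ i (same q) onto = trans up-onto (cong (S ℤ.*_) (slope-τ i))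
          up-τ i (same q) next = ⊥-elim (ℕₚ.<-irrefl refl q)
          up-τ i (same q) (over h) = ⊥-elim (ℕₚ.<-irrefl refl (ℕₚ.<-trans h (ℕₚ.≤-pred q)))
          up-τ i (more q) (under h) = ⊥-elim (ℕₚ.<-irrefl refl (ℕₚ.<-trans (ℕₚ.<-trans (ℕₚ.n<1+n _) h) q))
          up-τ i (more q) onto = ⊥-elim (ℕₚ.<-irrefl refl (ℕₚ.<-trans (ℕₚ.n<1+n _) q))
          up-τ i (more q) next = ⊥-elim (ℕₚ.<-irrefl refl q)
          up-τ {l} {r} i (more q) (over h) = old-τ depth (N ℤ.* slope hiᵢ r) i

          up-τ₀ : ∀ {l r} → (l , r) ∈ rays → ∀ {b} → Raise (suc k) l b → ∀ i → (pl : Place k i) → i ℕ.< suc L → i ≢ b → slope (tauAt pl) ((N ℤ.* slope hiᵢ r) ∷ Vec.map (S ℤ.*_) r) ≡ 0ℤ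
          up-τ₀ {l} {r} j (same q) i (under h) _ ne = old-τ₀ depth (N ℤ.* slope hiᵢ r) j i (ℕₚ.<-≤-trans h k≤L) ne
          up-τ₀ {l} {r} j (more q) i (under h) _ ne = old-τ₀ depth (N ℤ.* slope hiᵢ r) j i (ℕₚ.<-≤-trans h k≤L) (λ e → ℕₚ.<⇒≱ h (subst (k ℕ.≤_) (sym e) (ℕₚ.<⇒≤ q)))
          up-τ₀ {l} {r} j ra i onto _ ne = trans (up-onto {r}) (*0 S (slope-τ₀ j k k<L (λ e → ne (at-onto e ra))))
            where
              at-onto : ∀ {b} → k ≡ l → Raise (suc k) l b → k ≡ b
              at-onto refl (same q) = refl
              at-onto refl (more q) = ⊥-elim (ℕₚ.<-irrefl refl q)
          up-τ₀ {l} {r} j _ i next _ _ = up-next {r}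
          up-τ₀ {l} {r} j (same q) i (over h) h′ ne = old-τ₀ depth (N ℤ.* slope hiᵢ r) j _ (ℕₚ.≤-pred h′) (λ e → ℕₚ.<⇒≱ (ℕₚ.≤-trans q h) (ℕₚ.≤-reflexive e))
          up-τ₀ {l} {r} j (more q) i (over h) h′ ne = old-τ₀ depth (N ℤ.* slope hiᵢ r) j _ (ℕₚ.≤-pred h′) (λ e → ne (cong suc e))

          top-zero : ∀ {l r} → (l , r) ∈ newRays → suc k ℕ.≤ l → slope top r ≡ 0ℤ
          top-zero i h = elim (λ l r → suc k ℕ.≤ l → slope top r ≡ 0ℤ) (λ {l} i h → low-vanishing {l} i zero (inj₂ h)) (λ {l} i h → up-vanishing {l} i zero (inj₂ h)) (λ ()) i h

          rep-next : Rep newI X′ newRays (suc (suc k)) (tauAt {k} next)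
          rep-next = Rep-shift (1ℤ ⊡ up (Ψ (suc k)) ⊞ (ℤ.- D) ⊡ top) E (Rep-⊞ {F = 1ℤ ⊡ up (Ψ (suc k))} {F′ = (ℤ.- D) ⊡ top}
              (Rep-Ext {F = up (Ψ (suc k))} 1ℤ (Ext-upΨ (suc k) (ℕₚ.m≤n⇒m≤1+n g≤k) k<L) van)
              (Rep-Ext {F = top} (ℤ.- D) Ext-top (λ i q → top-zero i (ℕₚ.<⇒≤ q))))
            where
              from : ∀ {l b k′} → Raise k′ l b → suc (suc k) ℕ.≤ b → suc k ℕ.≤ l
              from (same _) q = ℕₚ.<⇒≤ q
              from (more _) q = ℕₚ.≤-pred q
              van : Vanishes newRays (suc (suc k)) (up (Ψ (suc k)))
              van i q = elim (λ l r → suc (suc k) ℕ.≤ l → slope (up (Ψ (suc k))) r ≡ 0ℤ)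
                (λ {l} {r} j q → upΨ-zero (suc k) (ℕₚ.m≤n⇒m≤1+n g≤k) {κ = N ℤ.* slope loᵢ r} j (from (raise? k l) q))
                (λ {l} {r} j q → upΨ-zero (suc k) (ℕₚ.m≤n⇒m≤1+n g≤k) {κ = N ℤ.* slope hiᵢ r} j (from (raise′? k l) q)) (λ ()) i q

          relevel : ∀ {l l′ r} → l ≡ l′ → (l , r) ∈ newRays → ∃ λ r → (l′ , r) ∈ newRays
          relevel {r = r} refl i = r , i

          split-cover : ∀ {i} → Place k i → i ℕ.< suc L → ∃ λ r → (i , r) ∈ newRays
          split-cover (under h) _ = relevel (raise-same h) (low∈ (proj₂ (covers _ (ℕₚ.<-≤-trans h k≤L))))
          split-cover onto _ = relevel (raise′-same ℕₚ.≤-refl) (up∈ (proj₂ (covers k k<L)))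
          split-cover next h = relevel (raise-more ℕₚ.≤-refl) (low∈ (proj₂ (covers k k<L)))
          split-cover (over h) h′ = relevel (raise-more (ℕₚ.<⇒≤ h)) (low∈ (proj₂ (covers _ (ℕₚ.≤-pred h′))))

          split-τ≥E : ∀ z v → X′ (z ∷ v) → ∀ {i} → (pl : Place k i) → i ℕ.< suc L → E ≤ eval (tauAt pl) (z ∷ v)
          split-τ≥E z v x (under h) _ = shift-τ≥ z v (proj₁ x) _ (ℕₚ.<-≤-trans h k≤L)
          split-τ≥E z v x onto _ = onto≥E z v x
          split-τ≥E z v (_ , _ , h , _) next _ = lin (D ∷ []) (z ∷ eval (Ψ (suc k)) v ∷ E ∷ 1z ∷ []) (λ D z φ E o → ((D ⊙ z ⊑ φ ⊕ (⊝ (E ⊕ E ⊕ o))) ∷ (𝟘 ⊑ o) ∷ []) ⊢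
              (E ⊑ con 1ℤ ⊙ φ ⊕ (:- D) ⊙ z ⊕ con ℤ.-1ℤ ⊙ E)) refl (h , 0≤1)
          split-τ≥E z v x (over h) h′ = shift-τ≥ z v (proj₁ x) _ (ℕₚ.≤-pred h′)

          split-τ-core : ∀ z v → core′ conditions (z ∷ v) → ∀ {i} → (pl : Place k i) → i ℕ.< suc L → 0z ≤ eval (tauAt pl) (z ∷ v) × eval (tauAt pl) (z ∷ v) ≤ K′
          split-τ-core z v c (under h) _ = shift-τ-core conditions z v c _ (ℕₚ.<-≤-trans h k≤L)
          split-τ-core z v c@(_ , _ , _ , t , l , h , _) onto _ = onto-core≥0 conditions z v c ,
              lin (D ∷ pos n ∷ []) (z ∷ eval (Ψ k) v ∷ eval (Ψ (suc k)) v ∷ eval (τ k) v ∷ E ∷ K ∷ W′ ‼ ∷ unit ∷ []) (λ D n z ψ φ t E K w u →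
                ((D ⊙ z ⊑ φ ⊖ₑ E) ∷ (φ ⊑ ψ ⊕ t ⊖ₑ K) ∷ (t ⊑ K ⊕ (E ⊕ E) ⊕ w ⊕ u ⊕ K ⊕ n ⊙ u) ∷ []) ⊢ (D ⊙ z ⊕ con ℤ.-1ℤ ⊙ ψ ⊕ con ℤ.-1ℤ ⊙ E ⊑ w ⊕ K ⊕ u ⊕ n ⊙ u)) refl
                (h , eq (eval-Ψ-suc g≤k v) , proj₂ (t k k<L))
          split-τ-core z v (_ , _ , _ , t , l , h , _) next _ =
              lin (D ∷ []) (z ∷ eval (Ψ (suc k)) v ∷ E ∷ []) (λ D z φ E → ((D ⊙ z ⊑ φ ⊖ₑ E) ∷ []) ⊢ (𝟘 ⊑ con 1ℤ ⊙ φ ⊕ (:- D) ⊙ z ⊕ con ℤ.-1ℤ ⊙ E)) refl h ,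
              lin (D ∷ pos n ∷ []) (z ∷ eval (Ψ k) v ∷ eval (Ψ (suc k)) v ∷ eval (τ k) v ∷ E ∷ K ∷ W′ ‼ ∷ unit ∷ []) (λ D n z ψ φ t E K w u →
                ((ψ ⊕ E ⊑ D ⊙ z) ∷ (φ ⊑ ψ ⊕ t ⊖ₑ K) ∷ (t ⊑ K ⊕ (E ⊕ E) ⊕ w ⊕ u ⊕ K ⊕ n ⊙ u) ∷ []) ⊢ (con 1ℤ ⊙ φ ⊕ (:- D) ⊙ z ⊕ con ℤ.-1ℤ ⊙ E ⊑ w ⊕ K ⊕ u ⊕ n ⊙ u)) refl
                (l , eq (eval-Ψ-suc g≤k v) , proj₂ (t k k<L))
          split-τ-core z v c (over h) h′ = shift-τ-core conditions z v c _ (ℕₚ.≤-pred h′)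

          split-rep : ∀ {i} → (pl : Place k i) → i ℕ.< suc L → Rep newI X′ newRays (suc i) (tauAt pl)
          split-rep (under h) _ = rep-under _ h (λ ())
          split-rep onto _ = rep-onto (λ ()) top-zero
          split-rep next _ = rep-next
          split-rep (over h) h′ = rep-over _ h (ℕₚ.≤-pred h′) (λ ())

          split-fibre : ∀ v → X v → ∃ λ z → eval (Ψ k ⊞ const (E + E)) v ≤ D · z × Below (just hi) v (D · z) × Cong z
          split-fibre = Conditions.fibre conditions

          split : NewPiece
          split = record
            { X = X′ ; core = core′ conditions ; L = suc L ; p = splitP k ; rays = newRays ; τ = τ′
            ; inhabited = inhabited′ conditions ; X⊆A = X′⊆A′ conditions ; core⊆A = core′⊆A′ conditions
            ; len = length-new ℕ.z≤n
            ; p≤L = λ { zero → ℕ.s≤s k≤L ; (suc j) → Raise-≤ (raise′? k (p j)) (p≤L j) }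
            ; range = elim (λ l _ → l ℕ.< suc L) (λ {l} i → ℕ.s≤s (raise-bound (raise? k l) (range i))) (λ {l} i → ℕ.s≤s (raise-bound (raise′? k l) (range i))) (λ ())
            ; covers = λ l h → split-cover (place k l) h
            ; positive = λ i → elim (λ l r → ∀ j → lookup newI j ≡ true → l ℕ.< splitP k j → 1ℤ ℤ.≤ lookup r j) low-positive up-positive (λ ()) i
            ; vanishing = λ i → elim (λ l r → ∀ j → lookup newI j ≡ false ⊎ splitP k j ℕ.≤ l → lookup r j ≡ 0ℤ) low-vanishing up-vanishing (λ ()) i
            ; moveX = λ i v w 0≤w → proj₁ (moves conditions i v w 0≤w)
            ; moveA = λ i v w 0≤w → proj₂ (moves conditions i v w 0≤w)
            ; slope-τ = elim (λ l r → slope (τ′ l) r ≡ W′) (λ {l} i → low-τ i (raise? k l) (place k _)) (λ {l} i → up-τ i (raise′? k l) (place k _)) (λ ())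
            ; slope-τ₀ = λ i → elim (λ l r → ∀ i → i ℕ.< suc L → i ≢ l → slope (τ′ i) r ≡ 0ℤ)
                (λ {l} j i → low-τ₀ j (raise? k l) i (place k i)) (λ {l} j i → up-τ₀ j (raise′? k l) i (place k i)) (λ ()) i
            ; τ≥E = λ { (z ∷ v) x i → split-τ≥E z v x (place k i) }
            ; τ-core = λ { (z ∷ v) c i → split-τ-core z v c (place k i) }
            ; bounded = bounded′ conditions
            ; decompose = decompose′ conditions
            ; rep = λ i → split-rep (place k i)
            }
            where
              raise-bound : ∀ {k l b} → Raise k l b → l ℕ.< L → b ℕ.≤ L
              raise-bound (same _) h = ℕₚ.<⇒≤ h
              raise-bound (more _) h = h

      -- The slab above Ψ L when there is no upper bound: the vertical direction is a ray of the new level L.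
      module Unbounded (g≤L : g ℕ.≤ L) where
        hiᵢ : Form m
        -- A unit step along the vertical ray raises D z by W′, so a core of this height meets every
        -- vertical line of the slab after finitely or infinitely many such steps in 𝒵.
        hiᵢ = Ψ L ⊞ const E ⊞ const (W′ ‼)

        vertical : Dir (suc m)
        -- Written as the lift of a zero ray with slope W, so that `Slice-move` and `slope-onto`
        -- apply literally.
        vertical = (N ℤ.* W) ∷ Vec.map (S ℤ.*_) zeros

        open Inserted L g≤L nothing hiᵢ ((L , vertical) ∷ []) public

        module _ (noBound : ∀ v x → Below Nu v x) (noSlope : ∀ r x → SlopeBelow Nu r x) where
          open AtMost ℕₚ.≤-refl

          scaled-zeros : ∀ {m} → Vec.map (S ℤ.*_) (zeros {m}) ≡ zeros
          scaled-zeros {zero} = refl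
          scaled-zeros {suc m} = cong₂ _∷_ (ℤₚ.*-zeroʳ S) scaled-zeros

          vert : Vertical
          vert (here refl) = N ℤ.* W , cong ((N ℤ.* W) ∷_) scaled-zeros

          up-≡ : ∀ r → slope hiᵢ r ≡ slope loᵢ r
          up-≡ r = +0 (Ψ L ⊞ const E) (W′ ‼) r

          conditions : Conditions
          conditions = record
            { slope-lo = λ _ → refl ; slope-hi = λ _ → tt
            ; slope-Mu = λ {l} {r} i → subst (slope Mu r ℤ.≤_) (sym (+0 (Ψ L) E r)) (slope-Ψ-mono i {0} {L} ℕ.z≤n ℕₚ.≤-refl)
            ; slope-mid = λ {l} {r} i → ℤₚ.≤-reflexive (sym (up-≡ r))
            ; slope-Nu = λ {l} {r} i → noSlope r _
            ; move-extra = λ { (here refl) u w 0≤w →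
                  Slice-move lo nothing zeros W (λ v w _ → subst X (sym (move-zeros v w))) (subst (ℤ._≤ W) (sym (slope-zeros lo)) (1≤⇒0≤ 1≤W)) tt 1≤S u w 0≤w
                , Slice-move Mu Nu zeros W (λ v w _ → subst A (sym (move-zeros v w))) (subst (ℤ._≤ W) (sym (slope-zeros Mu)) (1≤⇒0≤ 1≤W)) (noSlope _ _) 1≤S u w 0≤w }
            ; deepX = deepX
            ; inner = λ y c cc d h →
                lin [] (eval Mu y ∷ eval (Ψ L) y ∷ E ∷ []) (λ μ ψ E → ((μ ⊑ ψ) ∷ (𝟘 ⊑ E) ∷ []) ⊢ (μ ⊑ ψ ⊕ E)) refl (Ψ≥Mu L ℕₚ.≤-refl y h , 0≤E)
              , lin [] (eval (Ψ L) y + E ∷ W′ ‼ ∷ []) (λ x w → ((𝟘 ⊑ w) ∷ []) ⊢ (x ⊑ x ⊕ w)) refl 0≤W′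
              , noBound y _
            ; onX = λ v xv →
                lin [] (eval Mu v ∷ eval (Ψ L) v ∷ E ∷ []) (λ μ ψ E → ((μ ⊑ ψ) ∷ (𝟘 ⊑ E) ∷ (𝟘 ⊑ E) ∷ []) ⊢ (μ ⊑ ψ ⊕ (E ⊕ E))) refl (Ψ≥Mu L ℕₚ.≤-refl v (deepX v xv) , 0≤E , 0≤E)
              , λ x _ → noBound v x
            ; fibre = λ v xv → let z , h , _ , c = fibre-point 1≤D 1≤N (eval lo v) in z , h , tt , c
            ; start = λ z v x → begin-at z v (proj₁ (proj₂ x))
            }
            where
              begin-at : ∀ z v → eval lo v ≤ D · z → ∃ λ z₀ → Dec ((L , vertical) ∷ []) (z₀ ∷ v) (z ∷ v) × eval loᵢ v ≤ D · z₀ × D · z₀ ≤ eval hiᵢ v × (∃ λ k → z ≡ z₀ + N · k)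
              begin-at z v h = from (divide-nonneg W′ 1≤W′ (D · z + (- eval loᵢ v))
                  (lin (D ∷ []) (z ∷ eval (Ψ L) v ∷ E ∷ []) (λ D z ψ E → ((ψ ⊕ (E ⊕ E) ⊑ D ⊙ z) ∷ (𝟘 ⊑ E) ∷ []) ⊢ (𝟘 ⊑ D ⊙ z ⊖ₑ (ψ ⊕ E))) refl (h , 0≤E)))
                where
                  from : (∃ λ q → 0z ≤ q × W′ · q ≤ D · z + (- eval loᵢ v) × D · z + (- eval loᵢ v) + 1z ≤ W′ · q + W′ ‼) →
                         ∃ λ z₀ → Dec ((L , vertical) ∷ []) (z₀ ∷ v) (z ∷ v) × eval loᵢ v ≤ D · z₀ × D · z₀ ≤ eval hiᵢ v × (∃ λ k → z ≡ z₀ + N · k)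
                  from (q , 0≤q , a , b) = z + (- (N · W · q)) ,
                      step q 0≤q (subst (Dec [] _) (cong₂ _∷_ (eqn (N ∷ W ∷ []) (z ∷ q ∷ []) (λ N W z q → z ⊖ₑ N ⊙ W ⊙ q ⊕ (N :* W) ⊙ q ⊑ z) refl)
                        (trans (cong (λ r → v +[ q ] r) scaled-zeros) (move-zeros v q))) done) ,
                      lin (D ∷ N ∷ W ∷ []) (z ∷ eval loᵢ v ∷ q ∷ []) (λ D N W z x q → ((((D :* N) :* W) ⊙ q ⊑ D ⊙ z ⊖ₑ x) ∷ []) ⊢ (x ⊑ D ⊙ (z ⊖ₑ N ⊙ W ⊙ q))) refl a ,
                      lin (D ∷ N ∷ W ∷ []) (z ∷ eval loᵢ v ∷ q ∷ 1z ∷ []) (λ D N W z x q o → ((D ⊙ z ⊖ₑ x ⊕ o ⊑ ((D :* N) :* W) ⊙ q ⊕ ((D :* N) :* W) ⊙ o) ∷ (𝟘 ⊑ o) ∷ []) ⊢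
                        (D ⊙ (z ⊖ₑ N ⊙ W ⊙ q) ⊑ x ⊕ ((D :* N) :* W) ⊙ o)) refl (b , 0≤1) ,
                      W · q , eqn (N ∷ W ∷ []) (z ∷ q ∷ []) (λ N W z q → z ⊑ z ⊖ₑ N ⊙ W ⊙ q ⊕ N ⊙ W ⊙ q) refl

          raise-L : ∀ {l} → l ℕ.< L → raise′ L l ≡ raise L l
          raise-L h = trans (raise′-same (ℕₚ.<⇒≤ h)) (sym (raise-same h))

          -- The rays that follow the inner upper bound are those that follow the lower one.
          via : (Q : ℕ → Dir (suc m) → Set) → (∀ {l r} → (l , r) ∈ rays → Q (raise L l) ((N ℤ.* slope loᵢ r) ∷ Vec.map (S ℤ.*_) r)) →
                Q L vertical → ∀ {l r} → (l , r) ∈ newRays → Q l r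
          via Q a b = elim Q a (λ {l} {r} i → subst₂ (λ l s → Q l ((N ℤ.* s) ∷ Vec.map (S ℤ.*_) r)) (sym (raise-L (range i))) (sym (up-≡ r)) (a i)) (λ { (here refl) → b })

          vertical-old : ∀ i c → slope (up (τ i) ⊟ const c) vertical ≡ 0ℤ
          vertical-old i c = trans (shift-slope (τ i) c (N ℤ.* W) (Vec.map (S ℤ.*_) zeros)) (trans (cong (slope (τ i)) scaled-zeros) (slope-zeros (τ i)))

          vertical-onto : slope (tauAt {L} onto) vertical ≡ W′
          vertical-onto = trans (slope-onto L W zeros) (cong (S ℤ.*_) (trans (cong (λ s → W ℤ.+ ℤ.- s) (slope-zeros (Ψ L))) (ℤₚ.+-identityʳ W)))

          vertical-τ₀ : ∀ {i} → (pl : Place L i) → i ℕ.< suc L → i ≢ L → slope (tauAt pl) vertical ≡ 0ℤ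
          vertical-τ₀ (under {i} h) _ _ = vertical-old i depth
          vertical-τ₀ onto _ ne = ⊥-elim (ne refl)
          vertical-τ₀ next h _ = ⊥-elim (ℕₚ.<-irrefl refl h)
          vertical-τ₀ (over h) h′ _ = ⊥-elim (ℕₚ.<-asym h (ℕₚ.≤-pred h′))

          vertical-positive : ∀ j → lookup newI j ≡ true → L ℕ.< splitP L j → 1ℤ ℤ.≤ lookup vertical j
          vertical-positive zero _ _ = 1≤*′ 1≤N 1≤W
          vertical-positive (suc j) _ h = ⊥-elim (ℕₚ.<⇒≱ h (subst (ℕ._≤ L) (sym (raise′-same (p≤L j))) (p≤L j)))

          vertical-vanishing : ∀ j → lookup newI j ≡ false ⊎ splitP L j ℕ.≤ L → lookup vertical j ≡ 0ℤ
          vertical-vanishing zero (inj₂ h) = ⊥-elim (ℕₚ.<-irrefl refl h)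
          vertical-vanishing (suc j) _ = trans (cong (λ r → lookup r j) (scaled-zeros {m})) (lookup-zeros j)

          relevel : ∀ {l l′ r} → l ≡ l′ → (l , r) ∈ newRays → ∃ λ r → (l′ , r) ∈ newRays
          relevel {r = r} refl i = r , i

          tail-cover : ∀ {i} → Place L i → i ℕ.< suc L → ∃ λ r → (i , r) ∈ newRays
          tail-cover (under h) _ = relevel (raise-same h) (low∈ (proj₂ (covers _ h)))
          tail-cover onto _ = vertical , extra∈ (here refl)
          tail-cover next h = ⊥-elim (ℕₚ.<-irrefl refl h)
          tail-cover (over h) h′ = ⊥-elim (ℕₚ.<-asym h (ℕₚ.≤-pred h′))

          tail-τ≥E : ∀ z v → X′ (z ∷ v) → ∀ {i} → (pl : Place L i) → i ℕ.< suc L → E ≤ eval (tauAt pl) (z ∷ v)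
          tail-τ≥E z v x (under h) _ = shift-τ≥ z v (proj₁ x) _ h
          tail-τ≥E z v x onto _ = onto≥E z v x
          tail-τ≥E z v x next h = ⊥-elim (ℕₚ.<-irrefl refl h)
          tail-τ≥E z v x (over h) h′ = ⊥-elim (ℕₚ.<-asym h (ℕₚ.≤-pred h′))

          tail-τ-core : ∀ z v → core′ conditions (z ∷ v) → ∀ {i} → (pl : Place L i) → i ℕ.< suc L → 0z ≤ eval (tauAt pl) (z ∷ v) × eval (tauAt pl) (z ∷ v) ≤ K′
          tail-τ-core z v c (under h) _ = shift-τ-core conditions z v c _ h
          tail-τ-core z v c@(_ , _ , _ , _ , l , h , _) onto _ = onto-core≥0 conditions z v c ,
              lin (D ∷ pos n ∷ []) (z ∷ eval (Ψ L) v ∷ E ∷ K ∷ W′ ‼ ∷ unit ∷ []) (λ D n z ψ E K w u →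
                ((D ⊙ z ⊑ ψ ⊕ E ⊕ w) ∷ (𝟘 ⊑ K) ∷ (𝟘 ⊑ u) ∷ (𝟘 ⊑ n ⊙ u) ∷ []) ⊢ (D ⊙ z ⊕ con ℤ.-1ℤ ⊙ ψ ⊕ con ℤ.-1ℤ ⊙ E ⊑ w ⊕ K ⊕ u ⊕ n ⊙ u)) refl
                (h , 0≤K , 0≤unit , ·-nonneg 0≤pos 0≤unit)
          tail-τ-core z v c next h = ⊥-elim (ℕₚ.<-irrefl refl h)
          tail-τ-core z v c (over h) h′ = ⊥-elim (ℕₚ.<-asym h (ℕₚ.≤-pred h′))

          top-zero : ∀ {l r} → (l , r) ∈ newRays → suc L ℕ.≤ l → slope top r ≡ 0ℤ
          top-zero i h = via (λ l r → suc L ℕ.≤ l → slope top r ≡ 0ℤ) (λ {l} i h → low-vanishing {l} i zero (inj₂ h)) (λ h → ⊥-elim (ℕₚ.<-irrefl refl h)) i h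

          tail-rep : ∀ {i} → (pl : Place L i) → i ℕ.< suc L → Rep newI X′ newRays (suc i) (tauAt pl)
          tail-rep (under h) _ = rep-under _ h vert
          tail-rep onto _ = rep-onto vert top-zero
          tail-rep next h = ⊥-elim (ℕₚ.<-irrefl refl h)
          tail-rep (over h) h′ = ⊥-elim (ℕₚ.<-asym h (ℕₚ.≤-pred h′))

          unbounded-fibre : ∀ v → X v → ∃ λ z → eval (Ψ L ⊞ const (E + E)) v ≤ D · z × Below nothing v (D · z) × Cong z
          unbounded-fibre = Conditions.fibre conditions

          unbounded : NewPiece
          unbounded = record
            { X = X′ ; core = core′ conditions ; L = suc L ; p = splitP L ; rays = newRays ; τ = τ′
            ; inhabited = inhabited′ conditions ; X⊆A = X′⊆A′ conditions ; core⊆A = core′⊆A′ conditions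
            ; len = length-new (ℕ.s≤s ℕ.z≤n)
            ; p≤L = λ { zero → ℕₚ.≤-refl ; (suc j) → Raise-≤ (raise′? L (p j)) (p≤L j) }
            ; range = via (λ l _ → l ℕ.< suc L) (λ {l} i → subst (ℕ._< suc L) (sym (raise-same (range i))) (ℕₚ.m≤n⇒m≤1+n (range i))) ℕₚ.≤-refl
            ; covers = λ l h → tail-cover (place L l) h
            ; positive = λ i → via (λ l r → ∀ j → lookup newI j ≡ true → l ℕ.< splitP L j → 1ℤ ℤ.≤ lookup r j) low-positive vertical-positive i
            ; vanishing = λ i → via (λ l r → ∀ j → lookup newI j ≡ false ⊎ splitP L j ℕ.≤ l → lookup r j ≡ 0ℤ) low-vanishing vertical-vanishing i
            ; moveX = λ i v w 0≤w → proj₁ (moves conditions i v w 0≤w)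
            ; moveA = λ i v w 0≤w → proj₂ (moves conditions i v w 0≤w)
            ; slope-τ = via (λ l r → slope (τ′ l) r ≡ W′) (λ {l} i → low-τ i (raise? L l) (place L _)) (trans (cong (λ F → slope F vertical) (τ′-at onto)) vertical-onto)
            ; slope-τ₀ = λ i → via (λ l r → ∀ i → i ℕ.< suc L → i ≢ l → slope (τ′ i) r ≡ 0ℤ)
                (λ {l} j i → low-τ₀ j (raise? L l) i (place L i)) (λ i → vertical-τ₀ (place L i)) i
            ; τ≥E = λ { (z ∷ v) x i → tail-τ≥E z v x (place L i) }
            ; τ-core = λ { (z ∷ v) c i → tail-τ-core z v c (place L i) }
            ; bounded = bounded′ conditions
            ; decompose = decompose′ conditions
            ; rep = λ i → tail-rep (place L i)
            }

      -- The sequence of slabs over one piece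

      gν : ∀ ν → Nu ≡ just ν → ℕ
      gν ν e = Grade.g (gradeNu P ν e)

      gν≤L : ∀ ν e → gν ν e ℕ.≤ L
      gν≤L ν e = Grade.g≤L (gradeNu P ν e)

      -- ν - μ is non-negative on X, so `slope-nonneg` applies to it.
      slope-Mu≤Nu : ∀ ν e {l r} → (l , r) ∈ rays → slope Mu r ℤ.≤ slope ν r
      slope-Mu≤Nu ν e {l} {r} i = ℤₚ.0≤i-j⇒j≤i (subst (0ℤ ℤ.≤_) (cong (λ k → slope ν r ℤ.+ k) (ℤₚ.-1*i≡-i (slope Mu r)))
        (slope-nonneg P (ν ⊟ Mu) (λ v x → lin [] (eval ν v ∷ eval Mu v ∷ []) (λ a b → ((b ⊑ a) ∷ []) ⊢ (𝟘 ⊑ a ⊕ con ℤ.-1ℤ ⊙ b)) refl (Mu≤Nu ν e v (X⊆A v x))) i))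

      module Nu-bounds ν e = WithNu ν (gradeNu P ν e) (slope-Mu≤Nu ν e) (λ i h → W≤Nu ν e _ (Grade.pos-slope (gradeNu P ν e) i h)) (Mu≤Nu ν e)

      -- Along a ray of level gν < g the slope would be at least 1 for μ but 0 for ν.
      g≤gν : ∀ ν e → g ℕ.≤ gν ν e
      g≤gν ν e = from (g ℕ.≤? gν ν e)
        where
          contra : gν ν e ℕ.< g → ⊥
          contra q = let r , i = covers (gν ν e) (ℕₚ.<-≤-trans q g≤L) in
              ℤₚ.<⇒≱ (ℤ.+<+ (ℕ.s≤s ℕ.z≤n)) (ℤₚ.≤-trans (pos-slope i q) (ℤₚ.≤-trans (slope-Mu≤Nu ν e i) (ℤₚ.≤-reflexive (Grade.zero-slope (gradeNu P ν e) i ℕₚ.≤-refl))))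
          from : Relation.Nullary.Dec (g ℕ.≤ gν ν e) → g ℕ.≤ gν ν e
          from (yes q) = q
          from (no q) = ⊥-elim (contra (ℕₚ.≰⇒> q))

      -- Slabs are indexed by pairs (k, b) in lexicographic order, `false` first: (k, false) is the
      -- slab around Ψ k, (k, true) the one from Ψ k to Ψ (k + 1) or to +∞. At the two ends, `first`
      -- and `toNu` use μ and ν themselves.
      data Lower (k : ℕ) : Bool → Set where
        first : k ≡ g → Lower k false
        later : g ℕ.< k → Lower k false
        split : g ℕ.≤ k → Lower k true

      data Upper (k : ℕ) : Bool → Set where
        toNu : ∀ ν e → k ≡ gν ν e → Upper k false
        mid : k ℕ.≤ L → (∀ ν e → k ℕ.< gν ν e) → Upper k false
        toNext : k ℕ.< L → (∀ ν e → k ℕ.< gν ν e) → Upper k true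
        free : k ≡ L → Nu ≡ nothing → Upper k true

      loF : ∀ {k b} → Lower k b → Form m
      loF (first _) = Mu
      loF {k} (later _) = Ψ k ⊞ const (- (E + E))
      loF {k} (split _) = Ψ k ⊞ const (E + E)

      hiF : ∀ {k b} → Upper k b → Maybe (Form m)
      hiF (toNu ν _ _) = just ν
      -- The -1 leaves the value Ψ k + 2E to the slab of index (k, true).
      hiF {k} (mid _ _) = just (Ψ k ⊞ const (E + E + - 1z))
      hiF {k} (toNext _ _) = just (Ψ (suc k) ⊞ const (- (E + E + 1z)))
      hiF (free _ _) = nothing

      levels : Bool → ℕ → Fin (suc m) → ℕ
      levels false k zero = k
      levels false k (suc j) = p j
      levels true k = splitP k

      taus : Bool → ℕ → ℕ → Form (suc m)
      taus false k i = up (τ i) ⊟ const depth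
      taus true k i = tauAt (place k i)

      height : Bool → ℕ
      height false = L
      height true = suc L

      -- What the comparison of slabs over different pieces uses, in a form common to the
      -- constructions `Flat`, `Split` and `Unbounded`.
      record Cell : Set₁ where
        field
          Y : NewPiece
          k : ℕ
          b : Bool
          lower : Lower k b
          upper : Upper k b
          X⇒ : ∀ u → Piece.X Y u → Slice (loF lower) (hiF upper) X u
          X⇐ : ∀ u → Slice (loF lower) (hiF upper) X u → Piece.X Y u
          p≡ : ∀ j → Piece.p Y j ≡ levels b k j
          τ≡ : ∀ i → Piece.τ Y i ≡ taus b k i
          L≡ : Piece.L Y ≡ height b
          fibre : ∀ v → X v → ∃ λ z → Piece.X Y (z ∷ v)

      g≤lower : ∀ {k b} → Lower k b → g ℕ.≤ k
      g≤lower (first e) = ℕₚ.≤-reflexive (sym e)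
      g≤lower (later h) = ℕₚ.<⇒≤ h
      g≤lower (split h) = h

      upper≤L : ∀ {k b} → Upper k b → k ℕ.≤ L
      upper≤L (toNu ν e refl) = gν≤L ν e
      upper≤L (mid h _) = h
      upper≤L (toNext h _) = ℕₚ.<⇒≤ h
      upper≤L (free e _) = ℕₚ.≤-reflexive e

      Deep : Pt m → Set
      Deep y = ∀ i → i ℕ.< L → depth ≤ eval (τ i) y

      deep-gap : ∀ y → Deep y → ∀ {k k′} → g ℕ.≤ k → k ℕ.< k′ → k′ ℕ.≤ L → eval (Ψ k) y + (E + E) ≤ eval (Ψ k′) y
      deep-gap v h = eval-Ψ-gap v (E + E) (λ i q → lin [] (K ∷ E ∷ W′ ‼ ∷ eval (τ i) v ∷ []) (λ K E w t → ((K ⊕ (E ⊕ E) ⊕ w ⊑ t) ∷ (𝟘 ⊑ w) ∷ []) ⊢ (K ⊕ (E ⊕ E) ⊑ t)) refl (h i q , 0≤W′))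
              (lin [] (E ∷ []) (λ E → ((𝟘 ⊑ E) ∷ (𝟘 ⊑ E) ∷ []) ⊢ (𝟘 ⊑ E ⊕ E)) refl (0≤E , 0≤E))

      wide-gap : ∀ v → X v → ∀ {k k′} → g ℕ.≤ k → k ℕ.< k′ → k′ ℕ.≤ L → eval (Ψ k) v + (E + E + (E + E)) ≤ eval (Ψ k′) v
      wide-gap v xv = eval-Ψ-gap v (E + E + (E + E)) (λ i q → lin [] (K ∷ E ∷ W′ ‼ ∷ eval (τ i) v ∷ []) (λ K E w t → ((K ⊕ (E ⊕ E ⊕ (E ⊕ E)) ⊕ w ⊑ t) ∷ (𝟘 ⊑ w) ∷ []) ⊢ (K ⊕ (E ⊕ E ⊕ (E ⊕ E)) ⊑ t)) refl (τ≥E v xv i q , 0≤W′))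
              (lin [] (E ∷ []) (λ E → ((𝟘 ⊑ E) ∷ (𝟘 ⊑ E) ∷ (𝟘 ⊑ E) ∷ (𝟘 ⊑ E) ∷ []) ⊢ (𝟘 ⊑ E ⊕ E ⊕ (E ⊕ E))) refl (0≤E , 0≤E , 0≤E , 0≤E))

      Mu≡Ψ : eval Mu ≡ eval (Ψ g)
      Mu≡Ψ = cong eval (sym (Ψ-low g ℕₚ.≤-refl))

      lower-slope : ∀ {k} (lw : Lower k false) r → slope (loF lw) r ≡ slope (Ψ k) r
      lower-slope (first refl) r = cong (λ F → slope F r) (sym (Ψ-low g ℕₚ.≤-refl))
      lower-slope {k} (later _) r = +0 (Ψ k) (- (E + E)) r

      lower-eval : ∀ {k} (lw : Lower k false) → k ℕ.≤ L → ∀ y → Deep y → eval Mu y ≤ eval (loF lw) y × eval (loF lw) y ≤ eval (Ψ k) y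
      lower-eval (first refl) _ y dp = ≤-refl , eq (cong (λ f → f y) Mu≡Ψ)
      lower-eval {k} (later h) k≤L y dp =
          lin [] (eval Mu y ∷ eval (Ψ g) y ∷ eval (Ψ k) y ∷ E ∷ []) (λ μ x y E → ((μ ⊑ x) ∷ (x ⊕ (E ⊕ E) ⊑ y) ∷ []) ⊢ (μ ⊑ y ⊕ (⊝ (E ⊕ E)))) refl (eq (cong (λ f → f y) Mu≡Ψ) , deep-gap y dp ℕₚ.≤-refl h k≤L)
        , lin [] (eval (Ψ k) y ∷ E ∷ []) (λ y E → ((𝟘 ⊑ E) ∷ (𝟘 ⊑ E) ∷ []) ⊢ (y ⊕ (⊝ (E ⊕ E)) ⊑ y)) refl (0≤E , 0≤E)

      record UpperForm (k : ℕ) (up : Upper k false) : Set where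
        field
          F : Form m
          hi≡ : hiF up ≡ just F
          slope≥ : ∀ {l r} → (l , r) ∈ rays → slope (Ψ k) r ℤ.≤ slope F r
          slope-zero : ∀ {l r} → (l , r) ∈ rays → k ℕ.≤ l → slope F r ≡ 0ℤ
          slope-Nu : ∀ {l r} → (l , r) ∈ rays → SlopeBelow Nu r (slope F r)
          eval≥ : ∀ y c → core c → Dec rays c y → Deep y → eval (Ψ k) y ≤ eval F y × Below Nu y (eval F y)

      by-Nu : (Q : Maybe (Form m) → Set) → Q nothing → (∀ ν → Nu ≡ just ν → Q (just ν)) → Q Nu
      by-Nu = byMaybe Nu

      upperForm : ∀ {k} → g ℕ.≤ k → (u : Upper k false) → UpperForm k u
      upperForm {k} g≤k (toNu ν e k≡) = record { F = ν ; hi≡ = refl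
        ; slope≥ = λ i → Nu-bounds.slope-Ψ≤Nu ν e i k g≤k (ℕₚ.≤-reflexive k≡)
        ; slope-zero = λ i h → Grade.zero-slope (gradeNu P ν e) i (subst (ℕ._≤ _) k≡ h)
        ; slope-Nu = λ {l} {r} _ → subst (λ N → SlopeBelow N r (slope ν r)) (sym e) ℤₚ.≤-refl
        ; eval≥ = λ y c cc d dp → subst (λ k → eval (Ψ k) y ≤ eval ν y) (sym k≡) (Nu-bounds.Ψ≤Nu ν e (g≤gν ν e) c y cc d)
                                , subst (λ N → Below N y (eval ν y)) (sym e) ≤-refl }
      upperForm {k} g≤k (mid k≤L k<) = record { F = F ; hi≡ = refl
        ; slope≥ = λ {l} {r} i → ℤₚ.≤-reflexive (sym (+0 (Ψ k) (E + E + - 1z) r))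
        ; slope-zero = λ {l} {r} i h → trans (+0 (Ψ k) (E + E + - 1z) r) (slope-Ψ-zero i k g≤k h)
        ; slope-Nu = λ {l} {r} i → by-Nu (λ N → SlopeBelow N r (slope F r)) tt (λ ν e →
            subst (ℤ._≤ slope ν r) (sym (+0 (Ψ k) (E + E + - 1z) r)) (Nu-bounds.slope-Ψ≤Nu ν e i k g≤k (ℕₚ.<⇒≤ (k< ν e))))
        ; eval≥ = λ y c cc d dp →
            lin [] (eval (Ψ k) y ∷ E ∷ 1z ∷ []) (λ y E o → ((o ⊑ E) ∷ (𝟘 ⊑ E) ∷ []) ⊢ (y ⊑ y ⊕ (E ⊕ E ⊖ₑ o))) refl (1≤E , 0≤E)
          , by-Nu (λ N → Below N y (eval F y)) tt (λ ν e →
              lin [] (eval (Ψ k) y ∷ eval (Ψ (gν ν e)) y ∷ eval ν y ∷ E ∷ 1z ∷ []) (λ x y z E o → ((x ⊕ (E ⊕ E) ⊑ y) ∷ (y ⊑ z) ∷ (𝟘 ⊑ o) ∷ []) ⊢ (x ⊕ (E ⊕ E ⊖ₑ o) ⊑ z)) refl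
                (deep-gap y dp g≤k (k< ν e) (gν≤L ν e) , Nu-bounds.Ψ≤Nu ν e (g≤gν ν e) c y cc d , 0≤1)) }
        where F = Ψ k ⊞ const (E + E + - 1z)

      flat-fibre : ∀ {k} (lw : Lower k false) (u : Upper k false) → ∀ v → X v → ∃ λ z → eval (loF lw) v ≤ D · z × Below (hiF u) v (D · z) × Cong z
      -- If a single slab reaches from μ to ν, it may be too narrow for `fibre-point`; its fibres
      -- are then those of the given precell, which are non-empty.
      flat-fibre {k} (first refl) (toNu ν e k≡) v xv = let z , l , h , c = fibreA v (X⊆A v xv) in z , l , subst (λ N → Below N v (D · z)) e h , c
      -- The slab starts 2E below Ψ k ≤ ν, and S ≤ E.
      flat-fibre {k} (later h) (toNu ν e k≡) v xv = let z , l , h′ , c = fibre-point 1≤D 1≤N (eval (Ψ k) v + - (E + E)) ; cc = decompose v xv in z , l ,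
          lin (D ∷ []) (z ∷ eval (Ψ k) v ∷ eval ν v ∷ E ∷ S ‼ ∷ 1z ∷ []) (λ D z x ν E s o → ((D ⊙ z ⊕ o ⊑ x ⊕ (⊝ (E ⊕ E)) ⊕ s) ∷ (s ⊑ E) ∷ (𝟘 ⊑ E) ∷ (𝟘 ⊑ o) ∷ (x ⊑ ν) ∷ []) ⊢ (D ⊙ z ⊑ ν)) refl
            (h′ , S≤E , 0≤E , 0≤1 , proj₁ (UpperForm.eval≥ (upperForm (ℕₚ.<⇒≤ h) (toNu ν e k≡)) v (proj₁ cc) (proj₁ (proj₂ cc)) (proj₂ (proj₂ cc)) (deepX v xv))) , c
      flat-fibre {k} lw (mid k≤L k<) v xv = let z , l , h′ , c = fibre-point 1≤D 1≤N (eval (loF lw) v) in z , l ,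
          lin (D ∷ []) (z ∷ eval (loF lw) v ∷ eval (Ψ k) v ∷ E ∷ S ‼ ∷ 1z ∷ []) (λ D z l x E s o → ((D ⊙ z ⊕ o ⊑ l ⊕ s) ∷ (s ⊑ E) ∷ (𝟘 ⊑ E) ∷ (l ⊑ x) ∷ []) ⊢ (D ⊙ z ⊑ x ⊕ (E ⊕ E ⊖ₑ o))) refl
            (h′ , S≤E , 0≤E , proj₂ (lower-eval lw k≤L v (deepX v xv))) , c

      flatCell : ∀ {k} → Lower k false → Upper k false → Cell
      flatCell {k} lw u = build (upperForm (g≤lower lw) u)
        where
          build : UpperForm k u → Cell
          build uf = record
              { Y = Flat.flat k (loF lw) F fc ; k = k ; b = false ; lower = lw ; upper = u
              ; X⇒ = λ { (z ∷ v) (x , l , h , c) → x , l , subst (λ H → Below H v (D · z)) (sym hi≡) h , c }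
              ; X⇐ = λ { (z ∷ v) (x , l , h , c) → x , l , subst (λ H → Below H v (D · z)) hi≡ h , c }
              ; p≡ = λ { zero → refl ; (suc j) → refl } ; τ≡ = λ i → refl ; L≡ = refl
              ; fibre = λ v xv → let z , l , h , c = flat-fibre lw u v xv in z , xv , l , subst (λ H → Below H v (D · z)) hi≡ h , c }
            where
              open UpperForm uf
              k≤L = upper≤L u
              fc : Flat.FlatConditions k (loF lw) F
              fc = record { k≤L = k≤L
                ; lo-pos = λ {l} {r} i h → subst (1ℤ ℤ.≤_) (sym (lower-slope lw r)) (slope-Ψ-pos i k h k≤L)
                ; lo-zero = λ {l} {r} i h → trans (lower-slope lw r) (slope-Ψ-zero i k (g≤lower lw) h)
                ; hi-zero = slope-zero
                ; slope-mid = λ {l} {r} i → subst (ℤ._≤ slope F r) (sym (lower-slope lw r)) (slope≥ i)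
                ; slope-Mu = λ {l} {r} i → subst (slope Mu r ℤ.≤_) (sym (lower-slope lw r)) (slope-Ψ-mono i {0} {k} ℕ.z≤n k≤L)
                ; slope-Nu = slope-Nu
                ; inner = λ y c cc d dp → proj₁ (lower-eval lw k≤L y dp) , ≤-trans (proj₂ (lower-eval lw k≤L y dp)) (proj₁ (eval≥ y c cc d dp)) , proj₂ (eval≥ y c cc d dp)
                ; onX = λ v xv → proj₁ (lower-eval lw k≤L v (deepX v xv)) , λ x h → Below-≤ Nu h (let c , cc , d = decompose v xv in proj₂ (eval≥ v c cc d (deepX v xv)))
                ; fibre = λ v xv → let z , l , h , c = flat-fibre lw u v xv in z , l , subst (λ H → Below H v (D · z)) hi≡ h , c }

      splitCell : ∀ {k} → g ℕ.≤ k → k ℕ.< L → (∀ ν e → k ℕ.< gν ν e) → Cell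
      splitCell {k} g≤k k<L k< = record
          { Y = Split.split k g≤k sc ; k = k ; b = true ; lower = split g≤k ; upper = toNext k<L k<
          ; X⇒ = λ { (z ∷ v) x → x } ; X⇐ = λ { (z ∷ v) x → x } ; p≡ = λ _ → refl ; τ≡ = λ _ → refl ; L≡ = refl
          ; fibre = λ v xv → let z , f = Split.split-fibre k g≤k sc v xv in z , xv , f }
        where
          below-Nu : ∀ y c → core c → Dec rays c y → Deep y → Below Nu y (eval (Ψ (suc k)) y)
          below-Nu y c cc d dp = by-Nu (λ N → Below N y (eval (Ψ (suc k)) y)) tt (λ ν e → ≤-trans
              (eval-Ψ-mono y (λ i q → ≤-trans K≤depth (dp i q)) (k< ν e) (gν≤L ν e)) (Nu-bounds.Ψ≤Nu ν e (g≤gν ν e) c y cc d))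
          sc : Split.SplitConditions k g≤k
          sc = record { k<L = k<L
            ; slope-Nu = λ {l} {r} i → by-Nu (λ N → SlopeBelow N r (slope (Ψ (suc k)) r)) tt (λ ν e → Nu-bounds.slope-Ψ≤Nu ν e i (suc k) (ℕₚ.m≤n⇒m≤1+n g≤k) (k< ν e))
            ; inner-Nu = below-Nu
            ; onX-Nu = λ v xv → let c , cc , d = decompose v xv in below-Nu v c cc d (deepX v xv) }

      freeCell : Nu ≡ nothing → Cell
      freeCell e = record
          { Y = Unbounded.unbounded g≤L noBound noSlope ; k = L ; b = true ; lower = split g≤L ; upper = free refl e
          ; X⇒ = λ { (z ∷ v) x → x } ; X⇐ = λ { (z ∷ v) x → x } ; p≡ = λ _ → refl ; τ≡ = λ _ → refl ; L≡ = refl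
          ; fibre = λ v xv → let z , f = Unbounded.unbounded-fibre g≤L noBound noSlope v xv in z , xv , f }
        where
          noBound : ∀ v x → Below Nu v x
          noBound v x = subst (λ N → Below N v x) (sym e) tt
          noSlope : ∀ r x → SlopeBelow Nu r x
          noSlope r x = subst (λ N → SlopeBelow N r x) (sym e) tt

      -- The upper bound of a split slab tends to infinity along the rays of level k, while its lower bound is constant.
      grow : ∀ {k} → g ℕ.≤ k → k ℕ.< L → ∀ v x → X v → eval (Ψ k) v + (E + E) ≤ x →
             ∃ λ v′ → AgreeOn (J k) v v′ × X v′ × eval (Ψ k) v′ + (E + E) ≤ x × x ≤ eval (Ψ (suc k)) v′ + (- (E + E + 1z))
      grow {k} g≤k k<L v x xv l = along (covers k k<L)
        where
          F = Ψ (suc k)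
          w = max 0z (x + (E + E + 1z) + (- eval F v))
          0≤w : 0z ≤ w
          0≤w = x≤max 0z _
          along : (∃ λ r → (k , r) ∈ rays) → ∃ λ v′ → AgreeOn (J k) v v′ × X v′ × eval (Ψ k) v′ + (E + E) ≤ x × x ≤ eval (Ψ (suc k)) v′ + (- (E + E + 1z))
          along (r , i) = v +[ w ] r , ray-agree P i v w ℕₚ.≤-refl , moveX i v w 0≤w xv
            , lin (slope (Ψ k) r ∷ []) (eval (Ψ k) v ∷ eval (Ψ k) (v +[ w ] r) ∷ E ∷ x ∷ w ∷ []) (λ s x y E z w →
                ((x ⊕ (E ⊕ E) ⊑ z) ∷ (y ⊑ x ⊕ s ⊙ w) ∷ (s ⊙ w ⊑ con 0ℤ ⊙ w) ∷ []) ⊢ (y ⊕ (E ⊕ E) ⊑ z)) refl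
                (l , eq (eval-move (Ψ k) v w r) , ·-monoˡ (ℤₚ.≤-reflexive (slope-Ψ-zero i k g≤k ℕₚ.≤-refl)) 0≤w)
            , lin (slope F r ∷ []) (eval F v ∷ eval F (v +[ w ] r) ∷ E ∷ 1z ∷ x ∷ w ∷ []) (λ s x y E o z w →
                ((x ⊕ s ⊙ w ⊑ y) ∷ (w ⊑ s ⊙ w) ∷ (z ⊕ (E ⊕ E ⊕ o) ⊖ₑ x ⊑ w) ∷ []) ⊢ (z ⊑ y ⊕ (⊝ (E ⊕ E ⊕ o)))) refl
                (eq≥ (eval-move F v w r) , ·-grow (slope-Ψ-pos i (suc k) ℕₚ.≤-refl k<L) 0≤w , y≤max 0z _)

      -- `gν` depends on the equality proof as well, which is dealt with by uniqueness of identity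
      -- proofs.
      gν-unique : ∀ {ν ν′} (e : Nu ≡ just ν) (e′ : Nu ≡ just ν′) → gν ν e ≡ gν ν′ e′
      gν-unique {ν} {ν′} e e′ = from (trans (sym e) e′)
        where
          from : just ν ≡ just ν′ → gν ν e ≡ gν ν′ e′
          from refl = cong (gν ν) (uip e e′)
            where
              uip : ∀ {A : Set} {x y : A} (p q : x ≡ y) → p ≡ q
              uip refl refl = refl

      -- The lower end of the slab of index (k, b), apart from the first slab, which starts at μ.
      boundary : ℕ → Bool → Pt m → Z
      boundary k false v = eval (Ψ k) v + - (E + E)
      boundary k true v = eval (Ψ k) v + (E + E)

      next-boundary : ℕ → Bool → Pt m → Z
      next-boundary k false v = boundary k true v
      next-boundary k true v = boundary (suc k) false v

      data Last (k : ℕ) : Bool → Set where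
        lastNu : ∀ ν (e : Nu ≡ just ν) → k ≡ gν ν e → Last k false
        lastFree : k ≡ L → Last k true

      edge-lo : ∀ {k b} (lw : Lower k b) → g ℕ.< k ⊎ b ≡ true → ∀ v {x} → eval (loF lw) v ≤ x → boundary k b v ≤ x
      edge-lo (first refl) (inj₁ h) v l = ⊥-elim (ℕₚ.<-irrefl refl h)
      edge-lo (later _) _ v l = l
      edge-lo (split _) _ v l = l

      edge-hi : ∀ {k b} (u : Upper k b) → ∀ v {x} → Below (hiF u) v x → x + 1z ≤ next-boundary k b v ⊎ Last k b
      edge-hi (toNu ν e k≡) v h = inj₂ (lastNu ν e k≡)
      edge-hi {k} (mid _ _) v {x} h = inj₁ (lin [] (x ∷ eval (Ψ k) v ∷ E ∷ 1z ∷ []) (λ x y E o → ((x ⊑ y ⊕ (E ⊕ E ⊖ₑ o)) ∷ []) ⊢ (x ⊕ o ⊑ y ⊕ (E ⊕ E))) refl h)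
      edge-hi {k} (toNext _ _) v {x} h = inj₁ (lin [] (x ∷ eval (Ψ (suc k)) v ∷ E ∷ 1z ∷ []) (λ x y E o → ((x ⊑ y ⊕ (⊝ (E ⊕ E ⊕ o))) ∷ []) ⊢ (x ⊕ o ⊑ y ⊕ (⊝ (E ⊕ E)))) refl h)
      edge-hi (free k≡ _) v h = inj₂ (lastFree k≡)

      Before : ℕ → Bool → ℕ → Bool → Set
      Before k b k′ b′ = k ℕ.< k′ ⊎ (k ≡ k′ × b ≡ false × b′ ≡ true)

      step-lin : ∀ {k k′} v → X v → g ℕ.≤ k → k ℕ.< k′ → k′ ℕ.≤ L → boundary k true v ≤ boundary k′ false v
      step-lin {k} {k′} v xv g≤k h k′≤L = lin [] (eval (Ψ k) v ∷ eval (Ψ k′) v ∷ E ∷ []) (λ x y E → ((x ⊕ (E ⊕ E ⊕ (E ⊕ E)) ⊑ y) ∷ []) ⊢ (x ⊕ (E ⊕ E) ⊑ y ⊕ (⊝ (E ⊕ E)))) refl (wide-gap v xv g≤k h k′≤L)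

      false≤true : ∀ {k} v → boundary k false v ≤ boundary k true v
      false≤true {k} v = lin [] (eval (Ψ k) v ∷ E ∷ []) (λ x E → ((𝟘 ⊑ E) ∷ (𝟘 ⊑ E) ∷ (𝟘 ⊑ E) ∷ (𝟘 ⊑ E) ∷ []) ⊢ (x ⊕ (⊝ (E ⊕ E)) ⊑ x ⊕ (E ⊕ E))) refl (0≤E , 0≤E , 0≤E , 0≤E)

      boundary-mono : ∀ v → X v → ∀ {k b k′ b′} → g ℕ.≤ k → k′ ℕ.≤ L → Before k b k′ b′ → next-boundary k b v ≤ boundary k′ b′ v
      boundary-mono v xv g≤k k′≤L (inj₂ (refl , refl , refl)) = ≤-refl
      boundary-mono v xv {k} {b} {k′} {b′} g≤k k′≤L (inj₁ h) = ≤-trans (early b) (late b′)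
        where
          early : ∀ b → next-boundary k b v ≤ boundary k′ false v
          early false = step-lin v xv g≤k h k′≤L
          early true = from (ℕₚ.m≤n⇒m<n∨m≡n h)
            where
              from : suc k ℕ.< k′ ⊎ suc k ≡ k′ → boundary (suc k) false v ≤ boundary k′ false v
              from (inj₁ q) = ≤-trans (false≤true {suc k} v) (step-lin v xv (ℕₚ.m≤n⇒m≤1+n g≤k) q k′≤L)
              from (inj₂ refl) = ≤-refl
          late : ∀ b′ → boundary k′ false v ≤ boundary k′ b′ v
          late false = ≤-refl
          late true = false≤true {k′} v

      -- The points of a slab that is not the last lie strictly below its `next-boundary`, which is
      -- below every later boundary.
      overtake : ∀ {k b k′ b′} (u : Upper k b) v {x} → X v → g ℕ.≤ k → k′ ℕ.≤ L → Before k b k′ b′ → Below (hiF u) v x → boundary k′ b′ v ≤ x → Last k b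
      overtake {k} {b} {k′} {b′} u v {x} xv g≤k k′≤L bef h l = from (edge-hi u v h)
        where
          from : x + 1z ≤ next-boundary k b v ⊎ Last k b → Last k b
          from (inj₁ q) = ⊥-elim (absurd (lin [] (x ∷ 1z ∷ boundary k′ b′ v ∷ next-boundary k b v ∷ []) (λ x o y n → ((x ⊕ o ⊑ n) ∷ (n ⊑ y) ∷ (y ⊑ x) ∷ []) ⊢ (o ⊑ 𝟘)) refl
            (q , boundary-mono v xv g≤k k′≤L bef , l)))
          from (inj₂ q) = q

      beyond-last : ∀ {k b k′ b′} → Last k b → Before k b k′ b′ → Upper k′ b′ → ⊥
      beyond-last (lastFree refl) (inj₁ h) u = ℕₚ.<⇒≱ h (upper≤L u)
      beyond-last (lastNu ν e refl) (inj₁ h) (toNu ν′ e′ q) = ℕₚ.<⇒≢ h (trans (gν-unique e e′) (sym q))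
      beyond-last (lastNu ν e refl) (inj₁ h) (mid _ f) = ℕₚ.<-asym h (f ν e)
      beyond-last (lastNu ν e refl) (inj₁ h) (toNext _ f) = ℕₚ.<-asym h (f ν e)
      beyond-last (lastNu ν e refl) (inj₁ h) (free _ e′) = nothing≢just (trans (sym e′) e)
      beyond-last (lastNu ν e refl) (inj₂ (refl , _ , refl)) (toNext _ f) = ℕₚ.<-irrefl refl (f ν e)
      beyond-last (lastNu ν e refl) (inj₂ (refl , _ , refl)) (free _ e′) = nothing≢just (trans (sym e′) e)

      after-first : ∀ {k b k′ b′} → g ℕ.≤ k → Before k b k′ b′ → g ℕ.< k′ ⊎ b′ ≡ true
      after-first h (inj₁ q) = inj₁ (ℕₚ.≤-<-trans h q)
      after-first h (inj₂ (_ , _ , q)) = inj₂ q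

      Ordered : Cell → Cell → Set
      Ordered c c′ = Before (Cell.k c) (Cell.b c) (Cell.k c′) (Cell.b c′)

      Inside : Pt (suc m) → Cell → Set
      Inside u c = Piece.X (Cell.Y c) u

      ordered-disjoint : ∀ c c′ → Ordered c c′ → ∀ u → Inside u c → Inside u c′ → ⊥
      ordered-disjoint c c′ o (z ∷ v) x x′ = beyond-last (overtake C.upper v (proj₁ s) g≤k (upper≤L C′.upper) o (proj₁ (proj₂ (proj₂ s)))
          (edge-lo C′.lower (after-first g≤k o) v (proj₁ (proj₂ s′)))) o C′.upper
        where
          module C = Cell c
          module C′ = Cell c′
          s = C.X⇒ (z ∷ v) x
          s′ = C′.X⇒ (z ∷ v) x′
          g≤k = g≤lower C.lower

      record Cells (k : ℕ) (lw : Lower k false) : Set₁ where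
        field
          cells : List Cell
          atLeast : All (λ c → k ℕ.≤ Cell.k c) cells
          sorted : AllPairs Ordered cells
          cover : ∀ z v → X v → eval (loF lw) v ≤ D · z → Below Nu v (D · z) → Fibre.Cong D N ρ z → Any (Inside (z ∷ v)) cells

      lastNuCells : ∀ ν (e : Nu ≡ just ν) {k} lw → k ≡ gν ν e → Cells k lw
      lastNuCells ν e {k} lw k≡ = record { cells = flatCell lw (toNu ν e k≡) ∷ [] ; atLeast = ℕₚ.≤-refl ∷ [] ; sorted = [] ∷ []
        ; cover = λ z v xv l h c → here (Cell.X⇐ (flatCell lw (toNu ν e k≡)) (z ∷ v) (xv , l , subst (λ N → Below N v (D · z)) e h , c)) }

      in-mid : ∀ {k z v} → D · z + 1z ≤ eval (Ψ k) v + (E + E) → D · z ≤ eval (Ψ k ⊞ const (E + E + - 1z)) v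
      in-mid {k} {z} {v} q = lin [] (D · z ∷ eval (Ψ k) v ∷ E ∷ 1z ∷ []) (λ x y E o → ((x ⊕ o ⊑ y ⊕ (E ⊕ E)) ∷ []) ⊢ (x ⊑ y ⊕ (E ⊕ E ⊖ₑ o))) refl q

      lastFreeCells : (e : Nu ≡ nothing) → ∀ {k} lw → k ≡ L → Cells k lw
      lastFreeCells e {k} lw k≡ = record { cells = c₁ ∷ c₂ ∷ [] ; atLeast = ℕₚ.≤-refl ∷ ℕₚ.≤-reflexive k≡ ∷ []
          ; sorted = ((inj₂ (k≡ , refl , refl)) ∷ []) ∷ [] ∷ []
          ; cover = λ z v xv l h c → from z v xv l c (compare (eval (Ψ L) v + (E + E)) (D · z)) }
        where
          c₁ = flatCell lw (mid (ℕₚ.≤-reflexive k≡) (λ ν e′ → ⊥-elim (nothing≢just (trans (sym e) e′))))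
          c₂ = freeCell e
          from : ∀ z v → X v → eval (loF lw) v ≤ D · z → Fibre.Cong D N ρ z → eval (Ψ L) v + (E + E) ≤ D · z ⊎ D · z + 1z ≤ eval (Ψ L) v + (E + E) → Any (Inside (z ∷ v)) (c₁ ∷ c₂ ∷ [])
          from z v xv l c (inj₁ q) = there (here (Cell.X⇐ c₂ (z ∷ v) (xv , q , tt , c)))
          from z v xv l c (inj₂ q) = here (Cell.X⇐ c₁ (z ∷ v) (xv , l , in-mid {k} {z} {v} (subst (λ k → D · z + 1z ≤ eval (Ψ k) v + (E + E)) (sym k≡) q) , c))

      nextCells : ∀ {k} lw → k ℕ.< L → (∀ ν e → k ℕ.< gν ν e) → (∀ lw → Cells (suc k) lw) → Cells k lw
      nextCells {k} lw k<L k< rec = record { cells = c₁ ∷ c₂ ∷ R.cells ; atLeast = ℕₚ.≤-refl ∷ ℕₚ.≤-refl ∷ All.map ℕₚ.<⇒≤ R.atLeast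
          ; sorted = (inj₂ (refl , refl , refl) ∷ All.map inj₁ R.atLeast) ∷ (All.map inj₁ R.atLeast ∷ R.sorted)
          ; cover = λ z v xv l h c → from z v xv l h c (compare (eval (Ψ k) v + (E + E)) (D · z)) (compare (eval (Ψ (suc k)) v + (- (E + E))) (D · z)) }
        where
          g≤k = g≤lower lw
          c₁ = flatCell lw (mid (ℕₚ.<⇒≤ k<L) k<)
          c₂ = splitCell g≤k k<L k<
          module R = Cells (rec (later (ℕ.s≤s g≤k)))
          from : ∀ z v → X v → eval (loF lw) v ≤ D · z → Below Nu v (D · z) → Fibre.Cong D N ρ z →
                 eval (Ψ k) v + (E + E) ≤ D · z ⊎ D · z + 1z ≤ eval (Ψ k) v + (E + E) →
                 eval (Ψ (suc k)) v + (- (E + E)) ≤ D · z ⊎ D · z + 1z ≤ eval (Ψ (suc k)) v + (- (E + E)) → Any (Inside (z ∷ v)) (c₁ ∷ c₂ ∷ R.cells)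
          from z v xv l h c (inj₂ q) _ = here (Cell.X⇐ c₁ (z ∷ v) (xv , l , in-mid {k} {z} {v} q , c))
          from z v xv l h c (inj₁ q) (inj₂ q′) = there (here (Cell.X⇐ c₂ (z ∷ v) (xv , q ,
            lin [] (D · z ∷ eval (Ψ (suc k)) v ∷ E ∷ 1z ∷ []) (λ x y E o → ((x ⊕ o ⊑ y ⊕ (⊝ (E ⊕ E))) ∷ []) ⊢ (x ⊑ y ⊕ (⊝ (E ⊕ E ⊕ o)))) refl q′ , c)))
          from z v xv l h c (inj₁ q) (inj₁ q′) = there (there (R.cover z v xv q′ h c))

      -- The slabs of level at least k, counted down by the distance d to the last level e.
      cellsFrom : ∀ e → (∀ lw → Cells e lw) → (∀ k → k ℕ.< e → k ℕ.< L × (∀ ν e → k ℕ.< gν ν e)) → ∀ d k lw → d ℕ.+ k ≡ e → Cells k lw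
      cellsFrom e end below zero k lw refl = end lw
      cellsFrom e end below (suc d) k lw q = nextCells lw (proj₁ (below k k<e)) (proj₂ (below k k<e)) (λ lw′ → cellsFrom e end below d (suc k) lw′ (trans (ℕₚ.+-suc d k) q))
        where
          k<e = subst (k ℕ.<_) q (ℕ.s≤s (ℕₚ.m≤n+m k d))

      allCells : Cells g (first refl)
      allCells = from Nu refl
        where
          from : ∀ M → Nu ≡ M → Cells g (first refl)
          from nothing e = cellsFrom L (λ lw → lastFreeCells e lw refl) (λ k h → h , λ ν e′ → ⊥-elim (nothing≢just (trans (sym e) e′)))
            (L ℕ.∸ g) g (first refl) (ℕₚ.m∸n+n≡m g≤L)
          from (just ν) e = cellsFrom (gν ν e) (λ lw → lastNuCells ν e lw refl)
            (λ k h → ℕₚ.<-≤-trans h (gν≤L ν e) , λ ν′ e′ → subst (k ℕ.<_) (gν-unique e e′) h)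
            (gν ν e ℕ.∸ g) g (first refl) (ℕₚ.m∸n+n≡m (g≤gν ν e))

    -- Common faces of slabs over different pieces

    module Meet (P P′ : OldPiece) (l : ℕ) (l≤L : l ℕ.≤ Piece.L P) (l≤L′ : l ℕ.≤ Piece.L P′) (J≡J′ : Piece.J P l ≡ Piece.J P′ l) (sf : SameFace P P′ l l)
                (v₀ v₀′ : Pt m) (x₀ : Piece.X P v₀) (x₀′ : Piece.X P′ v₀′) (a₀ : AgreeOn (Piece.J P l) v₀ v₀′) where
      module SF = SameFace sf

      same-gν : ∀ ν e → (At.gν P) ν e ℕ.≤ l → (At.gν P) ν e ≡ (At.gν P′) ν e
      same-gν ν e h = same-grade P P′ ν (extNu ν e) (gradeNu P ν e) (gradeNu P′ ν e) l≤L l≤L′ v₀ v₀′ x₀ x₀′ J≡J′ a₀ sf h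

      same-gν′ : ∀ ν e → (At.gν P′) ν e ℕ.≤ l → (At.gν P′) ν e ≡ (At.gν P) ν e
      same-gν′ ν e h = same-grade P′ P ν (extNu ν e) (gradeNu P′ ν e) (gradeNu P ν e) l≤L′ l≤L v₀′ v₀ x₀′ x₀ (sym J≡J′)
        (λ j t → sym (a₀ j (trans (cong (λ J → lookup J j) J≡J′) t))) (SameFace-sym P P′ J≡J′ sf) h

      same-g : (At.g P) ℕ.≤ l → (At.g P) ≡ (At.g P′)
      same-g h = same-grade P P′ Mu extMu (gradeMu P) (gradeMu P′) l≤L l≤L′ v₀ v₀′ x₀ x₀′ J≡J′ a₀ sf h

      module _ {v v′ : Pt m} (xv : (Piece.X P) v) (xv′ : (Piece.X P′) v′) (a : AgreeOn ((Piece.J P) l) v v′) where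
        same-Nu : ∀ ν e → (At.gν P) ν e ℕ.≤ l → eval ν v ≡ eval ν v′
        same-Nu ν e h = proj₂ (ext-agree P P′ ν (extNu ν e) (gradeNu P ν e) (gradeNu P′ ν e) l l l≤L l≤L′ v v′ xv xv′ J≡J′ a h)

        same-Mu : (At.g P) ℕ.≤ l → eval Mu v ≡ eval Mu v′
        same-Mu h = proj₂ (ext-agree P P′ Mu extMu (gradeMu P) (gradeMu P′) l l l≤L l≤L′ v v′ xv xv′ J≡J′ a h)

        -- μ agrees as a common limit, by `ext-agree`; the summands τ i have i < l and agree by
        -- `SameFace`.
        same-Ψ : ∀ k → (At.g P) ℕ.≤ k → k ℕ.≤ l → eval ((At.Ψ P) k) v ≡ eval ((At.Ψ P′) k) v′
        same-Ψ k g≤k k≤l = from k (ℕₚ.m≤n⇒m<n∨m≡n g≤k) k≤l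
          where
            g≡g′ = same-g (ℕₚ.≤-trans g≤k k≤l)
            from : ∀ k → (At.g P) ℕ.< k ⊎ (At.g P) ≡ k → k ℕ.≤ l → eval ((At.Ψ P) k) v ≡ eval ((At.Ψ P′) k) v′
            from k (inj₂ q) k≤l = trans (cong (λ F → eval F v) ((At.Ψ-low P) k (ℕₚ.≤-reflexive (sym q)))) (trans (same-Mu (subst (ℕ._≤ l) (sym q) k≤l))
              (sym (cong (λ F → eval F v′) ((At.Ψ-low P′) k (ℕₚ.≤-reflexive (trans (sym q) g≡g′))))))
            from (suc k) (inj₁ q) k<l = trans ((At.eval-Ψ-suc P) (ℕₚ.≤-pred q) v) (trans (cong₂ (λ x t → x + t + (- K)) (from k (ℕₚ.m≤n⇒m<n∨m≡n (ℕₚ.≤-pred q)) (ℕₚ.<⇒≤ k<l)) (SF.τ≡τ′ v v′ xv xv′ a k k<l))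
              (sym ((At.eval-Ψ-suc P′) (subst (ℕ._≤ k) g≡g′ (ℕₚ.≤-pred q)) v′)))

        same-boundary : ∀ k b → (At.g P) ℕ.≤ k → k ℕ.≤ l → (At.boundary P) k b v ≡ (At.boundary P′) k b v′
        same-boundary k false h q = cong (_+ (- (E + E))) (same-Ψ k h q)
        same-boundary k true h q = cong (_+ (E + E)) (same-Ψ k h q)

        -- The lower boundary of the later slab has index at most l, so it takes the same value over
        -- both pieces. By `overtake` the earlier slab is the last one over P. If it ends at ν, its
        -- index is last over P′ too, and no later slab exists there; if it is free, its index is L
        -- already, too large.
        clash : ∀ {z} (c : (At.Cell P)) (c′ : (At.Cell P′)) → (At.Inside P) (z ∷ v) c → (At.Inside P′) (z ∷ v′) c′ → At.Cell.k c′ ℕ.≤ l →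
                (At.Before P) (At.Cell.k c) (At.Cell.b c) (At.Cell.k c′) (At.Cell.b c′) → ⊥
        clash {z} c c′ x x′ k′≤l bef = from ((At.overtake P) (At.Cell.upper c) v xv g≤k (ℕₚ.≤-trans k′≤l l≤L) bef (proj₁ (proj₂ (proj₂ s)))
              (subst (_≤ D · z) (sym (same-boundary (At.Cell.k c′) (At.Cell.b c′) g≤k′ k′≤l)) ((At.edge-lo P′) (At.Cell.lower c′) after v′ (proj₁ (proj₂ s′)))))
          where
            s = (At.Cell.X⇒ c) (z ∷ v) x
            s′ = (At.Cell.X⇒ c′) (z ∷ v′) x′
            g≤k = (At.g≤lower P) (At.Cell.lower c)
            k≤k′ : (At.Before P) (At.Cell.k c) (At.Cell.b c) (At.Cell.k c′) (At.Cell.b c′) → (At.Cell.k c) ℕ.≤ (At.Cell.k c′)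
            k≤k′ (inj₁ h) = ℕₚ.<⇒≤ h
            k≤k′ (inj₂ (h , _)) = ℕₚ.≤-reflexive h
            g≤k′ = ℕₚ.≤-trans g≤k (k≤k′ bef)
            after : (At.g P′) ℕ.< (At.Cell.k c′) ⊎ (At.Cell.b c′) ≡ true
            after = subst (λ g → g ℕ.< (At.Cell.k c′) ⊎ (At.Cell.b c′) ≡ true) (same-g (ℕₚ.≤-trans g≤k′ k′≤l)) ((At.after-first P) g≤k bef)
            move : (At.Last P) (At.Cell.k c) (At.Cell.b c) → (At.Last P′) (At.Cell.k c) (At.Cell.b c) ⊎ ⊥
            move (At.lastNu ν e q) = inj₁ (At.lastNu ν e (trans q (same-gν ν e (subst (ℕ._≤ l) q (ℕₚ.≤-trans (k≤k′ bef) k′≤l)))))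
            move (At.lastFree q) = inj₂ (absurd-free bef)
              where
                absurd-free : (At.Before P) (At.Cell.k c) true (At.Cell.k c′) (At.Cell.b c′) → ⊥
                absurd-free (inj₁ h) = ℕₚ.<⇒≱ (subst (ℕ._< (At.Cell.k c′)) q h) (ℕₚ.≤-trans k′≤l l≤L)
                absurd-free (inj₂ (_ , () , _))
            from : (At.Last P) (At.Cell.k c) (At.Cell.b c) → ⊥
            from la with move la
            ... | inj₁ q = (At.beyond-last P′) q bef (At.Cell.upper c′)

      same-lower : ∀ {k b} (lw : (At.Lower P) k b) (lw′ : (At.Lower P′) k b) → k ℕ.≤ l → ∀ {v v′} → (Piece.X P) v → (Piece.X P′) v′ → AgreeOn ((Piece.J P) l) v v′ → eval ((At.loF P) lw) v ≡ eval ((At.loF P′) lw′) v′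
      same-lower (At.first refl) (At.first _) k≤l xv xv′ a = same-Mu xv xv′ a k≤l
      same-lower (At.first refl) (At.later h) k≤l xv xv′ a = ⊥-elim (ℕₚ.<⇒≢ h (sym (same-g k≤l)))
      same-lower (At.later h) (At.first refl) k≤l xv xv′ a = ⊥-elim (ℕₚ.<⇒≢ h (same-g (ℕₚ.≤-trans (ℕₚ.<⇒≤ h) k≤l)))
      same-lower {k} (At.later h) (At.later _) k≤l xv xv′ a = same-boundary xv xv′ a k false (ℕₚ.<⇒≤ h) k≤l
      same-lower {k} (At.split h) (At.split _) k≤l xv xv′ a = same-boundary xv xv′ a k true h k≤l

      Lifted : ∀ {k b} → At.Lower P′ k b → At.Upper P′ k b → Z → Pt m → Set
      Lifted lw′ u′ z v = ∃ λ v′ → AgreeOn (Piece.J P l) v v′ × Slice (At.loF P′ lw′) (At.hiF P′ u′) (Piece.X P′) (z ∷ v′)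

      -- For k = l the bound Ψ (k + 1) is infinite on the common face, so v′ itself need not satisfy
      -- it. Moving v′ along a ray of level k achieves this without changing the coordinates that
      -- are finite on the face.
      along-base : ∀ {k} (lw′ : At.Lower P′ k true) (q : k ℕ.< Piece.L P′) (f : ∀ ν e → k ℕ.< At.gν P′ ν e) → k ≡ l → ∀ z v v′ → Piece.X P′ v′ → AgreeOn (Piece.J P l) v v′ →
                   eval (At.loF P′ lw′) v′ ≤ D · z → Cong z → Lifted lw′ (At.toNext q f) z v
      along-base {k} (At.split g≤k) q f k≡l z v v′ xv′ a lo c = done′ (At.grow P′ g≤k q v′ (D · z) xv′ lo)
        where
          done′ : (∃ λ v″ → AgreeOn (Piece.J P′ k) v′ v″ × Piece.X P′ v″ × eval (At.Ψ P′ k) v″ + (E + E) ≤ D · z × D · z ≤ eval (At.Ψ P′ (suc k)) v″ + (- (E + E + 1z))) → Lifted (At.split g≤k) (At.toNext q f) z v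
          done′ (v″ , a″ , x″ , l″ , h″) = v″ , (λ j t → trans (a j t) (a″ j (subst (λ J → lookup J j ≡ true) (trans J≡J′ (cong (Piece.J P′) (sym k≡l))) t))) , x″ , l″ , h″ , c

      lift-from : ∀ {k b} (u : At.Upper P k b) (lw′ : At.Lower P′ k b) (u′ : At.Upper P′ k b) → At.g P ℕ.≤ k → k ℕ.≤ l → ∀ z v v′ → Piece.X P v → Piece.X P′ v′ → AgreeOn (Piece.J P l) v v′ →
                  eval (At.loF P′ lw′) v′ ≤ D · z → Below (At.hiF P u) v (D · z) → Cong z → Lifted lw′ u′ z v
      lift-from (At.toNu ν e q) lw′ (At.toNu ν′ e′ q′) g≤k k≤l z v v′ xv xv′ a lo h c = v′ , a , xv′ , lo ,
        subst (λ N → Below N v′ (D · z)) (trans (sym e) e′) (subst (D · z ≤_) (same-Nu xv xv′ a ν e (subst (ℕ._≤ l) q k≤l)) h) , c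
      lift-from (At.toNu ν e q) lw′ (At.mid _ f) g≤k k≤l z v v′ xv xv′ a lo h c = ⊥-elim (ℕₚ.<⇒≢ (f ν e) (trans q (same-gν ν e (subst (ℕ._≤ l) q k≤l))))
      lift-from (At.mid _ f) lw′ (At.toNu ν e q) g≤k k≤l z v v′ xv xv′ a lo h c = ⊥-elim (ℕₚ.<⇒≢ (f ν e) (trans q (same-gν′ ν e (subst (ℕ._≤ l) q k≤l))))
      lift-from {k} (At.mid _ _) lw′ (At.mid _ _) g≤k k≤l z v v′ xv xv′ a lo h c = v′ , a , xv′ , lo , subst (λ x → D · z ≤ x + (E + E + - 1z)) (same-Ψ xv xv′ a k g≤k k≤l) h , c
      lift-from u lw′ (At.free _ _) g≤k k≤l z v v′ xv xv′ a lo h c = v′ , a , xv′ , lo , tt , c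
      lift-from {k} (At.toNext _ _) lw′ (At.toNext q′ f) g≤k k≤l z v v′ xv xv′ a lo h c = beyond (ℕₚ.m≤n⇒m<n∨m≡n k≤l)
        where
          beyond : k ℕ.< l ⊎ k ≡ l → Lifted lw′ (At.toNext q′ f) z v
          beyond (inj₁ k<l) = v′ , a , xv′ , lo , subst (λ x → D · z ≤ x + (- (E + E + 1z))) (same-Ψ xv xv′ a (suc k) (ℕₚ.m≤n⇒m≤1+n g≤k) k<l) h , c
          beyond (inj₂ k≡l) = along-base lw′ q′ f k≡l z v v′ xv′ a lo c
      lift-from (At.free q _) lw′ (At.toNext q′ f) g≤k k≤l z v v′ xv xv′ a lo h c =
        along-base lw′ q′ f (ℕₚ.≤-antisym k≤l (subst (l ℕ.≤_) (sym q) l≤L)) z v v′ xv′ a lo c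

      lift : ∀ {k b} (lw : At.Lower P k b) (u : At.Upper P k b) (lw′ : At.Lower P′ k b) (u′ : At.Upper P′ k b) → k ℕ.≤ l → ∀ z v →
             Slice (At.loF P lw) (At.hiF P u) (Piece.X P) (z ∷ v) → Lifted lw′ u′ z v
      lift lw u lw′ u′ k≤l z v (xv , lo , hi , c) = from (SF.to v xv)
        where
          from : (∃ λ v′ → Piece.X P′ v′ × AgreeOn (Piece.J P l) v v′) → Lifted lw′ u′ z v
          from (v′ , xv′ , a) = lift-from u lw′ u′ (At.g≤lower P lw) k≤l z v v′ xv xv′ a (subst (_≤ D · z) (same-lower lw lw′ k≤l xv xv′ a) lo) hi c

      tau-agree : ∀ {v v′ z} → (Piece.X P) v → (Piece.X P′) v′ → AgreeOn (Piece.J P l) v v′ → ∀ {k i} (pl : Place k i) → At.g P ℕ.≤ k → k ℕ.≤ l → i ℕ.≤ l →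
                  eval (At.tauAt P pl) (z ∷ v) ≡ eval (At.tauAt P′ pl) (z ∷ v′)
      tau-agree xv xv′ a (under h) _ k≤l _ = cong (_+ ℤ.-1ℤ · depth) (SF.τ≡τ′ _ _ xv xv′ a _ (ℕₚ.<-≤-trans h k≤l))
      tau-agree {z = z} xv xv′ a {k} onto g≤k k≤l _ = cong (λ x → D · z + ℤ.-1ℤ · x + ℤ.-1ℤ · E) (same-Ψ xv xv′ a k g≤k k≤l)
      tau-agree {z = z} xv xv′ a {k} next g≤k _ i≤l = cong (λ x → 1ℤ · x + (ℤ.- D) · z + ℤ.-1ℤ · E) (same-Ψ xv xv′ a (suc k) (ℕₚ.m≤n⇒m≤1+n g≤k) i≤l)
      tau-agree xv xv′ a (over h) _ _ i≤l = cong (_+ ℤ.-1ℤ · depth) (SF.τ≡τ′ _ _ xv xv′ a _ i≤l)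

    level : Bool → ℕ → ℕ
    level false k = k
    level true k = suc k

    module OfCell (P : OldPiece) (c : At.Cell P) where
      k = At.Cell.k c
      b = At.Cell.b c
      Y = At.Cell.Y c

      p-zero : Piece.p Y zero ≡ level b k
      p-zero = trans (At.Cell.p≡ c zero) (go b)
        where
          go : ∀ b → At.levels P b k zero ≡ level b k
          go false = refl
          go true = refl

      p-suc : ∀ j → Piece.p Y (suc j) ≡ raised b k (Piece.p P j)
      p-suc j = trans (At.Cell.p≡ c (suc j)) (go b)
        where
          go : ∀ b → At.levels P b k (suc j) ≡ raised b k (Piece.p P j)
          go false = refl
          go true = refl

      J-suc : ∀ {l l̂ t} → Drop k b l l̂ t → ∀ j → lookup (Piece.J Y l) (suc j) ≡ lookup (Piece.J P l̂) j
      J-suc {l} d j = bool-ext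
        (λ h → let i , q = J∈ Y {j = suc j} h in ∈J P i (raised≤⇒ d (subst (ℕ._≤ l) (p-suc j) q)))
        (λ h → let i , q = J∈ P {j = j} h in ∈J Y {j = suc j} i (subst (ℕ._≤ l) (sym (p-suc j)) (⇒raised≤ d q)))

      J-zero : ∀ {l l̂ t} → Drop k b l l̂ t → lookup (Piece.J Y l) zero ≡ t
      J-zero {l} {l̂} {t} d = bool-ext {lookup (Piece.J Y l) zero} {t} (λ h → forth d (subst (ℕ._≤ l) p-zero (proj₂ (J∈ Y {j = zero} h))))
                                      (λ h → ∈J Y {j = zero} refl (subst (ℕ._≤ l) (sym p-zero) (back d h)))
        where
          forth : ∀ {k b l l̂ t} → Drop k b l l̂ t → level b k ℕ.≤ l → t ≡ true
          forth (flat< q) h = ⊥-elim (ℕₚ.<⇒≱ q h)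
          forth (flat≥ _) _ = refl
          forth (split≤ q) h = ⊥-elim (ℕₚ.<⇒≱ h q)
          forth (split> _) _ = refl
          back : ∀ {k b l l̂ t} → Drop k b l l̂ t → t ≡ true → level b k ℕ.≤ l
          back (flat≥ q) _ = q
          back (split> q) _ = ℕ.s≤s q

      base≤L : ∀ {l l̂ t} → Drop k b l l̂ t → l ℕ.≤ Piece.L Y → l̂ ℕ.≤ Piece.L P
      base≤L {l} d h = go d (At.upper≤L P (At.Cell.upper c)) (subst (l ℕ.≤_) (At.Cell.L≡ c) h)
        where
          go : ∀ {k b l l̂ t} → Drop k b l l̂ t → k ℕ.≤ Piece.L P → l ℕ.≤ At.height P b → l̂ ℕ.≤ Piece.L P
          go (flat< _) _ h = h
          go (flat≥ _) _ h = h
          go (split≤ q) h _ = ℕₚ.≤-trans q h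
          go (split> _) _ h = ℕₚ.≤-pred h

      inX : ∀ {z v} → Piece.X Y (z ∷ v) → Piece.X P v
      inX {z} {v} x = proj₁ (At.Cell.X⇒ c (z ∷ v) x)

      τ-hidden : ∀ {l l̂} → Drop k b l l̂ false → ∀ {i} → i ℕ.< l → ∀ {z v} → eval (Piece.τ Y i) (z ∷ v) ≡ eval (Piece.τ P i) v + ℤ.-1ℤ · depth
      τ-hidden d {i} h {z} {v} = trans (cong (λ F → eval F (z ∷ v)) (At.Cell.τ≡ c i)) (go d h)
        where
          go : ∀ {k b l l̂} → Drop k b l l̂ false → i ℕ.< l → eval (At.taus P b k i) (z ∷ v) ≡ eval (Piece.τ P i) v + ℤ.-1ℤ · depth
          go (flat< _) _ = refl
          go {k} (split≤ q) h = cong (λ pl → eval (At.tauAt P pl) (z ∷ v)) (Place-unique (place k i) (under (ℕₚ.<-≤-trans h q)))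

      agree-suc : ∀ {l l̂ t} → Drop k b l l̂ t → ∀ {z z′ v v′} → AgreeOn (Piece.J Y l) (z ∷ v) (z′ ∷ v′) → AgreeOn (Piece.J P l̂) v v′
      agree-suc d a j h = a (suc j) (trans (J-suc d j) h)

      agree-cons : ∀ {l l̂ t} → Drop k b l l̂ t → ∀ {z z′ v v′} → (t ≡ true → z ≡ z′) → AgreeOn (Piece.J P l̂) v v′ → AgreeOn (Piece.J Y l) (z ∷ v) (z′ ∷ v′)
      agree-cons d e a zero h = e (trans (sym (J-zero d)) h)
      agree-cons d e a (suc j) h = a j (trans (sym (J-suc d j)) h)

    module Meets (P P′ : OldPiece) (l̂ : ℕ) (l≤L : l̂ ℕ.≤ Piece.L P) (l≤L′ : l̂ ℕ.≤ Piece.L P′) (J≡J′ : Piece.J P l̂ ≡ Piece.J P′ l̂) (sf : SameFace P P′ l̂ l̂) where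
      sf′ : SameFace P′ P l̂ l̂
      sf′ = SameFace-sym P P′ J≡J′ sf

      turn : ∀ {v v′} → AgreeOn (Piece.J P l̂) v v′ → AgreeOn (Piece.J P′ l̂) v′ v
      turn a j h = sym (a j (trans (cong (λ J → lookup J j) J≡J′) h))

      -- The new coordinate is infinite on the face, so the two slabs may have different indices:
      -- any point of the fibre serves as a partner, and below level l the data are those of the
      -- bases.
      hidden : ∀ c c′ {l l′} → Drop (At.Cell.k {P = P} c) (At.Cell.b c) l l̂ false → Drop (At.Cell.k {P = P′} c′) (At.Cell.b c′) l′ l̂ false → SameFace (At.Cell.Y c) (At.Cell.Y c′) l l′
      hidden c c′ {l} {l′} d d′ = record
          { l≡l′ = l≡
          ; p≡p′ = λ { zero h → ⊥-elim (false≢true (trans (sym (O.J-zero d)) h))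
                     ; (suc j) h → let h′ = trans (sym (O.J-suc d j)) h ; q = proj₂ (J∈ P {j = j} h′) ; e = SameFace.p≡p′ sf j h′ in
                         trans (O.p-suc j) (trans (raised-hidden d q) (trans e (sym (trans (O′.p-suc j) (raised-hidden d′ (subst (ℕ._≤ l̂) e q)))))) }
          ; τ≡τ′ = λ { (z ∷ v) (z′ ∷ v′) x x′ a i h → trans (O.τ-hidden d h) (trans (cong (_+ ℤ.-1ℤ · depth)
                (SameFace.τ≡τ′ sf v v′ (O.inX x) (O′.inX x′) (O.agree-suc d a) i (subst (i ℕ.<_) (Drop-hidden d) h))) (sym (O′.τ-hidden d′ (subst (i ℕ.<_) l≡ h)))) }
          ; to = λ { (z ∷ v) x → let v′ , xv′ , a = SameFace.to sf v (O.inX x) ; z′ , x′ = At.Cell.fibre c′ v′ xv′ in z′ ∷ v′ , x′ , O.agree-cons d (λ ()) a }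
          ; from = λ { (z′ ∷ v′) x′ → let v , xv , a = SameFace.from sf v′ (O′.inX x′) ; z , x = At.Cell.fibre c v xv in z ∷ v , x , O.agree-cons d (λ ()) a } }
        where
          module O = OfCell P c
          module O′ = OfCell P′ c′
          l≡ : l ≡ l′
          l≡ = trans (Drop-hidden d) (sym (Drop-hidden d′))
          false≢true : false ≡ true → ⊥
          false≢true ()

      -- The indices enter through equations, so that matching on `refl` makes those of both slabs
      -- definitionally equal and `lift` applies in both directions.
      visible : ∀ (c : At.Cell P) (c′ : At.Cell P′) {l l′ k b} → At.Cell.k c ≡ k → At.Cell.b c ≡ b → At.Cell.k c′ ≡ k → At.Cell.b c′ ≡ b → Drop k b l l̂ true → Drop k b l′ l̂ true →
                ∀ v v′ → Piece.X P v → Piece.X P′ v′ → AgreeOn (Piece.J P l̂) v v′ → SameFace (At.Cell.Y c) (At.Cell.Y c′) l l′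
      visible c@record { k = k ; b = b ; lower = lw ; upper = u ; X⇒ = f ; X⇐ = f⁻ } c′@record { lower = lw′ ; upper = u′ ; X⇒ = f′ ; X⇐ = f′⁻ } {l} {l′} refl refl refl refl d d′ v₀ v₀′ x₀ x₀′ a₀ = record
          { l≡l′ = Drop-visible-unique d d′
          ; p≡p′ = λ { zero h → trans O.p-zero (sym O′.p-zero)
                     ; (suc j) h → trans (O.p-suc j) (trans (cong (raised b k) (SameFace.p≡p′ sf j (trans (sym (O.J-suc d j)) h))) (sym (O′.p-suc j))) }
          ; τ≡τ′ = λ { (z ∷ v) (z′ ∷ v′) x x′ a i h → trans (cong (λ F → eval F (z ∷ v)) (At.Cell.τ≡ c i)) (trans
                (taus-agree b d (At.g≤lower P lw) (O.inX x) (O′.inX x′) (a zero (O.J-zero d)) (O.agree-suc d a) h)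
                (sym (cong (λ F → eval F (z′ ∷ v′)) (At.Cell.τ≡ c′ i)))) }
          ; to = λ { (z ∷ v) x → let v′ , a , s = M.lift lw u lw′ u′ k≤l z v (f (z ∷ v) x) in z ∷ v′ , f′⁻ (z ∷ v′) s , O.agree-cons d (λ _ → refl) a }
          ; from = λ { (z ∷ v′) x → let v , a , s = M⁻.lift lw′ u′ lw u k≤l z v′ (f′ (z ∷ v′) x) in
                z ∷ v , f⁻ (z ∷ v) s , O.agree-cons d (λ _ → refl) (λ j h → sym (a j (trans (sym (cong (λ J → lookup J j) J≡J′)) h))) } }
        where
          module O = OfCell P c
          module O′ = OfCell P′ c′
          module M = Meet P P′ l̂ l≤L l≤L′ J≡J′ sf v₀ v₀′ x₀ x₀′ a₀
          module M⁻ = Meet P′ P l̂ l≤L′ l≤L (sym J≡J′) sf′ v₀′ v₀ x₀′ x₀ (turn {v₀} {v₀′} a₀)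
          k≤l = Drop-visible d
          taus-agree : ∀ {k l} b → Drop k b l l̂ true → At.g P ℕ.≤ k → ∀ {z z′ v v′} → Piece.X P v → Piece.X P′ v′ → z ≡ z′ → AgreeOn (Piece.J P l̂) v v′ → ∀ {i} → i ℕ.< l →
                       eval (At.taus P b k i) (z ∷ v) ≡ eval (At.taus P′ b k i) (z′ ∷ v′)
          taus-agree false (flat≥ _) _ xv xv′ refl a h = cong (_+ ℤ.-1ℤ · depth) (SameFace.τ≡τ′ sf _ _ xv xv′ a _ h)
          taus-agree {k} true (split> k≤l) g≤k xv xv′ refl a {i} h = M.tau-agree xv xv′ a (place k i) g≤k k≤l (ℕₚ.≤-pred h)

      compare-index : ∀ k b k′ b′ → At.Before P k b k′ b′ ⊎ (k ≡ k′ × b ≡ b′) ⊎ At.Before P′ k′ b′ k b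
      compare-index k b k′ b′ = go (ℕₚ.<-cmp k k′) b b′
        where
          go : Tri (k ℕ.< k′) (k ≡ k′) (k′ ℕ.< k) → ∀ b b′ → At.Before P k b k′ b′ ⊎ (k ≡ k′ × b ≡ b′) ⊎ At.Before P′ k′ b′ k b
          go (tri< h _ _) _ _ = inj₁ (inj₁ h)
          go (tri> _ _ h) _ _ = inj₂ (inj₂ (inj₁ h))
          go (tri≈ _ e _) false false = inj₂ (inj₁ (e , refl))
          go (tri≈ _ e _) true true = inj₂ (inj₁ (e , refl))
          go (tri≈ _ e _) false true = inj₁ (inj₂ (e , refl , refl))
          go (tri≈ _ e _) true false = inj₂ (inj₂ (inj₂ (sym e , refl , refl)))

      -- If the new coordinate is finite on the face, the two points share it, and `clash`, used in
      -- both orders, excludes different indices.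
      same-face : ∀ (c : At.Cell P) (c′ : At.Cell P′) {l l′ t} → Drop (At.Cell.k c) (At.Cell.b c) l l̂ t → Drop (At.Cell.k c′) (At.Cell.b c′) l′ l̂ t → ∀ {z z′ v v′} →
                  At.Inside P (z ∷ v) c → At.Inside P′ (z′ ∷ v′) c′ → (t ≡ true → z ≡ z′) → AgreeOn (Piece.J P l̂) v v′ → SameFace (At.Cell.Y c) (At.Cell.Y c′) l l′
      same-face c c′ {t = false} d d′ x x′ z≡z′ a = hidden c c′ d d′
      same-face c c′ {l} {l′} {true} d d′ {z} {z′} {v} {v′} x x′ z≡z′ a = go (compare-index (At.Cell.k c) (At.Cell.b c) (At.Cell.k c′) (At.Cell.b c′))
        where
          module O = OfCell P c
          module O′ = OfCell P′ c′
          xv = O.inX x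
          xv′ = O′.inX x′
          x″ = subst (λ z → At.Inside P′ (z ∷ v′) c′) (sym (z≡z′ refl)) x′
          go : At.Before P O.k O.b O′.k O′.b ⊎ (O.k ≡ O′.k × O.b ≡ O′.b) ⊎ At.Before P′ O′.k O′.b O.k O.b → SameFace O.Y O′.Y l l′
          go (inj₁ q) = ⊥-elim (Meet.clash P P′ l̂ l≤L l≤L′ J≡J′ sf v v′ xv xv′ a xv xv′ a c c′ x x″ (Drop-visible d′) q)
          go (inj₂ (inj₂ q)) = ⊥-elim (Meet.clash P′ P l̂ l≤L′ l≤L (sym J≡J′) sf′ v′ v xv′ xv (turn {v} {v′} a) xv′ xv (turn {v} {v′} a) c′ c x″ x (Drop-visible d) q)
          go (inj₂ (inj₁ (ek , eb))) = visible c c′ refl refl (sym ek) (sym eb) d (subst₂ (λ k b → Drop k b l′ l̂ true) (sym ek) (sym eb) d′) v v′ xv xv′ a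

    -- `drop?` sends faces of the slabs to faces of their bases. Equal supports upstairs give equal
    -- supports below, so the compatibility of the bases can be invoked there.
    cells-compatible : ∀ P P′ → Compatible P P′ → (c : At.Cell P) (c′ : At.Cell P′) → Compatible (At.Cell.Y c) (At.Cell.Y c′)
    cells-compatible P P′ comp c c′ l l′ h h′ (z ∷ v) (z′ ∷ v′) x x′ J≡ a = go (drop? O.k O.b l) (drop? O′.k O′.b l′)
      where
        module O = OfCell P c
        module O′ = OfCell P′ c′
        at : ∀ j → lookup (Piece.J O.Y l) j ≡ lookup (Piece.J O′.Y l′) j
        at j = cong (λ J → lookup J j) J≡
        go : ∃₂ (Drop O.k O.b l) → ∃₂ (Drop O′.k O′.b l′) → SameFace O.Y O′.Y l l′
        go (l̂ , t , d) (l̂′ , t′ , d′) = meet d d′ (trans (sym (O.J-zero d)) (trans (at zero) (O′.J-zero d′)))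
            (lookup-ext _ _ λ j → trans (sym (O.J-suc d j)) (trans (at (suc j)) (O′.J-suc d′ j)))
          where
            meet : ∀ {l̂ l̂′ t t′} → Drop O.k O.b l l̂ t → Drop O′.k O′.b l′ l̂′ t′ → t ≡ t′ → Piece.J P l̂ ≡ Piece.J P′ l̂′ → SameFace O.Y O′.Y l l′
            meet {l̂} {l̂′} {t} d d′ refl e = glue sf (SameFace.l≡l′ sf) d′ e
              where
                ag = O.agree-suc d a
                sf = comp l̂ l̂′ (O.base≤L d h) (O′.base≤L d′ h′) v v′ (O.inX x) (O′.inX x′) e ag
                glue : ∀ {l̂′} → SameFace P P′ l̂ l̂′ → l̂ ≡ l̂′ → Drop O′.k O′.b l′ l̂′ t → Piece.J P l̂ ≡ Piece.J P′ l̂′ → SameFace O.Y O′.Y l l′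
                glue sf refl d′ e = Meets.same-face P P′ l̂ (O.base≤L d h) (O′.base≤L d′ h′) e sf c c′ d d′ x x′ (λ q → a zero (trans (O.J-zero d) q)) ag

    -- Continuity of the bounds and refinement of a collection

    Ext-shift : ∀ {I : Vec Bool m} {X : Pt m → Set} {F : Form m} c → Ext I X F → Ext I X (F ⊞ const c)
    Ext-shift {I} {X} {F} c (g , h) = (λ x → Maybe.map (_+ c) (g x)) , λ x lim → go x (g x) (h x lim)
      where
        go : ∀ x o → ExtAt I X F x o → ExtAt I X (F ⊞ const c) x (Maybe.map (_+ c) o)
        go x (just a) (b , k) = b , λ v xv n → cong (_+ c) (k v xv n)
        go x nothing k a = let b , f = k (a + (- c)) in b , λ v xv n →
          lin [] (a ∷ c ∷ eval F v ∷ []) (λ a c f → ((a ⊖ₑ c ⊑ f) ∷ []) ⊢ (a ⊑ f ⊕ c)) refl (f v xv n)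

    module Bounds (P : OldPiece) where
      Ext-lower : ∀ {k b} (lw : At.Lower P k b) → k ℕ.≤ Piece.L P → Ext I (Piece.X P) (At.loF P lw)
      Ext-lower (At.first _) _ = Ext-⊆ {F = Mu} (Piece.X⊆A P) extMu
      Ext-lower {k} (At.later h) k≤L = Ext-shift {F = At.Ψ P k} (- (E + E)) (At.Ext-Ψ P k (ℕₚ.<⇒≤ h) k≤L)
      Ext-lower {k} (At.split h) k≤L = Ext-shift {F = At.Ψ P k} (E + E) (At.Ext-Ψ P k h k≤L)

      Ext-upper : ∀ {k b} (u : At.Upper P k b) → At.g P ℕ.≤ k → ∀ F → At.hiF P u ≡ just F → Ext I (Piece.X P) F
      Ext-upper (At.toNu ν e _) _ _ refl = Ext-⊆ {F = ν} (Piece.X⊆A P) (extNu ν e)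
      Ext-upper {k} (At.mid k≤L _) h _ refl = Ext-shift {F = At.Ψ P k} (E + E + - 1z) (At.Ext-Ψ P k h k≤L)
      Ext-upper {k} (At.toNext k<L _) h _ refl = Ext-shift {F = At.Ψ P (suc k)} (- (E + E + 1z)) (At.Ext-Ψ P (suc k) (ℕₚ.m≤n⇒m≤1+n h) k<L)

      lower≥0 : ∀ {k b} (lw : At.Lower P k b) → k ℕ.≤ Piece.L P → ∀ v → Piece.X P v → 0z ≤ eval (At.loF P lw) v
      lower≥0 {k} {false} lw k≤L v xv = ≤-trans (Mu≥0 v (Piece.X⊆A P v xv)) (proj₁ (At.lower-eval P lw k≤L v (At.deepX P v xv)))
      lower≥0 {k} (At.split h) k≤L v xv = lin [] (eval Mu v ∷ eval (At.Ψ P k) v ∷ E ∷ []) (λ μ x E → ((𝟘 ⊑ μ) ∷ (μ ⊑ x) ∷ (𝟘 ⊑ E) ∷ (𝟘 ⊑ E) ∷ []) ⊢ (𝟘 ⊑ x ⊕ (E ⊕ E))) refl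
        (Mu≥0 v (Piece.X⊆A P v xv) , At.Ψ≥Mu P k k≤L v (At.deepX P v xv) , 0≤E , 0≤E)

    -- The property Q of the pieces is inherited, as Q′, by the slabs between two forms over them.
    Inherits : ((Pt m → Set) → Set) → ((Pt (suc m) → Set) → Set) → Set₁
    Inherits Q Q′ = ∀ {X Y} (lo : Form m) (hi : Maybe (Form m)) → (∀ v → X v → A v) → Q X → (∀ u → Y u → Slice lo hi X u) → (∀ u → Slice lo hi X u → Y u) →
      (∀ v → X v → ∃ λ z → Y (z ∷ v)) → Ext I X lo → (∀ F → hi ≡ just F → Ext I X F) → (∀ v → X v → 0z ≤ eval lo v) → Q′ Y

    inherit : ∀ {Q Q′} → Inherits Q Q′ → (P : OldPiece) (c : At.Cell P) → Q (Piece.X P) → Q′ (Piece.X (At.Cell.Y c))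
    inherit inh P c q = inh (At.loF P lower) (At.hiF P upper) (Piece.X⊆A P) q X⇒ X⇐ fibre (Bounds.Ext-lower P lower (At.upper≤L P upper)) (Bounds.Ext-upper P upper (At.g≤lower P lower))
        (Bounds.lower≥0 P lower (At.upper≤L P upper))
      where open At.Cell c

    module _ {Q : (Pt m → Set) → Set} {Q′ : (Pt (suc m) → Set) → Set} (inh : Inherits Q Q′) where
      cellsOf : OldPiece → List NewPiece
      cellsOf P = List.map At.Cell.Y (At.Cells.cells (At.allCells P))

      ∈cellsOf : ∀ P {R} → R ∈ cellsOf P → ∃ λ c → R ≡ At.Cell.Y {P} c
      ∈cellsOf P i = let c , _ , e = ∈-map⁻ At.Cell.Y i in c , e

      ∈cellsOf⇒X : ∀ P {R} → R ∈ cellsOf P → ∀ z v → Piece.X R (z ∷ v) → Piece.X P v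
      ∈cellsOf⇒X P i z v x with ∈cellsOf P i
      ... | c , refl = proj₁ (At.Cell.X⇒ c (z ∷ v) x)

      refineList : List OldPiece → List NewPiece
      refineList [] = []
      refineList (P ∷ Ps) = cellsOf P List.++ refineList Ps

      origin : ∀ Ps {R} → R ∈ refineList Ps → ∃ λ P → P ∈ Ps × R ∈ cellsOf P
      origin (P ∷ Ps) i = go (∈-++⁻ (cellsOf P) i)
        where
          go : ∀ {R} → R ∈ cellsOf P ⊎ R ∈ refineList Ps → ∃ λ P′ → P′ ∈ P ∷ Ps × R ∈ cellsOf P′
          go (inj₁ i) = P , here refl , i
          go (inj₂ i) = let P′ , j , k = origin Ps i in P′ , there j , k

      refine-disjoint : ∀ {Ps} → AllPairs Disjoint Ps → AllPairs Disjoint (refineList Ps)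
      refine-disjoint [] = []
      refine-disjoint {P ∷ Ps} (h ∷ hs) = AllPairsₚ.++⁺
          (AllPairsₚ.map⁺ (AllPairs.map (λ {c} {c′} o u → At.ordered-disjoint P c c′ o u) (At.Cells.sorted (At.allCells P))))
          (refine-disjoint hs)
          (All.tabulate λ i → All.tabulate λ i′ → apart i (origin Ps i′))
        where
          apart : ∀ {R R′} → R ∈ cellsOf P → (∃ λ P′ → P′ ∈ Ps × R′ ∈ cellsOf P′) → Disjoint R R′
          apart i (P′ , j , k) (z ∷ v) x x′ = All.lookup h j v (∈cellsOf⇒X P i z v x) (∈cellsOf⇒X P′ k z v x′)

      refine-cover : ∀ Ps z v → Any (λ P → Piece.X P v) Ps → A′ (z ∷ v) → Any (λ R → Piece.X R (z ∷ v)) (refineList Ps)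
      refine-cover (P ∷ Ps) z v (here xv) (_ , l , h , c) = Anyₚ.++⁺ˡ (Anyₚ.map⁺ (At.Cells.cover (At.allCells P) z v xv l h c))
      refine-cover (P ∷ Ps) z v (there i) a = Anyₚ.++⁺ʳ (cellsOf P) (refine-cover Ps z v i a)

      refine-compatible : ∀ {Ps} → (∀ {P P′} → P ∈ Ps → P′ ∈ Ps → Compatible P P′) → ∀ {R R′} → R ∈ refineList Ps → R′ ∈ refineList Ps → Compatible R R′
      refine-compatible {Ps} comp i i′ with origin Ps i | origin Ps i′
      ... | P , j , k | P′ , j′ , k′ with ∈cellsOf P k | ∈cellsOf P′ k′
      ... | c , refl | c′ , refl = cells-compatible P P′ (comp j j′) c c′

      refine-holds : ∀ {Ps} → (∀ {P} → P ∈ Ps → Q (Piece.X P)) → ∀ {R} → R ∈ refineList Ps → Q′ (Piece.X R)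
      refine-holds {Ps} h i with origin Ps i
      ... | P , j , k with ∈cellsOf P k
      ... | c , refl = inherit {Q} {Q′} inh P c (h j)

      refine : Collection I A W K n Ê Q → Collection newI A′ W′ K′ (suc (n ℕ.+ n)) E Q′
      refine C = record { list = refineList list ; disjoint = refine-disjoint disjoint ; compatible = refine-compatible compatible ; holds = refine-holds holds
                        ; cover = λ { (z ∷ v) a → refine-cover list z v (cover v (proj₁ a)) a } }
        where open Collection C

  -- Monohedral decompositions

  Val : Subset m → ℕ → Aff m → Maybe (Form m) → Set
  Val I d infA nothing = ⊤
  Val I d infA (just F) = ⊥
  Val I d (linA q qs) nothing = ⊥
  Val I d (linA q qs) (just F) = ∀ v → evalAff I (linA q qs) (toG (rv I) v) ≈Ω just (eval F v // d)

  parse : ∀ (I : Subset m) α → ∃₂ λ d F → Val I d α F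
  parse I infA = 0 , nothing , tt
  parse I (linA q qs) = let F , d , h = fromAff I q qs in d , just F , h

  Val-∞ : ∀ (I : Subset m) d α → Val I d α nothing → ∀ a → evalAff I α a ≡ nothing
  Val-∞ I d infA _ a = refl

  Val-just : ∀ (I : Subset m) d α {F} → Val I d α (just F) → ∀ v → evalAff I α (toG (rv I) v) ≈Ω just (eval F v // d)
  Val-just I d (linA q qs) h = h

  //-scale : ∀ {d d′} c a → pos (suc d′) ≡ c ℤ.* pos (suc d) → (a // d) ≈Q ((c · a) // d′)
  //-scale {d} {d′} c a e = ⇒≈Q (a // d) ((c · a) // d′) (trans (cong (_· a) e) (eqn (c ∷ pos (suc d) ∷ []) (a ∷ []) (λ c d a → (c :* d) ⊙ a ⊑ d ⊙ c ⊙ a) refl))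

  Val-scale : ∀ (I : Subset m) {d d′} c α F → pos (suc d′) ≡ c ℤ.* pos (suc d) → Val I d α F → Val I d′ α (Maybe.map (c ⊡_) F)
  Val-scale I c infA nothing e h = tt
  Val-scale I {d} {d′} c (linA q qs) (just F) e h v = ≈Ω-trans (evalAff I (linA q qs) (toG (rv I) v)) (just (eval F v // d)) (just ((c · eval F v) // d′)) (h v) (//-scale c (eval F v) e)

  module _ (I : Subset m) (d : ℕ) where
    Val-upper : ∀ α N → Val I d α N → ∀ v z → just (embQ z) ≤Ω evalAff I α (toG (rv I) v) → Below N v (pos (suc d) · z)
    Val-upper α nothing _ v z h = tt
    Val-upper α (just F) val v z h = ≤Ω⇒ (evalAff I α (toG (rv I) v)) d z (Val-just I d α val v) h

    upper-Val : ∀ α N → Val I d α N → ∀ v z → Below N v (pos (suc d) · z) → just (embQ z) ≤Ω evalAff I α (toG (rv I) v)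
    upper-Val α nothing val v z h = subst (just (embQ z) ≤Ω_) (sym (Val-∞ I d α val (toG (rv I) v))) tt
    upper-Val α (just F) val v z h = ⇒≤Ω (evalAff I α (toG (rv I) v)) d z (Val-just I d α val v) h

  Inner : Vec ℕ m → Subset m → Vec Bool m → (Pt m → Set) → Set
  Inner {m} N I J X = IsLCPrecell m N I (gp J X)

  -- Codes in `Ã` vanish outside J, which makes `toG` injective on them. W, K and n come before E,
  -- because the margin demanded one dimension lower is computed from W, K and E.
  record Decomposition {m} (N : Vec ℕ m) (I : Subset m) (J : Vec Bool m) (A : Pred (GPt m) 0ℓ) : Set₁ where
    field
      Ã : Pt m → Set
      zero-off : ∀ v → Ã v → ZeroOff J v
      Ã⇒ : ∀ v → Ã v → A (toG J v)
      Ã⇐ : ∀ v → ZeroOff J v → A (toG J v) → Ã v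
      W : ℤ
      K E₀ : Z
      n : ℕ
      1≤W : 1ℤ ℤ.≤ W
      0≤K : 0z ≤ K
      pieces : ∀ E → E₀ ≤ E → 0z ≤ E → Collection J Ã W K n E (Inner N I J)

  module _ {m} (N : Vec ℕ (suc m)) (1≤last : 1 ℕ.≤ last N) (I : Subset (suc m)) (A : Pred (GPt (suc m)) 0ℓ) (suppA : ∀ a → A a → supp a ≡ I) where
    open LastCoordinate N I

    last-finite : ∀ b o → A (b ∷ʳ o) → is-just o ≡ last I
    last-finite b o a = trans (sym (last-supp b o)) (cong last (suppA _ a))

    infinite-step : last I ≡ false → Decomposition (init N) (init I) J (Soc A) → Decomposition N I (false ∷ J) A
    infinite-step e dec = record
        { Ã = Flat Ã
        ; zero-off = λ { (z ∷ v) (q , a) zero _ → q ; (z ∷ v) (q , a) (suc j) h → zero-off v a j h }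
        ; Ã⇒ = λ { (z ∷ v) (_ , a) → let o , s = Ã⇒ v a in go v o (trans (last-finite (toG J v) o s) e) s }
        ; Ã⇐ = λ { (z ∷ v) h a → h zero refl , Ã⇐ v (λ j → h (suc j)) (nothing , a) }
        ; W = W ; K = K ; E₀ = E₀ ; n = n ; 1≤W = 1≤W ; 0≤K = 0≤K
        ; pieces = λ E h h′ → flat-collection {Q = Inner (init N) (init I) J} {Q′ = Inner N I (false ∷ J)}
            (λ {X} q → infinite-precell e 1≤last {X} {Flat X} q (λ z v y → proj₂ y) (λ v x → 0z , refl , x)) (pieces E h h′)
        }
      where
        open Decomposition dec
        go : ∀ v o → is-just o ≡ false → A (toG J v ∷ʳ o) → A (toG J v ∷ʳ nothing)
        go v nothing _ s = s

    module FiniteStep (e : last I ≡ true) (pres : Presentation m N I A) (lcμ : LargelyCont (Soc A) (evalAff (init I) (Presentation.μ pres)))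
                      (lcν : LargelyCont (Soc A) (evalAff (init I) (Presentation.ν pres))) (dec : Decomposition (init N) (init I) J (Soc A)) where
      open Presentation pres
      open Decomposition dec

      finite-fibre : ∀ v → Ã v → ∃ λ z → A (toG J v ∷ʳ just z)
      finite-fibre v a = let o , s = Ã⇒ v a in go o (trans (last-finite (toG J v) o s) e) s
        where
          go : ∀ o → is-just o ≡ true → A (toG J v ∷ʳ o) → ∃ λ z → A (toG J v ∷ʳ just z)
          go (just z) _ s = z , s

      -- The last coordinate is finite on F_I here, so the lower bound +∞ leaves no point at all.
      empty : ∀ d → Val (init I) d μ nothing → Decomposition N I (true ∷ J) A
      empty d val = record
          { Ã = λ _ → ⊥ ; zero-off = λ _ () ; Ã⇒ = λ _ ()
          ; Ã⇐ = λ { (z ∷ v) _ a → no-point z v (proj₁ (proj₂ (proj₂ (Equivalence.to (shape (toG J v) (just z)) a)))) }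
          ; W = 1ℤ ; K = 0z ; E₀ = 0z ; n = 0 ; 1≤W = ℤₚ.≤-refl ; 0≤K = ≤-refl
          ; pieces = λ _ _ _ → record { list = [] ; disjoint = [] ; compatible = λ () ; holds = λ () ; cover = λ _ () } }
        where
          no-point : ∀ z v → evalAff (init I) μ (toG J v) ≤Ω just (embQ z) → ⊥
          no-point z v h = subst (_≤Ω just (embQ z)) (Val-∞ (init I) d μ val (toG J v)) h

      module Scaled (w : ℕ) (W≡ : W ≡ pos (suc w)) (d₁ : ℕ) (F₁ : Form m) (val₁ : Val (init I) d₁ μ (just F₁)) (d₂ : ℕ) (F₂ : Maybe (Form m)) (val₂ : Val (init I) d₂ ν F₂) where
        -- Besides the denominators of μ and ν, the common denominator contains W, so that all
        -- slopes of `Mu` and `Nu` are multiples of W; a positive one is then at least W.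
        d : ℕ
        d = (d₁ ⊗ d₂) ⊗ w

        D Nm c₁ c₂ : ℤ
        D = pos (suc d)
        Nm = pos (last N)
        c₁ = W ℤ.* pos (suc d₂)
        c₂ = W ℤ.* pos (suc d₁)

        ρz : Z
        ρz = times ρ 1z

        D≡ : D ≡ (pos (suc d₁) ℤ.* pos (suc d₂)) ℤ.* W
        D≡ = trans (pos-⊗ (d₁ ⊗ d₂) w) (cong₂ ℤ._*_ (pos-⊗ d₁ d₂) (sym W≡))

        D≡₁ : D ≡ c₁ ℤ.* pos (suc d₁)
        D≡₁ = trans D≡ (trans (ℤₚ.*-comm (pos (suc d₁) ℤ.* pos (suc d₂)) W) (trans (cong (W ℤ.*_) (ℤₚ.*-comm (pos (suc d₁)) (pos (suc d₂)))) (sym (ℤₚ.*-assoc W (pos (suc d₂)) (pos (suc d₁))))))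

        D≡₂ : D ≡ c₂ ℤ.* pos (suc d₂)
        D≡₂ = trans D≡ (trans (ℤₚ.*-comm (pos (suc d₁) ℤ.* pos (suc d₂)) W) (sym (ℤₚ.*-assoc W (pos (suc d₁)) (pos (suc d₂)))))

        Mu : Form m
        Mu = c₁ ⊡ F₁

        Nu : Maybe (Form m)
        Nu = Maybe.map (c₂ ⊡_) F₂

        valMu : ∀ v → evalAff (init I) μ (toG J v) ≈Ω just (eval Mu v // d)
        valMu = Val-just (init I) d μ {Mu} (Val-scale (init I) c₁ μ (just F₁) D≡₁ val₁)

        valNu : Val (init I) d ν Nu
        valNu = Val-scale (init I) c₂ ν F₂ D≡₂ val₂

        open Fibre D Nm ρz using (Cong; Slice)

        on-fibre : ∀ v z → A (toG J v ∷ʳ just z) → eval Mu v ≤ D · z × Below Nu v (D · z) × Cong z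
        on-fibre v z a = let _ , _ , l , h , c = Equivalence.to (shape (toG J v) (just z)) a in
            Ω≤⇒ (evalAff (init I) μ (toG J v)) d z (valMu v) l , Val-upper (init I) d ν Nu valNu v z h , cong-· {z} {ρz} {last N} c

        fibreA : ∀ v → Ã v → ∃ λ z → eval Mu v ≤ D · z × Below Nu v (D · z) × Cong z
        fibreA v a = let z , s = finite-fibre v a in z , on-fibre v z s

        extMu : Ext J Ã Mu
        extMu = LC⇒Ext J Mu d (evalAff (init I) μ) Ã⇒ (λ v _ → valMu v) lcμ

        extNu : ∀ F → Nu ≡ just F → Ext J Ã F
        extNu F q = LC⇒Ext J F d (evalAff (init I) ν) Ã⇒ (λ v _ → Val-just (init I) d ν (subst (Val (init I) d ν) q valNu) v) lcν

        Mu≥0 : ∀ v → Ã v → 0z ≤ eval Mu v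
        Mu≥0 v a = 0≤Ω⇒ (evalAff (init I) μ (toG J v)) d (valMu v) (μ≥0 _ (Ã⇒ v a))

        Mu≤Nu : ∀ F → Nu ≡ just F → ∀ v → Ã v → eval Mu v ≤ eval F v
        Mu≤Nu F q v a = let z , l , h , _ = fibreA v a in ≤-trans l (subst (λ N → Below N v (D · z)) q h)

        W≤Nu : ∀ F → Nu ≡ just F → ∀ r → 1ℤ ℤ.≤ slope F r → W ℤ.≤ slope F r
        W≤Nu F q r h = go F₂ q h
          where
            multiple : ∀ x → 1ℤ ℤ.≤ W ℤ.* x → W ℤ.≤ W ℤ.* x
            multiple x h = from (1≤or≤0 x)
              where
                W≥0 = ℤ.nonNegative {W} (1≤⇒0≤ 1≤W)
                from : 1ℤ ℤ.≤ x ⊎ x ℤ.≤ 0ℤ → W ℤ.≤ W ℤ.* x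
                from (inj₁ k) = subst (ℤ._≤ W ℤ.* x) (ℤₚ.*-identityʳ W) (ℤₚ.*-monoˡ-≤-nonNeg W {{W≥0}} k)
                from (inj₂ k) = ⊥-elim (ℤₚ.<⇒≱ (ℤ.+<+ (ℕ.s≤s ℕ.z≤n)) (ℤₚ.≤-trans h (subst (W ℤ.* x ℤ.≤_) (ℤₚ.*-zeroʳ W) (ℤₚ.*-monoˡ-≤-nonNeg W {{W≥0}} k))))
            go : ∀ F₂ → Maybe.map (c₂ ⊡_) F₂ ≡ just F → 1ℤ ℤ.≤ slope F r → W ℤ.≤ slope F r
            go (just F₀) refl h = subst (W ℤ.≤_) (sym assoc) (multiple (pos (suc d₁) ℤ.* slope F₀ r) (subst (1ℤ ℤ.≤_) assoc h))
              where
                assoc : c₂ ℤ.* slope F₀ r ≡ W ℤ.* (pos (suc d₁) ℤ.* slope F₀ r)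
                assoc = ℤₚ.*-assoc W (pos (suc d₁)) (slope F₀ r)

        1≤D : 1ℤ ℤ.≤ D
        1≤D = ℤ.+≤+ (ℕ.s≤s ℕ.z≤n)

        1≤Nm : 1ℤ ℤ.≤ Nm
        1≤Nm = ℤ.+≤+ 1≤last

        S : ℤ
        S = D ℤ.* Nm

        setting : ∀ E → S ‼ ≤ E → Setting m
        setting E S≤E = record { I = J ; A = Ã ; W = W ; K = K ; n = n ; D = D ; N = Nm ; ρ = ρz ; E = E ; 1≤D = 1≤D ; 1≤N = 1≤Nm ; 1≤W = 1≤W ; 0≤K = 0≤K ; Mu = Mu ; Nu = Nu
          ; S≤E = S≤E ; extMu = extMu ; Mu≥0 = Mu≥0 ; extNu = extNu ; Mu≤Nu = Mu≤Nu ; W≤Nu = W≤Nu ; fibreA = fibreA }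

        -- W′ and K′ do not depend on E; they are read off the setting with the smallest admissible
        -- E.
        least : Setting m
        least = setting (S ‼) ≤-refl

        W′ : ℤ
        W′ = Step.W′ least

        K′ : Z
        K′ = Step.K′ least

        inherits : ∀ {X Y} (lo : Form m) (hi : Maybe (Form m)) → (∀ v → X v → Ã v) → Inner (init N) (init I) J X → (∀ u → Y u → Slice lo hi X u) → (∀ u → Slice lo hi X u → Y u) →
                   (∀ v → X v → ∃ λ z → Y (z ∷ v)) → Ext J X lo → (∀ F → hi ≡ just F → Ext J X F) → (∀ v → X v → 0z ≤ eval lo v) → Inner N I (true ∷ J) Y
        inherits lo hi X⊆ q Y⇒ Y⇐ fib el eh lo≥0 = finite-precell e d ρ ρ<N lo hi (λ v x → zero-off v (X⊆ v x)) q Y⇒ Y⇐ fib el eh lo≥0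

        refined : ∀ E → max E₀ (S ‼) ≤ E → 0z ≤ E → Collection (true ∷ J) (Slice Mu Nu Ã) W′ K′ (suc (n ℕ.+ n)) E (Inner N I (true ∷ J))
        refined E h 0≤E = Step.refine (setting E (≤-trans (y≤max E₀ (S ‼)) h)) {Q = Inner (init N) (init I) J} {Q′ = Inner N I (true ∷ J)} inherits
            -- This is the margin `Ê` of the setting for E.
            (pieces (K + (E + E + (E + E)) + W′ ‼) big nonneg)
          where
            big : E₀ ≤ K + (E + E + (E + E)) + W′ ‼
            big = lin [] (E₀ ∷ K ∷ E ∷ W′ ‼ ∷ []) (λ E₀ K E w → ((E₀ ⊑ E) ∷ (𝟘 ⊑ K) ∷ (𝟘 ⊑ w) ∷ (𝟘 ⊑ E) ∷ (𝟘 ⊑ E) ∷ (𝟘 ⊑ E) ∷ []) ⊢ (E₀ ⊑ K ⊕ (E ⊕ E ⊕ (E ⊕ E)) ⊕ w)) refl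
              (≤-trans (x≤max E₀ (S ‼)) h , 0≤K , Step.0≤W′ least , 0≤E , 0≤E , 0≤E)
            nonneg : 0z ≤ K + (E + E + (E + E)) + W′ ‼
            nonneg = lin [] (K ∷ E ∷ W′ ‼ ∷ []) (λ K E w → ((𝟘 ⊑ K) ∷ (𝟘 ⊑ w) ∷ (𝟘 ⊑ E) ∷ (𝟘 ⊑ E) ∷ (𝟘 ⊑ E) ∷ (𝟘 ⊑ E) ∷ []) ⊢ (𝟘 ⊑ K ⊕ (E ⊕ E ⊕ (E ⊕ E)) ⊕ w)) refl
              (0≤K , Step.0≤W′ least , 0≤E , 0≤E , 0≤E , 0≤E)

        decomposition : Decomposition N I (true ∷ J) A
        decomposition = record
            { Ã = Slice Mu Nu Ã
            ; zero-off = λ { (z ∷ v) (a , _) (suc j) h → zero-off v a j h }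
            ; Ã⇒ = λ { (z ∷ v) (a , l , h , c) → Equivalence.from (shape (toG J v) (just z))
                ( supp-toG e (z ∷ v) , Ã⇒ v a , ⇒Ω≤ (evalAff (init I) μ (toG J v)) d z (valMu v) l , upper-Val (init I) d ν Nu valNu v z h , ·-cong {z} {ρz} {last N} (proj₁ c) (proj₂ c)) }
            ; Ã⇐ = λ { (z ∷ v) h a → Ã⇐ v (λ j → h (suc j)) (just z , a) , on-fibre v z a }
            ; W = W′ ; K = K′ ; E₀ = max E₀ (S ‼) ; n = suc (n ℕ.+ n) ; 1≤W = Step.1≤W′ least ; 0≤K = Step.0≤K′ least
            ; pieces = refined }

      finite-step : Decomposition N I (true ∷ J) A
      finite-step = go (parse (init I) μ) (parse (init I) ν) W refl 1≤W
        where
          go : (∃₂ λ d F → Val (init I) d μ F) → (∃₂ λ d F → Val (init I) d ν F) → ∀ x → W ≡ x → 1ℤ ℤ.≤ x → Decomposition N I (true ∷ J) A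
          go (d , nothing , val) _ _ _ _ = empty d val
          go (d₁ , just F₁ , val₁) (d₂ , F₂ , val₂) (pos (suc w)) W≡ _ = Scaled.decomposition w W≡ d₁ F₁ val₁ d₂ F₂ val₂
          go _ _ (pos zero) _ (ℤ.+≤+ ())

  All-∷ʳ⁻ : ∀ {P : ℕ → Set} (xs : Vec ℕ m) {x} → VAll.All P (xs ∷ʳ x) → VAll.All P xs × P x
  All-∷ʳ⁻ [] (p VAll.∷ VAll.[]) = VAll.[] , p
  All-∷ʳ⁻ (x ∷ xs) (p VAll.∷ ps) = let qs , q = All-∷ʳ⁻ xs ps in p VAll.∷ qs , q

  base : (I : Subset 0) (A : Pred (GPt 0) 0ℓ) → (∀ a → A a) → Decomposition [] I [] A
  base I A all = record
      { Ã = λ _ → ⊤ ; zero-off = λ _ _ () ; Ã⇒ = λ v _ → all _ ; Ã⇐ = λ _ _ _ → tt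
      ; W = 1ℤ ; K = 0z ; E₀ = 0z ; n = 0 ; 1≤W = ℤₚ.≤-refl ; 0≤K = ≤-refl
      ; pieces = λ E _ _ → record
          { list = point E ∷ [] ; disjoint = [] ∷ []
          ; compatible = λ { (here refl) (here refl) → same-point E }
          ; holds = λ { (here refl) → λ { [] → [] , tt , refl } }
          ; cover = λ _ _ → here tt } }
    where
      point : ∀ E → Piece [] (λ _ → ⊤) 1ℤ 0z 0 E
      point E = record
          { X = λ _ → ⊤ ; core = λ _ → ⊤ ; L = 0 ; p = λ () ; rays = [] ; τ = λ _ → const 0z
          ; inhabited = [] , tt ; X⊆A = λ _ _ → tt ; core⊆A = λ _ _ → tt ; len = ℕ.z≤n ; p≤L = λ ()
          ; range = λ () ; covers = λ _ () ; positive = λ () ; vanishing = λ () ; moveX = λ () ; moveA = λ () ; slope-τ = λ () ; slope-τ₀ = λ ()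
          ; τ≥E = λ _ _ _ () ; τ-core = λ _ _ _ () ; bounded = λ F → eval F [] , λ { [] _ → ≤-refl } ; decompose = λ v _ → v , tt , done ; rep = λ _ () }
      same-point : ∀ E → Compatible (point E) (point E)
      same-point E zero zero _ _ _ _ _ _ _ _ = record { l≡l′ = refl ; p≡p′ = λ () ; τ≡τ′ = λ _ _ _ _ _ _ () ; to = λ v x → v , x , λ _ _ → refl ; from = λ v x → v , x , λ _ _ → refl }

  decomposition : ∀ m (N : Vec ℕ m) → VAll.All (1 ℕ.≤_) N → (I : Subset m) (A : Pred (GPt m) 0ℓ) → (∀ a → A a → supp a ≡ I) → IsLCPrecell m N I A → Decomposition N I (rv I) A
  decomposition zero [] _ [] A _ all = base [] A all
  decomposition (suc m) N 1≤N I A suppA (soc , pres , lcμ , lcν) = go (last I) refl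
    where
      1≤ = All-∷ʳ⁻ (init N) (subst (VAll.All (1 ℕ.≤_)) (init-last N) 1≤N)
      rec = decomposition m (init N) (proj₁ 1≤) (init I) (Soc A) (λ b (o , a) → trans (sym (init-supp b o)) (cong init (suppA _ a))) soc
      go : ∀ t → last I ≡ t → Decomposition N I (rv I) A
      go true e = subst (λ t → Decomposition N I (t ∷ rv (init I)) A) (sym e) (FiniteStep.finite-step N (proj₂ 1≤) I A suppA e pres lcμ lcν rec)
      go false e = subst (λ t → Decomposition N I (t ∷ rv (init I)) A) (sym e) (infinite-step N (proj₂ 1≤) I A suppA e rec)

  fromG : GPt m → Pt m
  fromG a = Vec.map (Maybe.fromMaybe 0z) (rv a)

  zipWith-mk : (xs : Vec Γ m) → zipWith mk (Vec.map is-just xs) (Vec.map (Maybe.fromMaybe 0z) xs) ≡ xs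
  zipWith-mk [] = refl
  zipWith-mk (just x ∷ xs) = cong (just x ∷_) (zipWith-mk xs)
  zipWith-mk (nothing ∷ xs) = cong (nothing ∷_) (zipWith-mk xs)

  toG-fromG : ∀ (a : GPt m) → toG (rv (supp a)) (fromG a) ≡ a
  toG-fromG a = rv-injective _ _ (trans (rv-toG _ _) (trans (cong (λ J → zipWith mk J (fromG a)) (rv-map is-just a)) (zipWith-mk (rv a))))

  fromG-zero : ∀ (a : GPt m) → ZeroOff (rv (supp a)) (fromG a)
  fromG-zero a = subst (λ J → ZeroOff J (fromG a)) (sym (rv-map is-just a)) (go (rv a))
    where
      go : ∀ {m} (xs : Vec Γ m) → ZeroOff (Vec.map is-just xs) (Vec.map (Maybe.fromMaybe 0z) xs)
      go (nothing ∷ xs) zero _ = refl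
      go (x ∷ xs) (suc j) h = go xs j h

  -- Transfers disjointness from the codes to the points of Γ^m.
  toG-injective : ∀ (J : Vec Bool m) v v′ → ZeroOff J v → ZeroOff J v′ → toG J v ≡ toG J v′ → v ≡ v′
  toG-injective [] [] [] _ _ _ = refl
  toG-injective (t ∷ J) (z ∷ v) (z′ ∷ v′) h h′ e = cong₂ _∷_ (one t (h zero) (h′ zero) (proj₂ (∷ʳ-injective _ _ e))) (toG-injective J v v′ (λ j → h (suc j)) (λ j → h′ (suc j)) (proj₁ (∷ʳ-injective _ _ e)))
    where
      one : ∀ t → (t ≡ false → z ≡ 0z) → (t ≡ false → z′ ≡ 0z) → mk t z ≡ mk t z′ → z ≡ z′
      one true _ _ refl = refl
      one false p q _ = trans (p refl) (sym (q refl))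

  module _ {A B : Set₁} (f : A → B) where
    lookup-map-∈ : ∀ xs (i : Fin (length (List.map f xs))) → ∃ λ x → x ∈ xs × List.lookup (List.map f xs) i ≡ f x
    lookup-map-∈ (x ∷ xs) zero = x , here refl , refl
    lookup-map-∈ (x ∷ xs) (suc i) = let y , j , e = lookup-map-∈ xs i in y , there j , e

  AllPairs-lookup : ∀ {A : Set₁} {R : A → A → Set} → (∀ {x y} → R x y → R y x) → ∀ {xs} → AllPairs R xs → ∀ i j → i ≢ j → R (List.lookup xs i) (List.lookup xs j)
  AllPairs-lookup sy (h ∷ hs) zero zero q = ⊥-elim (q refl)
  AllPairs-lookup sy {xs = x ∷ xs} (h ∷ hs) zero (suc j) q = All.lookup h (∈-lookup j)
  AllPairs-lookup sy (h ∷ hs) (suc i) zero q = sy (All.lookup h (∈-lookup i))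
  AllPairs-lookup sy (h ∷ hs) (suc i) (suc j) q = AllPairs-lookup sy hs i j (λ e → q (cong suc e))

  monohedral-decomposition : ∀ m (N : Vec ℕ m) → VAll.All (1 ℕ.≤_) N → (I : Subset m) (A : Pred (GPt m) 0ℓ) → (∀ a → A a → supp a ≡ I) → IsLCPrecell m N I A →
    ∃ λ (Cs : List (Pred (GPt m) 0ℓ)) → IsComplex Cs × (∀ i → Monohedral (List.lookup Cs i) × ∃ λ J → IsLCPrecell m N J (List.lookup Cs i)) × (∀ a → A a ⇔ ∃ λ i → List.lookup Cs i a)
  monohedral-decomposition m N 1≤N I A suppA lc = Cs , (apart , common) , good , λ a → mk⇔ (forth a) (back a)
    where
      open Decomposition (decomposition m N 1≤N I A suppA lc)
      E = max E₀ 0z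
      open Collection (pieces E (x≤max E₀ 0z) (y≤max E₀ 0z))
      set : Piece (rv I) Ã W K n E → Pred (GPt m) 0ℓ
      set P = gp (rv I) (Piece.X P)
      Cs = List.map set list
      Apart : Pred (GPt m) 0ℓ → Pred (GPt m) 0ℓ → Set
      Apart S S′ = ∀ a → S a → S′ a → ⊥
      set-apart : ∀ P P′ → Disjoint P P′ → Apart (set P) (set P′)
      set-apart P P′ d a (v , x , e) (v′ , x′ , e′) = d v x (subst (Piece.X P′) (sym (toG-injective (rv I) v v′ (zero-off v (Piece.X⊆A P v x)) (zero-off v′ (Piece.X⊆A P′ v′ x′)) (trans (sym e) e′))) x′)
      apart : ∀ i j → i ≢ j → Apart (List.lookup Cs i) (List.lookup Cs j)
      apart = AllPairs-lookup {R = Apart} (λ h a s s′ → h a s′ s) (AllPairsₚ.map⁺ (AllPairs.map (λ {P} {P′} → set-apart P P′) disjoint))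
      common : ∀ i j → CommonFaces (List.lookup Cs i) (List.lookup Cs j)
      common i j = let P , p , e = lookup-map-∈ set list i ; P′ , p′ , e′ = lookup-map-∈ set list j in
        subst₂ CommonFaces (sym e) (sym e′) (commonFaces P P′ (compatible p p′))
      good : ∀ i → Monohedral (List.lookup Cs i) × ∃ λ J → IsLCPrecell m N J (List.lookup Cs i)
      good i = let P , p , e = lookup-map-∈ set list i in
        subst (λ S → Monohedral S × ∃ λ J → IsLCPrecell m N J S) (sym e) (monohedral P , I , holds p)
      forth : ∀ a → A a → ∃ λ i → List.lookup Cs i a
      forth a s = Any.index any , Anyₚ.lookup-index any
        where
          J≡ : rv (supp a) ≡ rv I
          J≡ = cong rv (suppA a s)
          a≡ : toG (rv I) (fromG a) ≡ a
          a≡ = subst (λ J → toG J (fromG a) ≡ a) J≡ (toG-fromG a)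
          any : Any (λ S → S a) Cs
          any = Anyₚ.map⁺ (Any.map (λ x → fromG a , x , sym a≡) (cover (fromG a) (Ã⇐ (fromG a) (subst (λ J → ZeroOff J (fromG a)) J≡ (fromG-zero a)) (subst A (sym a≡) s))))
      back : ∀ a → (∃ λ i → List.lookup Cs i a) → A a
      back a (i , s) = let P , p , e = lookup-map-∈ set list i in inside P (subst (λ S → S a) e s)
        where
          inside : ∀ P → set P a → A a
          inside P (v , x , q) = subst A (sym q) (Ã⇒ v (Piece.X⊆A P v x))

open import Data.Nat using (_≤_)
open import Data.Vec.Relation.Unary.All using (All)
open import Data.List using (lookup)

theorem5p4 : (G : ZGStr) → IsZGroup G →
    (m : ℕ) (N : Vec ℕ m) → All (λ n → 1 ≤ n) N →
    (I : Subset m) (A : Pred (Geometry.GPt G m) 0ℓ) →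
    (∀ a → A a → Geometry.supp G a ≡ I) →
    Geometry.IsLCPrecell G m N I A →
    ∃ λ (Cs : List (Pred (Geometry.GPt G m) 0ℓ)) →
    Geometry.IsComplex G Cs ×
    (∀ i → Geometry.Monohedral G (lookup Cs i) ×
    ∃ λ J → Geometry.IsLCPrecell G m N J (lookup Cs i)) ×
    (∀ a → A a ⇔ ∃ λ i → lookup Cs i a)
theorem5p4 = Decompositions.monohedral-decomposition
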